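{- For every integer $n\geq 3$, if an $n$-vertex graph $G$ has more than $\lfloor (7n-15)/2\rfloor$ edges, then every $(\geq 1)$-subdivision of $G$ has twin-width at least $4$. Furthermore, for every integer $n\geq 3$, there exists an $n$-vertex graph $G$ with exactly $\lfloor (7n-15)/2\rfloor$ edges such that every $(\geq 1)$-subdivision of $G$ has twin-width at most $3$.
   Context: Graphs are finite and simple. A $(\geq 1)$-subdivision of $G$ is a graph obtained from $G$ by replacing each edge by a path of length at least $2$ (internal vertices new and distinct). Twin-width: for a trigraph (vertex set with disjoint black and red edge sets; a graph has no red edges), contracting distinct vertices $u,v$ yields a new vertex $x$ with $xy$ black if $uy,vy$ both black, no edge if neither is an edge, and red otherwise. The twin-width is the least $d$ such that there is a sequence of contractions down to a single vertex in which every trigraph has every vertex incident with at most $d$ red edges. -}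

module Defs where

open import Data.Nat using (ℕ; zero; suc; _+_; _≤_; _<_)
open import Data.Bool using (Bool; true; false; _∧_; if_then_else_)
open import Data.Fin using (Fin; toℕ; punchIn; _≟_)
open import Data.List using (List; map; allFin)
open import Data.Nat.ListAction using (sum)
open import Data.Sum using (_⊎_)
open import Data.Product using (_×_)
open import Relation.Nullary using (¬_; yes; no)
open import Relation.Binary.PropositionalEquality using (_≡_; _≢_)
open import Function.Bundles using (_⤖_; _⇔_; Bijection)

record Graph (n : ℕ) : Set where
  field
    adj    : Fin n → Fin n → Bool
    sym    : ∀ i j → adj i j ≡ adj j i
    irrefl : ∀ i → adj i i ≡ false
open Graph public

Edge : ∀ {n} → Graph n → Fin n → Fin n → Set
Edge G u v = adj G u v ≡ true

edgeCount : ∀ {n} → Graph n → ℕ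
edgeCount {n} G =
  sum (map (λ i → sum (map (λ j →
        if (toℕ i Data.Nat.<ᵇ toℕ j) ∧ adj G i j then 1 else 0)
      (allFin n))) (allFin n))

-- (≥1)-subdivisions.
-- 'len u v' is the number of new internal vertices on the path replacing
-- the edge uv (for u < v); it is 0 exactly for non-edges / u ≥ v.

data Pos (n : ℕ) (len : Fin n → Fin n → ℕ) : Set where
  br  : Fin n → Pos n len
  mid : (u v : Fin n) → Fin (len u v) → Pos n len

data Step {n : ℕ} {len : Fin n → Fin n → ℕ} : Pos n len → Pos n len → Set where
  first : ∀ u v (i : Fin (len u v)) → toℕ i ≡ 0 → Step (br u) (mid u v i)
  next  : ∀ u v (i j : Fin (len u v)) → toℕ j ≡ suc (toℕ i) → Step (mid u v i) (mid u v j)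
  last  : ∀ u v (i : Fin (len u v)) → suc (toℕ i) ≡ len u v → Step (mid u v i) (br v)

SubAdj : ∀ {n} {len : Fin n → Fin n → ℕ} → Pos n len → Pos n len → Set
SubAdj p q = Step p q ⊎ Step q p

record IsSubdivision {n m : ℕ} (G : Graph n) (H : Graph m) : Set where
  field
    len      : Fin n → Fin n → ℕ
    len-pos  : ∀ u v → toℕ u < toℕ v → Edge G u v → 1 ≤ len u v
    len-zero : ∀ u v → 1 ≤ len u v → toℕ u < toℕ v × Edge G u v
    iso      : Pos n len ⤖ Fin m
    adj-iso  : ∀ p q → (Edge H (Bijection.to iso p) (Bijection.to iso q) ⇔ SubAdj p q)

data Col : Set where
  none black red : Col

Trigraph : ℕ → Set
Trigraph k = Fin k → Fin k → Col

graph→trigraph : ∀ {k} → Graph k → Trigraph k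
graph→trigraph G i j = if adj G i j then black else none

merge : Col → Col → Col
merge black black = black
merge none  none  = none
merge _     _     = red

-- contract distinct u, v of T: v is deleted (remaining vertices are
-- indexed via punchIn v), and the vertex at position u becomes the new vertex
contract : ∀ {k} → Trigraph (suc k) → (u v : Fin (suc k)) → u ≢ v → Trigraph k
contract T u v _ a b with punchIn v a ≟ u | punchIn v b ≟ u
... | yes _ | yes _ = none
... | yes _ | no _  = merge (T u (punchIn v b)) (T v (punchIn v b))
... | no _  | yes _ = merge (T (punchIn v a) u) (T (punchIn v a) v)
... | no _  | no _  = T (punchIn v a) (punchIn v b)

isRed : Col → Bool
isRed red = true
isRed _   = false

redDeg : ∀ {k} → Trigraph k → Fin k → ℕ
redDeg {k} T a = sum (map (λ b → if isRed (T a b) then 1 else 0) (allFin k))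

MaxRedDeg≤ : ∀ {k} → ℕ → Trigraph k → Set
MaxRedDeg≤ d T = ∀ a → redDeg T a ≤ d

data ContractionSeq (d : ℕ) : ∀ {k} → Trigraph k → Set where
  done : ∀ {k} {T : Trigraph k} → k ≤ 1 → ContractionSeq d T
  step : ∀ {k} {T : Trigraph (suc (suc k))} (u v : Fin (suc (suc k))) (u≢v : u ≢ v) →
         MaxRedDeg≤ d (contract T u v u≢v) →
         ContractionSeq d (contract T u v u≢v) → ContractionSeq d T

TwwAtMost : ∀ {m} → ℕ → Graph m → Set
TwwAtMost d H = MaxRedDeg≤ d (graph→trigraph H) × ContractionSeq d (graph→trigraph H)

{-# OPTIONS --safe #-}
-- Lower bound.  A graph with more than (7n − 15)/2 edges has a minor K₆⁻, the complete graph on six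
-- vertices minus an edge (Jakobsen).  In a minimal counterexample every edge lies in three triangles
-- and some vertex v has degree 4, 5 or 6, so the neighbourhood of v has minimum degree 3.  A component
-- C of the graph outside v and its neighbours that touches two non-adjacent neighbours of v, or four
-- neighbours, completes the minor (up to one exceptional neighbourhood); otherwise at most three
-- vertices separate C, and counting edges on both sides contradicts minimality.
--
-- Along a contraction sequence with red degrees at most 3 that starts with a subdivision, some minor
-- among K₆⁻, M₇ and V₈ persists.  As black edges contain no C₄, a new vertex has at most one black
-- neighbour; if that is a branch vertex, both contracted vertices can be moved into its bag, and
-- otherwise the contracted pair u, v has at most three neighbours.  The patterns are so well connected
-- that u and v then only serve to join the bags of these neighbours, and what is lost is at worst a
-- triangle of the pattern that turns into a claw.  This exchange leads from K₆⁻ to M₇, from M₇ to V₈,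
-- and V₈ has no triangle.
--
-- Upper bound.  Glue copies of K₅ (and perhaps one K₄) along a common triangle of hubs 0, 1, 2.  For
-- each further pair of vertices d, e the paths from a hub to d and to e are merged into a single part;
-- then d and e have the same three neighbours and are merged as well, and the result is absorbed by
-- the part X next to the three hubs.

module Submission where

open import Defs hiding (sym; irrefl)
import Data.Bool as Bool
open import Data.Bool using (Bool; true; false; _∧_; _∨_; not; if_then_else_)
open import Data.Bool.Properties using (T-≡; ∧-comm; ∨-comm; ∧-zeroʳ; ∧-identityʳ)
open import Data.Empty using (⊥; ⊥-elim)
open import Data.Fin using (Fin; zero; suc; toℕ; fromℕ; fromℕ<; punchIn; punchOut; _≟_; #_)
open import Data.Fin.Properties using (any?; toℕ-injective; toℕ<n; toℕ-fromℕ; toℕ-fromℕ<; fromℕ<-toℕ; punchIn-punchOut; punchIn-injective; punchInᵢ≢i)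
import Data.List as List
open import Data.List using (List; []; _∷_; map; length; allFin)
open import Data.List.Properties using (length-map; map-∘)
open import Data.List.Membership.Propositional using (_∈_)
open import Data.List.Membership.Propositional.Properties using (∈-map⁺; ∈-map⁻; ∈-lookup)
open import Data.List.Relation.Unary.All using (All; []; _∷_)
import Data.List.Relation.Unary.All as All
import Data.List.Relation.Unary.All.Properties as Allₚ
open import Data.List.Relation.Unary.AllPairs using (AllPairs; []; _∷_)
import Data.List.Relation.Unary.AllPairs as AllPairs
import Data.List.Relation.Unary.AllPairs.Properties as AllPairsₚ
open import Data.List.Relation.Unary.Any using (here; there)
import Data.Maybe as Maybe
open import Data.Maybe using (Maybe; just; nothing; _>>=_; fromMaybe)
open import Data.Maybe.Properties using (just-injective; ≡-dec)
open import Data.Nat using (ℕ; zero; suc; _+_; _*_; _∸_; _^_; _≤_; _<_; _≤?_; _<?_; _≡ᵇ_; _≤ᵇ_; _<ᵇ_; z≤n; s≤s)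
open import Data.Nat.DivMod using (_/_; _%_; m≡m%n+[m/n]*n; m%n<n; +-distrib-/-∣ʳ)
open import Data.Nat.Divisibility using (divides)
open import Data.Nat.Induction using (<-rec)
open import Data.Nat.ListAction using (sum)
import Data.Nat.Properties as ℕₚ
open import Data.Nat.Properties hiding (_≟_)
open import Data.Nat.Solver using (module +-*-Solver)
open import Data.Product using (Σ; ∃; ∃₂; _×_; _,_; proj₁; proj₂)
open import Data.Sum using (_⊎_; inj₁; inj₂; [_,_]′)
import Data.Sum as Sum
open import Data.Unit using (⊤; tt)
open import Data.Vec using (Vec; []; _∷_; _++_; lookup; tabulate; replicate)
open import Data.Vec.Properties using (lookup∘tabulate)
open import Function using (_∘_; id)
open import Function.Bundles using (Bijection; Equivalence)
open import Relation.Binary.Definitions using (tri<; tri≈; tri>)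
open import Relation.Binary.PropositionalEquality using (_≡_; _≢_; refl; sym; trans; cong; cong₂; subst; module ≡-Reasoning)
open import Relation.Nullary using (¬_; Dec; yes; no)
open import Relation.Nullary.Decidable using (_×-dec_; _⊎-dec_; ¬?; from-no)

open +-*-Solver using (solve; _:=_; _:+_; _:*_; con)


-- The patterns are chosen for three properties, checked by evaluation: every vertex has at least
-- three neighbours, two vertices together have at least four others as neighbours, and a vertex
-- with exactly three has pairwise non-adjacent ones. Hence the contracted pair cannot contain two
-- bags, and next to a single bag inside the pair nothing else has to run through it. In all other
-- cases the pair merely connects the bags at its at most three neighbours. One new vertex, put into
-- one of these bags, restores all such connections unless the bags are distinct and pairwise
-- adjacent; this is where a triangle gives way to a claw. `V₈` is the Wagner graph. The slope 7/2
-- appears twice. Two further vertices joined to three hubs and to each other bring 3 + 3 + 1 edges.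
-- Conversely, if a graph with 2e ≥ 7n - 14 is split along σ vertices, with the separator completed
-- on one side, then one side meets the same bound when (σ - 4)² > 0. The count breaks at σ = 4, so
-- four neighbours of v that touch one component have to yield the minor directly.

data Path {V : Set} (E : V → V → Set) (P : V → Set) : V → V → Set where
  stop : ∀ {a} → P a → Path E P a a
  move : ∀ {a b c} → P a → E a b → Path E P b c → Path E P a c

module _ {V : Set} {E : V → V → Set} {P : V → Set} where

  path-start : ∀ {a b} → Path E P a b → P a
  path-start (stop p)     = p
  path-start (move p _ _) = p

  path-end : ∀ {a b} → Path E P a b → P b
  path-end (stop p)     = p
  path-end (move _ _ r) = path-end r

  infixr 5 _◅◅_
  _◅◅_ : ∀ {a b c} → Path E P a b → Path E P b c → Path E P a c
  stop _     ◅◅ r = r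
  move p e q ◅◅ r = move p e (q ◅◅ r)

  edge-path : ∀ {a b} → P a → P b → E a b → Path E P a b
  edge-path p q e = move p e (stop q)

  path-reverse : (∀ {x y} → E x y → E y x) → ∀ {a b} → Path E P a b → Path E P b a
  path-reverse s (stop p)     = stop p
  path-reverse s (move p e r) = path-reverse s r ◅◅ edge-path (path-start r) p (s e)

path-bind : ∀ {V W : Set} {E : V → V → Set} {P : V → Set} {E′ : W → W → Set} {P′ : W → Set}
            (f : V → W) → (∀ {a} → P a → P′ (f a)) →
            (∀ {a b} → P a → P b → E a b → Path E′ P′ (f a) (f b)) →
            ∀ {a b} → Path E P a b → Path E′ P′ (f a) (f b)
path-bind f h g (stop p)     = stop (h p)
path-bind f h g (move p e r) = g p (path-start r) e ◅◅ path-bind f h g r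

-- Minor models given by partial labellings

Pattern : ℕ → Set
Pattern p = Fin p → Fin p → Bool

⟦_⟧ : ∀ {p} → Pattern p → Fin p → Fin p → Set
⟦ K ⟧ i j = K i j ≡ true

-- One partial function in place of a family of branch sets: disjointness holds by construction, and
-- `nothing` marks the vertices outside every bag.
Labelling : Set → ℕ → Set
Labelling V p = V → Maybe (Fin p)

Joined : ∀ {V p} → (V → V → Set) → Labelling V p → Fin p → Fin p → Set
Joined E β i j = ∃₂ λ a b → β a ≡ just i × β b ≡ just j × E a b

Bag : ∀ {V p} → Labelling V p → Fin p → V → Set
Bag β i a = β a ≡ just i

record Model {V : Set} (E : V → V → Set) {p} (K : Pattern p) (β : Labelling V p) : Set where
  field
    inhabited : ∀ i → ∃ λ a → β a ≡ just i
    connected : ∀ {i a b} → β a ≡ just i → β b ≡ just i → Path E (Bag β i) a b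
    joined    : ∀ {i j} → K i j ≡ true → Joined E β i j
open Model public

module _ {V W : Set} {E : V → V → Set} {E′ : W → W → Set} {p} {K : Pattern p}
         {β : Labelling V p} {β′ : Labelling W p} where

  -- Labelled vertices are moved along f; a vertex that changes its label is moved
  -- to some vertex that keeps the old one.
  transfer : (∀ {x y} → E′ x y → E′ y x) → (f : V → W) →
             (∀ {a i} → β a ≡ just i → β′ (f a) ≡ just i) →
             (∀ {a b i} → β a ≡ just i → β b ≡ just i → E a b → Path E′ (Bag β′ i) (f a) (f b)) →
             (∀ {w i} → β′ w ≡ just i → ∃ λ a → β a ≡ just i × Path E′ (Bag β′ i) w (f a)) →
             (∀ {a b i j} → K i j ≡ true → β a ≡ just i → β b ≡ just j → E a b → Joined E′ β′ i j) →
             Model E K β → Model E′ K β′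
  transfer s f lab inner cover outer M = record
    { inhabited = λ i → f (proj₁ (inhabited M i)) , lab (proj₂ (inhabited M i))
    ; connected = λ wi w′i → conn (cover wi) (cover w′i)
    ; joined    = λ k → jn k (joined M k)
    }
    where
    conn : ∀ {i w w′} → (∃ λ a → β a ≡ just i × Path E′ (Bag β′ i) w (f a)) →
           (∃ λ a → β a ≡ just i × Path E′ (Bag β′ i) w′ (f a)) → Path E′ (Bag β′ i) w w′
    conn (a , ai , q) (b , bi , r) =
      q ◅◅ path-bind f lab inner (connected M ai bi) ◅◅ path-reverse s r
    jn : ∀ {i j} → K i j ≡ true → Joined E β i j → Joined E′ β′ i j
    jn k (a , b , ai , bj , e) = outer k ai bj e

model-mono : ∀ {V : Set} {E E′ : V → V → Set} {p} {K : Pattern p} {β : Labelling V p} →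
             (∀ {a b} → E a b → E′ a b) → Model E K β → Model E′ K β
model-mono h M = record
  { inhabited = inhabited M
  ; connected = λ a b → path-bind (λ z → z) (λ z → z) (λ p q e → edge-path p q (h e)) (connected M a b)
  ; joined    = λ k → let a , b , p , q , e = joined M k in a , b , p , q , h e
  }

model-ext : ∀ {V : Set} {E : V → V → Set} {p} {K : Pattern p} {β β′ : Labelling V p} →
            (∀ a → β′ a ≡ β a) → Model E K β → Model E K β′
model-ext {β = β} {β′} h M = record
  { inhabited = λ i → let a , e = inhabited M i in a , trans (h a) e
  ; connected = λ {i} a b → path-bind (λ z → z) (λ {z} e → trans (h z) e)
                      (λ {x} {y} p q e → edge-path (trans (h x) p) (trans (h y) q) e)
                      (connected M (trans (sym (h _)) a) (trans (sym (h _)) b))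
  ; joined    = λ k → let a , b , p , q , e = joined M k in a , b , trans (h a) p , trans (h b) q , e
  }

bind-just : ∀ {A B : Set} (m : Maybe A) (φ : A → Maybe B) {y} → (m >>= φ) ≡ just y →
            ∃ λ x → m ≡ just x × φ x ≡ just y
bind-just (just x) φ e = x , refl , e

-- Transitivity of the minor relation. A path of `N` through vertices of `K` lifts to the host edge
-- by edge: `joined M` realises each edge, and `connected M` bridges the bag between two such edges.
model-compose : ∀ {V : Set} {E : V → V → Set} {p q} {K : Pattern p} {K′ : Pattern q}
                {β : Labelling V p} {φ : Labelling (Fin p) q} →
                Model E K β → Model ⟦ K ⟧ K′ φ → Model E K′ (λ a → β a >>= φ)
model-compose {V} {E} {K = K} {β = β} {φ} M N = record
  { inhabited = λ i → let x , e = inhabited N i ; a , d = inhabited M x in a , lift d e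
  ; connected = λ {i} {a} {b} ai bi →
      let x , ax , xi = bind-just (β a) φ ai ; y , by , yi = bind-just (β b) φ bi
      in go ax by (connected N xi yi)
  ; joined    = λ k → let x , y , xi , yj , e = joined N k ; a , b , ax , by , d = joined M e
                      in a , b , lift ax xi , lift by yj , d
  }
  where
  lift : ∀ {a x i} → β a ≡ just x → φ x ≡ just i → (β a >>= φ) ≡ just i
  lift d e = trans (cong (_>>= φ) d) e
  within : ∀ {x i a b} → φ x ≡ just i → β a ≡ just x → β b ≡ just x →
           Path E (Bag (λ a → β a >>= φ) i) a b
  within xi ax bx = path-bind (λ z → z) (λ d → lift d xi)
    (λ p q e → edge-path (lift p xi) (lift q xi) e) (connected M ax bx)
  go : ∀ {x y i a b} → β a ≡ just x → β b ≡ just y → Path ⟦ K ⟧ (Bag φ i) x y →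
       Path E (Bag (λ a → β a >>= φ) i) a b
  go ax by (stop xi)     = within xi ax by
  go ax by (move xi e r) = let c , d , cx , dz , f = joined M e in
    within xi ax cx ◅◅ move (lift cx xi) f (go dz by r)

-- The patterns K₆⁻, M₇ and V₈

infixr 4 _⇒ᵇ_
_⇒ᵇ_ : Bool → Bool → Bool
true  ⇒ᵇ b = b
false ⇒ᵇ b = true

⇒ᵇ-elim : ∀ {a b} → (a ⇒ᵇ b) ≡ true → a ≡ true → b ≡ true
⇒ᵇ-elim h refl = h

∧-split : ∀ {a b} → a ∧ b ≡ true → a ≡ true × b ≡ true
∧-split {true} {true} refl = refl , refl

∨-split : ∀ {a b} → a ∨ b ≡ true → a ≡ true ⊎ b ≡ true
∨-split {true}  e = inj₁ refl
∨-split {false} e = inj₂ e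

not-true : ∀ {a} → not a ≡ true → a ≢ true
not-true {false} _ ()

every : ∀ n → (Fin n → Bool) → Bool
every zero    f = true
every (suc n) f = f zero ∧ every n (f ∘ suc)

every-elim : ∀ {n} (f : Fin n → Bool) → every n f ≡ true → ∀ i → f i ≡ true
every-elim f h zero    = proj₁ (∧-split h)
every-elim f h (suc i) = every-elim (f ∘ suc) (proj₂ (∧-split {f zero} h)) i

every-intro : ∀ {n} (f : Fin n → Bool) → (∀ i → f i ≡ true) → every n f ≡ true
every-intro {zero}  f h = refl
every-intro {suc n} f h rewrite h zero = every-intro (f ∘ suc) (h ∘ suc)

some : ∀ n → (Fin n → Bool) → Bool
some zero    f = false
some (suc n) f = f zero ∨ some n (f ∘ suc)

some-elim : ∀ {n} (f : Fin n → Bool) → some n f ≡ true → ∃ λ i → f i ≡ true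
some-elim {suc n} f h with ∨-split {f zero} h
... | inj₁ e = zero , e
... | inj₂ e = let i , d = some-elim (f ∘ suc) e in suc i , d

true-or-false : ∀ b → b ≡ true ⊎ b ≡ false
true-or-false true  = inj₁ refl
true-or-false false = inj₂ refl

false≢true : ∀ {b} → b ≡ false → b ≢ true
false≢true refl ()

∨-introˡ : ∀ {a b} → a ≡ true → a ∨ b ≡ true
∨-introˡ refl = refl

∨-introʳ : ∀ {a b} → b ≡ true → a ∨ b ≡ true
∨-introʳ {true}  _ = refl
∨-introʳ {false} e = e

not-true⁻¹ : ∀ {b} → b ≢ true → not b ≡ true
not-true⁻¹ {true}  h = ⊥-elim (h refl)
not-true⁻¹ {false} _ = refl

some-intro : ∀ {n} (f : Fin n → Bool) i → f i ≡ true → some n f ≡ true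
some-intro f zero    e = ∨-introˡ e
some-intro f (suc i) e = ∨-introʳ {f zero} (some-intro (f ∘ suc) i e)

infix 7 _==_
_==_ : ∀ {n} → Fin n → Fin n → Bool
i == j = toℕ i ≡ᵇ toℕ j

==-sound : ∀ {n} (i j : Fin n) → i == j ≡ true → i ≡ j
==-sound i j h = toℕ-injective (≡ᵇ⇒≡ (toℕ i) (toℕ j) (Equivalence.from T-≡ h))

==-refl : ∀ {n} (i : Fin n) → i == i ≡ true
==-refl i = Equivalence.to T-≡ (≡⇒≡ᵇ (toℕ i) (toℕ i) refl)

≠-sound : ∀ {n} (i j : Fin n) → not (i == j) ≡ true → i ≢ j
≠-sound i .i h refl with i == i in e
≠-sound i .i () refl | true
... | false with trans (sym e) (==-refl i)
...   | ()

among : ∀ {n} → Fin n → Fin n → Fin n → Fin n → Bool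
among x i j k = x == i ∨ x == j ∨ x == k

among-intro : ∀ {n} (x i j k : Fin n) → x ≡ i ⊎ x ≡ j ⊎ x ≡ k → among x i j k ≡ true
among-intro x i j k (inj₁ refl)        rewrite ==-refl x = refl
among-intro x i j k (inj₂ (inj₁ refl)) rewrite ==-refl x with x == i
... | true  = refl
... | false = refl
among-intro x i j k (inj₂ (inj₂ refl)) rewrite ==-refl x with x == i | x == j
... | true  | _     = refl
... | false | true  = refl
... | false | false = refl

occurs : ℕ → List ℕ → Bool
occurs n []       = false
occurs n (m ∷ ms) = (n ≡ᵇ m) ∨ occurs n ms

fromNeighbours : ∀ {p} → Vec (List ℕ) p → Pattern p
fromNeighbours rows i j = occurs (toℕ j) (lookup rows i)

K₆⁻ : Pattern 6
K₆⁻ i j = not (i == j) ∧ not (i == # 0 ∧ j == # 1) ∧ not (i == # 1 ∧ j == # 0)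

-- M₇ and V₈ are what remains when triangles are exchanged for claws, see claw-minor.
M₇ : Pattern 7
M₇ = fromNeighbours
  ((1 ∷ 2 ∷ 4 ∷ 6 ∷ []) ∷ (0 ∷ 3 ∷ 5 ∷ 6 ∷ []) ∷ (0 ∷ 3 ∷ 5 ∷ 6 ∷ []) ∷ (1 ∷ 2 ∷ 4 ∷ 6 ∷ []) ∷
   (0 ∷ 3 ∷ 5 ∷ []) ∷ (1 ∷ 2 ∷ 4 ∷ []) ∷ (0 ∷ 1 ∷ 2 ∷ 3 ∷ []) ∷ [])

V₈ : Pattern 8
V₈ = fromNeighbours
  ((1 ∷ 2 ∷ 3 ∷ []) ∷ (0 ∷ 4 ∷ 5 ∷ []) ∷ (0 ∷ 4 ∷ 6 ∷ []) ∷ (0 ∷ 5 ∷ 7 ∷ []) ∷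
   (1 ∷ 2 ∷ 7 ∷ []) ∷ (1 ∷ 3 ∷ 6 ∷ []) ∷ (2 ∷ 5 ∷ 7 ∷ []) ∷ (3 ∷ 4 ∷ 6 ∷ []) ∷ [])

data Member : Set where
  k₆⁻ m₇ v₈ : Member

size : Member → ℕ
size k₆⁻ = 6
size m₇  = 7
size v₈  = 8

pattern-of : (F : Member) → Pattern (size F)
pattern-of k₆⁻ = K₆⁻
pattern-of m₇  = M₇
pattern-of v₈  = V₈

module _ {p} (K : Pattern p) where

  loopless-test : Bool
  loopless-test = every p λ i → not (K i i)

  symmetric-test : Bool
  symmetric-test = every p λ i → every p λ j → K i j ⇒ᵇ K j i

  degree-test : Bool
  degree-test = every p λ w → every p λ i → every p λ j →
    some p λ x → not (x == i) ∧ not (x == j) ∧ K w x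

  pair-test : Bool
  pair-test = every p λ w → every p λ w′ → w == w′ ∨
    (every p λ i → every p λ j → every p λ k →
      some p λ x → (K w x ∨ K w′ x) ∧ not (x == w) ∧ not (x == w′) ∧ not (among x i j k))

  cubic-test : Bool
  cubic-test = every p λ w → every p λ i → every p λ j → every p λ k →
    (every p λ x → K w x ⇒ᵇ among x i j k) ⇒ᵇ
    not (i == j) ∧ not (i == k) ∧ not (j == k) ∧
    not (K i j) ∧ not (K j i) ∧ not (K i k) ∧ not (K k i) ∧ not (K j k) ∧ not (K k j)

per-member : (P : ∀ {p} → Pattern p → Bool) → P K₆⁻ ≡ true → P M₇ ≡ true → P V₈ ≡ true →
             ∀ F → P (pattern-of F) ≡ true
per-member P a b c k₆⁻ = a
per-member P a b c m₇  = b
per-member P a b c v₈  = c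

loopless : ∀ F i → pattern-of F i i ≢ true
loopless F i = not-true (every-elim _ (per-member loopless-test refl refl refl F) i)

symmetric : ∀ F i j → pattern-of F i j ≡ true → pattern-of F j i ≡ true
symmetric F i j = ⇒ᵇ-elim (every-elim _ (every-elim _ (per-member symmetric-test refl refl refl F) i) j)

-- Its main use is against a bag that consists of a single vertex with only two neighbours; `i` and
-- `j` are then the labels of these.
degree≥3 : ∀ F w i j → ∃ λ x → x ≢ i × x ≢ j × pattern-of F w x ≡ true
degree≥3 F w i j
  with x , h ← some-elim _ (every-elim _ (every-elim _ (every-elim _
                 (per-member degree-test refl refl refl F) w) i) j)
  with a , h ← ∧-split {not (x == i)} h
  with b , c ← ∧-split {not (x == j)} h
  = x , ≠-sound x i a , ≠-sound x j b , c

-- Two bags that fill the contracted pair would need four further bags at the boundary of the pair,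
-- which has at most three vertices. The labels of these will be `i`, `j`, `k`.
pair-neighbours≥4 : ∀ F w w′ → w ≢ w′ → ∀ i j k → ∃ λ x →
  (pattern-of F w x ≡ true ⊎ pattern-of F w′ x ≡ true) × x ≢ w × x ≢ w′ × x ≢ i × x ≢ j × x ≢ k
pair-neighbours≥4 F w w′ w≢w′ i j k
  with ∨-split {w == w′} (every-elim _ (every-elim _ (per-member pair-test refl refl refl F) w) w′)
... | inj₁ e = ⊥-elim (w≢w′ (==-sound w w′ e))
... | inj₂ h
  with x , h ← some-elim _ (every-elim _ (every-elim _ (every-elim _ h i) j) k)
  with a , h ← ∧-split {pattern-of F w x ∨ pattern-of F w′ x} h
  with b , h ← ∧-split {not (x == w)} h
  with c , d ← ∧-split {not (x == w′)} h
  = x , ∨-split a , ≠-sound x w b , ≠-sound x w′ c ,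
    (λ e → not-true d (among-intro x i j k (inj₁ e))) ,
    (λ e → not-true d (among-intro x i j k (inj₂ (inj₁ e)))) ,
    (λ e → not-true d (among-intro x i j k (inj₂ (inj₂ e))))

record Independent {p} (K : Pattern p) (i j k : Fin p) : Set where
  field
    i≢j : i ≢ j
    i≢k : i ≢ k
    j≢k : j ≢ k
    ij  : K i j ≢ true
    ji  : K j i ≢ true
    ik  : K i k ≢ true
    ki  : K k i ≢ true
    jk  : K j k ≢ true
    kj  : K k j ≢ true

-- For a bag inside the contracted pair: its three neighbouring bags neither coincide nor are
-- adjacent, so no connection among them has to run through the pair. The premise never holds in
-- `K₆⁻`; in `M₇` it concerns the vertices 4 and 5 of degree three; `V₈` is cubic and has no
-- triangles.
cubic-independent : ∀ F w i j k →
  (∀ x → pattern-of F w x ≡ true → x ≡ i ⊎ x ≡ j ⊎ x ≡ k) → Independent (pattern-of F) i j k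
cubic-independent F w i j k h = record
  { i≢j = ≠-sound i j a ; i≢k = ≠-sound i k b ; j≢k = ≠-sound j k c
  ; ij = not-true d ; ji = not-true e ; ik = not-true f ; ki = not-true g
  ; jk = not-true l ; kj = not-true m }
  where
  K = pattern-of F
  covered : (every _ λ x → K w x ⇒ᵇ among x i j k) ≡ true
  covered = every-intro _ λ x → lemma x (h x)
    where
    lemma : ∀ x → (K w x ≡ true → x ≡ i ⊎ x ≡ j ⊎ x ≡ k) → (K w x ⇒ᵇ among x i j k) ≡ true
    lemma x g with K w x
    ... | true  = among-intro x i j k (g refl)
    ... | false = refl
  all = ⇒ᵇ-elim (every-elim _ (every-elim _ (every-elim _ (every-elim _
          (per-member cubic-test refl refl refl F) w) i) j) k) covered
  s₁ = ∧-split {not (i == j)} all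
  s₂ = ∧-split {not (i == k)} (proj₂ s₁)
  s₃ = ∧-split {not (j == k)} (proj₂ s₂)
  s₄ = ∧-split {not (K i j)} (proj₂ s₃)
  s₅ = ∧-split {not (K j i)} (proj₂ s₄)
  s₆ = ∧-split {not (K i k)} (proj₂ s₅)
  s₇ = ∧-split {not (K k i)} (proj₂ s₆)
  s₈ = ∧-split {not (K j k)} (proj₂ s₇)
  a = proj₁ s₁ ; b = proj₁ s₂ ; c = proj₁ s₃ ; d = proj₁ s₄ ; e = proj₁ s₅
  f = proj₁ s₆ ; g = proj₁ s₇ ; l = proj₁ s₈ ; m = proj₂ s₈

-- Vertex zero is the centre of the claw that replaces the triangle ijk.
claw : ∀ {p} → Pattern p → Fin p → Fin p → Fin p → Pattern (suc p)
claw K i j k zero    zero    = false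
claw K i j k zero    (suc y) = among y i j k
claw K i j k (suc x) zero    = among x i j k
claw K i j k (suc x) (suc y) = K x y ∧ not (among x i j k ∧ among y i j k)

-- A permutation `ψ` together with its inverse `φ`: `ψ` places the target pattern as a spanning
-- subgraph of the host, and `φ` is the corresponding labelling. With both stored, the verification
-- is a finite evaluation.
Embedding : ℕ → Set
Embedding q = Vec (Fin q) q × Vec (Fin q) q

embedding-test : ∀ {q} → Pattern q → Pattern q → Embedding q → Bool
embedding-test {q} K K′ (ψ , φ) =
  (every q λ i → lookup φ (lookup ψ i) == i) ∧
  (every q λ a → lookup ψ (lookup φ a) == a) ∧
  (every q λ i → every q λ j → K′ i j ⇒ᵇ K (lookup ψ i) (lookup ψ j))

embedding-model : ∀ {q} (K K′ : Pattern q) ((ψ , φ) : Embedding q) →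
                  embedding-test K K′ (ψ , φ) ≡ true → Model ⟦ K ⟧ K′ (λ a → just (lookup φ a))
embedding-model {q} K K′ (ψ , φ) h = record
  { inhabited = λ i → lookup ψ i , cong just (φψ i)
  ; connected = λ {i} {a} {b} ai bi → conn a b ai bi
  ; joined    = λ {i} {j} e → lookup ψ i , lookup ψ j , cong just (φψ i) , cong just (φψ j) , ⇒ᵇ-elim (every-elim _ (every-elim _ (proj₂ s₂) i) j) e
  }
  where
  s₁ = ∧-split {every q λ i → lookup φ (lookup ψ i) == i} h
  s₂ = ∧-split {every q λ a → lookup ψ (lookup φ a) == a} (proj₂ s₁)
  φψ : ∀ i → lookup φ (lookup ψ i) ≡ i
  φψ i = ==-sound _ _ (every-elim _ (proj₁ s₁) i)
  ψφ : ∀ a → lookup ψ (lookup φ a) ≡ a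
  ψφ a = ==-sound _ _ (every-elim _ (proj₁ s₂) a)
  conn : ∀ {i} a b → just (lookup φ a) ≡ just i → just (lookup φ b) ≡ just i →
         Path ⟦ K ⟧ (Bag (λ a → just (lookup φ a)) i) a b
  conn a b ai bi
    with refl ← trans (sym (ψφ a)) (trans (cong (lookup ψ) (just-injective (trans ai (sym bi)))) (ψφ b))
    = stop ai

-- The code does not depend on the order of i, j, k.
code : ∀ {p} → Fin p → Fin p → Fin p → ℕ
code i j k = 2 ^ toℕ i + 2 ^ toℕ j + 2 ^ toℕ k

find : ∀ {A : Set} → List (ℕ × A) → A → ℕ → A
find []             d n = d
find ((m , a) ∷ as) d n with m ≡ᵇ n
... | true  = a
... | false = find as d n

-- The keys are the codes of the triangles of `K₆⁻`; the default entry serves the remaining triangle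
-- 3 4 5.
claw-embedding₇ : ℕ → Embedding 7
claw-embedding₇ = find
  ((13 , (# 3 ∷ # 5 ∷ # 6 ∷ # 4 ∷ # 0 ∷ # 1 ∷ # 2 ∷ []) , (# 4 ∷ # 5 ∷ # 6 ∷ # 0 ∷ # 3 ∷ # 1 ∷ # 2 ∷ [])) ∷
   (21 , (# 3 ∷ # 4 ∷ # 6 ∷ # 5 ∷ # 0 ∷ # 1 ∷ # 2 ∷ []) , (# 4 ∷ # 5 ∷ # 6 ∷ # 0 ∷ # 1 ∷ # 3 ∷ # 2 ∷ [])) ∷
   (37 , (# 3 ∷ # 4 ∷ # 5 ∷ # 6 ∷ # 0 ∷ # 1 ∷ # 2 ∷ []) , (# 4 ∷ # 5 ∷ # 6 ∷ # 0 ∷ # 1 ∷ # 2 ∷ # 3 ∷ [])) ∷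
   (25 , (# 3 ∷ # 4 ∷ # 5 ∷ # 6 ∷ # 1 ∷ # 0 ∷ # 2 ∷ []) , (# 5 ∷ # 4 ∷ # 6 ∷ # 0 ∷ # 1 ∷ # 2 ∷ # 3 ∷ [])) ∷
   (41 , (# 3 ∷ # 4 ∷ # 6 ∷ # 5 ∷ # 1 ∷ # 0 ∷ # 2 ∷ []) , (# 5 ∷ # 4 ∷ # 6 ∷ # 0 ∷ # 1 ∷ # 3 ∷ # 2 ∷ [])) ∷
   (49 , (# 3 ∷ # 5 ∷ # 6 ∷ # 4 ∷ # 1 ∷ # 0 ∷ # 2 ∷ []) , (# 5 ∷ # 4 ∷ # 6 ∷ # 0 ∷ # 3 ∷ # 1 ∷ # 2 ∷ [])) ∷
   (14 , (# 3 ∷ # 5 ∷ # 6 ∷ # 4 ∷ # 0 ∷ # 2 ∷ # 1 ∷ []) , (# 4 ∷ # 6 ∷ # 5 ∷ # 0 ∷ # 3 ∷ # 1 ∷ # 2 ∷ [])) ∷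
   (22 , (# 3 ∷ # 4 ∷ # 6 ∷ # 5 ∷ # 0 ∷ # 2 ∷ # 1 ∷ []) , (# 4 ∷ # 6 ∷ # 5 ∷ # 0 ∷ # 1 ∷ # 3 ∷ # 2 ∷ [])) ∷
   (38 , (# 3 ∷ # 4 ∷ # 5 ∷ # 6 ∷ # 0 ∷ # 2 ∷ # 1 ∷ []) , (# 4 ∷ # 6 ∷ # 5 ∷ # 0 ∷ # 1 ∷ # 2 ∷ # 3 ∷ [])) ∷
   (26 , (# 3 ∷ # 4 ∷ # 5 ∷ # 6 ∷ # 2 ∷ # 0 ∷ # 1 ∷ []) , (# 5 ∷ # 6 ∷ # 4 ∷ # 0 ∷ # 1 ∷ # 2 ∷ # 3 ∷ [])) ∷
   (42 , (# 3 ∷ # 4 ∷ # 6 ∷ # 5 ∷ # 2 ∷ # 0 ∷ # 1 ∷ []) , (# 5 ∷ # 6 ∷ # 4 ∷ # 0 ∷ # 1 ∷ # 3 ∷ # 2 ∷ [])) ∷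
   (50 , (# 3 ∷ # 5 ∷ # 6 ∷ # 4 ∷ # 2 ∷ # 0 ∷ # 1 ∷ []) , (# 5 ∷ # 6 ∷ # 4 ∷ # 0 ∷ # 3 ∷ # 1 ∷ # 2 ∷ [])) ∷
   (28 , (# 1 ∷ # 3 ∷ # 4 ∷ # 2 ∷ # 5 ∷ # 0 ∷ # 6 ∷ []) , (# 5 ∷ # 0 ∷ # 3 ∷ # 1 ∷ # 2 ∷ # 4 ∷ # 6 ∷ [])) ∷
   (44 , (# 1 ∷ # 3 ∷ # 4 ∷ # 2 ∷ # 6 ∷ # 0 ∷ # 5 ∷ []) , (# 5 ∷ # 0 ∷ # 3 ∷ # 1 ∷ # 2 ∷ # 6 ∷ # 4 ∷ [])) ∷
   (52 , (# 1 ∷ # 3 ∷ # 5 ∷ # 2 ∷ # 6 ∷ # 0 ∷ # 4 ∷ []) , (# 5 ∷ # 0 ∷ # 3 ∷ # 1 ∷ # 6 ∷ # 2 ∷ # 4 ∷ [])) ∷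
   []) ((# 1 ∷ # 4 ∷ # 5 ∷ # 2 ∷ # 6 ∷ # 0 ∷ # 3 ∷ []) , (# 5 ∷ # 0 ∷ # 3 ∷ # 6 ∷ # 1 ∷ # 2 ∷ # 4 ∷ []))

-- `M₇` has four triangles, all through vertex 6; the default entry serves 2 3 6.
claw-embedding₈ : ℕ → Embedding 8
claw-embedding₈ = find
  ((67 , (# 0 ∷ # 7 ∷ # 1 ∷ # 2 ∷ # 3 ∷ # 4 ∷ # 5 ∷ # 6 ∷ []) , (# 0 ∷ # 2 ∷ # 3 ∷ # 4 ∷ # 5 ∷ # 6 ∷ # 7 ∷ # 1 ∷ [])) ∷
   (69 , (# 0 ∷ # 7 ∷ # 1 ∷ # 3 ∷ # 2 ∷ # 4 ∷ # 5 ∷ # 6 ∷ []) , (# 0 ∷ # 2 ∷ # 4 ∷ # 3 ∷ # 5 ∷ # 6 ∷ # 7 ∷ # 1 ∷ [])) ∷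
   (74 , (# 0 ∷ # 7 ∷ # 2 ∷ # 4 ∷ # 1 ∷ # 3 ∷ # 6 ∷ # 5 ∷ []) , (# 0 ∷ # 4 ∷ # 2 ∷ # 5 ∷ # 3 ∷ # 7 ∷ # 6 ∷ # 1 ∷ [])) ∷
   []) ((# 0 ∷ # 7 ∷ # 3 ∷ # 4 ∷ # 1 ∷ # 2 ∷ # 6 ∷ # 5 ∷ []) , (# 0 ∷ # 4 ∷ # 5 ∷ # 2 ∷ # 3 ∷ # 7 ∷ # 6 ∷ # 1 ∷ []))

triangle : ∀ {p} → Pattern p → Fin p → Fin p → Fin p → Bool
triangle K i j k = K i j ∧ K i k ∧ K j k

ClawTest : ∀ {p} → Pattern p → Pattern (suc p) → (ℕ → Embedding (suc p)) → Fin p → Fin p → Fin p → Bool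
ClawTest K K′ emb i j k = triangle K i j k ⇒ᵇ embedding-test (claw K i j k) K′ (emb (code i j k))

every³ : ∀ {p} → (Fin p → Fin p → Fin p → Bool) → Bool
every³ {p} f = every p λ i → every p λ j → every p λ k → f i j k

every³-elim : ∀ {p} (f : Fin p → Fin p → Fin p → Bool) → every³ f ≡ true → ∀ i j k → f i j k ≡ true
every³-elim {p} f h i j k = every-elim (f i j) (every-elim (λ j → every p (f i j))
  (every-elim (λ i → every p λ j → every p (f i j)) h i) j) k

-- Settled by evaluation. Exchanging a triangle of `K₆⁻` for a claw keeps the number 14 of edges,
-- and the outcome depends on whether the triangle contains an end of the missing edge; `M₇`, with
-- 13 edges, is a spanning subgraph of both outcomes. Likewise `V₈`, with 12 edges, lies in what any
-- triangle of `M₇` leaves.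
claw-minor : ∀ F i j k → triangle (pattern-of F) i j k ≡ true →
             ∃₂ λ F′ φ → Model ⟦ claw (pattern-of F) i j k ⟧ (pattern-of F′) φ
claw-minor k₆⁻ i j k t = m₇ , _ , embedding-model _ M₇ (claw-embedding₇ (code i j k))
  (⇒ᵇ-elim (every³-elim (ClawTest K₆⁻ M₇ claw-embedding₇) refl i j k) t)
claw-minor m₇ i j k t = v₈ , _ , embedding-model _ V₈ (claw-embedding₈ (code i j k))
  (⇒ᵇ-elim (every³-elim (ClawTest M₇ V₈ claw-embedding₈) refl i j k) t)
claw-minor v₈ i j k t =
  ⊥-elim (not-true (every³-elim (λ i j k → not (triangle V₈ i j k)) refl i j k) t)

-- Minors under identification of two vertices

module _ {k p : ℕ} where

  put : Fin k → Maybe (Fin p) → Labelling (Fin k) p → Labelling (Fin k) p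
  put m l β z with z ≟ m
  ... | yes _ = l
  ... | no  _ = β z

  put-same : ∀ m l β → put m l β m ≡ l
  put-same m l β with m ≟ m
  ... | yes _  = refl
  ... | no m≢m = ⊥-elim (m≢m refl)

  put-other : ∀ m l β {z} → z ≢ m → put m l β z ≡ β z
  put-other m l β {z} z≢m with z ≟ m
  ... | yes z≡m = ⊥-elim (z≢m z≡m)
  ... | no  _   = refl

just≢nothing : ∀ {A : Set} {m : Maybe A} {x} → m ≡ just x → m ≢ nothing
just≢nothing refl ()

label≡ : ∀ {p} {m : Maybe (Fin p)} {i j} → m ≡ just i → m ≡ just j → i ≡ j
label≡ a b = just-injective (trans (sym a) b)

fromMaybe-just : ∀ {A : Set} {m : Maybe A} {d x} → m ≡ just x → fromMaybe d m ≡ x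
fromMaybe-just refl = refl

module Relabel {k} {E : Fin k → Fin k → Set} (E-sym : ∀ {a b} → E a b → E b a)
               (F : Member) {β : Labelling (Fin k) (size F)} (M : Model E (pattern-of F) β) where
  private
    K = pattern-of F
    _≟ₗ_ = ≡-dec (_≟_ {size F})

  module _ (m y s : Fin k) (my : E m y) (y≢m : y ≢ m) (nbr : ∀ z → E m z → z ≡ y ⊎ z ≡ s) where

    -- If `m` were its whole bag, the pattern vertex `i` could be adjacent only to the labels of `y`
    -- and `s`, against minimum degree three. So the bag goes on, and as `y` is not in it, it goes
    -- on through `s`.
    second-neighbour : ∀ {i} → β m ≡ just i → β y ≢ just i → β s ≡ just i × E m s
    second-neighbour {i} mi ynot with any? (λ b → (β b ≟ₗ just i) ×-dec ¬? (b ≟ m))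
    ... | yes (b , bi , b≢m) = first-step (connected M mi bi) b≢m
      where
      first-step : ∀ {b} → Path E (Bag β i) m b → b ≢ m → β s ≡ just i × E m s
      first-step (stop _) b≢m = ⊥-elim (b≢m refl)
      first-step (move {b = z} _ e r) _ with nbr z e
      ... | inj₁ refl = ⊥-elim (ynot (path-start r))
      ... | inj₂ refl = path-start r , e
    ... | no alone with degree≥3 F i (fromMaybe i (β y)) (fromMaybe i (β s))
    ... | x , x≢y , x≢s , ix with joined M ix
    ... | a , b , ai , bx , e with a ≟ m
    ... | no a≢m = ⊥-elim (alone (a , ai , a≢m))
    ... | yes refl with nbr b e
    ... | inj₁ refl = ⊥-elim (x≢y (sym (fromMaybe-just bx)))
    ... | inj₂ refl = ⊥-elim (x≢s (sym (fromMaybe-just bx)))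

    private
      β′ = put m (β y) β
      m-lab : β′ m ≡ β y
      m-lab = put-same m (β y) β
      o-lab : ∀ {z} → z ≢ m → β′ z ≡ β z
      o-lab = put-other m (β y) β
      y-lab : β′ y ≡ β y
      y-lab = o-lab y≢m

    unchanged : β m ≡ β y → Model E K β′
    unchanged e = model-ext same M
      where
      same : ∀ z → β′ z ≡ β z
      same z with z ≟ m
      ... | yes refl = sym e
      ... | no _ = refl

    attach : β m ≡ nothing → ∀ {i} → β y ≡ just i → Model E K β′
    attach mn {i} yi = transfer E-sym (λ z → z) lab
      (λ a b e → edge-path (lab a) (lab b) e) cover
      (λ _ a b e → _ , _ , lab a , lab b , e) M
      where
      lab : ∀ {a j} → β a ≡ just j → β′ a ≡ just j
      lab {a} aj = trans (o-lab (λ { refl → just≢nothing aj mn })) aj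
      cover : ∀ {w j} → β′ w ≡ just j → ∃ λ a → β a ≡ just j × Path E (Bag β′ j) w a
      cover {w} wj with w ≟ m in eq
      ... | yes refl = y , wj , edge-path (trans m-lab wj) (trans y-lab wj) my
      ... | no w≢m = w , wj , stop (trans (o-lab w≢m) wj)

    -- `m` hangs on its bag only at `s`, so the bag stays connected without it. In the new position
    -- the edge between `m` and `s` takes over every adjacency that the edge between `m` and `y` had
    -- provided.
    move-leaf : ∀ {i} → β m ≡ just i → β y ≢ just i → β s ≡ just i → E m s → Model E K β′
    move-leaf {i} mi ynot si ms = transfer E-sym f lab inner cover outer M
      where
      -- `E` may have loops, so `s` could be `m` itself; then `m` would be its whole bag and see no
      -- other bag than that of `y`.
      s≢m : s ≢ m
      s≢m refl with degree≥3 F i (fromMaybe i (β y)) i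
      ... | x , x≢y , x≢i , ix with joined M ix
      ... | a , b , ai , bx , e with only (connected M mi ai)
        where
        only : ∀ {a} → Path E (Bag β i) m a → a ≡ m
        only (stop _) = refl
        only (move {b = z} _ e r) with nbr z e
        ... | inj₁ refl = ⊥-elim (ynot (path-start r))
        ... | inj₂ refl = only r
      ... | refl with nbr b e
      ... | inj₁ refl = x≢y (sym (fromMaybe-just bx))
      ... | inj₂ refl = x≢i (label≡ bx mi)
      f : Fin k → Fin k
      f a with a ≟ m
      ... | yes _ = s
      ... | no _ = a
      lab : ∀ {a j} → β a ≡ just j → β′ (f a) ≡ just j
      lab {a} aj with a ≟ m
      ... | yes refl = trans (o-lab s≢m) (trans si (trans (sym mi) aj))
      ... | no a≢m = trans (o-lab a≢m) aj
      inner : ∀ {a b j} → β a ≡ just j → β b ≡ just j → E a b → Path E (Bag β′ j) (f a) (f b)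
      inner {a} {b} aj bj e with a ≟ m | b ≟ m
      ... | yes refl | yes refl = stop (trans (o-lab s≢m) (trans si (trans (sym mi) aj)))
      ... | no a≢m | no b≢m = edge-path (trans (o-lab a≢m) aj) (trans (o-lab b≢m) bj) e
      ... | yes refl | no b≢m with nbr b e
      ...   | inj₁ refl = ⊥-elim (ynot (trans bj (trans (sym aj) mi)))
      ...   | inj₂ refl = stop (trans (o-lab s≢m) bj)
      inner {a} {b} aj bj e | no a≢m | yes refl with nbr a (E-sym e)
      ...   | inj₁ refl = ⊥-elim (ynot (trans aj (trans (sym bj) mi)))
      ...   | inj₂ refl = stop (trans (o-lab s≢m) aj)
      f-other : ∀ {a} → a ≢ m → f a ≡ a
      f-other {a} a≢m with a ≟ m
      ... | yes a≡m = ⊥-elim (a≢m a≡m)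
      ... | no _ = refl
      cover : ∀ {w j} → β′ w ≡ just j → ∃ λ a → β a ≡ just j × Path E (Bag β′ j) w (f a)
      cover {w} {j} wj with w ≟ m
      ... | yes refl = y , wj , subst (Path E (Bag β′ j) m) (sym (f-other y≢m)) (edge-path (trans m-lab wj) (trans y-lab wj) my)
      ... | no w≢m = w , wj , subst (Path E (Bag β′ j) w) (sym (f-other w≢m)) (stop (trans (o-lab w≢m) wj))
      outer : ∀ {a b j l} → K j l ≡ true → β a ≡ just j → β b ≡ just l → E a b → Joined E β′ j l
      outer {a} {b} jl aj bl e with a ≟ m | b ≟ m
      ... | yes refl | yes refl = ⊥-elim (loopless F _ (subst (λ x → K _ x ≡ true) (label≡ bl aj) jl))
      ... | no a≢m | no b≢m = a , b , trans (o-lab a≢m) aj , trans (o-lab b≢m) bl , e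
      ... | yes refl | no b≢m with nbr b e
      ...   | inj₁ refl = s , m , trans (o-lab s≢m) (trans si (trans (sym mi) aj)) , trans m-lab bl , E-sym ms
      ...   | inj₂ refl = ⊥-elim (loopless F _ (subst (λ x → K x _ ≡ true) (trans (label≡ aj mi) (label≡ si bl)) jl))
      outer {a} {b} jl aj bl e | no a≢m | yes refl with nbr a (E-sym e)
      ...   | inj₁ refl = m , s , trans m-lab aj , trans (o-lab s≢m) (trans si (trans (sym mi) bl)) , ms
      ...   | inj₂ refl = ⊥-elim (loopless F _ (subst (λ x → K _ x ≡ true) (trans (label≡ bl mi) (label≡ si aj)) jl))

    relabel : Model E K (put m (β y) β)
    relabel = go (β m) refl (β y) refl
      where
      go : ∀ l → β m ≡ l → ∀ l′ → β y ≡ l′ → Model E K β′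
      go nothing  mn nothing  yn = unchanged (trans mn (sym yn))
      go nothing  mn (just i) yi = attach mn yi
      go (just i) mi l′ yl with β y ≟ₗ just i
      ... | yes yi = unchanged (trans mi (sym yi))
      ... | no ynot = let si , ms = second-neighbour mi ynot in move-leaf mi ynot si ms

module Identify {k} {E E′ : Fin k → Fin k → Set} (E′-sym : ∀ {a b} → E′ a b → E′ b a)
                (F : Member) {β : Labelling (Fin k) (size F)} (M : Model E (pattern-of F) β)
                (u v : Fin k) (u≢v : u ≢ v) where
  private
    K = pattern-of F
    _≟ₗ_ = ≡-dec (_≟_ {size F})

  Out In Boundary : Fin k → Set
  Out z = z ≢ u × z ≢ v
  In z = z ≡ u ⊎ z ≡ v
  Boundary z = Out z × (E u z ⊎ E v z)

  in-or-out : ∀ z → In z ⊎ Out z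
  in-or-out z with z ≟ u | z ≟ v
  ... | yes e | _     = inj₁ (inj₁ e)
  ... | no _  | yes e = inj₁ (inj₂ e)
  ... | no e  | no d  = inj₂ (e , d)

  -- The vertex u of E′ stands for the identified vertex; v is discarded.
  Result : Set
  Result = Σ Member λ F′ → Σ (Fin (size F) → Maybe (Fin (size F′))) λ φ →
           Σ (Labelling (Fin k) (size F′)) λ β′ →
           Model E′ (pattern-of F′) β′ × (∀ z → Out z → β′ z ≡ (β z >>= φ)) × β′ v ≡ nothing

  -- The three vertices may coincide, so the second alternative covers every nonempty boundary.
  AtMostThree : Set
  AtMostThree = (∀ z → ¬ Boundary z) ⊎
    (∃ λ a → ∃₂ λ b c → Boundary a × Boundary b × Boundary c ×
      (∀ z → Boundary z → z ≡ a ⊎ z ≡ b ⊎ z ≡ c))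

  abstract
    β₀ : Maybe (Fin (size F)) → Labelling (Fin k) (size F)
    β₀ l = put u l (put v nothing β)

    β₀-u : ∀ l → β₀ l u ≡ l
    β₀-u l = put-same u l (put v nothing β)

    β₀-v : ∀ l → β₀ l v ≡ nothing
    β₀-v l = trans (put-other u l (put v nothing β) (λ e → u≢v (sym e))) (put-same v nothing β)

    β₀-out : ∀ l {z} → Out z → β₀ l z ≡ β z
    β₀-out l (z≢u , z≢v) = trans (put-other u l (put v nothing β) z≢u) (put-other v nothing β z≢v)

  β₀-labelled : ∀ l z {i} → β₀ l z ≡ just i → z ≡ u × l ≡ just i ⊎ Out z × β z ≡ just i
  β₀-labelled l z e with in-or-out z
  ... | inj₁ (inj₁ refl) = inj₁ (refl , trans (sym (β₀-u l)) e)
  ... | inj₁ (inj₂ refl) = ⊥-elim (just≢nothing e (β₀-v l))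
  ... | inj₂ o           = inj₂ (o , trans (sym (β₀-out l o)) e)

  >>=-just : ∀ {A : Set} (m : Maybe A) → m ≡ (m >>= just)
  >>=-just (just _) = refl
  >>=-just nothing  = refl

  finish : ∀ l → Model E′ K (β₀ l) → Result
  finish l N = F , just , β₀ l , N , (λ z o → trans (β₀-out l o) (>>=-just (β z))) , β₀-v l

  -- Equal labels mean that the identification happens inside one bag or outside all bags, so the
  -- size of the boundary does not matter: every edge is mapped to an edge or collapses, and an edge
  -- between different bags cannot collapse.
  same-bag : (∀ {a b} → Out a → Out b → E a b → E′ a b) → (∀ {z} → Out z → E u z ⊎ E v z → E′ u z) →
             (∀ {a b} → E a b → E b a) → β u ≡ β v → Model E′ K (β₀ (β u))
  same-bag keep extend E-sym same = transfer E′-sym f lab inner cover outer M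
    where
    f : Fin k → Fin k
    f a with a ≟ v
    ... | yes _ = u
    ... | no _ = a
    f-out : ∀ {a} → Out a → f a ≡ a
    f-out {a} (_ , a≢v) with a ≟ v
    ... | yes e = ⊥-elim (a≢v e)
    ... | no _ = refl
    f-in : ∀ {a} → In a → f a ≡ u
    f-in {a} i with a ≟ v
    f-in i | yes _ = refl
    f-in (inj₁ e) | no _ = e
    f-in (inj₂ e) | no a≢v = ⊥-elim (a≢v e)
    in-label : ∀ {a i} → In a → β a ≡ just i → β u ≡ just i
    in-label (inj₁ refl) e = e
    in-label (inj₂ refl) e = trans same e
    lab : ∀ {a i} → β a ≡ just i → β₀ (β u) (f a) ≡ just i
    lab {a} ai with in-or-out a
    ... | inj₁ i = trans (cong (β₀ (β u)) (f-in i)) (trans (β₀-u (β u)) (in-label i ai))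
    ... | inj₂ o = trans (cong (β₀ (β u)) (f-out o)) (trans (β₀-out (β u) o) ai)
    in-edge : ∀ {a b} → In a → E a b → E u b ⊎ E v b
    in-edge (inj₁ refl) e = inj₁ e
    in-edge (inj₂ refl) e = inj₂ e
    hom : ∀ {a b} → E a b → f a ≡ f b ⊎ E′ (f a) (f b)
    hom {a} {b} e with in-or-out a | in-or-out b
    ... | inj₁ i | inj₁ j = inj₁ (trans (f-in i) (sym (f-in j)))
    ... | inj₂ o | inj₂ o′ = inj₂ (cong₂-E (f-out o) (f-out o′) (keep o o′ e))
      where
      cong₂-E : ∀ {x y z w} → x ≡ z → y ≡ w → E′ z w → E′ x y
      cong₂-E refl refl e = e
    ... | inj₁ i | inj₂ o rewrite f-in i | f-out o = inj₂ (extend o (in-edge i e))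
    ... | inj₂ o | inj₁ i rewrite f-in i | f-out o = inj₂ (E′-sym (extend o (in-edge i (E-sym e))))
    inner : ∀ {a b i} → β a ≡ just i → β b ≡ just i → E a b → Path E′ (Bag (β₀ (β u)) i) (f a) (f b)
    inner {a} {b} {i} ai bi e with hom e
    ... | inj₁ eq = subst (Path E′ (Bag (β₀ (β u)) i) (f a)) eq (stop (lab ai))
    ... | inj₂ d  = edge-path (lab ai) (lab bi) d
    cover : ∀ {w i} → β₀ (β u) w ≡ just i → ∃ λ a → β a ≡ just i × Path E′ (Bag (β₀ (β u)) i) w (f a)
    cover {w} {i} wi with β₀-labelled (β u) w wi
    ... | inj₁ (refl , ui) = u , ui , subst (Path E′ (Bag (β₀ (β u)) i) u) (sym (f-in (inj₁ refl))) (stop wi)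
    ... | inj₂ (o , wi′)   = w , wi′ , subst (Path E′ (Bag (β₀ (β u)) i) w) (sym (f-out o)) (stop wi)
    outer : ∀ {a b i j} → K i j ≡ true → β a ≡ just i → β b ≡ just j → E a b → Joined E′ (β₀ (β u)) i j
    outer {a} {b} ij ai bj e with hom e
    ... | inj₁ eq = ⊥-elim (loopless F _ (subst (λ x → K _ x ≡ true)
                      (label≡ (trans (cong (β₀ (β u)) eq) (lab bj)) (lab ai)) ij))
    ... | inj₂ d  = f a , f b , lab ai , lab bj , d

  module Small (keep : ∀ {a b} → Out a → Out b → E a b → E′ a b)
               (extend : ∀ {z} → Boundary z → E′ u z)
               (E-sym : ∀ {a b} → E a b → E b a)
               (bounded : AtMostThree) where

    exit : ∀ {w o i} → Path E (Bag β i) w o → In w → Out o → ∃ λ z → Boundary z × β z ≡ just i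
    exit (stop _) (inj₁ e) (o , _) = ⊥-elim (o e)
    exit (stop _) (inj₂ e) (_ , o) = ⊥-elim (o e)
    exit (move {b = b} _ e r) w o with in-or-out b
    ... | inj₁ i = exit r i o
    ... | inj₂ b-out = b , (b-out , boundary w e) , path-start r
      where
      boundary : ∀ {w b} → In w → E w b → E u b ⊎ E v b
      boundary (inj₁ refl) e = inj₁ e
      boundary (inj₂ refl) e = inj₂ e

    step-boundary : ∀ {a b} → In a → Out b → E a b → Boundary b
    step-boundary (inj₁ refl) o e = o , inj₁ e
    step-boundary (inj₂ refl) o e = o , inj₂ e

    Conflict : Fin (size F) → Fin (size F) → Set
    Conflict i j = i ≡ j ⊎ K i j ≡ true

    -- If no bag lies inside {u , v}, the two vertices only serve to connect bags that
    -- meet the boundary, so they can be exchanged for a complete graph on the boundary.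
    module NoneInside (leave : ∀ {w i} → In w → β w ≡ just i → ∃ λ z → Boundary z × β z ≡ just i) where

      EΔ : Fin k → Fin k → Set
      EΔ a b = (Out a × Out b × E a b) ⊎ (Boundary a × Boundary b)

      EΔ-sym : ∀ {a b} → EΔ a b → EΔ b a
      EΔ-sym (inj₁ (a , b , e)) = inj₁ (b , a , E-sym e)
      EΔ-sym (inj₂ (a , b))     = inj₂ (b , a)

      -- A labelled vertex of the pair moves to a boundary vertex of its own bag; all other vertices
      -- stay. The fields presuppose a label because `leave` offers no boundary vertex to an
      -- unlabelled one.
      record Image (a : Fin k) : Set where
        field
          img     : Fin k
          img-out : ∀ {i} → β a ≡ just i → Out img
          img-lab : ∀ {i} → β a ≡ just i → β img ≡ just i
          img-in  : ∀ {i} → β a ≡ just i → In a → Boundary img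
          img-id  : Out a → img ≡ a
      open Image

      image : ∀ a → Image a
      image a with in-or-out a
      ... | inj₂ o = record { img = a ; img-out = λ _ → o ; img-lab = λ e → e
                            ; img-in = λ { _ (inj₁ e) → ⊥-elim (proj₁ o e) ; _ (inj₂ e) → ⊥-elim (proj₂ o e) }
                            ; img-id = λ _ → refl }
      ... | inj₁ i with β a in eq
      ...   | nothing = record { img = a ; img-out = λ e → ⊥-elim (just≢nothing e eq) ; img-lab = λ e → e
                               ; img-in = λ e → ⊥-elim (just≢nothing e eq) ; img-id = λ _ → refl }
      ...   | just l with leave i eq
      ...     | z , b , zl = record { img = z ; img-out = λ _ → proj₁ b
                                    ; img-lab = λ e → trans zl (trans (sym eq) e) ; img-in = λ _ _ → b
                                    ; img-id = λ o → ⊥-elim ([ proj₁ o , proj₂ o ]′ i) }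

      f : Fin k → Fin k
      f a = img (image a)

      f-edge : ∀ {a b i j} → β a ≡ just i → β b ≡ just j → E a b → EΔ (f a) (f b)
      f-edge {a} {b} ai bj e = go (in-or-out a) (in-or-out b)
        where
        cong₂-E : ∀ {x y z w} → x ≡ z → y ≡ w → E z w → E x y
        cong₂-E refl refl e = e
        go : In a ⊎ Out a → In b ⊎ Out b → EΔ (f a) (f b)
        go (inj₁ x) (inj₁ y) = inj₂ (img-in (image a) ai x , img-in (image b) bj y)
        go (inj₁ x) (inj₂ o) = inj₂ (img-in (image a) ai x ,
          subst Boundary (sym (img-id (image b) o)) (step-boundary x o e))
        go (inj₂ o) (inj₁ y) = inj₂
          (subst Boundary (sym (img-id (image a) o)) (step-boundary y o (E-sym e)) , img-in (image b) bj y)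
        go (inj₂ o) (inj₂ o′) = inj₁ (img-out (image a) ai , img-out (image b) bj ,
          cong₂-E (img-id (image a) o) (img-id (image b) o′) e)

      f-lab : ∀ {a i} → β a ≡ just i → β₀ nothing (f a) ≡ just i
      f-lab {a} ai = trans (β₀-out nothing (img-out (image a) ai)) (img-lab (image a) ai)

      MΔ : Model EΔ K (β₀ nothing)
      MΔ = transfer EΔ-sym f f-lab
        (λ ai bi e → edge-path (f-lab ai) (f-lab bi) (f-edge ai bi e)) cover
        (λ _ ai bj e → _ , _ , f-lab ai , f-lab bj , f-edge ai bj e) M
        where
        cover : ∀ {w i} → β₀ nothing w ≡ just i → ∃ λ a → β a ≡ just i × Path EΔ (Bag (β₀ nothing) i) w (f a)
        cover {w} {i} wi with β₀-labelled nothing w wi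
        ... | inj₂ (o , wi′) = w , wi′ , subst (Path EΔ (Bag (β₀ nothing) i) w) (sym (img-id (image w) o)) (stop wi)

      out-label : ∀ {a i} → β₀ nothing a ≡ just i → Out a × β a ≡ just i
      out-label {a} e with β₀-labelled nothing a e
      ... | inj₂ r = r

      -- The edges added on the boundary serve only bags that are equal or adjacent. If no two
      -- boundary vertices carry such labels, all of these edges can go, and `u` stays outside the
      -- model.
      dismiss : (∀ {p q i j} → Boundary p → Boundary q → β p ≡ just i → β q ≡ just j → Conflict i j → p ≡ q) → Result
      dismiss free = finish nothing (transfer E′-sym (λ z → z) (λ e → e) inner (λ e → _ , e , stop e) outer MΔ)
        where
        inner : ∀ {a b i} → β₀ nothing a ≡ just i → β₀ nothing b ≡ just i → EΔ a b → Path E′ (Bag (β₀ nothing) i) a b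
        inner ai bi (inj₁ (o , o′ , e)) = edge-path ai bi (keep o o′ e)
        inner ai bi (inj₂ (p , q)) with free p q (proj₂ (out-label ai)) (proj₂ (out-label bi)) (inj₁ refl)
        ... | refl = stop ai
        outer : ∀ {a b i j} → K i j ≡ true → β₀ nothing a ≡ just i → β₀ nothing b ≡ just j → EΔ a b → Joined E′ (β₀ nothing) i j
        outer ij ai bj (inj₁ (o , o′ , e)) = _ , _ , ai , bj , keep o o′ e
        outer ij ai bj (inj₂ (p , q)) with free p q (proj₂ (out-label ai)) (proj₂ (out-label bj)) (inj₂ ij)
        ... | refl = ⊥-elim (loopless F _ (subst (λ x → K _ x ≡ true) (label≡ bj ai) ij))

      -- As every conflict involves `l`, it is enough to put `u` into bag `l`: being adjacent to the
      -- whole boundary, it joins the pieces of this bag and links it to the others.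
      absorb : ∀ {c l} → Boundary c → β c ≡ just l →
               (∀ {p q i j} → Boundary p → Boundary q → β p ≡ just i → β q ≡ just j → Conflict i j → p ≡ q ⊎ i ≡ l ⊎ j ≡ l) → Result
      absorb {c} {l} c-bd cl covered = finish (just l) (transfer E′-sym (λ z → z) lab inner cover outer MΔ)
        where
        β₁ = β₀ (just l)
        ul : β₁ u ≡ just l
        ul = β₀-u (just l)
        lab : ∀ {a i} → β₀ nothing a ≡ just i → β₁ a ≡ just i
        lab e = let o , d = out-label e in trans (β₀-out (just l) o) d
        inner : ∀ {a b i} → β₀ nothing a ≡ just i → β₀ nothing b ≡ just i → EΔ a b → Path E′ (Bag β₁ i) a b
        inner ai bi (inj₁ (o , o′ , e)) = edge-path (lab ai) (lab bi) (keep o o′ e)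
        inner ai bi (inj₂ (p , q)) with covered p q (proj₂ (out-label ai)) (proj₂ (out-label bi)) (inj₁ refl)
        ... | inj₁ refl = stop (lab ai)
        ... | inj₂ (inj₁ refl) = move (lab ai) (E′-sym (extend p)) (edge-path ul (lab bi) (extend q))
        ... | inj₂ (inj₂ refl) = move (lab ai) (E′-sym (extend p)) (edge-path ul (lab bi) (extend q))
        cover : ∀ {w i} → β₁ w ≡ just i → ∃ λ a → β₀ nothing a ≡ just i × Path E′ (Bag β₁ i) w a
        cover {w} wi with β₀-labelled (just l) w wi
        ... | inj₂ (o , d) = w , trans (β₀-out nothing o) d , stop wi
        ... | inj₁ (refl , refl) = c , trans (β₀-out nothing (proj₁ c-bd)) cl ,
                                   edge-path wi (trans (β₀-out (just l) (proj₁ c-bd)) cl) (extend c-bd)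
        outer : ∀ {a b i j} → K i j ≡ true → β₀ nothing a ≡ just i → β₀ nothing b ≡ just j → EΔ a b → Joined E′ β₁ i j
        outer ij ai bj (inj₁ (o , o′ , e)) = _ , _ , lab ai , lab bj , keep o o′ e
        outer ij ai bj (inj₂ (p , q)) with covered p q (proj₂ (out-label ai)) (proj₂ (out-label bj)) (inj₂ ij)
        ... | inj₁ refl = ⊥-elim (loopless F _ (subst (λ x → K _ x ≡ true) (label≡ bj ai) ij))
        ... | inj₂ (inj₁ refl) = u , _ , ul , lab bj , extend q
        ... | inj₂ (inj₂ refl) = _ , u , lab ai , ul , E′-sym (extend p)

      -- With `u` in bag `i`, the pairs `i j` and `i l` would be served but not `j l`, and likewise
      -- for the other choices. So `u` becomes a bag of its own, the centre of the claw.
      module Triangle {a b c i j l} (a-bd : Boundary a) (b-bd : Boundary b) (c-bd : Boundary c)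
                      (all : ∀ z → Boundary z → z ≡ a ⊎ z ≡ b ⊎ z ≡ c)
                      (ai : β a ≡ just i) (bj : β b ≡ just j) (cl : β c ≡ just l)
                      (i≢j : i ≢ j) (i≢l : i ≢ l) (j≢l : j ≢ l) where

        abstract
          β₂ : Labelling (Fin k) (suc (size F))
          β₂ z with z ≟ u
          ... | yes _ = just zero
          ... | no _  = Maybe.map suc (β₀ nothing z)

          β₂-u : β₂ u ≡ just zero
          β₂-u with u ≟ u
          ... | yes _ = refl
          ... | no e = ⊥-elim (e refl)

          β₂-out : ∀ {z} → Out z → β₂ z ≡ Maybe.map suc (β z)
          β₂-out {z} o with z ≟ u
          ... | yes e = ⊥-elim (proj₁ o e)
          ... | no _ = cong (Maybe.map suc) (β₀-out nothing o)

          β₂-v : β₂ v ≡ nothing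
          β₂-v with v ≟ u
          ... | yes e = ⊥-elim (u≢v (sym e))
          ... | no _ = cong (Maybe.map suc) (β₀-v nothing)

        up : ∀ {z x} → β₀ nothing z ≡ just x → β₂ z ≡ just (suc x)
        up e = let o , d = out-label e in trans (β₂-out o) (cong (Maybe.map suc) d)

        map-suc : ∀ {m : Maybe (Fin (size F))} {x} → Maybe.map suc m ≡ just (suc x) → m ≡ just x
        map-suc {just _} refl = refl

        down : ∀ {z x} → β₂ z ≡ just (suc x) → β₀ nothing z ≡ just x
        down {z} e with in-or-out z
        ... | inj₁ (inj₁ refl) with () ← trans (sym e) β₂-u
        ... | inj₁ (inj₂ refl) = ⊥-elim (just≢nothing e β₂-v)
        ... | inj₂ o = trans (β₀-out nothing o) (map-suc (trans (sym (β₂-out o)) e))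

        zero-u : ∀ {z} → β₂ z ≡ just zero → z ≡ u
        zero-u {z} e with in-or-out z
        ... | inj₁ (inj₁ r) = r
        ... | inj₁ (inj₂ refl) = ⊥-elim (just≢nothing e β₂-v)
        ... | inj₂ o with β z | trans (sym (β₂-out o)) e
        ...   | just _  | ()
        ...   | nothing | ()

        corner : ∀ {z x} → Boundary z → β z ≡ just x → z ≡ a × x ≡ i ⊎ z ≡ b × x ≡ j ⊎ z ≡ c × x ≡ l
        corner {z} z-bd zx with all z z-bd
        ... | inj₁ refl        = inj₁ (refl , label≡ zx ai)
        ... | inj₂ (inj₁ refl) = inj₂ (inj₁ (refl , label≡ zx bj))
        ... | inj₂ (inj₂ refl) = inj₂ (inj₂ (refl , label≡ zx cl))

        corner-label : ∀ {z x} → Boundary z → β z ≡ just x → among x i j l ≡ true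
        corner-label z-bd zx = among-intro _ i j l (Sum.map proj₂ (Sum.map proj₂ proj₂) (corner z-bd zx))

        corner-unique : ∀ {z w x} → Boundary z → Boundary w → β z ≡ just x → β w ≡ just x → z ≡ w
        corner-unique p q zx wx with corner p zx | corner q wx
        ... | inj₁ (refl , _) | inj₁ (refl , _) = refl
        ... | inj₂ (inj₁ (refl , _)) | inj₂ (inj₁ (refl , _)) = refl
        ... | inj₂ (inj₂ (refl , _)) | inj₂ (inj₂ (refl , _)) = refl
        ... | inj₁ (_ , e) | inj₂ (inj₁ (_ , d)) = ⊥-elim (i≢j (trans (sym e) d))
        ... | inj₁ (_ , e) | inj₂ (inj₂ (_ , d)) = ⊥-elim (i≢l (trans (sym e) d))
        ... | inj₂ (inj₁ (_ , e)) | inj₁ (_ , d) = ⊥-elim (i≢j (trans (sym d) e))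
        ... | inj₂ (inj₁ (_ , e)) | inj₂ (inj₂ (_ , d)) = ⊥-elim (j≢l (trans (sym e) d))
        ... | inj₂ (inj₂ (_ , e)) | inj₁ (_ , d) = ⊥-elim (i≢l (trans (sym d) e))
        ... | inj₂ (inj₂ (_ , e)) | inj₂ (inj₁ (_ , d)) = ⊥-elim (j≢l (trans (sym d) e))

        spoke : ∀ {x} → among x i j l ≡ true → ∃ λ z → β₂ z ≡ just (suc x) × E′ u z
        spoke {x} h with ∨-split {x == i} h
        ... | inj₁ e rewrite ==-sound x i e = a , up (trans (β₀-out nothing (proj₁ a-bd)) ai) , extend a-bd
        ... | inj₂ h with ∨-split {x == j} h
        ...   | inj₁ e rewrite ==-sound x j e = b , up (trans (β₀-out nothing (proj₁ b-bd)) bj) , extend b-bd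
        ...   | inj₂ e rewrite ==-sound x l e = c , up (trans (β₀-out nothing (proj₁ c-bd)) cl) , extend c-bd

        claw-model : Model E′ (claw K i j l) β₂
        claw-model = record { inhabited = inh ; connected = conn ; joined = λ {x} {y} → jn x y }
          where
          inh : ∀ x → ∃ λ z → β₂ z ≡ just x
          inh zero = u , β₂-u
          inh (suc x) = let z , e = inhabited MΔ x in z , up e
          conn : ∀ {x z w} → β₂ z ≡ just x → β₂ w ≡ just x → Path E′ (Bag β₂ x) z w
          conn {zero} {z} {w} e d with refl ← zero-u {z} e | refl ← zero-u {w} d = stop e
          conn {suc x} {z} {w} e d = path-bind (λ z → z) (λ {z} → up {z}) along (connected MΔ (down {z} e) (down {w} d))
            where
            along : ∀ {z w} → β₀ nothing z ≡ just x → β₀ nothing w ≡ just x → EΔ z w → Path E′ (Bag β₂ (suc x)) z w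
            along {z} {w} zx wx (inj₁ (o , o′ , e)) = edge-path (up {z} zx) (up {w} wx) (keep o o′ e)
            along {z} {w} zx wx (inj₂ (p , q)) with corner-unique p q (proj₂ (out-label {z} zx)) (proj₂ (out-label {w} wx))
            ... | refl = stop (up {z} zx)
          jn : ∀ x y → claw K i j l x y ≡ true → Joined E′ β₂ x y
          jn zero (suc y) h = let z , e , d = spoke h in u , z , β₂-u , e , d
          jn (suc x) zero h = let z , e , d = spoke h in z , u , e , β₂-u , E′-sym d
          -- An edge of the claw pattern between old labels does not join two of `i`, `j`, `l`, so
          -- it cannot rest on an edge that was added on the boundary.
          jn (suc x) (suc y) h with ∧-split {K x y} h
          ... | xy , apart with joined MΔ xy
          ...   | z , w , zx , wy , inj₁ (o , o′ , e) = z , w , up zx , up wy , keep o o′ e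
          ...   | z , w , zx , wy , inj₂ (p , q) = ⊥-elim (not-true apart
                    (cong₂ _∧_ (corner-label p (proj₂ (out-label zx))) (corner-label q (proj₂ (out-label wy)))))

        to-claw : K i j ≡ true → K i l ≡ true → K j l ≡ true → Result
        to-claw ij il jl with claw-minor F i j l (cong₂ _∧_ ij (cong₂ _∧_ il jl))
        ... | F′ , φ , N = F′ , φ ∘ suc , (λ z → β₂ z >>= φ) , model-compose claw-model N ,
              (λ z o → trans (cong (_>>= φ) (β₂-out o)) (map-bind (β z))) , cong (_>>= φ) β₂-v
          where
          map-bind : ∀ m → (Maybe.map suc m >>= φ) ≡ (m >>= (φ ∘ suc))
          map-bind (just _) = refl
          map-bind nothing  = refl

      Clash : Fin k → Fin k → Set
      Clash a b = ∃₂ λ i j → β a ≡ just i × β b ≡ just j × Conflict i j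

      clash? : ∀ a b → Dec (Clash a b)
      clash? a b with β a | β b
      ... | nothing | _ = no λ { (_ , _ , () , _) }
      ... | just i | nothing = no λ { (_ , _ , _ , () , _) }
      ... | just i | just j with (i ≟ j) ⊎-dec (K i j Bool.≟ true)
      ...   | yes r = yes (i , j , refl , refl , r)
      ...   | no r = no λ { (_ , _ , refl , refl , q) → r q }

      clash-sym : ∀ {a b} → Clash a b → Clash b a
      clash-sym (i , j , ai , bj , inj₁ e) = j , i , bj , ai , inj₁ (sym e)
      clash-sym (i , j , ai , bj , inj₂ e) = j , i , bj , ai , inj₂ (symmetric F i j e)

      -- Without a clash between a and b, every clash involves c.
      via : ∀ {a b c} → Boundary c → (∀ z → Boundary z → z ≡ a ⊎ z ≡ b ⊎ z ≡ c) → ¬ Clash a b → Result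
      via {a} {b} {c} c-bd all free = go (β c) refl
        where
        quiet : ∀ {p q i j} → Boundary p → Boundary q → β p ≡ just i → β q ≡ just j → Conflict i j → p ≡ q ⊎ p ≡ c ⊎ q ≡ c
        quiet {p} {q} p-bd q-bd pi qj r with all p p-bd | all q q-bd
        ... | inj₂ (inj₂ e) | _ = inj₂ (inj₁ e)
        ... | _ | inj₂ (inj₂ e) = inj₂ (inj₂ e)
        ... | inj₁ refl | inj₁ refl = inj₁ refl
        ... | inj₂ (inj₁ refl) | inj₂ (inj₁ refl) = inj₁ refl
        ... | inj₁ refl | inj₂ (inj₁ refl) = ⊥-elim (free (_ , _ , pi , qj , r))
        ... | inj₂ (inj₁ refl) | inj₁ refl = ⊥-elim (free (clash-sym (_ , _ , pi , qj , r)))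
        go : ∀ m → β c ≡ m → Result
        go nothing cn = dismiss λ p q pi qj r → [ (λ e → e) , [ (λ { refl → ⊥-elim (just≢nothing pi cn) }) , (λ { refl → ⊥-elim (just≢nothing qj cn) }) ]′ ]′ (quiet p q pi qj r)
        go (just l) cl = absorb c-bd cl λ p q pi qj r → Sum.map₂ (Sum.map (λ { refl → label≡ pi cl }) (λ { refl → label≡ qj cl })) (quiet p q pi qj r)

      -- Two different boundary vertices always include `a` or `b`, and both of these lie in bag
      -- `l`.
      twins : ∀ {a b c l} → Boundary a → (∀ z → Boundary z → z ≡ a ⊎ z ≡ b ⊎ z ≡ c) →
              β a ≡ just l → β b ≡ just l → Result
      twins {a} {b} {c} {l} a-bd all al bl = absorb a-bd al λ {p} {q} p-bd q-bd pi qj _ → go (all p p-bd) (all q q-bd) pi qj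
        where
        go : ∀ {p q i j} → p ≡ a ⊎ p ≡ b ⊎ p ≡ c → q ≡ a ⊎ q ≡ b ⊎ q ≡ c → β p ≡ just i → β q ≡ just j → p ≡ q ⊎ i ≡ l ⊎ j ≡ l
        go (inj₁ refl) _ pi qj = inj₂ (inj₁ (label≡ pi al))
        go (inj₂ (inj₁ refl)) _ pi qj = inj₂ (inj₁ (label≡ pi bl))
        go _ (inj₁ refl) pi qj = inj₂ (inj₂ (label≡ qj al))
        go _ (inj₂ (inj₁ refl)) pi qj = inj₂ (inj₂ (label≡ qj bl))
        go (inj₂ (inj₂ refl)) (inj₂ (inj₂ refl)) pi qj = inj₁ refl

      -- Either one boundary vertex meets all clashes, or two boundary vertices share a label, or
      -- the labels form a triangle of the pattern. Only the last case changes the pattern.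
      corners : ∀ {a b c} → Boundary a → Boundary b → Boundary c →
                (∀ z → Boundary z → z ≡ a ⊎ z ≡ b ⊎ z ≡ c) → Result
      corners {a} {b} {c} a-bd b-bd c-bd all with clash? a b | clash? a c | clash? b c
      ... | no r | _ | _ = via c-bd all r
      ... | yes _ | no r | _ = via b-bd (λ z z-bd → Sum.map₂ Sum.swap (all z z-bd)) r
      ... | yes _ | yes _ | no r = via a-bd (λ z z-bd → Sum.assocʳ (Sum.swap (all z z-bd))) r
      ... | yes (i , j , ai , bj , r) | yes (i₁ , l , ai₁ , cl , s) | yes (j₁ , l₁ , bj₁ , cl₁ , t)
        with refl ← label≡ ai ai₁ | refl ← label≡ bj bj₁ | refl ← label≡ cl cl₁ with r | s | t
      ...   | inj₁ refl | _ | _ = twins a-bd all ai bj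
      ...   | inj₂ _ | inj₁ refl | _ = twins {a} {c} {b} a-bd (λ z z-bd → Sum.map₂ Sum.swap (all z z-bd)) ai cl
      ...   | inj₂ _ | inj₂ _ | inj₁ refl = twins {b} {c} {a} b-bd (λ z z-bd → Sum.assocʳ (Sum.swap (all z z-bd))) bj cl
      ...   | inj₂ ij | inj₂ il | inj₂ jl = Triangle.to-claw a-bd b-bd c-bd all ai bj cl
                (λ { refl → loopless F i ij }) (λ { refl → loopless F i il }) (λ { refl → loopless F j jl }) ij il jl

      none-inside : Result
      none-inside = [ (λ empty → dismiss λ p → ⊥-elim (empty _ p)) ,
                      (λ { (_ , _ , _ , a-bd , b-bd , c-bd , all) → corners a-bd b-bd c-bd all }) ]′ bounded

    Inside : Fin (size F) → Set
    Inside i = ∀ {z} → β z ≡ just i → In z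

    boundary-label : ∀ {x a b c} → (∀ z → Boundary z → z ≡ a ⊎ z ≡ b ⊎ z ≡ c) → ∀ {w z} →
                     Boundary z → β z ≡ just x →
                     x ≡ fromMaybe w (β a) ⊎ x ≡ fromMaybe w (β b) ⊎ x ≡ fromMaybe w (β c)
    boundary-label all {z = z} z-bd zx with all z z-bd
    ... | inj₁ refl        = inj₁ (sym (fromMaybe-just zx))
    ... | inj₂ (inj₁ refl) = inj₂ (inj₁ (sym (fromMaybe-just zx)))
    ... | inj₂ (inj₂ refl) = inj₂ (inj₂ (sym (fromMaybe-just zx)))

    -- Each of the two bags is a single vertex of the pair, so every other bag adjacent to one of
    -- them appears at the boundary: four labels on at most three vertices.
    two-inside : ∀ {w w′} → w ≢ w′ → Inside w → Inside w′ → Result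
    two-inside {w} {w′} w≢w′ w-in w′-in = ⊥-elim ([ empty , few ]′ bounded)
      where
      labels : ∀ {z} → In z → β z ≡ just w ⊎ β z ≡ just w′
      labels i with inhabited M w | inhabited M w′
      ... | a , aw | b , bw′ with w-in aw | w′-in bw′ | i
      ...   | inj₁ refl | inj₁ refl | _ = ⊥-elim (w≢w′ (label≡ aw bw′))
      ...   | inj₂ refl | inj₂ refl | _ = ⊥-elim (w≢w′ (label≡ aw bw′))
      ...   | inj₁ refl | inj₂ refl | inj₁ refl = inj₁ aw
      ...   | inj₁ refl | inj₂ refl | inj₂ refl = inj₂ bw′
      ...   | inj₂ refl | inj₁ refl | inj₁ refl = inj₂ bw′
      ...   | inj₂ refl | inj₁ refl | inj₂ refl = inj₁ aw
      reach : ∀ {y x} → Inside y → K y x ≡ true → x ≢ w → x ≢ w′ → ∃ λ z → Boundary z × β z ≡ just x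
      reach y-in yx x≢w x≢w′ with joined M yx
      ... | a , b , ay , bx , e with in-or-out b
      ...   | inj₂ o = b , step-boundary (y-in ay) o e , bx
      ...   | inj₁ i = ⊥-elim ([ (λ d → x≢w (label≡ bx d)) , (λ d → x≢w′ (label≡ bx d)) ]′ (labels i))
      neighbour : ∀ i j l → ∃ λ x → x ≢ i × x ≢ j × x ≢ l × ∃ λ z → Boundary z × β z ≡ just x
      neighbour i j l with pair-neighbours≥4 F w w′ w≢w′ i j l
      ... | x , inj₁ e , x≢w , x≢w′ , xi , xj , xl = x , xi , xj , xl , reach w-in e x≢w x≢w′
      ... | x , inj₂ e , x≢w , x≢w′ , xi , xj , xl = x , xi , xj , xl , reach w′-in e x≢w x≢w′
      empty : ¬ (∀ z → ¬ Boundary z)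
      empty e = let _ , _ , _ , _ , z , b , _ = neighbour w w w in e z b
      few : ¬ (∃ λ a → ∃₂ λ b c → Boundary a × Boundary b × Boundary c × (∀ z → Boundary z → z ≡ a ⊎ z ≡ b ⊎ z ≡ c))
      few (a , b , c , _ , _ , _ , all) =
        let _ , xi , xj , xl , z , z-bd , zx = neighbour (fromMaybe w (β a)) (fromMaybe w (β b)) (fromMaybe w (β c))
        in [ xi , [ xj , xl ]′ ]′ (boundary-label all z-bd zx)

    -- A bag inside {u , v} has three neighbouring bags, one for each boundary vertex; as these
    -- are pairwise non-adjacent in the pattern, the other vertex of {u , v} is not needed.
    module OneInside {w} (w-in : Inside w)
                     (leave : ∀ {x i} → In x → β x ≡ just i → i ≢ w → ∃ λ z → Boundary z × β z ≡ just i) where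

      reach : ∀ {a b x} → In a → β b ≡ just x → x ≢ w → E a b → ∃ λ z → Boundary z × β z ≡ just x
      reach {b = b} a-in bx x≢w e with in-or-out b
      ... | inj₂ o = b , step-boundary a-in o e , bx
      ... | inj₁ i = leave i bx x≢w

      neighbour : ∀ x → K w x ≡ true → ∃ λ z → Boundary z × β z ≡ just x
      neighbour x wx with joined M wx
      ... | a , b , aw , bx , e = reach (w-in aw) bx (λ { refl → loopless F w wx }) e

      module _ (distinct : ∀ {p q i} → Boundary p → Boundary q → β p ≡ just i → β q ≡ just i → p ≡ q)
               (apart : ∀ {p q i j} → Boundary p → Boundary q → β p ≡ just i → β q ≡ just j → K i j ≢ true) where

        β₁ = β₀ (just w)

        record Image (a : Fin k) : Set where
          field
            img    : Fin k
            in-w   : β a ≡ just w → img ≡ u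
            in-bd  : ∀ {i} → In a → β a ≡ just i → i ≢ w → Boundary img × β img ≡ just i
            img-id : Out a → img ≡ a
        open Image

        image : ∀ a → Image a
        image a with in-or-out a
        ... | inj₂ o = record { img = a
                              ; in-w = λ e → ⊥-elim ([ proj₁ o , proj₂ o ]′ (w-in e))
                              ; in-bd = λ i → ⊥-elim ([ proj₁ o , proj₂ o ]′ i)
                              ; img-id = λ _ → refl }
        ... | inj₁ i with β a in eq
        ...   | nothing = record { img = u ; in-w = λ _ → refl
                                 ; in-bd = λ _ e → ⊥-elim (just≢nothing e eq)
                                 ; img-id = λ o → ⊥-elim ([ proj₁ o , proj₂ o ]′ i) }
        ...   | just l with l ≟ w
        ...     | yes refl = record { img = u ; in-w = λ _ → refl
                                    ; in-bd = λ _ e l≢w → ⊥-elim (l≢w (label≡ e eq))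
                                    ; img-id = λ o → ⊥-elim ([ proj₁ o , proj₂ o ]′ i) }
        ...     | no l≢w with leave i eq l≢w
        ...       | z , b , zl = record { img = z
                                        ; in-w = λ e → ⊥-elim (l≢w (label≡ eq e))
                                        ; in-bd = λ _ e _ → b , trans zl (trans (sym eq) e)
                                        ; img-id = λ o → ⊥-elim ([ proj₁ o , proj₂ o ]′ i) }

        f : Fin k → Fin k
        f a = img (image a)

        uw : β₁ u ≡ just w
        uw = β₀-u (just w)

        lab : ∀ {a i} → β a ≡ just i → β₁ (f a) ≡ just i
        lab {a} {i} ai with i ≟ w
        ... | yes refl = trans (cong β₁ (in-w (image a) ai)) uw
        ... | no i≢w = go (in-or-out a)
          where
          go : In a ⊎ Out a → β₁ (f a) ≡ just i
          go (inj₁ x) = let b , e = in-bd (image a) x ai i≢w in trans (β₀-out (just w) (proj₁ b)) e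
          go (inj₂ o) = trans (cong β₁ (img-id (image a) o)) (trans (β₀-out (just w) o) ai)

        image-edge : ∀ {a b i j} → β a ≡ just i → β b ≡ just j → i ≢ w → j ≢ w → E a b →
                     E′ (f a) (f b) ⊎ (Boundary (f a) × Boundary (f b) × β (f a) ≡ just i × β (f b) ≡ just j)
        image-edge {a} {b} {i} {j} ai bj i≢w j≢w e = go (in-or-out a) (in-or-out b)
          where
          cong₂-E : ∀ {x y z w} → x ≡ z → y ≡ w → E′ z w → E′ x y
          cong₂-E refl refl e = e
          stay : ∀ {a i} → Out a → Boundary a → β a ≡ just i → Boundary (f a) × β (f a) ≡ just i
          stay {a} o b ai = subst Boundary (sym (img-id (image a) o)) b , trans (cong β (img-id (image a) o)) ai
          go : In a ⊎ Out a → In b ⊎ Out b → _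
          go (inj₂ o) (inj₂ o′) = inj₁ (cong₂-E (img-id (image a) o) (img-id (image b) o′) (keep o o′ e))
          go (inj₁ x) (inj₁ y) = let p , p′ = in-bd (image a) x ai i≢w ; q , q′ = in-bd (image b) y bj j≢w
                                 in inj₂ (p , q , p′ , q′)
          go (inj₁ x) (inj₂ o) = let p , p′ = in-bd (image a) x ai i≢w ; q , q′ = stay o (step-boundary x o e) bj
                                 in inj₂ (p , q , p′ , q′)
          go (inj₂ o) (inj₁ y) = let p , p′ = stay o (step-boundary y o (E-sym e)) ai ; q , q′ = in-bd (image b) y bj j≢w
                                 in inj₂ (p , q , p′ , q′)

        from-w : ∀ {a b j} → β a ≡ just w → β b ≡ just j → j ≢ w → E a b → E′ u (f b)
        from-w {a} {b} aw bj j≢w e = go (in-or-out b)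
          where
          go : In b ⊎ Out b → E′ u (f b)
          go (inj₁ x) = extend (proj₁ (in-bd (image b) x bj j≢w))
          go (inj₂ o) = subst (E′ u) (sym (img-id (image b) o)) (extend (step-boundary (w-in aw) o e))

        inner : ∀ {a b i} → β a ≡ just i → β b ≡ just i → E a b → Path E′ (Bag β₁ i) (f a) (f b)
        inner {a} {b} {i} ai bi e with i ≟ w
        ... | yes refl = subst (Path E′ (Bag β₁ i) (f a)) (trans (in-w (image a) ai) (sym (in-w (image b) bi))) (stop (lab ai))
        ... | no i≢w with image-edge ai bi i≢w i≢w e
        ...   | inj₁ d = edge-path (lab ai) (lab bi) d
        ...   | inj₂ (p , q , p′ , q′) = subst (Path E′ (Bag β₁ i) (f a)) (distinct p q p′ q′) (stop (lab ai))

        cover : ∀ {z i} → β₁ z ≡ just i → ∃ λ a → β a ≡ just i × Path E′ (Bag β₁ i) z (f a)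
        cover {z} {i} zi with β₀-labelled (just w) z zi
        ... | inj₂ (o , e) = z , e , subst (Path E′ (Bag β₁ i) z) (sym (img-id (image z) o)) (stop zi)
        ... | inj₁ (refl , refl) = let a , aw = inhabited M w in
                a , aw , subst (Path E′ (Bag β₁ i) u) (sym (in-w (image a) aw)) (stop zi)

        outer : ∀ {a b i j} → K i j ≡ true → β a ≡ just i → β b ≡ just j → E a b → Joined E′ β₁ i j
        outer {a} {b} {i} {j} ij ai bj e with i ≟ w | j ≟ w
        ... | yes refl | yes refl = ⊥-elim (loopless F _ ij)
        ... | yes refl | no j≢w = u , f b , uw , lab bj , from-w ai bj j≢w e
        ... | no i≢w | yes refl = f a , u , lab ai , uw , E′-sym (from-w bj ai i≢w (E-sym e))
        ... | no i≢w | no j≢w with image-edge ai bj i≢w j≢w e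
        ...   | inj₁ d = f a , f b , lab ai , lab bj , d
        ...   | inj₂ (p , q , p′ , q′) = ⊥-elim (apart p q p′ q′ ij)

        stay-claw : Result
        stay-claw = finish (just w) (transfer E′-sym f lab inner cover outer M)

      one-inside : Result
      one-inside = [ (λ empty → let x , _ , _ , wx = degree≥3 F w w w ; z , b , _ = neighbour x wx
                                in ⊥-elim (empty z b)) ,
                     (λ { (a , b , c , _ , _ , _ , all) → stay-claw (distinct all) (apart all) }) ]′ bounded
        where
        module _ {a b c} (all : ∀ z → Boundary z → z ≡ a ⊎ z ≡ b ⊎ z ≡ c) where
          open Independent
          I : Independent K (fromMaybe w (β a)) (fromMaybe w (β b)) (fromMaybe w (β c))
          I = cubic-independent F w _ _ _ λ x wx →
                let z , z-bd , zx = neighbour x wx in boundary-label all z-bd zx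
          distinct : ∀ {p q i} → Boundary p → Boundary q → β p ≡ just i → β q ≡ just i → p ≡ q
          distinct {p} {q} p-bd q-bd pi qi with all p p-bd | all q q-bd | trans (fromMaybe-just {d = w} pi) (sym (fromMaybe-just qi))
          ... | inj₁ refl | inj₁ refl | _ = refl
          ... | inj₂ (inj₁ refl) | inj₂ (inj₁ refl) | _ = refl
          ... | inj₂ (inj₂ refl) | inj₂ (inj₂ refl) | _ = refl
          ... | inj₁ refl | inj₂ (inj₁ refl) | e = ⊥-elim (i≢j I e)
          ... | inj₁ refl | inj₂ (inj₂ refl) | e = ⊥-elim (i≢k I e)
          ... | inj₂ (inj₁ refl) | inj₁ refl | e = ⊥-elim (i≢j I (sym e))
          ... | inj₂ (inj₁ refl) | inj₂ (inj₂ refl) | e = ⊥-elim (j≢k I e)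
          ... | inj₂ (inj₂ refl) | inj₁ refl | e = ⊥-elim (i≢k I (sym e))
          ... | inj₂ (inj₂ refl) | inj₂ (inj₁ refl) | e = ⊥-elim (j≢k I (sym e))
          apart : ∀ {p q i j} → Boundary p → Boundary q → β p ≡ just i → β q ≡ just j → K i j ≢ true
          apart {p} {q} {i} {j} p-bd q-bd pi qj ij
            with all p p-bd | all q q-bd | subst (λ x → K x _ ≡ true) (sym (fromMaybe-just {d = w} pi)) (subst (λ x → K _ x ≡ true) (sym (fromMaybe-just {d = w} qj)) ij)
          ... | inj₁ refl | inj₁ refl | e = loopless F _ e
          ... | inj₂ (inj₁ refl) | inj₂ (inj₁ refl) | e = loopless F _ e
          ... | inj₂ (inj₂ refl) | inj₂ (inj₂ refl) | e = loopless F _ e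
          ... | inj₁ refl | inj₂ (inj₁ refl) | e = Independent.ij I e
          ... | inj₁ refl | inj₂ (inj₂ refl) | e = ik I e
          ... | inj₂ (inj₁ refl) | inj₁ refl | e = ji I e
          ... | inj₂ (inj₁ refl) | inj₂ (inj₂ refl) | e = jk I e
          ... | inj₂ (inj₂ refl) | inj₁ refl | e = ki I e
          ... | inj₂ (inj₂ refl) | inj₂ (inj₁ refl) | e = kj I e

    inside-or-outside : ∀ i → Inside i ⊎ ∃ λ o → Out o × β o ≡ just i
    inside-or-outside i with any? (λ o → (¬? (o ≟ u) ×-dec ¬? (o ≟ v)) ×-dec (β o ≟ₗ just i))
    ... | yes (o , out , oi) = inj₂ (o , out , oi)
    ... | no absent = inj₁ λ {z} zi → [ (λ i → i) , (λ o → ⊥-elim (absent (z , o , zi))) ]′ (in-or-out z)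

    -- The cases are distinguished by which bags of `u` and `v` have no vertex outside the pair.
    identify : Result
    identify = by-labels (β u) refl (β v) refl
      where
      leave : ∀ {x i} → In x → β x ≡ just i → (∃ λ o → Out o × β o ≡ just i) → ∃ λ z → Boundary z × β z ≡ just i
      leave x-in xi (o , out , oi) = exit (connected M xi oi) x-in out
      by-labels : ∀ l → β u ≡ l → ∀ l′ → β v ≡ l′ → Result
      by-labels nothing un nothing vn = NoneInside.none-inside
        λ { (inj₁ refl) e → ⊥-elim (just≢nothing e un) ; (inj₂ refl) e → ⊥-elim (just≢nothing e vn) }
      by-labels (just i) ui nothing vn with inside-or-outside i
      ... | inj₁ i-in = OneInside.one-inside i-in
              λ { (inj₁ refl) e ≢i → ⊥-elim (≢i (label≡ e ui)) ; (inj₂ refl) e → ⊥-elim (just≢nothing e vn) }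
      ... | inj₂ i-out = NoneInside.none-inside
              λ { (inj₁ refl) e → leave (inj₁ refl) e (subst (λ x → ∃ λ o → Out o × β o ≡ just x) (label≡ ui e) i-out)
                ; (inj₂ refl) e → ⊥-elim (just≢nothing e vn) }
      by-labels nothing un (just j) vj with inside-or-outside j
      ... | inj₁ j-in = OneInside.one-inside j-in
              λ { (inj₂ refl) e ≢j → ⊥-elim (≢j (label≡ e vj)) ; (inj₁ refl) e → ⊥-elim (just≢nothing e un) }
      ... | inj₂ j-out = NoneInside.none-inside
              λ { (inj₂ refl) e → leave (inj₂ refl) e (subst (λ x → ∃ λ o → Out o × β o ≡ just x) (label≡ vj e) j-out)
                ; (inj₁ refl) e → ⊥-elim (just≢nothing e un) }
      by-labels (just i) ui (just j) vj with inside-or-outside i | inside-or-outside j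
      ... | inj₂ i-out | inj₂ j-out = NoneInside.none-inside
              λ { (inj₁ refl) e → leave (inj₁ refl) e (subst (λ x → ∃ λ o → Out o × β o ≡ just x) (label≡ ui e) i-out)
                ; (inj₂ refl) e → leave (inj₂ refl) e (subst (λ x → ∃ λ o → Out o × β o ≡ just x) (label≡ vj e) j-out) }
      ... | inj₁ i-in | inj₂ j-out = OneInside.one-inside i-in
              λ { (inj₁ refl) e ≢i → ⊥-elim (≢i (label≡ e ui))
                ; (inj₂ refl) e _ → leave (inj₂ refl) e (subst (λ x → ∃ λ o → Out o × β o ≡ just x) (label≡ vj e) j-out) }
      ... | inj₂ i-out | inj₁ j-in = OneInside.one-inside j-in
              λ { (inj₂ refl) e ≢j → ⊥-elim (≢j (label≡ e vj))
                ; (inj₁ refl) e _ → leave (inj₁ refl) e (subst (λ x → ∃ λ o → Out o × β o ≡ just x) (label≡ ui e) i-out) }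
      ... | inj₁ i-in | inj₁ j-in with i ≟ j
      ...   | no i≢j = two-inside i≢j i-in j-in
      ...   | yes refl = OneInside.one-inside i-in
              λ { (inj₁ refl) e ≢i → ⊥-elim (≢i (label≡ e ui)) ; (inj₂ refl) e ≢i → ⊥-elim (≢i (label≡ e vj)) }

-- Counting

b2n : Bool → ℕ
b2n b = if b then 1 else 0

b2n≤1 : ∀ b → b2n b ≤ 1
b2n≤1 true  = ≤-refl
b2n≤1 false = z≤n

b2n-mono : ∀ {a b} → (a ≡ true → b ≡ true) → b2n a ≤ b2n b
b2n-mono {false} h = z≤n
b2n-mono {true}  h rewrite h refl = ≤-refl

total : ∀ {n} → (Fin n → ℕ) → ℕ
total {zero}  f = 0
total {suc n} f = f zero + total (f ∘ suc)

total-mono : ∀ {n} {f g : Fin n → ℕ} → (∀ a → f a ≤ g a) → total f ≤ total g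
total-mono {zero}  h = z≤n
total-mono {suc n} h = +-mono-≤ (h zero) (total-mono (h ∘ suc))

total-cong : ∀ {n} {f g : Fin n → ℕ} → (∀ a → f a ≡ g a) → total f ≡ total g
total-cong {zero}  h = refl
total-cong {suc n} h = cong₂ _+_ (h zero) (total-cong (h ∘ suc))

interchange : ∀ a b c d → (a + b) + (c + d) ≡ (a + c) + (b + d)
interchange a b c d = begin
  (a + b) + (c + d) ≡⟨ +-assoc a b (c + d) ⟩
  a + (b + (c + d)) ≡⟨ cong (a +_) (sym (+-assoc b c d)) ⟩
  a + ((b + c) + d) ≡⟨ cong (λ x → a + (x + d)) (+-comm b c) ⟩
  a + ((c + b) + d) ≡⟨ cong (a +_) (+-assoc c b d) ⟩
  a + (c + (b + d)) ≡⟨ sym (+-assoc a c (b + d)) ⟩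
  (a + c) + (b + d) ∎
  where open ≡-Reasoning

total-+ : ∀ {n} (f g : Fin n → ℕ) → total (λ a → f a + g a) ≡ total f + total g
total-+ {zero}  f g = refl
total-+ {suc n} f g = trans (cong (f zero + g zero +_) (total-+ (f ∘ suc) (g ∘ suc)))
                            (interchange (f zero) (g zero) _ _)

total-0 : ∀ {n} → total {n} (λ _ → 0) ≡ 0
total-0 {zero}  = refl
total-0 {suc n} = total-0 {n}

total-swap : ∀ {m n} (f : Fin m → Fin n → ℕ) →
             total (λ a → total (f a)) ≡ total (λ b → total (λ a → f a b))
total-swap {zero}  {n} f = sym (total-0 {n})
total-swap {suc m} f = trans (cong (total (f zero) +_) (total-swap (f ∘ suc)))
                             (sym (total-+ (f zero) (λ b → total (λ a → f (suc a) b))))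

total-* : ∀ {n} c (f : Fin n → ℕ) → total (λ a → c * f a) ≡ c * total f
total-* {zero}  c f = sym (*-zeroʳ c)
total-* {suc n} c f = trans (cong (c * f zero +_) (total-* c (f ∘ suc))) (sym (*-distribˡ-+ c (f zero) _))

without : ∀ {n} → Fin n → (Fin n → ℕ) → Fin n → ℕ
without u f a = if a == u then 0 else f a

total-pick : ∀ {n} (u : Fin n) (f : Fin n → ℕ) → total f ≡ f u + total (without u f)
total-pick zero    f = refl
total-pick (suc u) f = begin
  f zero + total (f ∘ suc)                              ≡⟨ cong (f zero +_) (total-pick u (f ∘ suc)) ⟩
  f zero + (f (suc u) + total (without u (f ∘ suc)))    ≡⟨ sym (+-assoc (f zero) _ _) ⟩
  f zero + f (suc u) + total (without u (f ∘ suc))      ≡⟨ cong (_+ total (without u (f ∘ suc))) (+-comm (f zero) _) ⟩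
  f (suc u) + f zero + total (without u (f ∘ suc))      ≡⟨ +-assoc (f (suc u)) _ _ ⟩
  f (suc u) + (f zero + total (without u (f ∘ suc)))    ∎
  where open ≡-Reasoning

card : ∀ {n} → (Fin n → Bool) → ℕ
card f = total (b2n ∘ f)

card-mono : ∀ {n} {f g : Fin n → Bool} → (∀ a → f a ≡ true → g a ≡ true) → card f ≤ card g
card-mono h = total-mono (λ a → b2n-mono (h a))

infix 8 _∖_
_∖_ : ∀ {n} → (Fin n → Bool) → Fin n → Fin n → Bool
(f ∖ u) a = f a ∧ not (a == u)

card-∖ : ∀ {n} (f : Fin n → Bool) u → card f ≡ b2n (f u) + card (f ∖ u)
card-∖ f u = trans (total-pick u (b2n ∘ f)) (cong (b2n (f u) +_) (total-cong eq))
  where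
  eq : ∀ a → without u (b2n ∘ f) a ≡ b2n ((f ∖ u) a)
  eq a with a == u | f a
  ... | true  | true  = refl
  ... | true  | false = refl
  ... | false | true  = refl
  ... | false | false = refl

card-remove : ∀ {n} (f : Fin n → Bool) {u} → f u ≡ true → card f ≡ suc (card (f ∖ u))
card-remove f {u} e = trans (card-∖ f u) (cong (λ b → b2n b + card (f ∖ u)) e)

≢⇒not== : ∀ {n} {a u : Fin n} → a ≢ u → not (a == u) ≡ true
≢⇒not== {a = a} {u} d with a == u in e
... | true  = ⊥-elim (d (==-sound a u e))
... | false = refl

∖-intro : ∀ {n} (f : Fin n → Bool) {u a} → f a ≡ true → a ≢ u → (f ∖ u) a ≡ true
∖-intro f p d = cong₂ _∧_ p (≢⇒not== d)

∖-elim : ∀ {n} (f : Fin n → Bool) u a → (f ∖ u) a ≡ true → f a ≡ true × a ≢ u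
∖-elim f u a h = let p , q = ∧-split {f a} h in p , ≠-sound a u q

card-strict : ∀ {n} {f g : Fin n → Bool} {u} → (∀ a → f a ≡ true → g a ≡ true) → f u ≡ false → g u ≡ true → card f < card g
card-strict {f = f} {g} {u} h fu gu = subst (suc (card f) ≤_) (sym (card-remove g gu))
  (s≤s (card-mono {f = f} {g ∖ u} λ a e → ∖-intro g (h a e) λ { refl → false≢true fu e }))

record Elements {n} (f : Fin n → Bool) : Set where
  field
    list     : List (Fin n)
    number   : length list ≡ card f
    sound    : ∀ {a} → a ∈ list → f a ≡ true
    complete : ∀ {a} → f a ≡ true → a ∈ list
    distinct : AllPairs _≢_ list
    weigh    : ∀ (w : Fin n → ℕ) → total (λ a → if f a then w a else 0) ≡ sum (map w list)
open Elements public

elements : ∀ {n} (f : Fin n → Bool) → Elements f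
elements {zero} f = record { list = [] ; number = refl ; sound = λ () ; complete = λ { {()} }
                           ; distinct = [] ; weigh = λ _ → refl }
elements {suc n} f with f zero in eq | elements (f ∘ suc)
... | true | e = record
  { list = zero ∷ map suc (list e)
  ; number = trans (cong suc (trans (length-map suc (list e)) (number e))) (sym (cong (λ b → b2n b + card (f ∘ suc)) eq))
  ; sound = λ { (here refl) → eq ; (there i) → let a , j , d = ∈-map⁻ suc i in trans (cong f d) (sound e j) }
  ; complete = λ { {zero} _ → here refl ; {suc a} h → there (∈-map⁺ suc (complete e h)) }
  ; distinct = Allₚ.map⁺ (All.tabulate (λ _ ())) ∷ AllPairsₚ.map⁺ (AllPairs.map (λ { d refl → d refl }) (distinct e))
  ; weigh = λ w → cong₂ _+_ (cong (if_then w zero else 0) eq)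
      (trans (weigh e (w ∘ suc)) (cong sum (map-∘ (list e)))) }
... | false | e = record
  { list = map suc (list e)
  ; number = trans (length-map suc (list e)) (trans (number e) (sym (cong (λ b → b2n b + card (f ∘ suc)) eq)))
  ; sound = λ i → let a , j , d = ∈-map⁻ suc i in trans (cong f d) (sound e j)
  ; complete = λ { {zero} h → ⊥-elim (false≢true eq h) ; {suc a} h → ∈-map⁺ suc (complete e h) }
  ; distinct = AllPairsₚ.map⁺ (AllPairs.map (λ { d refl → d refl }) (distinct e))
  ; weigh = λ w → trans (cong (_+ total (λ a → if f (suc a) then w (suc a) else 0)) (cong (if_then w zero else 0) eq))
      (trans (weigh e (w ∘ suc)) (cong sum (map-∘ (list e)))) }

sum-tabulate : ∀ {n} {A : Set} (f : A → ℕ) (h : Fin n → A) → sum (map f (List.tabulate h)) ≡ total (f ∘ h)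
sum-tabulate {zero}  f h = refl
sum-tabulate {suc n} f h = cong (f (h zero) +_) (sum-tabulate f (h ∘ suc))

sum-allFin : ∀ {n} (f : Fin n → ℕ) → sum (map f (allFin n)) ≡ total f
sum-allFin f = sum-tabulate f id

-- Contraction sequences of subdivisions

AtMostThree : ∀ {k} → (Fin k → Bool) → Set
AtMostThree P = (∀ z → P z ≢ true) ⊎ (∃ λ a → ∃₂ λ b c → P a ≡ true × P b ≡ true × P c ≡ true ×
                                        (∀ z → P z ≡ true → z ≡ a ⊎ z ≡ b ⊎ z ≡ c))

at-most-three : ∀ {k} (P : Fin k → Bool) → sum (map (b2n ∘ P) (allFin k)) ≤ 3 → AtMostThree P
at-most-three {k} P bound = go (list el) refl
  where
  el = elements P
  sound′ : ∀ {xs} → list el ≡ xs → ∀ {z} → z ∈ xs → P z ≡ true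
  sound′ refl = sound el
  complete′ : ∀ {xs} → list el ≡ xs → ∀ {z} → P z ≡ true → z ∈ xs
  complete′ refl = complete el
  go : ∀ xs → list el ≡ xs → AtMostThree P
  go [] e = inj₁ λ z h → absurd (complete′ e h)
    where
    absurd : ∀ {z : Fin k} → z ∈ [] → ⊥
    absurd ()
  go (a ∷ []) e = inj₂ (a , a , a , sound′ e (here refl) , sound′ e (here refl) , sound′ e (here refl) , λ z h → pick (complete′ e h))
    where
    pick : ∀ {z} → z ∈ a ∷ [] → z ≡ a ⊎ z ≡ a ⊎ z ≡ a
    pick (here e) = inj₁ e
  go (a ∷ b ∷ []) e = inj₂ (a , b , b , sound′ e (here refl) , sound′ e (there (here refl)) , sound′ e (there (here refl)) , λ z h → pick (complete′ e h))
    where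
    pick : ∀ {z} → z ∈ a ∷ b ∷ [] → z ≡ a ⊎ z ≡ b ⊎ z ≡ b
    pick (here e) = inj₁ e
    pick (there (here e)) = inj₂ (inj₁ e)
  go (a ∷ b ∷ c ∷ []) e = inj₂ (a , b , c , sound′ e (here refl) , sound′ e (there (here refl)) , sound′ e (there (there (here refl))) , λ z h → pick (complete′ e h))
    where
    pick : ∀ {z} → z ∈ a ∷ b ∷ c ∷ [] → z ≡ a ⊎ z ≡ b ⊎ z ≡ c
    pick (here e) = inj₁ e
    pick (there (here e)) = inj₂ (inj₁ e)
    pick (there (there (here e))) = inj₂ (inj₂ e)
  go (_ ∷ _ ∷ _ ∷ _ ∷ _) e with subst (_≤ 3) (trans (sum-allFin (b2n ∘ P)) (trans (sym (number el)) (cong length e))) bound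
  ... | s≤s (s≤s (s≤s ()))

_≟ᶜ_ : (c d : Col) → Dec (c ≡ d)
none  ≟ᶜ none  = yes refl
none  ≟ᶜ black = no λ ()
none  ≟ᶜ red   = no λ ()
black ≟ᶜ none  = no λ ()
black ≟ᶜ black = yes refl
black ≟ᶜ red   = no λ ()
red   ≟ᶜ none  = no λ ()
red   ≟ᶜ black = no λ ()
red   ≟ᶜ red   = yes refl

merge-none : ∀ c d → merge c d ≡ none → c ≡ none × d ≡ none
merge-none none  none  _  = refl , refl
merge-none none  black ()
merge-none none  red   ()
merge-none black none  ()
merge-none black black ()
merge-none black red   ()
merge-none red   _     ()

merge-black : ∀ c d → merge c d ≡ black → c ≡ black × d ≡ black
merge-black black black _ = refl , refl
merge-black none  none  ()
merge-black none  black ()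
merge-black none  red   ()
merge-black black none  ()
merge-black black red   ()
merge-black red   _     ()

module Contraction {k} (T : Trigraph (suc k)) (T-sym : ∀ a b → T a b ≡ T b a)
                   (u v : Fin (suc k)) (u≢v : u ≢ v) where

  T′ : Trigraph k
  T′ = contract T u v u≢v

  in₋ : Fin k → Fin (suc k)
  in₋ = punchIn v

  out : ∀ {z} → z ≢ v → Fin k
  out z≢v = punchOut {i = v} (λ e → z≢v (sym e))

  in-out : ∀ {z} (z≢v : z ≢ v) → in₋ (out z≢v) ≡ z
  in-out z≢v = punchIn-punchOut (λ e → z≢v (sym e))

  x : Fin k
  x = out u≢v

  in-x : in₋ x ≡ u
  in-x = in-out u≢v

  in≢v : ∀ a → in₋ a ≢ v
  in≢v a = punchInᵢ≢i v a

  both-other : ∀ {a b} → in₋ a ≢ u → in₋ b ≢ u → T′ a b ≡ T (in₋ a) (in₋ b)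
  both-other {a} {b} p q with punchIn v a ≟ u | punchIn v b ≟ u
  ... | yes e | _     = ⊥-elim (p e)
  ... | no _  | yes e = ⊥-elim (q e)
  ... | no _  | no _  = refl

  left-new : ∀ {a b} → in₋ a ≡ u → in₋ b ≢ u → T′ a b ≡ merge (T u (in₋ b)) (T v (in₋ b))
  left-new {a} {b} p q with punchIn v a ≟ u | punchIn v b ≟ u
  ... | no e  | _     = ⊥-elim (e p)
  ... | yes _ | yes e = ⊥-elim (q e)
  ... | yes _ | no _  = refl

  right-new : ∀ {a b} → in₋ a ≢ u → in₋ b ≡ u → T′ a b ≡ merge (T (in₋ a) u) (T (in₋ a) v)
  right-new {a} {b} p q with punchIn v a ≟ u | punchIn v b ≟ u
  ... | yes e | _     = ⊥-elim (p e)
  ... | no _  | no e  = ⊥-elim (e q)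
  ... | no _  | yes _ = refl

  both-new : ∀ {a b} → in₋ a ≡ u → in₋ b ≡ u → T′ a b ≡ none
  both-new {a} {b} p q with punchIn v a ≟ u | punchIn v b ≟ u
  ... | no e  | _     = ⊥-elim (e p)
  ... | yes _ | no e  = ⊥-elim (e q)
  ... | yes _ | yes _ = refl

  T′-sym : ∀ a b → T′ a b ≡ T′ b a
  T′-sym a b = go (in₋ a ≟ u) (in₋ b ≟ u)
    where
    go : Dec (in₋ a ≡ u) → Dec (in₋ b ≡ u) → T′ a b ≡ T′ b a
    go (yes p) (yes q) = trans (both-new {a} {b} p q) (sym (both-new {b} {a} q p))
    go (yes p) (no q)  = trans (left-new {a} {b} p q)
      (trans (cong₂ merge (T-sym u _) (T-sym v _)) (sym (right-new {b} {a} q p)))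
    go (no p)  (yes q) = trans (right-new {a} {b} p q)
      (trans (cong₂ merge (T-sym _ u) (T-sym _ v)) (sym (left-new {b} {a} q p)))
    go (no p)  (no q)  = trans (both-other {a} {b} p q) (trans (T-sym _ _) (sym (both-other {b} {a} q p)))

  E : Fin (suc k) → Fin (suc k) → Set
  E a b = T a b ≢ none

  E-sym : ∀ {a b} → E a b → E b a
  E-sym {a} {b} e d = e (trans (T-sym a b) d)

  E″ : Fin k → Fin k → Set
  E″ a b = T′ a b ≢ none

  -- The contracted graph carried back to the old vertex set, where `u` plays the new vertex and `v`
  -- is isolated. Models before and after the contraction thus live on the same vertices, and the
  -- change of indices is confined to `reindex`.
  E′ : Fin (suc k) → Fin (suc k) → Set
  E′ p q = ∃₂ λ a b → in₋ a ≡ p × in₋ b ≡ q × E″ a b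

  E′-sym : ∀ {p q} → E′ p q → E′ q p
  E′-sym (a , b , p , q , e) = b , a , q , p , λ d → e (trans (T′-sym a b) d)

  keep : ∀ {a b} → a ≢ u × a ≢ v → b ≢ u × b ≢ v → E a b → E′ a b
  keep {a} {b} (a≢u , a≢v) (b≢u , b≢v) e = out a≢v , out b≢v , in-out a≢v , in-out b≢v , λ d →
    e (trans (sym (cong₂ T (in-out a≢v) (in-out b≢v)))
      (trans (sym (both-other (λ r → a≢u (trans (sym (in-out a≢v)) r)) (λ r → b≢u (trans (sym (in-out b≢v)) r)))) d))

  new-colour : ∀ {z} (z≢u : z ≢ u) (z≢v : z ≢ v) → T′ x (out z≢v) ≡ merge (T u z) (T v z)
  new-colour {z} z≢u z≢v =
    trans (left-new in-x (λ r → z≢u (trans (sym (in-out z≢v)) r)))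
          (cong₂ merge (cong (T u) (in-out z≢v)) (cong (T v) (in-out z≢v)))

  extend : ∀ {z} → z ≢ u × z ≢ v → E u z ⊎ E v z → E′ u z
  extend {z} (z≢u , z≢v) e = x , out z≢v , in-x , in-out z≢v , λ d →
    let p , q = merge-none (T u z) (T v z) (trans (sym (new-colour z≢u z≢v)) d)
    in [ (λ e → e p) , (λ e → e q) ]′ e

  reindex : ∀ {p} {K : Pattern p} {β : Labelling (Fin (suc k)) p} → β v ≡ nothing →
            Model E′ K β → Model E″ K (β ∘ in₋)
  reindex {p} {K} {β} vn M = transfer (λ {a} {b} e d → e (trans (T′-sym a b) d)) f lab
    (λ ai bi e → edge-path (lab ai) (lab bi) (f-edge e))
    (λ {w} wi → in₋ w , wi , subst (Path E″ (Bag (β ∘ in₋) _) w) (sym (f-in refl)) (stop wi))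
    (λ _ ai bj e → _ , _ , lab ai , lab bj , f-edge e) M
    where
    f : Fin (suc k) → Fin k
    f z with z ≟ v
    ... | yes _ = x
    ... | no z≢v = out z≢v
    f-in : ∀ {a z} → in₋ a ≡ z → f z ≡ a
    f-in {a} {z} e with z ≟ v
    ... | yes z≡v = ⊥-elim (in≢v a (trans e z≡v))
    ... | no z≢v = punchIn-injective v _ _ (trans (in-out z≢v) (sym e))
    lab : ∀ {z i} → β z ≡ just i → β (in₋ (f z)) ≡ just i
    lab {z} e with z ≟ v
    ... | yes refl = ⊥-elim (just≢nothing e vn)
    ... | no z≢v = trans (cong β (in-out z≢v)) e
    f-edge : ∀ {a b} → E′ a b → E″ (f a) (f b)
    f-edge (a , b , p , q , e) = subst (λ y → E″ y _) (sym (f-in p)) (subst (E″ a) (sym (f-in q)) e)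

-- The invariant of a contraction sequence

data Kind : Set where
  branch middle merged : Kind

-- The model ignores colours. The other fields keep what remains of a subdivision: middle vertices
-- never gain neighbours, branch vertices are not joined by black edges, and the black edges among
-- original vertices form no four-cycle. A merged vertex has at most one black neighbour, hence at
-- most four neighbours in all while its red degree is at most three.
record Invariant {k} (T : Trigraph k) : Set where
  field
    F     : Member
    β     : Labelling (Fin k) (size F)
    model : Model (λ a b → T a b ≢ none) (pattern-of F) β
    kind  : Fin k → Kind
    symm  : ∀ a b → T a b ≡ T b a
    middle-degree : ∀ {a} → kind a ≡ middle → ∃₂ λ p q → ∀ z → T a z ≢ none → z ≡ p ⊎ z ≡ q
    branch-apart  : ∀ {a b} → kind a ≡ branch → kind b ≡ branch → T a b ≢ black
    merged-black  : ∀ {a y z} → kind a ≡ merged → T a y ≡ black → T a z ≡ black → y ≡ z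
    no-square     : ∀ {a b y z} → kind a ≢ merged → kind b ≢ merged → kind y ≢ merged → kind z ≢ merged →
                    a ≢ b → T a y ≡ black → T b y ≡ black → T a z ≡ black → T b z ≡ black → y ≡ z
    -- The black neighbours that arise around a branch vertex stay in its bag.
    star          : ∀ {a y} → kind a ≡ merged → kind y ≡ branch → T a y ≡ black → β a ≡ β y

module OneContraction {k} {T : Trigraph (suc k)} (I : Invariant T) (u v : Fin (suc k)) (u≢v : u ≢ v)
            (low : MaxRedDeg≤ 3 (contract T u v u≢v)) where
  open Invariant I
  open Contraction T symm u v u≢v

  Out : Fin (suc k) → Set
  Out z = z ≢ u × z ≢ v

  kind′ : Fin k → Kind
  kind′ a with in₋ a ≟ u
  ... | yes _ = merged
  ... | no _  = kind (in₋ a)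

  kind′-x : ∀ {a} → in₋ a ≡ u → kind′ a ≡ merged
  kind′-x {a} e with in₋ a ≟ u
  ... | yes _ = refl
  ... | no d  = ⊥-elim (d e)

  kind′-old : ∀ {a} → in₋ a ≢ u → kind′ a ≡ kind (in₋ a)
  kind′-old {a} d with in₋ a ≟ u
  ... | yes e = ⊥-elim (d e)
  ... | no _  = refl

  unmerged : ∀ {a} → kind′ a ≢ merged → in₋ a ≢ u × kind (in₋ a) ≢ merged
  unmerged {a} h = (λ e → h (kind′-x e)) , λ e → h (trans (kind′-old (λ d → h (kind′-x d))) e)

  ofKind : ∀ {a c} → c ≢ merged → kind′ a ≡ c → in₋ a ≢ u × kind (in₋ a) ≡ c
  ofKind {a} c≢m e = a≢u , trans (sym (kind′-old a≢u)) e
    where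
    a≢u : in₋ a ≢ u
    a≢u d = c≢m (trans (sym e) (kind′-x d))

  is-merged? : ∀ a → Dec (kind a ≡ merged)
  is-merged? a with kind a
  ... | branch = no λ ()
  ... | middle = no λ ()
  ... | merged = yes refl

  black-sym : ∀ {a b} → T a b ≡ black → T b a ≡ black
  black-sym {a} {b} e = trans (symm b a) e

  -- C₄-freeness leaves the new vertex at most one black neighbour.
  common-black : ∀ {y z} → T u y ≡ black → T v y ≡ black → T u z ≡ black → T v z ≡ black → y ≡ z
  common-black {y} {z} uy vy uz vz with is-merged? u | is-merged? v | is-merged? y | is-merged? z
  ... | yes m | _ | _ | _ = merged-black m uy uz
  ... | no _ | yes m | _ | _ = merged-black m vy vz
  ... | no _ | no _ | yes m | _ = ⊥-elim (u≢v (merged-black m (black-sym uy) (black-sym vy)))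
  ... | no _ | no _ | no _ | yes m = ⊥-elim (u≢v (merged-black m (black-sym uz) (black-sym vz)))
  ... | no a | no b | no c | no d = no-square a b c d u≢v uy vy uz vz

  new-black : ∀ {a b} → in₋ a ≡ u → T′ a b ≡ black → in₋ b ≢ u × T u (in₋ b) ≡ black × T v (in₋ b) ≡ black
  new-black {a} {b} p e = b≢u , merge-black _ _ (trans (sym (left-new p b≢u)) e)
    where
    none≢black : none ≢ black
    none≢black ()
    b≢u : in₋ b ≢ u
    b≢u q = none≢black (trans (sym (both-new p q)) e)

  old-black : ∀ {a b} → in₋ a ≢ u → T′ a b ≡ black → T (in₋ a) (in₋ b) ≡ black
  old-black {a} {b} p e = go (in₋ b ≟ u)
    where
    go : Dec (in₋ b ≡ u) → T (in₋ a) (in₋ b) ≡ black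
    go (no q)  = trans (sym (both-other p q)) e
    go (yes q) = trans (cong (T (in₋ a)) q) (proj₁ (merge-black _ _ (trans (sym (right-new p q)) e)))

  project : ∀ {a b} → in₋ a ≢ u → T′ a b ≢ none → T (in₋ a) (in₋ b) ≢ none ⊎ in₋ b ≡ u × T (in₋ a) v ≢ none
  project {a} {b} p e = go (in₋ b ≟ u) (T (in₋ a) u ≟ᶜ none) (T (in₋ a) v ≟ᶜ none)
    where
    go : Dec (in₋ b ≡ u) → Dec (T (in₋ a) u ≡ none) → Dec (T (in₋ a) v ≡ none) →
         T (in₋ a) (in₋ b) ≢ none ⊎ in₋ b ≡ u × T (in₋ a) v ≢ none
    go (no q)  _       _       = inj₁ λ d → e (trans (both-other p q) d)
    go (yes q) (no r)  _       = inj₁ λ d → r (trans (cong (T (in₋ a)) (sym q)) d)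
    go (yes q) (yes _) (no s)  = inj₂ (q , s)
    go (yes q) (yes r) (yes s) = ⊥-elim (e (trans (right-new p q) (cong₂ merge r s)))

  -- The map `φ` keeps equal labels equal, which is how `star` survives a change of pattern. Middle
  -- vertices are exempt from the agreement with `φ`, since one of them may have been relabelled on
  -- the way.
  rebuild : (F′ : Member) (φ : Fin (size F) → Maybe (Fin (size F′))) (β′ : Labelling (Fin (suc k)) (size F′)) →
            Model E′ (pattern-of F′) β′ → β′ v ≡ nothing →
            (∀ z → Out z → kind z ≢ middle → β′ z ≡ (β z >>= φ)) →
            (∀ y → Out y → kind y ≡ branch → T u y ≡ black → T v y ≡ black → β′ u ≡ β′ y) →
            Invariant T′
  rebuild F′ φ β′ M′ vn old new = record
    { F = F′ ; β = β′ ∘ in₋ ; model = reindex vn M′ ; kind = kind′ ; symm = T′-sym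
    ; middle-degree = md
    ; branch-apart = λ {a} {b} ka kb e →
        let a≢u , ka′ = ofKind (λ ()) ka ; _ , kb′ = ofKind (λ ()) kb in branch-apart ka′ kb′ (old-black a≢u e)
    ; merged-black = mb
    ; no-square = λ ka kb ky kz a≢b ay by az bz →
        let a≢u , ka′ = unmerged ka ; b≢u , kb′ = unmerged kb in
        punchIn-injective v _ _ (no-square ka′ kb′ (proj₂ (unmerged ky)) (proj₂ (unmerged kz))
          (λ e → a≢b (punchIn-injective v _ _ e)) (old-black a≢u ay) (old-black b≢u by) (old-black a≢u az) (old-black b≢u bz))
    ; star = st
    }
    where
    md : ∀ {a} → kind′ a ≡ middle → ∃₂ λ p q → ∀ z → T′ a z ≢ none → z ≡ p ⊎ z ≡ q
    md {a} ka with ofKind (λ ()) ka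
    ... | a≢u , ka′ with middle-degree ka′
    ...   | p , q , cover = r p , r q , λ z e → Sum.map sym sym (nbr z e)
      where
      r : Fin (suc k) → Fin k
      r z with z ≟ v
      ... | yes _ = x
      ... | no z≢v = out z≢v
      r-v : r v ≡ x
      r-v with v ≟ v
      ... | yes _ = refl
      ... | no d = ⊥-elim (d refl)
      r-in : ∀ z → r (in₋ z) ≡ z
      r-in z with in₋ z ≟ v
      ... | yes d = ⊥-elim (in≢v z d)
      ... | no d = punchIn-injective v _ _ (in-out d)
      nbr : ∀ z → T′ a z ≢ none → r p ≡ z ⊎ r q ≡ z
      nbr z e with project a≢u e
      ... | inj₁ d = Sum.map (λ eq → trans (cong r (sym eq)) (r-in z)) (λ eq → trans (cong r (sym eq)) (r-in z)) (cover (in₋ z) d)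
      ... | inj₂ (zu , d) = Sum.map via via (cover v d)
        where
        via : ∀ {y} → v ≡ y → r y ≡ z
        via refl = trans r-v (punchIn-injective v _ _ (trans in-x (sym zu)))
    mb : ∀ {a y z} → kind′ a ≡ merged → T′ a y ≡ black → T′ a z ≡ black → y ≡ z
    mb {a} ka ay az = go (in₋ a ≟ u)
      where
      go : Dec (in₋ a ≡ u) → _
      go (yes p) = let _ , b , c = new-black p ay ; _ , d , e = new-black p az
                   in punchIn-injective v _ _ (common-black b c d e)
      go (no p)  = punchIn-injective v _ _ (merged-black (trans (sym (kind′-old p)) ka) (old-black p ay) (old-black p az))
    st : ∀ {a y} → kind′ a ≡ merged → kind′ y ≡ branch → T′ a y ≡ black → β′ (in₋ a) ≡ β′ (in₋ y)
    st {a} {y} ka ky ay = go (in₋ a ≟ u)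
      where
      y≢u = proj₁ (ofKind (λ ()) ky)
      ky′ = proj₂ (ofKind (λ ()) ky)
      branch≢middle : branch ≢ middle
      branch≢middle ()
      merged≢middle : merged ≢ middle
      merged≢middle ()
      go : Dec (in₋ a ≡ u) → _
      go (yes p) = let _ , b , c = new-black p ay in trans (cong β′ p) (new (in₋ y) (y≢u , in≢v y) ky′ b c)
      go (no p)  = let ka′ = trans (sym (kind′-old p)) ka in
        trans (old (in₋ a) (p , in≢v a) (λ e → merged≢middle (trans (sym ka′) e)))
        (trans (cong (_>>= φ) (star ka′ ky′ (old-black p ay)))
        (sym (old (in₋ y) (y≢u , in≢v y) (λ e → branch≢middle (trans (sym ky′) e)))))

  module _ {F₁ : Member} {β₁ : Labelling (Fin (suc k)) (size F₁)} where

    -- The boundary of {u , v} in a graph E₁ that omits the black neighbour of the new vertex.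
    bounded : {E₁ : Fin (suc k) → Fin (suc k) → Set} (M₁ : Model E₁ (pattern-of F₁) β₁) →
              (∀ {z} → Out z → E₁ u z ⊎ E₁ v z → merge (T u z) (T v z) ≡ red) →
              (∀ {z} → Out z → merge (T u z) (T v z) ≡ red → E₁ u z ⊎ E₁ v z) →
              Identify.AtMostThree {E = E₁} {E′ = E′} E′-sym F₁ M₁ u v u≢v
    bounded {E₁} M₁ to from = Sum.map none-red some-red (at-most-three (λ b → isRed (T′ x b)) (low x))
      where
      open Identify {E = E₁} {E′ = E′} E′-sym F₁ M₁ u v u≢v using (Boundary)
      is-red : ∀ {c} → isRed c ≡ true → c ≡ red
      is-red {red} _ = refl
      red-out : ∀ {z} (b : Boundary z) → isRed (T′ x (out (proj₂ (proj₁ b)))) ≡ true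
      red-out ((z≢u , z≢v) , e) = cong isRed (trans (new-colour z≢u z≢v) (to (z≢u , z≢v) e))
      red-in : ∀ {a} → isRed (T′ x a) ≡ true → Boundary (in₋ a)
      red-in {a} h = (a≢u , in≢v a) , from (a≢u , in≢v a) (trans (sym (left-new in-x a≢u)) (is-red h))
        where
        none≢red : none ≢ red
        none≢red ()
        a≢u : in₋ a ≢ u
        a≢u q = none≢red (trans (sym (both-new in-x q)) (is-red h))
      none-red : (∀ z → isRed (T′ x z) ≢ true) → ∀ z → ¬ Boundary z
      none-red h z b = h _ (red-out b)
      some-red : _ → _
      some-red (a , b , c , ra , rb , rc , all) = in₋ a , in₋ b , in₋ c , red-in ra , red-in rb , red-in rc ,
        λ z z-bd → Sum.map (back z-bd) (Sum.map (back z-bd) (back z-bd)) (all _ (red-out z-bd))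
        where
        back : ∀ {z a} (b : Boundary z) → out (proj₂ (proj₁ b)) ≡ a → z ≡ in₋ a
        back b e = trans (sym (in-out (proj₂ (proj₁ b)))) (cong in₋ e)

  red-merge : ∀ {c d} → c ≢ none ⊎ d ≢ none → ¬ (c ≡ black × d ≡ black) → merge c d ≡ red
  red-merge {none}  {none}  (inj₁ h) _ = ⊥-elim (h refl)
  red-merge {none}  {none}  (inj₂ h) _ = ⊥-elim (h refl)
  red-merge {none}  {black} _ _ = refl
  red-merge {none}  {red}   _ _ = refl
  red-merge {black} {none}  _ _ = refl
  red-merge {black} {black} _ h = ⊥-elim (h (refl , refl))
  red-merge {black} {red}   _ _ = refl
  red-merge {red}   {_}     _ _ = refl

  merge-red : ∀ {c d} → merge c d ≡ red → c ≢ none ⊎ d ≢ none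
  merge-red {none}  {none}  ()
  merge-red {none}  {black} _ = inj₂ λ ()
  merge-red {none}  {red}   _ = inj₂ λ ()
  merge-red {black} {_}     _ = inj₁ λ ()
  merge-red {red}   {_}     _ = inj₁ λ ()

  -- All neighbours of the new vertex are red, so the boundary of the pair has at most three
  -- vertices.
  no-black : (∀ z → Out z → ¬ (T u z ≡ black × T v z ≡ black)) → Invariant T′
  no-black h =
    let F′ , φ , β′ , M′ , old , vn = Identify.Small.identify {E = E} {E′ = E′} E′-sym F model u v u≢v
          keep (λ { (o , e) → extend o e }) E-sym
          (bounded model (λ o e → red-merge e (h _ o)) (λ _ → merge-red))
    in rebuild F′ φ β′ M′ vn (λ z o _ → old z o) (λ y o _ a b → ⊥-elim (h y o (a , b)))

  black≢none : ∀ {c} → c ≡ black → c ≢ none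
  black≢none refl ()

  -- `y` has no neighbours but `u` and `v`. It joins the bag of `u` and is then suppressed; so it
  -- leaves the boundary of the pair, where only the red neighbours of the new vertex remain.
  module BlackMiddle (y : Fin (suc k)) (y-out : Out y) (ky : kind y ≡ middle)
                     (uy : T u y ≡ black) (vy : T v y ≡ black) where

    nbr : ∀ z → E y z → z ≡ u ⊎ z ≡ v
    nbr z e with middle-degree ky
    ... | p , q , cover with cover u (black≢none (black-sym uy)) | cover v (black≢none (black-sym vy)) | cover z e
    ...   | inj₁ refl | inj₁ d | _ = ⊥-elim (u≢v (sym d))
    ...   | inj₂ refl | inj₂ d | _ = ⊥-elim (u≢v (sym d))
    ...   | inj₁ refl | inj₂ refl | c = c
    ...   | inj₂ refl | inj₁ refl | c = Sum.swap c

    yu : E y u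
    yu = black≢none (black-sym uy)

    y≢u = proj₁ y-out
    y≢v = proj₂ y-out

    β₁ β₂ : Labelling (Fin (suc k)) (size F)
    β₁ = put y (β u) β

    M₁ : Model E (pattern-of F) β₁
    M₁ = Relabel.relabel E-sym F model y u v yu (λ e → y≢u (sym e)) nbr

    abstract
      β₂ = put y nothing β₁

      β₂-y : β₂ y ≡ nothing
      β₂-y = put-same y nothing β₁

      β₂-other : ∀ {z} → z ≢ y → β₂ z ≡ β z
      β₂-other d = trans (put-other y nothing β₁ d) (put-other y (β u) β d)

    -- The path u y v becomes the edge uv.
    E₂ : Fin (suc k) → Fin (suc k) → Set
    E₂ a b = (a ≢ y × b ≢ y × E a b) ⊎ (a ≡ u × b ≡ v) ⊎ (a ≡ v × b ≡ u)

    E₂-sym : ∀ {a b} → E₂ a b → E₂ b a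
    E₂-sym (inj₁ (p , q , e)) = inj₁ (q , p , E-sym e)
    E₂-sym (inj₂ (inj₁ (p , q))) = inj₂ (inj₂ (q , p))
    E₂-sym (inj₂ (inj₂ (p , q))) = inj₂ (inj₁ (q , p))

    f : Fin (suc k) → Fin (suc k)
    f z with z ≟ y
    ... | yes _ = u
    ... | no _ = z

    f-y : f y ≡ u
    f-y with y ≟ y
    ... | yes _ = refl
    ... | no d = ⊥-elim (d refl)

    f-other : ∀ {z} → z ≢ y → f z ≡ z
    f-other {z} d with z ≟ y
    ... | yes e = ⊥-elim (d e)
    ... | no _ = refl

    lab : ∀ {a i} → β₁ a ≡ just i → β₂ (f a) ≡ just i
    lab {a} {i} e = go (a ≟ y)
      where
      go : Dec (a ≡ y) → β₂ (f a) ≡ just i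
      go (yes refl) = trans (cong β₂ f-y) (trans (β₂-other (λ d → y≢u (sym d))) (trans (sym (put-same y (β u) β)) e))
      go (no d) = trans (cong β₂ (f-other d)) (trans (β₂-other d) (trans (sym (put-other y (β u) β d)) e))

    hom : ∀ {a b} → E a b → f a ≡ f b ⊎ E₂ (f a) (f b)
    hom {a} {b} e = go (a ≟ y) (b ≟ y)
      where
      E₂-≡ : ∀ {p q r s} → p ≡ r → q ≡ s → E₂ r s → E₂ p q
      E₂-≡ refl refl h = h
      to-y : ∀ {z} → z ≢ y → E y z → f z ≡ u ⊎ E₂ (f z) u
      to-y {z} d e with nbr z e
      ... | inj₁ refl = inj₁ (f-other d)
      ... | inj₂ refl = inj₂ (E₂-≡ (f-other d) refl (inj₂ (inj₂ (refl , refl))))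
      go : Dec (a ≡ y) → Dec (b ≡ y) → f a ≡ f b ⊎ E₂ (f a) (f b)
      go (yes refl) (yes refl) = inj₁ refl
      go (no p) (no q) = inj₂ (E₂-≡ (f-other p) (f-other q) (inj₁ (p , q , e)))
      go (no p) (yes refl) = Sum.map (λ d → trans d (sym f-y)) (E₂-≡ refl f-y) (to-y p (E-sym e))
      go (yes refl) (no q) = Sum.map (λ d → trans f-y (sym d)) (λ h → E₂-≡ f-y refl (E₂-sym h)) (to-y q e)

    M₂ : Model E₂ (pattern-of F) β₂
    M₂ = transfer E₂-sym f (λ {a} → lab {a}) inner cover outer M₁
      where
      inner : ∀ {a b i} → β₁ a ≡ just i → β₁ b ≡ just i → E a b → Path E₂ (Bag β₂ i) (f a) (f b)
      inner {a} {b} {i} ai bi e with hom e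
      ... | inj₁ eq = subst (Path E₂ (Bag β₂ i) (f a)) eq (stop (lab {a} ai))
      ... | inj₂ d = edge-path (lab {a} ai) (lab {b} bi) d
      cover : ∀ {w i} → β₂ w ≡ just i → ∃ λ a → β₁ a ≡ just i × Path E₂ (Bag β₂ i) w (f a)
      cover {w} {i} wi = go (w ≟ y)
        where
        go : Dec (w ≡ y) → _
        go (yes refl) = ⊥-elim (just≢nothing wi β₂-y)
        go (no d) = w , trans (put-other y (β u) β d) (trans (sym (β₂-other d)) wi) ,
                    subst (Path E₂ (Bag β₂ i) w) (sym (f-other d)) (stop wi)
      outer : ∀ {a b i j} → pattern-of F i j ≡ true → β₁ a ≡ just i → β₁ b ≡ just j → E a b → Joined E₂ β₂ i j
      outer {a} {b} ij ai bj e with hom e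
      ... | inj₁ eq = ⊥-elim (loopless F _ (subst (λ l → pattern-of F _ l ≡ true)
                        (label≡ (trans (cong β₂ eq) (lab {b} bj)) (lab {a} ai)) ij))
      ... | inj₂ d = f a , f b , lab {a} ai , lab {b} bj , d

    black-middle : Invariant T′
    black-middle =
      let F′ , φ , β′ , M′ , old , vn = Identify.Small.identify {E = E₂} {E′ = E′} E′-sym F M₂ u v u≢v
            (λ o o′ e → keep o o′ (inner-edge o o′ e)) (λ { (o , e) → extend o (Sum.map (away o) (away′ o) e) }) E₂-sym
            (bounded M₂ (λ {z} o e → red-merge (Sum.map (away o) (away′ o) e)
                                     λ { (a , b) → not-y o e (common-black a b uy vy) })
                        (λ {z} o r → Sum.map (λ e → inj₁ ((λ d → y≢u (sym d)) , red≢y r , e))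
                                             (λ e → inj₁ ((λ d → y≢v (sym d)) , red≢y r , e)) (merge-red r)))
      in rebuild F′ φ β′ M′ vn
           (λ z o km → trans (old z o) (cong (_>>= φ) (β₂-other (λ { refl → km ky }))))
           (λ z o kz a b → ⊥-elim (branch≢middle (trans (sym kz) (trans (cong kind (common-black a b uy vy)) ky))))
      where
      branch≢middle : branch ≢ middle
      branch≢middle ()
      inner-edge : ∀ {a b} → Out a → Out b → E₂ a b → E a b
      inner-edge _ _ (inj₁ (_ , _ , e)) = e
      inner-edge (p , _) _ (inj₂ (inj₁ (q , _))) = ⊥-elim (p q)
      inner-edge (_ , p) _ (inj₂ (inj₂ (q , _))) = ⊥-elim (p q)
      away : ∀ {z} → Out z → E₂ u z → E u z
      away _ (inj₁ (_ , _ , e)) = e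
      away (_ , q) (inj₂ (inj₁ (_ , e))) = ⊥-elim (q e)
      away (p , _) (inj₂ (inj₂ (_ , e))) = ⊥-elim (p e)
      away′ : ∀ {z} → Out z → E₂ v z → E v z
      away′ _ (inj₁ (_ , _ , e)) = e
      away′ (_ , q) (inj₂ (inj₁ (_ , e))) = ⊥-elim (q e)
      away′ (p , _) (inj₂ (inj₂ (_ , e))) = ⊥-elim (p e)
      not-y : ∀ {z} → Out z → E₂ u z ⊎ E₂ v z → z ≢ y
      not-y _ (inj₁ (inj₁ (_ , p , _))) = p
      not-y _ (inj₂ (inj₁ (_ , p , _))) = p
      not-y (_ , q) (inj₁ (inj₂ (inj₁ (_ , e)))) = ⊥-elim (q e)
      not-y (p , _) (inj₁ (inj₂ (inj₂ (_ , e)))) = ⊥-elim (p e)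
      not-y (_ , q) (inj₂ (inj₂ (inj₁ (_ , e)))) = ⊥-elim (q e)
      not-y (p , _) (inj₂ (inj₂ (inj₂ (_ , e)))) = ⊥-elim (p e)
      red≢y : ∀ {z} → merge (T u z) (T v z) ≡ red → z ≢ y
      red≢y {z} r refl with trans (sym r) (cong₂ merge uy vy)
      ... | ()

  module BlackBranch (y : Fin (suc k)) (y-out : Out y) (ky : kind y ≡ branch)
                     (uy : T u y ≡ black) (vy : T v y ≡ black) where

    record Pulled (w : Fin (suc k)) (β₁ : Labelling (Fin (suc k)) (size F)) : Set where
      field
        β₂   : Labelling (Fin (suc k)) (size F)
        M₂   : Model E (pattern-of F) β₂
        β₂-w : β₂ w ≡ β₁ y
        same : ∀ {z} → z ≢ w → β₂ z ≡ β₁ z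

    -- A middle vertex can be relabelled because it has at most two neighbours, a merged one carries
    -- the label of `y` already by `star`, and a branch vertex has no black edge to `y`. Once `u`
    -- and `v` both carry this label, `same-bag` applies, whatever the size of the boundary.
    pull : ∀ {w} → y ≢ w → T w y ≡ black → ∀ {β₁} → Model E (pattern-of F) β₁ → β₁ w ≡ β w → β₁ y ≡ β y → Pulled w β₁
    pull {w} y≢w wy {β₁} M₁ ew ey with kind w in kw
    ... | merged = record { β₂ = β₁ ; M₂ = M₁ ; β₂-w = trans ew (trans (star kw ky wy) (sym ey)) ; same = λ _ → refl }
    ... | branch = ⊥-elim (branch-apart kw ky wy)
    ... | middle with middle-degree kw
    ...   | p , q , cover = record
      { β₂ = put w (β₁ y) β₁
      ; M₂ = Relabel.relabel E-sym F M₁ w y s (black≢none wy) y≢w nbr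
      ; β₂-w = put-same w (β₁ y) β₁ ; same = put-other w (β₁ y) β₁ }
      where
      other : ∃ λ s → ∀ z → E w z → z ≡ y ⊎ z ≡ s
      other with cover y (black≢none wy)
      ... | inj₁ refl = q , cover
      ... | inj₂ refl = p , λ z e → Sum.swap (cover z e)
      s = proj₁ other
      nbr = proj₂ other

    black-branch : Invariant T′
    black-branch =
      let module P = Pulled (pull (proj₁ y-out) uy model refl refl)
          v-same = P.same (λ e → u≢v (sym e))
          y-same = P.same (proj₁ y-out)
          module Q = Pulled (pull (proj₂ y-out) vy P.M₂ v-same y-same)
          u-lab = trans (Q.same u≢v) P.β₂-w
          v-lab = trans Q.β₂-w y-same
          y-lab = trans (Q.same (proj₂ y-out)) y-same
          open Identify {E = E} {E′ = E′} E′-sym F Q.M₂ u v u≢v using (β₀; β₀-u; β₀-v; β₀-out; same-bag; >>=-just)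
      in rebuild F just (β₀ (Q.β₂ u)) (same-bag keep extend E-sym (trans u-lab (sym v-lab))) (β₀-v _)
           (λ z o _ → trans (β₀-out _ o) (trans (Q.same (proj₂ o)) (trans (P.same (proj₁ o)) (>>=-just (β z)))))
           (λ z o kz a b → trans (β₀-u _) (trans u-lab (trans (sym y-lab)
             (trans (cong Q.β₂ (common-black uy vy a b)) (sym (β₀-out _ o))))))

  invariant-step : Invariant T′
  invariant-step with any? (λ z → (¬? (z ≟ u) ×-dec ¬? (z ≟ v)) ×-dec ((T u z ≟ᶜ black) ×-dec (T v z ≟ᶜ black)))
  ... | no h = no-black λ z o b → h (z , o , b)
  ... | yes (y , o , uy , vy) = by-kind (kind y) refl
    where
    by-kind : ∀ c → kind y ≡ c → Invariant T′
    by-kind branch ky = BlackBranch.black-branch y o ky uy vy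
    by-kind middle ky = BlackMiddle.black-middle y o ky uy vy
    by-kind merged ky = ⊥-elim (u≢v (merged-black ky (black-sym uy) (black-sym vy)))

single-vertex : ∀ {k} {T : Trigraph k} → Invariant T → ¬ k ≤ 1
single-vertex {k} I k≤1 = two F (λ i → inhabited model i)
  where
  open Invariant I
  equal : ∀ {k} → k ≤ 1 → (a b : Fin k) → a ≡ b
  equal (s≤s z≤n) zero zero = refl
  two : (F : Member) {β : Labelling (Fin k) (size F)} → (∀ i → ∃ λ a → β a ≡ just i) → ⊥
  two F {β} inh = unequal F λ i j → let a , ai = inh i ; b , bj = inh j
                                     in label≡ ai (trans (cong β (equal k≤1 a b)) bj)
    where
    unequal : (F : Member) → ¬ (∀ (i j : Fin (size F)) → i ≡ j)
    unequal k₆⁻ h with () ← h zero (suc zero)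
    unequal m₇  h with () ← h zero (suc zero)
    unequal v₈  h with () ← h zero (suc zero)

no-sequence : ∀ {k} {T : Trigraph k} → Invariant T → ¬ ContractionSeq 3 T
no-sequence I (done k≤1)             = single-vertex I k≤1
no-sequence I (step u v u≢v low seq) = no-sequence (OneContraction.invariant-step I u v u≢v low) seq

-- Subdivisions satisfy the invariant

module Subdivided {n m} {G : Graph n} {H : Graph m} (S : IsSubdivision G H) where
  open IsSubdivision S

  Vertex : Set
  Vertex = Pos n len

  to : Vertex → Fin m
  to = Bijection.to iso

  pos : Fin m → Vertex
  pos a = proj₁ (Bijection.surjective iso a)

  to-pos : ∀ a → to (pos a) ≡ a
  to-pos a = proj₂ (Bijection.surjective iso a) refl

  to-injective : ∀ {p q} → to p ≡ to q → p ≡ q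
  to-injective = Bijection.injective iso

  pos-to : ∀ p → pos (to p) ≡ p
  pos-to p = to-injective (to-pos (to p))

  pos-injective : ∀ {a b} → pos a ≡ pos b → a ≡ b
  pos-injective {a} {b} e = trans (sym (to-pos a)) (trans (cong to e) (to-pos b))

  Adj : Vertex → Vertex → Set
  Adj = SubAdj

  T₀ : Trigraph m
  T₀ = graph→trigraph H

  edge-adj : ∀ {a b} → Edge H a b → Adj (pos a) (pos b)
  edge-adj {a} {b} e = Equivalence.to (adj-iso (pos a) (pos b)) (trans (cong₂ (adj H) (to-pos a) (to-pos b)) e)

  T₀-edge : ∀ {a b} → T₀ a b ≢ none → Adj (pos a) (pos b)
  T₀-edge {a} {b} e = edge-adj (edge (adj H a b) e)
    where
    edge : ∀ c → (if c then black else none) ≢ none → c ≡ true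
    edge true  _ = refl
    edge false h = ⊥-elim (h refl)

  T₀-edge⁻¹ : ∀ {p q} → Adj p q → T₀ (to p) (to q) ≢ none
  T₀-edge⁻¹ {p} {q} s e with adj H (to p) (to q) | Equivalence.from (adj-iso p q) s
  T₀-edge⁻¹ {p} {q} s () | true | refl

  T₀-sym : ∀ a b → T₀ a b ≡ T₀ b a
  T₀-sym a b = cong (if_then black else none) (Graph.sym H a b)

  Adj-sym : ∀ {p q : Vertex} → Adj p q → Adj q p
  Adj-sym = Sum.swap

  endpoints-ordered : ∀ {u v} → Fin (len u v) → toℕ u < toℕ v
  endpoints-ordered {u} {v} i = proj₁ (len-zero u v (≤-trans (s≤s z≤n) (toℕ<n i)))

  endpoints-distinct : ∀ {u v} → Fin (len u v) → u ≢ v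
  endpoints-distinct i refl = <-irrefl refl (endpoints-ordered i)

  predecessor : ∀ u v (i : Fin (len u v)) → ∃ λ (p : Vertex) → ∀ q → Step q (mid u v i) → q ≡ p
  predecessor u v i with toℕ i in eq
  ... | zero  = br u , λ { _ (first _ _ _ _) → refl
                         ; _ (next _ _ j _ e) → ⊥-elim (0≢suc (trans (sym eq) e)) }
    where
    0≢suc : ∀ {a} → 0 ≢ suc a
    0≢suc ()
  ... | suc t = mid u v (fromℕ< t<len) , λ
      { _ (first _ _ _ e) → ⊥-elim (suc≢0 (trans (sym eq) e))
      ; _ (next _ _ j _ e) → cong (mid u v) (toℕ-injective (trans (suc-injective (trans (sym e) eq)) (sym (toℕ-fromℕ< t<len)))) }
    where
    suc≢0 : ∀ {a} → suc a ≢ 0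
    suc≢0 ()
    t<len : t < len u v
    t<len = <-trans (n<1+n t) (subst (_< len u v) eq (toℕ<n i))

  successor : ∀ u v (i : Fin (len u v)) → ∃ λ (p : Vertex) → ∀ q → Step (mid u v i) q → q ≡ p
  successor u v i with suc (toℕ i) ℕₚ.≟ len u v
  ... | yes eq = br v , λ
      { _ (next _ _ _ j e) → ⊥-elim (<-irrefl (trans e eq) (toℕ<n j)) ; _ (last _ _ _ _) → refl }
  ... | no ne = mid u v (fromℕ< lt) , λ
      { _ (next _ _ _ j e) → cong (mid u v) (toℕ-injective (trans e (sym (toℕ-fromℕ< lt)))) ; _ (last _ _ _ e) → ⊥-elim (ne e) }
    where
    lt : suc (toℕ i) < len u v
    lt = ≤∧≢⇒< (toℕ<n i) ne

  mid-neighbours : ∀ u v (i : Fin (len u v)) → ∃₂ λ p q → ∀ z → Adj (mid u v i) z → z ≡ p ⊎ z ≡ q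
  mid-neighbours u v i = let p , P = predecessor u v i ; q , Q = successor u v i
                         in p , q , λ { z (inj₁ s) → inj₂ (Q z s) ; z (inj₂ s) → inj₁ (P z s) }

  br-apart : ∀ {u v} → ¬ Adj (br u) (br v)
  br-apart (inj₁ ())
  br-apart (inj₂ ())

  data Near (c : Fin n) : Vertex → Set where
    at-first : ∀ {v} (i : Fin (len c v)) → toℕ i ≡ 0 → Near c (mid c v i)
    at-last  : ∀ {u} (i : Fin (len u c)) → suc (toℕ i) ≡ len u c → Near c (mid u c i)

  near : ∀ {c y} → Adj (br c) y → Near c y
  near (inj₁ (first _ _ i e)) = at-first i e
  near (inj₂ (last _ _ i e))  = at-last i e

  two-branches : ∀ {c d y z} → c ≢ d → Near c y → Near d y → Near c z → Near d z → y ≡ z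
  two-branches c≢d (at-first i e) (at-first _ _) _ _ = ⊥-elim (c≢d refl)
  two-branches c≢d (at-last i e) (at-last _ _) _ _ = ⊥-elim (c≢d refl)
  two-branches c≢d (at-first i e) (at-last _ _) (at-first j d) (at-last _ _) = cong (mid _ _) (toℕ-injective (trans e (sym d)))
  two-branches c≢d (at-last i _) (at-first _ e) (at-last j _) (at-first _ d) = cong (mid _ _) (toℕ-injective (trans e (sym d)))
  two-branches c≢d (at-first i e) (at-last _ _) (at-last j _) (at-first _ d) =
    ⊥-elim (<-asym (endpoints-ordered i) (endpoints-ordered j))
  two-branches c≢d (at-last i _) (at-first _ e) (at-first j d) (at-last _ _) =
    ⊥-elim (<-asym (endpoints-ordered i) (endpoints-ordered j))
  two-branches c≢d _ _ (at-first _ _) (at-first _ _) = ⊥-elim (c≢d refl)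
  two-branches c≢d _ _ (at-last _ _) (at-last _ _) = ⊥-elim (c≢d refl)

  Consecutive : ℕ → ℕ → Set
  Consecutive i j = j ≡ suc i ⊎ i ≡ suc j

  data OnPath (u v : Fin n) (i : Fin (len u v)) : Vertex → Set where
    on : ∀ j → Consecutive (toℕ i) (toℕ j) → OnPath u v i (mid u v j)

  on-path : ∀ {u v i a b j} → Adj (mid u v i) (mid a b j) → OnPath u v i (mid a b j)
  on-path (inj₁ (next _ _ _ j e)) = on j (inj₁ e)
  on-path (inj₂ (next _ _ j _ e)) = on j (inj₂ e)

  branch-and-middle : ∀ {c u v i y z} → Near c y → Adj (mid u v i) y → Near c z → Adj (mid u v i) z → y ≡ z
  branch-and-middle {y = mid _ _ _} {z = mid _ _ _} y-near y-adj z-near z-adj with on-path y-adj | on-path z-adj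
  ... | on j _ | on l _ = same y-near z-near
    where
    same : ∀ {c u v} {j l : Fin (len u v)} → Near c (mid u v j) → Near c (mid u v l) → mid u v j ≡ mid u v l
    same (at-first _ e) (at-first _ d) = cong (mid _ _) (toℕ-injective (trans e (sym d)))
    same (at-last _ e) (at-last _ d) = cong (mid _ _) (toℕ-injective (suc-injective (trans e (sym d))))
    same (at-first i _) (at-last _ _) = ⊥-elim (endpoints-distinct i refl)
    same (at-last i _) (at-first _ _) = ⊥-elim (endpoints-distinct i refl)

  between : ∀ {i j y z} → i ≢ j → Consecutive i y → Consecutive j y → Consecutive i z → Consecutive j z → y ≡ z
  between i≢j (inj₁ a) (inj₁ b) _ _ = ⊥-elim (i≢j (suc-injective (trans (sym a) b)))
  between i≢j (inj₂ a) (inj₂ b) _ _ = ⊥-elim (i≢j (trans a (sym b)))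
  between i≢j _ _ (inj₁ a) (inj₁ b) = ⊥-elim (i≢j (suc-injective (trans (sym a) b)))
  between i≢j _ _ (inj₂ a) (inj₂ b) = ⊥-elim (i≢j (trans a (sym b)))
  between i≢j (inj₁ refl) (inj₂ b) (inj₁ refl) (inj₂ d) = refl
  between i≢j (inj₂ a) (inj₁ refl) (inj₂ c) (inj₁ refl) = refl
  between i≢j (inj₁ refl) (inj₂ refl) (inj₂ c) (inj₁ d) = ⊥-elim (loop c d)
    where
    loop : ∀ {i z} → i ≡ suc z → z ≡ suc (suc (suc i)) → ⊥
    loop refl ()
  between i≢j (inj₂ refl) (inj₁ refl) (inj₁ c) (inj₂ d) = ⊥-elim (loop c d)
    where
    loop : ∀ {j z} → z ≡ suc (suc (suc j)) → j ≡ suc z → ⊥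
    loop refl ()

  three-middles : ∀ {u v i u′ v′ i′ a b j a′ b′ j′} → _≢_ {A = Vertex} (mid u v i) (mid u′ v′ i′) →
    Adj (mid u v i) (mid a b j) → Adj (mid u′ v′ i′) (mid a b j) →
    Adj (mid u v i) (mid a′ b′ j′) → Adj (mid u′ v′ i′) (mid a′ b′ j′) → mid a b j ≡ mid a′ b′ j′
  three-middles ne p q r s with on-path p | on-path q
  ... | on j c | on _ d with on-path r
  ...   | on j′ e with on-path s
  ...     | on _ f = cong (mid _ _) (toℕ-injective (between (λ h → ne (cong (mid _ _) (toℕ-injective h))) c d e f))

  -- As no two branch vertices are adjacent, a four-cycle could only consist of two paths of length
  -- two between the same two branch vertices. Since `len u v` is positive only for `u` below `v`,
  -- each pair has just one path.
  C₄-free : ∀ {a b y z : Vertex} → a ≢ b → Adj a y → Adj b y → Adj a z → Adj b z → y ≡ z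
  C₄-free {br _} {br _} ne ay by az bz = two-branches (λ { refl → ne refl }) (near ay) (near by) (near az) (near bz)
  C₄-free {br _} {mid _ _ _} ne ay by az bz = branch-and-middle (near ay) by (near az) bz
  C₄-free {mid _ _ _} {br _} ne ay by az bz = branch-and-middle (near by) ay (near bz) az
  C₄-free {mid _ _ _} {mid _ _ _} {mid _ _ _} {mid _ _ _} ne ay by az bz = three-middles ne ay by az bz
  C₄-free {mid _ _ _} {mid _ _ _} {br c} {br d} ne ay by az bz with c ≟ d
  ... | yes refl = refl
  ... | no c≢d = ⊥-elim (ne (two-branches c≢d (near (Adj-sym ay)) (near (Adj-sym az)) (near (Adj-sym by)) (near (Adj-sym bz))))
  C₄-free {mid _ _ _} {mid _ _ _} {br c} {mid _ _ _} ne ay by az bz =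
    ⊥-elim (ne (branch-and-middle (near (Adj-sym ay)) (Adj-sym az) (near (Adj-sym by)) (Adj-sym bz)))
  C₄-free {mid _ _ _} {mid _ _ _} {mid _ _ _} {br c} ne ay by az bz =
    ⊥-elim (ne (branch-and-middle (near (Adj-sym az)) (Adj-sym ay) (near (Adj-sym bz)) (Adj-sym by)))

  module _ {p} {K : Pattern p} {β : Labelling (Fin n) p} (M : Model (Edge G) K β) where

    -- Each path goes to the bag of its smaller end, so an edge between two bags becomes the last
    -- edge of its path.
    β₊ : Labelling Vertex p
    β₊ (br u)      = β u
    β₊ (mid u _ _) = β u

    walk : ∀ {u v l} t (i : Fin (len u v)) → toℕ i ≡ t → β u ≡ just l → Path Adj (Bag β₊ l) (br u) (mid u v i)
    walk zero    i e ul = edge-path ul ul (inj₁ (first _ _ i e))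
    walk {u} {v} (suc t) i e ul = walk t i′ (toℕ-fromℕ< t<len) ul ◅◅ edge-path ul ul (inj₁ (next _ _ i′ i (trans e (cong suc (sym (toℕ-fromℕ< t<len))))))
      where
      t<len : t < len u v
      t<len = <-trans (n<1+n t) (subst (_< len u v) e (toℕ<n i))
      i′ = fromℕ< t<len

    final : ∀ {u v} → 1 ≤ len u v → ∃ λ (i : Fin (len u v)) → suc (toℕ i) ≡ len u v
    final {u} {v} h with len u v
    final (s≤s _) | suc l = fromℕ l , cong suc (toℕ-fromℕ l)

    arrive : ∀ {u v l} → toℕ u < toℕ v → Edge G u v → β u ≡ just l →
             ∃ λ (i : Fin (len u v)) → Path Adj (Bag β₊ l) (br u) (mid u v i) × Adj (mid u v i) (br v)
    arrive {u} {v} u<v e ul = let i , d = final (len-pos u v u<v e) in i , walk (toℕ i) i refl ul , inj₁ (last u v i d)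

    edge-cases : ∀ {u v} → Edge G u v → toℕ u < toℕ v ⊎ toℕ v < toℕ u
    edge-cases {u} {v} e with <-cmp (toℕ u) (toℕ v)
    ... | tri< lt _ _ = inj₁ lt
    ... | tri> _ _ gt = inj₂ gt
    ... | tri≈ _ eq _ with refl ← toℕ-injective eq with () ← trans (sym e) (Graph.irrefl G u)

    model₊ : Model Adj K β₊
    model₊ = transfer Adj-sym br (λ e → e) inner cover outer M
      where
      flip : ∀ {u v} → Edge G u v → Edge G v u
      flip {u} {v} e = trans (Graph.sym G v u) e
      across : ∀ {u v l} → toℕ u < toℕ v → β u ≡ just l → β v ≡ just l → Edge G u v → Path Adj (Bag β₊ l) (br u) (br v)
      across lt ul vl e = let i , r , s = arrive lt e ul in r ◅◅ edge-path (path-end r) vl s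
      inner : ∀ {u v l} → β u ≡ just l → β v ≡ just l → Edge G u v → Path Adj (Bag β₊ l) (br u) (br v)
      inner ul vl e with edge-cases e
      ... | inj₁ lt = across lt ul vl e
      ... | inj₂ gt = path-reverse Adj-sym (across gt vl ul (flip e))
      cover : ∀ {w l} → β₊ w ≡ just l → ∃ λ a → β a ≡ just l × Path Adj (Bag β₊ l) w (br a)
      cover {br u} ul = u , ul , stop ul
      cover {mid u v i} ul = u , ul , path-reverse Adj-sym (walk (toℕ i) i refl ul)
      outer : ∀ {u v i j} → K i j ≡ true → β u ≡ just i → β v ≡ just j → Edge G u v → Joined Adj β₊ i j
      outer {u} {v} _ ui vj e with edge-cases e
      ... | inj₁ lt = let i , r , s = arrive lt e ui in mid u v i , br v , ui , vj , s
      ... | inj₂ gt = let i , r , s = arrive gt (flip e) vj in br u , mid v u i , ui , vj , Adj-sym s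

    model₀ : Model (λ a b → T₀ a b ≢ none) K (β₊ ∘ pos)
    model₀ = transfer (λ {a} {b} e d → e (trans (T₀-sym a b) d)) to lab
      (λ ai bi e → edge-path (lab ai) (lab bi) (T₀-edge⁻¹ e))
      (λ {w} wi → pos w , wi , subst (Path _ (Bag (β₊ ∘ pos) _) w) (sym (to-pos w)) (stop wi))
      (λ _ ai bj e → _ , _ , lab ai , lab bj , T₀-edge⁻¹ e) model₊
      where
      lab : ∀ {p i} → β₊ p ≡ just i → β₊ (pos (to p)) ≡ just i
      lab {p} e = trans (cong β₊ (pos-to p)) e

  kind₀ : Vertex → Kind
  kind₀ (br _)      = branch
  kind₀ (mid _ _ _) = middle

  start : ∀ {β} → Model (Edge G) K₆⁻ β → Invariant T₀
  start M = record
    { F = k₆⁻ ; β = β₊ M ∘ pos ; model = model₀ M ; kind = kind₀ ∘ pos ; symm = T₀-sym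
    ; middle-degree = λ {a} k → md a (pos a) refl k
    ; branch-apart = λ {a} {b} ka kb e → ba (pos a) (pos b) ka kb (T₀-edge {a} {b} (black-edge e))
    ; merged-black = λ {a} k → ⊥-elim (unmerged (pos a) k)
    ; no-square = λ _ _ _ _ a≢b ay by az bz → pos-injective
        (C₄-free (λ e → a≢b (pos-injective e)) (T₀-edge (black-edge ay)) (T₀-edge (black-edge by)) (T₀-edge (black-edge az)) (T₀-edge (black-edge bz)))
    ; star = λ {a} k → ⊥-elim (unmerged (pos a) k)
    }
    where
    black-edge : ∀ {c} → c ≡ black → c ≢ none
    black-edge refl ()
    unmerged : ∀ p → kind₀ p ≢ merged
    unmerged (br _) ()
    unmerged (mid _ _ _) ()
    ba : ∀ p q → kind₀ p ≡ branch → kind₀ q ≡ branch → ¬ Adj p q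
    ba (br _) (br _) _ _ = br-apart
    md : ∀ a p → pos a ≡ p → kind₀ p ≡ middle → ∃₂ λ x y → ∀ z → T₀ a z ≢ none → z ≡ x ⊎ z ≡ y
    md a (mid u v i) e _ with mid-neighbours u v i
    ... | p , q , h = to p , to q , λ z d →
      Sum.map (λ r → trans (sym (to-pos z)) (cong to r)) (λ r → trans (sym (to-pos z)) (cong to r))
        (h (pos z) (subst (λ w → Adj w (pos z)) e (T₀-edge d)))

subdivision-bound : ∀ {n m} {G : Graph n} {H : Graph m} {β} → IsSubdivision G H → Model (Edge G) K₆⁻ β → ¬ TwwAtMost 3 H
subdivision-bound S M (_ , seq) = no-sequence (Subdivided.start S M) seq

-- Neighbourhoods of vertices of small degree

HasMinor : ∀ {V : Set} → (V → V → Set) → Set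
HasMinor E = ∃ λ β → Model E K₆⁻ β

minor-mono : ∀ {V : Set} {E E′ : V → V → Set} → (∀ {a b} → E a b → E′ a b) → HasMinor E → HasMinor E′
minor-mono h (β , M) = β , model-mono h M

-- Models whose bags are single vertices `w i`, except that a connected set `B` is contracted to its
-- member `r`. If `r` is one of the `w i`, then `Link` lets every vertex of `B` act for it. The set
-- `B` will be a vertex, an edge, a component, or a component together with one of its neighbours.
module Pack {N q} {E : Fin N → Fin N → Set} (E-sym : ∀ {a b} → E a b → E b a)
            (B : Fin N → Bool) (r : Fin N) (r∈B : B r ≡ true)
            (reach : ∀ {b} → B b ≡ true → Path E (λ z → B z ≡ true) b r)
            (w : Fin q → Fin N) (w-inj : ∀ {i j} → w i ≡ w j → i ≡ j)
            (w∈B : ∀ {i} → B (w i) ≡ true → w i ≡ r) where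

  Link : Fin N → Fin N → Set
  Link a b = E a b ⊎ (a ≡ r × ∃ λ c → B c ≡ true × E c b) ⊎ (b ≡ r × ∃ λ c → B c ≡ true × E a c)

  rep : Fin N → Fin N
  rep z = if B z then r else z

  rep-in : ∀ {z} → B z ≡ true → rep z ≡ r
  rep-in e = cong (if_then r else _) e

  rep-w : ∀ i → rep (w i) ≡ w i
  rep-w i with B (w i) in e
  ... | true  = sym (w∈B e)
  ... | false = refl

  index : Fin N → Maybe (Fin q)
  index z with any? (λ i → w i ≟ z)
  ... | yes (i , _) = just i
  ... | no _        = nothing

  index-w : ∀ i → index (w i) ≡ just i
  index-w i with any? (λ j → w j ≟ w i)
  ... | yes (j , e) = cong just (w-inj e)
  ... | no absent     = ⊥-elim (absent (i , refl))

  index-just : ∀ {z i} → index z ≡ just i → w i ≡ z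
  index-just {z} e with any? (λ j → w j ≟ z)
  index-just refl | yes (i , d) = d

  β : Labelling (Fin N) q
  β z = index (rep z)

  β-w : ∀ i → β (w i) ≡ just i
  β-w i = trans (cong index (rep-w i)) (index-w i)

  β-in : ∀ {c i} → B c ≡ true → w i ≡ r → β c ≡ just i
  β-in {c} {i} c∈B e = trans (cong index (trans (rep-in c∈B) (sym e))) (index-w i)

  to-rep : ∀ {a i} → β a ≡ just i → Path E (Bag β i) a (rep a)
  to-rep {a} {i} ai with B a in e
  ... | false = stop (trans (cong (λ b → index (if b then r else a)) e) ai)
  ... | true  = path-bind (λ z → z) (λ {z} → lab {z}) (λ {x} {y} p q d → edge-path (lab {x} p) (lab {y} q) d) (reach e)
    where
    lab : ∀ {z} → B z ≡ true → β z ≡ just i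
    lab d = trans (cong index (rep-in d)) ai

  packed : (κ : Pattern q) → (∀ i j → κ i j ≡ true → Link (w i) (w j)) → Model E κ β
  packed κ link = record
    { inhabited = λ i → w i , β-w i
    ; connected = λ {i} {a} {b} ai bi → to-rep {a} ai ◅◅
        subst (λ z → Path E (Bag β i) z b) (trans (sym (index-just bi)) (index-just ai))
          (path-reverse E-sym (to-rep {b} bi))
    ; joined = λ {i} {j} k → jn (link i j k) }
    where
    jn : ∀ {i j} → Link (w i) (w j) → Joined E β i j
    jn {i} {j} (inj₁ e) = w i , w j , β-w i , β-w j , e
    jn {i} {j} (inj₂ (inj₁ (ir , c , c∈B , e))) = c , w j , β-in {c} c∈B ir , β-w j , e
    jn {i} {j} (inj₂ (inj₂ (jr , c , c∈B , e))) = w i , c , β-w i , β-in {c} c∈B jr , e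

swap : ∀ {n} → Fin n → Fin n → Fin n → Fin n
swap a b z = if z == a then b else if z == b then a else z

near-complete : Fin 6 → Fin 6 → Pattern 6
near-complete p q i j = not (i == j) ∧ not (i == p ∧ j == q) ∧ not (i == q ∧ j == p)

-- For distinct `p` and `q` the first permutation sends 0 to `p` and 1 to `q`. Vertex 1 is exchanged
-- with `swap (# 0) p q` instead of `q`, because the exchange of 0 and `p` is applied afterwards.
relabelling : Fin 6 → Fin 6 → Embedding 6
relabelling p q = tabulate (λ i → swap (# 0) p (swap (# 1) (swap (# 0) p q) i)) ,
                  tabulate (λ i → swap (# 1) (swap (# 0) p q) (swap (# 0) p i))

RelabelTest : Fin 6 → Fin 6 → Bool
RelabelTest p q = p == q ∨ embedding-test (near-complete p q) K₆⁻ (relabelling p q)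

relabel-test : ∀ p q → RelabelTest p q ≡ true
relabel-test p q = every-elim (RelabelTest p) (every-elim (λ p → every 6 (RelabelTest p)) refl p) q

near-complete-minor : ∀ p q → p ≢ q → HasMinor ⟦ near-complete p q ⟧
near-complete-minor p q p≢q = [ (λ e → ⊥-elim (p≢q (==-sound p q e))) ,
  (λ t → _ , embedding-model (near-complete p q) K₆⁻ (relabelling p q) t) ]′
  (∨-split {p == q} (relabel-test p q))

pairs : List (Fin 6 × Fin 6)
pairs = (# 0 , # 1) ∷ (# 0 , # 2) ∷ (# 0 , # 3) ∷ (# 0 , # 4) ∷ (# 0 , # 5) ∷ (# 1 , # 2) ∷ (# 1 , # 3) ∷ (# 1 , # 4) ∷
        (# 1 , # 5) ∷ (# 2 , # 3) ∷ (# 2 , # 4) ∷ (# 2 , # 5) ∷ (# 3 , # 4) ∷ (# 3 , # 5) ∷ (# 4 , # 5) ∷ []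

-- The first non-adjacent pair, the only one allowed to fail in near-test.
first-missing : List (Fin 6 × Fin 6) → Pattern 6 → Fin 6 × Fin 6
first-missing [] κ = # 0 , # 1
first-missing ((i , j) ∷ ps) κ = if κ i j then first-missing ps κ else (i , j)

near-test : Pattern 6 → Bool
near-test κ = not (p == q) ∧ (every 6 λ i → every 6 λ j → near-complete p q i j ⇒ᵇ κ i j)
  where
  p = proj₁ (first-missing pairs κ)
  q = proj₂ (first-missing pairs κ)

near-test-sound : ∀ κ → near-test κ ≡ true → HasMinor ⟦ κ ⟧
near-test-sound κ h = minor-mono
  (λ {i} {j} e → ⇒ᵇ-elim (every-elim (λ j → near-complete p q i j ⇒ᵇ κ i j)
    (every-elim (λ i → every 6 λ j → near-complete p q i j ⇒ᵇ κ i j) (proj₂ s) i) j) e)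
  (near-complete-minor p q (≠-sound p q (proj₁ s)))
  where
  p = proj₁ (first-missing pairs κ)
  q = proj₂ (first-missing pairs κ)
  s = ∧-split {not (p == q)} h

contract-pattern : Pattern 7 → Fin 7 → Fin 7 → Pattern 6
contract-pattern κ x y i j = κ i′ j′ ∨ i′ == y ∧ κ x j′ ∨ j′ == y ∧ κ i′ x
  where
  i′ = punchIn x i
  j′ = punchIn x j

-- Only edges that avoid vertex 0 are tried; in all applications this vertex stands for `v` and has
-- many neighbours already.
contract-test : Pattern 7 → Bool
contract-test κ = some 6 λ x → some 6 λ y →
  (toℕ x <ᵇ toℕ y) ∧ κ (suc x) (suc y) ∧ near-test (contract-pattern κ (suc x) (suc y))

contracted-minor : ∀ κ → (∀ {i j} → κ i j ≡ true → κ j i ≡ true) → ∀ x y → κ x y ≡ true →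
                   HasMinor ⟦ contract-pattern κ x y ⟧ → HasMinor ⟦ κ ⟧
contracted-minor κ κ-sym x y b (φ , M) = _ , model-compose (packed (contract-pattern κ x y) link) M
  where
  B : Fin 7 → Bool
  B z = z == x ∨ z == y
  y∈B : B y ≡ true
  y∈B rewrite ==-refl y with y == x
  ... | true = refl
  ... | false = refl
  x∈B : B x ≡ true
  x∈B rewrite ==-refl x = refl
  reach : ∀ {z} → B z ≡ true → Path ⟦ κ ⟧ (λ z → B z ≡ true) z y
  reach {z} e with ∨-split {z == x} e
  ... | inj₁ d rewrite ==-sound z x d = edge-path x∈B y∈B b
  ... | inj₂ d rewrite ==-sound z y d = stop y∈B
  inside : ∀ {i} → B (punchIn x i) ≡ true → punchIn x i ≡ y
  inside {i} e with ∨-split {punchIn x i == x} e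
  ... | inj₁ d = ⊥-elim (punchInᵢ≢i x i (==-sound _ x d))
  ... | inj₂ d = ==-sound _ y d
  open Pack {E = ⟦ κ ⟧} κ-sym B y y∈B reach (punchIn x) (λ {i} {j} → punchIn-injective x i j) inside
  link : ∀ i j → contract-pattern κ x y i j ≡ true → Link (punchIn x i) (punchIn x j)
  link i j e with ∨-split {κ (punchIn x i) (punchIn x j)} e
  ... | inj₁ d = inj₁ d
  ... | inj₂ d with ∨-split {punchIn x i == y ∧ κ x (punchIn x j)} d
  ...   | inj₁ f = let p , q = ∧-split {punchIn x i == y} f in inj₂ (inj₁ (==-sound _ y p , x , x∈B , q))
  ...   | inj₂ f = let p , q = ∧-split {punchIn x j == y} f in inj₂ (inj₂ (==-sound _ y p , x , x∈B , q))

some²-elim : ∀ {n} (c d e : Fin n → Fin n → Bool) → (some n λ x → some n λ y → c x y ∧ d x y ∧ e x y) ≡ true →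
             ∃₂ λ x y → d x y ≡ true × e x y ≡ true
some²-elim {n} c d e h =
  let x , h = some-elim (λ x → some n λ y → c x y ∧ d x y ∧ e x y) h
      y , h = some-elim (λ y → c x y ∧ d x y ∧ e x y) h
  in x , y , ∧-split {d x y} (proj₂ (∧-split {c x y} h))

contract-test-sound : ∀ κ → (∀ {i j} → κ i j ≡ true → κ j i ≡ true) → contract-test κ ≡ true → HasMinor ⟦ κ ⟧
contract-test-sound κ κ-sym h =
  let x , y , e , n = some²-elim (λ x y → toℕ x <ᵇ toℕ y) (λ x y → κ (suc x) (suc y))
                                 (λ x y → near-test (contract-pattern κ (suc x) (suc y))) h
  in contracted-minor κ κ-sym (suc x) (suc y) e (near-test-sound (contract-pattern κ (suc x) (suc y)) n)

-- Exhaustive checks of neighbourhoods with five or six vertices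

every-bits : ∀ n → (Vec Bool n → Bool) → Bool
every-bits zero    f = f []
every-bits (suc n) f = every-bits n (f ∘ (true ∷_)) ∧ every-bits n (f ∘ (false ∷_))

every-bits-elim : ∀ {n} (f : Vec Bool n → Bool) → every-bits n f ≡ true → ∀ v → f v ≡ true
every-bits-elim f h []          = h
every-bits-elim f h (true ∷ v)  = every-bits-elim (f ∘ (true ∷_)) (proj₁ (∧-split h)) v
every-bits-elim {suc n} f h (false ∷ v) =
  every-bits-elim (f ∘ (false ∷_)) (proj₂ (∧-split {every-bits n (f ∘ (true ∷_))} h)) v

Symmetric Irreflexive : ∀ {n} → Pattern n → Set
Symmetric M   = ∀ i j → M i j ≡ M j i
Irreflexive M = ∀ i → M i i ≡ false

-- A symmetric irreflexive n × n pattern as a vector of b bits.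
record Encoding (n b : ℕ) : Set where
  field
    slot : Vec (Vec (Fin b) n) n
    row  : Vec (Fin n) b
    col  : Vec (Fin n) b

  decode : Vec Bool b → Pattern n
  decode v i j = not (i == j) ∧ lookup v (lookup (lookup slot i) j)

  encode : Pattern n → Vec Bool b
  encode M = tabulate (λ k → M (lookup row k) (lookup col k))

  normal : Pattern n → Pattern n
  normal M = decode (encode M)

  SlotTest : Fin n → Fin n → Bool
  SlotTest i j = i == j ∨ lookup row k == i ∧ lookup col k == j ∨ lookup row k == j ∧ lookup col k == i
    where k = lookup (lookup slot i) j

  -- A check of all bit vectors therefore reaches every symmetric irreflexive pattern, up to
  -- pointwise equality.
  normal-≡ : (every n λ i → every n (SlotTest i)) ≡ true →
             ∀ M → Symmetric M → Irreflexive M → ∀ i j → normal M i j ≡ M i j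
  normal-≡ ok M M-sym M-irr i j with i == j in e
  ... | true  = sym (trans (cong (M i) (sym (==-sound i j e))) (M-irr i))
  ... | false = trans (lookup∘tabulate (λ k → M (lookup row k) (lookup col k)) k) (place (∨-split {i == j} slot-ok))
    where
    k = lookup (lookup slot i) j
    slot-ok : SlotTest i j ≡ true
    slot-ok = every-elim (SlotTest i) (every-elim (λ i → every n (SlotTest i)) ok i) j
    at : ∀ {a b c d : Fin n} → a == c ∧ b == d ≡ true → M a b ≡ M c d
    at {a} {b} {c} {d} h = let p , q = ∧-split {a == c} h in cong₂ M (==-sound a c p) (==-sound b d q)
    place : i == j ≡ true ⊎ (lookup row k == i ∧ lookup col k == j ∨ lookup row k == j ∧ lookup col k == i) ≡ true →
            M (lookup row k) (lookup col k) ≡ M i j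
    place (inj₁ d) = ⊥-elim (false≢true e d)
    place (inj₂ h) with ∨-split {lookup row k == i ∧ lookup col k == j} h
    ... | inj₁ d = at d
    ... | inj₂ d = trans (at d) (M-sym j i)

encoding₅ : Encoding 5 10
encoding₅ = record
  { slot =
    ((# 0 ∷ # 0 ∷ # 1 ∷ # 2 ∷ # 3 ∷ []) ∷
     (# 0 ∷ # 0 ∷ # 4 ∷ # 5 ∷ # 6 ∷ []) ∷
     (# 1 ∷ # 4 ∷ # 0 ∷ # 7 ∷ # 8 ∷ []) ∷
     (# 2 ∷ # 5 ∷ # 7 ∷ # 0 ∷ # 9 ∷ []) ∷
     (# 3 ∷ # 6 ∷ # 8 ∷ # 9 ∷ # 0 ∷ []) ∷ [])
  ; row = (# 0 ∷ # 0 ∷ # 0 ∷ # 0 ∷ # 1 ∷ # 1 ∷ # 1 ∷ # 2 ∷ # 2 ∷ # 3 ∷ [])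
  ; col = (# 1 ∷ # 2 ∷ # 3 ∷ # 4 ∷ # 2 ∷ # 3 ∷ # 4 ∷ # 3 ∷ # 4 ∷ # 4 ∷ []) }

encoding₆ : Encoding 6 15
encoding₆ = record
  { slot =
    ((# 0 ∷ # 0 ∷ # 1 ∷ # 2 ∷ # 3 ∷ # 4 ∷ []) ∷
     (# 0 ∷ # 0 ∷ # 5 ∷ # 6 ∷ # 7 ∷ # 8 ∷ []) ∷
     (# 1 ∷ # 5 ∷ # 0 ∷ # 9 ∷ # 10 ∷ # 11 ∷ []) ∷
     (# 2 ∷ # 6 ∷ # 9 ∷ # 0 ∷ # 12 ∷ # 13 ∷ []) ∷
     (# 3 ∷ # 7 ∷ # 10 ∷ # 12 ∷ # 0 ∷ # 14 ∷ []) ∷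
     (# 4 ∷ # 8 ∷ # 11 ∷ # 13 ∷ # 14 ∷ # 0 ∷ []) ∷ [])
  ; row = (# 0 ∷ # 0 ∷ # 0 ∷ # 0 ∷ # 0 ∷ # 1 ∷ # 1 ∷ # 1 ∷ # 1 ∷ # 2 ∷ # 2 ∷ # 2 ∷ # 3 ∷ # 3 ∷ # 4 ∷ [])
  ; col = (# 1 ∷ # 2 ∷ # 3 ∷ # 4 ∷ # 5 ∷ # 2 ∷ # 3 ∷ # 4 ∷ # 5 ∷ # 3 ∷ # 4 ∷ # 5 ∷ # 4 ∷ # 5 ∷ # 5 ∷ []) }

apex : ∀ {n} → Pattern n → Pattern (suc n)
apex κ zero    zero    = false
apex κ zero    (suc _) = true
apex κ (suc _) zero    = true
apex κ (suc i) (suc j) = κ i j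

plus : ∀ {n} → Pattern (suc (suc n)) → Pattern (suc (suc n))
plus κ zero       (suc zero) = true
plus κ (suc zero) zero       = true
plus κ i          j          = κ i j

degree : ∀ {n} → Pattern n → Fin n → ℕ
degree M i = card (M i)

degrees≥3 : ∀ {n} → Pattern n → Bool
degrees≥3 {n} M = every n λ i → 3 ≤ᵇ degree M i

-- Together with minimum degree three and the missing edge 0 1 this describes the join of two
-- isolated vertices, 0 and 1, with two disjoint edges on 2, 3, 4, 5.
special-test : Pattern 6 → Bool
special-test M = every 6 λ j → j == # 0 ∨ j == # 1 ∨ (M (# 0) j ∧ M (# 1) j ∧ (degree M j ≤ᵇ 3))

open Encoding encoding₅ using () renaming (decode to decode₅)
open Encoding encoding₆ using () renaming (decode to decode₆)

-- In `encoding₆` the five leading bits fill row 0 and the next four complete row 1, so the degrees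
-- of the vertices 0 and 1 are known before the remaining bits are chosen; the padding lies outside
-- these rows.
first-row : Vec Bool 5 → Bool
first-row a = 3 ≤ᵇ degree (decode₆ (a ++ replicate 10 false)) (# 0)

second-row : Vec Bool 5 → Vec Bool 4 → Bool
second-row a b = 3 ≤ᵇ degree (decode₆ (a ++ b ++ replicate 6 false)) (# 1)

module _ (f : Vec Bool 15 → Bool) where

  third : Vec Bool 5 → Vec Bool 4 → Bool
  third a b = every-bits 6 λ c → f (a ++ b ++ c)

  second : Vec Bool 5 → Bool
  second a = every-bits 4 λ b → second-row a b ⇒ᵇ third a b

  -- The rows of the first two vertices are enumerated first, to prune on their degrees.
  rowwise : Bool
  rowwise = every-bits 5 λ a → first-row a ⇒ᵇ second a

  rowwise-elim : rowwise ≡ true → ∀ v → (3 ≤ᵇ degree (decode₆ v) (# 0)) ≡ true →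
                 (3 ≤ᵇ degree (decode₆ v) (# 1)) ≡ true → f v ≡ true
  rowwise-elim h (a₀ ∷ a₁ ∷ a₂ ∷ a₃ ∷ a₄ ∷ b₀ ∷ b₁ ∷ b₂ ∷ b₃ ∷ c) d₀ d₁ =
    every-bits-elim (λ c → f (a ++ b ++ c))
      (⇒ᵇ-elim {second-row a b} {third a b}
        (every-bits-elim (λ b → second-row a b ⇒ᵇ third a b)
          (⇒ᵇ-elim {first-row a} {second a} (every-bits-elim (λ a → first-row a ⇒ᵇ second a) h a) d₀) b) d₁) c
    where
    a b : Vec Bool _
    a = a₀ ∷ a₁ ∷ a₂ ∷ a₃ ∷ a₄ ∷ []
    b = b₀ ∷ b₁ ∷ b₂ ∷ b₃ ∷ []

-- With minimum degree three on five vertices the missing edges form a matching, so at most one edge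
-- is missing besides 0 1.
pair-test₅ : Pattern 5 → Bool
pair-test₅ M = not (M (# 0) (# 1)) ⇒ᵇ degrees≥3 M ⇒ᵇ near-test (apex (plus M))

-- The bound 18 is what density leaves for the neighbourhood of a vertex adjacent to all others in a
-- graph of order six: 7 · 6 - 14 - 2 · 5.
full-test₅ : Pattern 5 → Bool
full-test₅ M = degrees≥3 M ⇒ᵇ (18 ≤ᵇ total (degree M)) ⇒ᵇ near-test (apex M)

-- Six neighbours and their apex are seven vertices, so one edge may be contracted. All
-- neighbourhoods on which this fails are special.
pair-test₆ : Pattern 6 → Bool
pair-test₆ M = not (M (# 0) (# 1)) ⇒ᵇ degrees≥3 M ⇒ᵇ contract-test (apex (plus M)) ∨ special-test M

-- The bound is 7 · 7 - 14 - 2 · 6, the analogue for order seven.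
full-test₆ : Pattern 6 → Bool
full-test₆ M = degrees≥3 M ⇒ᵇ (23 ≤ᵇ total (degree M)) ⇒ᵇ contract-test (apex M)

module _ {n : ℕ} where

  apex-sym : (κ : Pattern n) → (∀ {i j} → κ i j ≡ true → κ j i ≡ true) →
             ∀ {i j} → apex κ i j ≡ true → apex κ j i ≡ true
  apex-sym κ h {zero}  {suc _} e = refl
  apex-sym κ h {suc _} {zero}  e = refl
  apex-sym κ h {suc _} {suc _} e = h e

  apex-mono : (κ κ′ : Pattern n) → (∀ {i j} → κ i j ≡ true → κ′ i j ≡ true) →
              ∀ {i j} → apex κ i j ≡ true → apex κ′ i j ≡ true
  apex-mono κ κ′ h {zero}  {suc _} e = refl
  apex-mono κ κ′ h {suc _} {zero}  e = refl
  apex-mono κ κ′ h {suc _} {suc _} e = h e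

plus-elim : ∀ {n} (κ : Pattern (suc (suc n))) i j → plus κ i j ≡ true →
            κ i j ≡ true ⊎ (i ≡ zero × j ≡ suc zero) ⊎ (i ≡ suc zero × j ≡ zero)
plus-elim κ zero          (suc zero)    e = inj₂ (inj₁ (refl , refl))
plus-elim κ (suc zero)    zero          e = inj₂ (inj₂ (refl , refl))
plus-elim κ zero          zero          e = inj₁ e
plus-elim κ zero          (suc (suc j)) e = inj₁ e
plus-elim κ (suc zero)    (suc j)       e = inj₁ e
plus-elim κ (suc (suc i)) j             e = inj₁ e

plus-sym : ∀ {n} (κ : Pattern (suc (suc n))) → (∀ {i j} → κ i j ≡ true → κ j i ≡ true) →
           ∀ {i j} → plus κ i j ≡ true → plus κ j i ≡ true
plus-sym κ h {i} {j} e with plus-elim κ i j e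
... | inj₂ (inj₁ (refl , refl)) = refl
... | inj₂ (inj₂ (refl , refl)) = refl
... | inj₁ d = add {j} {i} (h d)
  where
  add : ∀ {i j} → κ i j ≡ true → plus κ i j ≡ true
  add {zero}  {zero}        d = d
  add {zero}  {suc zero}    d = refl
  add {zero}  {suc (suc j)} d = d
  add {suc zero} {zero}     d = refl
  add {suc zero} {suc j}    d = d
  add {suc (suc i)} {j}     d = d

plus-mono : ∀ {n} (κ κ′ : Pattern (suc (suc n))) → (∀ {i j} → κ i j ≡ true → κ′ i j ≡ true) →
            ∀ {i j} → plus κ i j ≡ true → plus κ′ i j ≡ true
plus-mono κ κ′ h {zero}  {zero}        d = h d
plus-mono κ κ′ h {zero}  {suc zero}    d = refl
plus-mono κ κ′ h {zero}  {suc (suc j)} d = h d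
plus-mono κ κ′ h {suc zero} {zero}     d = refl
plus-mono κ κ′ h {suc zero} {suc j}    d = h d
plus-mono κ κ′ h {suc (suc i)} {j}     d = h d

≤ᵇ-true : ∀ {m n} → m ≤ n → (m ≤ᵇ n) ≡ true
≤ᵇ-true h = Equivalence.to T-≡ (≤⇒≤ᵇ h)

≤ᵇ-elim : ∀ {m n} → (m ≤ᵇ n) ≡ true → m ≤ n
≤ᵇ-elim h = ≤ᵇ⇒≤ _ _ (Equivalence.from T-≡ h)

module Normal {n b} (enc : Encoding n b)
              (ok : (every n λ i → every n (Encoding.SlotTest enc i)) ≡ true)
              (M : Pattern n) (M-sym : Symmetric M) (M-irr : Irreflexive M) where

  M′ : Pattern n
  M′ = Encoding.normal enc M

  same : ∀ i j → M′ i j ≡ M i j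
  same = Encoding.normal-≡ enc ok M M-sym M-irr

  M′-to : ∀ {i j} → M′ i j ≡ true → M i j ≡ true
  M′-to {i} {j} e = trans (sym (same i j)) e

  M′-sym : ∀ {i j} → M′ i j ≡ true → M′ j i ≡ true
  M′-sym {i} {j} e = trans (same j i) (trans (M-sym j i) (M′-to e))

  degree-same : ∀ i → degree M′ i ≡ degree M i
  degree-same i = total-cong (λ j → cong b2n (same i j))

  total-same : total (degree M′) ≡ total (degree M)
  total-same = total-cong degree-same

  degrees : (∀ i → 3 ≤ degree M i) → degrees≥3 M′ ≡ true
  degrees h = every-intro _ λ i → ≤ᵇ-true (subst (3 ≤_) (sym (degree-same i)) (h i))

not-false : ∀ {b} → b ≡ false → not b ≡ true
not-false refl = refl

pair-holds₅ : ∀ v → pair-test₅ (decode₅ v) ≡ true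
pair-holds₅ = every-bits-elim (λ v → pair-test₅ (decode₅ v)) refl

full-holds₅ : ∀ v → full-test₅ (decode₅ v) ≡ true
full-holds₅ = every-bits-elim (λ v → full-test₅ (decode₅ v)) refl

pair-holds₆ : ∀ v → (3 ≤ᵇ degree (decode₆ v) (# 0)) ≡ true → (3 ≤ᵇ degree (decode₆ v) (# 1)) ≡ true →
              pair-test₆ (decode₆ v) ≡ true
pair-holds₆ = rowwise-elim (λ v → pair-test₆ (decode₆ v)) refl

full-holds₆ : ∀ v → (3 ≤ᵇ degree (decode₆ v) (# 0)) ≡ true → (3 ≤ᵇ degree (decode₆ v) (# 1)) ≡ true →
              full-test₆ (decode₆ v) ≡ true
full-holds₆ = rowwise-elim (λ v → full-test₆ (decode₆ v)) refl

pair-elim₆ : ∀ M → pair-test₆ M ≡ true → not (M (# 0) (# 1)) ≡ true → degrees≥3 M ≡ true →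
             contract-test (apex (plus M)) ∨ special-test M ≡ true
pair-elim₆ M t a b = ⇒ᵇ-elim (⇒ᵇ-elim t a) b

full-elim₆ : ∀ M → full-test₆ M ≡ true → degrees≥3 M ≡ true → (23 ≤ᵇ total (degree M)) ≡ true →
             contract-test (apex M) ≡ true
full-elim₆ M t a b = ⇒ᵇ-elim (⇒ᵇ-elim t a) b

module _ (M : Pattern 5) (M-sym : Symmetric M) (M-irr : Irreflexive M) (deg : ∀ i → 3 ≤ degree M i) where
  open Normal encoding₅ refl M M-sym M-irr

  five-pair : M (# 0) (# 1) ≡ false → HasMinor ⟦ apex (plus M) ⟧
  five-pair e = minor-mono (λ {i} {j} → apex-mono (plus M′) (plus M) (λ {i} {j} → plus-mono M′ M (λ {i} {j} → M′-to {i} {j}) {i} {j}) {i} {j}) (near-test-sound (apex (plus M′))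
    (⇒ᵇ-elim (⇒ᵇ-elim (pair-holds₅ (Encoding.encode encoding₅ M))
      (not-false (trans (same (# 0) (# 1)) e))) (degrees deg)))

  five-full : 18 ≤ total (degree M) → HasMinor ⟦ apex M ⟧
  five-full h = minor-mono (λ {i} {j} → apex-mono M′ M (λ {i} {j} → M′-to {i} {j}) {i} {j}) (near-test-sound (apex M′)
    (⇒ᵇ-elim (⇒ᵇ-elim (full-holds₅ (Encoding.encode encoding₅ M))
      (degrees deg)) (≤ᵇ-true (subst (18 ≤_) (sym total-same) h))))

SpecialPair : Pattern 6 → Set
SpecialPair M = ∀ j → j ≢ # 0 → j ≢ # 1 → M (# 0) j ≡ true × M (# 1) j ≡ true × degree M j ≤ 3

module _ (M : Pattern 6) (M-sym : Symmetric M) (M-irr : Irreflexive M) (deg : ∀ i → 3 ≤ degree M i) where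
  open Normal encoding₆ refl M M-sym M-irr

  private
    row : ∀ i → (3 ≤ᵇ degree M′ i) ≡ true
    row i = ≤ᵇ-true (subst (3 ≤_) (sym (degree-same i)) (deg i))

  six-pair : M (# 0) (# 1) ≡ false → HasMinor ⟦ apex (plus M) ⟧ ⊎ SpecialPair M
  six-pair e = [ (λ t → inj₁ (minor-mono (λ {i} {j} → convert {i} {j}) (contract-test-sound κ (λ {i} {j} → κ-sym {i} {j}) t))) , (λ t → inj₂ (special t)) ]′
                 (∨-split {contract-test κ} {special-test M′} tested)
    where
    κ = apex (plus M′)
    κ-sym : ∀ {i j} → κ i j ≡ true → κ j i ≡ true
    κ-sym {i} {j} = apex-sym (plus M′) (λ {i} {j} → plus-sym M′ (λ {i} {j} → M′-sym {i} {j}) {i} {j}) {i} {j}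
    convert : ∀ {i j} → κ i j ≡ true → apex (plus M) i j ≡ true
    convert {i} {j} = apex-mono (plus M′) (plus M) (λ {i} {j} → plus-mono M′ M (λ {i} {j} → M′-to {i} {j}) {i} {j}) {i} {j}
    tested : contract-test κ ∨ special-test M′ ≡ true
    tested = pair-elim₆ M′ (pair-holds₆ (Encoding.encode encoding₆ M) (row (# 0)) (row (# 1)))
      (not-false (trans (same (# 0) (# 1)) e)) (degrees deg)
    special : special-test M′ ≡ true → SpecialPair M
    special t j j≢0 j≢1 with ∨-split {j == # 0} (every-elim (λ j → j == # 0 ∨ j == # 1 ∨ (M′ (# 0) j ∧ M′ (# 1) j ∧ (degree M′ j ≤ᵇ 3))) t j)
    ... | inj₁ d = ⊥-elim (j≢0 (==-sound j (# 0) d))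
    ... | inj₂ d with ∨-split {j == # 1} d
    ...   | inj₁ f = ⊥-elim (j≢1 (==-sound j (# 1) f))
    ...   | inj₂ f = let p , q = ∧-split {M′ (# 0) j} f ; q , r = ∧-split {M′ (# 1) j} q
                     in M′-to {# 0} {j} p , M′-to {# 1} {j} q , subst (_≤ 3) (degree-same j) (≤ᵇ-elim r)

  six-full : 23 ≤ total (degree M) → HasMinor ⟦ apex M ⟧
  six-full h = minor-mono (λ {i} {j} → convert {i} {j}) (contract-test-sound κ (λ {i} {j} → κ-sym {i} {j}) tested)
    where
    κ = apex M′
    κ-sym : ∀ {i j} → κ i j ≡ true → κ j i ≡ true
    κ-sym {i} {j} = apex-sym M′ (λ {i} {j} → M′-sym {i} {j}) {i} {j}
    convert : ∀ {i j} → κ i j ≡ true → apex M i j ≡ true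
    convert {i} {j} = apex-mono M′ M (λ {i} {j} → M′-to {i} {j}) {i} {j}
    tested : contract-test κ ≡ true
    tested = full-elim₆ M′ (full-holds₆ (Encoding.encode encoding₆ M) (row (# 0)) (row (# 1)))
      (degrees deg) (≤ᵇ-true (subst (23 ≤_) (sym total-same) h))

-- Deletion and contraction

-- A graph on the vertices of Fin N selected by live.
record LiveGraph (N : ℕ) : Set where
  field
    E      : Fin N → Fin N → Bool
    live   : Fin N → Bool
    E-sym  : ∀ a b → E a b ≡ E b a
    E-irr  : ∀ a → E a a ≡ false
    E-live : ∀ {a b} → E a b ≡ true → live a ≡ true

  flip : ∀ {a b} → E a b ≡ true → E b a ≡ true
  flip {a} {b} e = trans (E-sym b a) e

  apart : ∀ {a b} → E a b ≡ true → a ≢ b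
  apart {a} e refl with trans (sym e) (E-irr a)
  ... | ()

  Edges : Fin N → Fin N → Set
  Edges a b = E a b ≡ true

  order : ℕ
  order = card live

  deg : Fin N → ℕ
  deg a = card (E a)

  degree-sum : ℕ
  degree-sum = total deg

  common : Fin N → Fin N → ℕ
  common u v = card (λ z → E u z ∧ E v z)
open LiveGraph public

K₆⁻-Minor : ∀ {N} → LiveGraph N → Set
K₆⁻-Minor g = ∃ λ β → Model (Edges g) K₆⁻ β

==-comm : ∀ {n} (a b : Fin n) → (a == b) ≡ (b == a)
==-comm a b with a == b in p | b == a in q
... | true  | true  = refl
... | false | false = refl
... | true  | false = trans (sym (==-refl b)) (trans (cong (b ==_) (sym (==-sound a b p))) q)
... | false | true  = trans (sym p) (trans (cong (_== b) (sym (==-sound b a q))) (==-refl b))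

≢⇒==false : ∀ {n} {a b : Fin n} → a ≢ b → (a == b) ≡ false
≢⇒==false {a = a} {b} d with a == b in e
... | true  = ⊥-elim (d (==-sound a b e))
... | false = refl

≡⇒== : ∀ {n} {a b : Fin n} → a ≡ b → (a == b) ≡ true
≡⇒== {a = a} refl = ==-refl a

without-same : ∀ {n} (u : Fin n) f → without u f u ≡ 0
without-same u f rewrite ==-refl u = refl

without-other : ∀ {n} {u a : Fin n} f → a ≢ u → without u f a ≡ f a
without-other f d rewrite ≢⇒==false d = refl

card-single : ∀ {n} (u : Fin n) → card (_== u) ≡ 1
card-single {n} u = trans (total-pick u (λ a → b2n (a == u)))
  (cong₂ _+_ (cong b2n (==-refl u)) (trans (total-cong zero-out) (total-0 {n})))
  where
  zero-out : ∀ a → without u (λ a → b2n (a == u)) a ≡ 0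
  zero-out a with a == u
  ... | true  = refl
  ... | false = refl

total-strict : ∀ {n} {f g : Fin n → ℕ} u → (∀ a → f a ≤ g a) → f u < g u → total f < total g
total-strict {f = f} {g} u h lt = begin-strict
  total f                        ≡⟨ total-pick u f ⟩
  f u + total (without u f)      <⟨ +-mono-<-≤ lt (total-mono le) ⟩
  g u + total (without u g)      ≡⟨ sym (total-pick u g) ⟩
  total g                        ∎
  where
  open ≤-Reasoning
  le : ∀ a → without u f a ≤ without u g a
  le a with a == u
  ... | true  = z≤n
  ... | false = h a

-- Made for the ends `u` and `v` of a contracted edge: the entries at `v` are emptied into those at
-- `u`, so a comparison is possible only for their sum, with the slack `m`.
total-except-two : ∀ {n} {f g : Fin n → ℕ} {u v m} → u ≢ v →
                   (∀ a → a ≢ u → a ≢ v → f a ≤ g a) → f u + f v ≤ g u + g v + m → total f ≤ total g + m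
total-except-two {f = f} {g} {u} {v} {m} u≢v h two = begin
  total f                                ≡⟨ split f ⟩
  f u + f v + total (rest f)             ≤⟨ +-mono-≤ two (total-mono le) ⟩
  g u + g v + m + total (rest g)         ≡⟨ +-assoc (g u + g v) m _ ⟩
  g u + g v + (m + total (rest g))       ≡⟨ cong (g u + g v +_) (+-comm m _) ⟩
  g u + g v + (total (rest g) + m)       ≡⟨ sym (+-assoc (g u + g v) _ m) ⟩
  g u + g v + total (rest g) + m         ≡⟨ cong (_+ m) (sym (split g)) ⟩
  total g + m                            ∎
  where
  open ≤-Reasoning
  rest : (Fin _ → ℕ) → Fin _ → ℕ
  rest f = without v (without u f)
  split : ∀ f → total f ≡ f u + f v + total (rest f)
  split f = trans (total-pick u f) (trans (cong (f u +_) (trans (total-pick v (without u f))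
              (cong (_+ total (rest f)) (without-other f (λ e → u≢v (sym e)))))) (sym (+-assoc (f u) (f v) _)))
  le : ∀ a → rest f a ≤ rest g a
  le a with a ≟ v | a ≟ u
  ... | yes refl | _ rewrite ==-refl a = z≤n
  ... | no a≢v | yes refl rewrite ≢⇒==false a≢v | ==-refl a = z≤n
  ... | no a≢v | no a≢u rewrite ≢⇒==false a≢v | ≢⇒==false a≢u = h a a≢u a≢v

b2n-union : ∀ x y z → (x ≡ true → z ≡ true) → (y ≡ true → z ≡ true) → b2n x + b2n y ≤ b2n z + b2n (x ∧ y)
b2n-union false false z p q = z≤n
b2n-union false true  z p q rewrite q refl = ≤-refl
b2n-union true  false z p q rewrite p refl = ≤-refl
b2n-union true  true  z p q rewrite p refl = ≤-refl

module _ {N} (g : LiveGraph N) where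

  restrict : (Fin N → Bool) → LiveGraph N
  restrict Q = record
    { E = λ a b → (Q a ∧ Q b) ∧ E g a b
    ; live = λ a → live g a ∧ Q a
    ; E-sym = λ a b → cong₂ _∧_ (∧-comm (Q a) (Q b)) (E-sym g a b)
    ; E-irr = λ a → trans (cong ((Q a ∧ Q a) ∧_) (E-irr g a)) (∧-zeroʳ (Q a ∧ Q a))
    ; E-live = λ {a} {b} e → let p , q = ∧-split {Q a ∧ Q b} e in cong₂ _∧_ (E-live g q) (proj₁ (∧-split {Q a} p))
    }

  restrict-minor : ∀ Q → K₆⁻-Minor (restrict Q) → K₆⁻-Minor g
  restrict-minor Q (β , M) = β , model-mono (λ {a} {b} e → proj₂ (∧-split {Q a ∧ Q b} e)) M

  delete : Fin N → LiveGraph N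
  delete v = restrict (λ a → not (a == v))

  delete-order : ∀ {v} → live g v ≡ true → order g ≡ suc (order (delete v))
  delete-order {v} l = card-remove (live g) l

  delete-degrees : ∀ v → degree-sum g ≤ degree-sum (delete v) + 2 * deg g v
  delete-degrees v = begin
    degree-sum g                                             ≡⟨ total-pick v (deg g) ⟩
    deg g v + total (without v (deg g))                      ≤⟨ +-monoʳ-≤ (deg g v) (total-mono row) ⟩
    deg g v + total (λ a → b2n (E g a v) + deg (delete v) a) ≡⟨ cong (deg g v +_) (total-+ (λ a → b2n (E g a v)) (deg (delete v))) ⟩
    deg g v + (card (λ a → E g a v) + degree-sum (delete v)) ≡⟨ cong (λ x → deg g v + (x + degree-sum (delete v))) (total-cong (λ a → cong b2n (E-sym g a v))) ⟩
    deg g v + (deg g v + degree-sum (delete v))              ≡⟨ sym (+-assoc (deg g v) _ _) ⟩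
    deg g v + deg g v + degree-sum (delete v)                ≡⟨ +-comm (deg g v + deg g v) _ ⟩
    degree-sum (delete v) + (deg g v + deg g v)              ≡⟨ cong (λ x → degree-sum (delete v) + (deg g v + x)) (sym (+-identityʳ (deg g v))) ⟩
    degree-sum (delete v) + 2 * deg g v                      ∎
    where
    open ≤-Reasoning
    row : ∀ a → without v (deg g) a ≤ b2n (E g a v) + deg (delete v) a
    row a with a == v
    ... | true  = z≤n
    ... | false = ≤-trans (≤-reflexive (total-pick v (b2n ∘ E g a))) (+-monoʳ-≤ (b2n (E g a v)) (total-mono entry))
      where
      entry : ∀ b → without v (b2n ∘ E g a) b ≤ b2n ((true ∧ not (b == v)) ∧ E g a b)
      entry b with b == v
      ... | true  = z≤n
      ... | false = ≤-refl

  module EdgeDeletion {u v : Fin N} (uv : E g u v ≡ true) where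

    hit : Fin N → Fin N → Bool
    hit a b = a == u ∧ b == v ∨ a == v ∧ b == u

    delete-edge : LiveGraph N
    delete-edge = record
      { E = λ a b → E g a b ∧ not (hit a b)
      ; live = live g
      ; E-sym = λ a b → cong₂ (λ x y → x ∧ not y) (E-sym g a b)
          (trans (∨-comm (a == u ∧ b == v) (a == v ∧ b == u))
                 (cong₂ _∨_ (∧-comm (a == v) (b == u)) (∧-comm (a == u) (b == v))))
      ; E-irr = λ a → cong (_∧ not (hit a a)) (E-irr g a)
      ; E-live = λ {a} {b} e → E-live g (proj₁ (∧-split {E g a b} e))
      }

    delete-edge-minor : K₆⁻-Minor delete-edge → K₆⁻-Minor g
    delete-edge-minor (β , M) = β , model-mono (λ {a} {b} e → proj₁ (∧-split {E g a b} e)) M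

    delete-edge-degrees : degree-sum g ≤ degree-sum delete-edge + 2
    delete-edge-degrees = begin
      degree-sum g                                                         ≤⟨ total-mono row ⟩
      total (λ a → deg delete-edge a + (b2n (a == u) + b2n (a == v)))      ≡⟨ total-+ (deg delete-edge) _ ⟩
      degree-sum delete-edge + total (λ a → b2n (a == u) + b2n (a == v))   ≡⟨ cong (degree-sum delete-edge +_) (trans (total-+ (λ a → b2n (a == u)) _) (cong₂ _+_ (card-single u) (card-single v))) ⟩
      degree-sum delete-edge + 2                                           ∎
      where
      open ≤-Reasoning
      drop-one : ∀ w (f h : Fin N → Bool) → (∀ b → b ≢ w → f b ≡ true → h b ≡ true) → card f ≤ card h + 1
      drop-one w f h k = ≤-trans (≤-reflexive (total-pick w (b2n ∘ f)))
        (≤-trans (+-mono-≤ (b2n≤1 (f w)) (total-mono entry)) (≤-reflexive (+-comm 1 (card h))))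
        where
        entry : ∀ b → without w (b2n ∘ f) b ≤ b2n (h b)
        entry b with b == w in e
        ... | true  = z≤n
        ... | false = b2n-mono (k b λ { refl → false≢true e (==-refl b) })
      row : ∀ a → deg g a ≤ deg delete-edge a + (b2n (a == u) + b2n (a == v))
      row a with a ≟ u | a ≟ v
      ... | yes refl | _ = ≤-trans (drop-one v (E g a) (E delete-edge a) λ b d e →
              cong₂ _∧_ e (cong not (cong₂ _∨_ (trans (cong (a == u ∧_) (≢⇒==false d)) (∧-zeroʳ (a == u)))
                (cong (_∧ b == u) (≢⇒==false (apart g uv))))))
              (+-monoʳ-≤ (deg delete-edge a) (≤-trans (≤-reflexive (cong b2n (sym (==-refl a)))) (m≤m+n _ _)))
      ... | no a≢u | yes refl = ≤-trans (drop-one u (E g a) (E delete-edge a) λ b d e →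
              cong₂ _∧_ e (cong not (cong₂ _∨_ (cong (_∧ b == v) (≢⇒==false a≢u))
                (trans (cong (a == v ∧_) (≢⇒==false d)) (∧-zeroʳ (a == v))))))
              (+-monoʳ-≤ (deg delete-edge a) (≤-trans (≤-reflexive (cong b2n (sym (==-refl a)))) (m≤n+m _ _)))
      ... | no a≢u | no a≢v = ≤-trans (card-mono {f = E g a} {E delete-edge a} λ b e →
              cong₂ _∧_ e (cong not (cong₂ _∨_ (cong (_∧ b == v) (≢⇒==false a≢u)) (cong (_∧ b == u) (≢⇒==false a≢v)))))
              (m≤m+n _ _)

    delete-edge-fewer : degree-sum delete-edge < degree-sum g
    delete-edge-fewer = total-strict u
      (λ a → card-mono {f = E delete-edge a} {E g a} λ b e → proj₁ (∧-split {E g a b} e))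
      (card-strict {f = E delete-edge u} {E g u} {v} (λ b e → proj₁ (∧-split {E g u b} e))
        (trans (cong (λ x → E g u v ∧ not x) (cong (_∨ (u == v ∧ v == u)) (cong₂ _∧_ (==-refl u) (==-refl v)))) (∧-zeroʳ (E g u v))) uv)

  module EdgeContraction {u v : Fin N} (uv : E g u v ≡ true) where

    u≢v : u ≢ v
    u≢v = apart g uv

    E′ : Fin N → Fin N → Bool
    E′ a b = (not (a == v) ∧ not (b == v)) ∧ (not (a == b) ∧ (E g a b ∨ (a == u ∧ E g v b ∨ b == u ∧ E g v a)))

    contract-edge : LiveGraph N
    contract-edge = record
      { E = E′
      ; live = live g ∖ v
      ; E-sym = λ a b → cong₂ _∧_ (∧-comm (not (a == v)) (not (b == v)))
          (cong₂ _∧_ (cong not (==-comm a b)) (cong₂ _∨_ (E-sym g a b) (∨-comm (a == u ∧ E g v b) _)))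
      ; E-irr = λ a → trans (cong (λ x → (not (a == v) ∧ not (a == v)) ∧ (not x ∧ (E g a a ∨ (a == u ∧ E g v a ∨ a == u ∧ E g v a)))) (==-refl a)) (∧-zeroʳ _)
      ; E-live = λ {a} {b} e → live-end a b e
      }
      where
      live-end : ∀ a b → E′ a b ≡ true → (live g ∖ v) a ≡ true
      live-end a b e =
        let p , q = ∧-split {not (a == v) ∧ not (b == v)} e
            r = proj₂ (∧-split {not (a == b)} q)
        in cong₂ _∧_ (from (∨-split {E g a b} r)) (proj₁ (∧-split {not (a == v)} p))
        where
        from : E g a b ≡ true ⊎ (a == u ∧ E g v b ∨ b == u ∧ E g v a) ≡ true → live g a ≡ true
        from (inj₁ d) = E-live g d
        from (inj₂ d) with ∨-split {a == u ∧ E g v b} d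
        ... | inj₁ f = trans (cong (live g) (==-sound a u (proj₁ (∧-split {a == u} f)))) (E-live g uv)
        ... | inj₂ f = E-live g (flip g (proj₂ (∧-split {b == u} f)))

    contract-order : order g ≡ suc (order contract-edge)
    contract-order = card-remove (live g) (E-live g (flip g uv))

    E′-elim : ∀ {a b} → E′ a b ≡ true → a ≢ v × b ≢ v × (E g a b ≡ true ⊎ (a ≡ u × E g v b ≡ true) ⊎ (b ≡ u × E g v a ≡ true))
    E′-elim {a} {b} e =
      let p , q = ∧-split {not (a == v) ∧ not (b == v)} e
          p₁ , p₂ = ∧-split {not (a == v)} p
          r = proj₂ (∧-split {not (a == b)} q)
      in ≠-sound a v p₁ , ≠-sound b v p₂ , from (∨-split {E g a b} r)
      where
      from : E g a b ≡ true ⊎ (a == u ∧ E g v b ∨ b == u ∧ E g v a) ≡ true → _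
      from (inj₁ d) = inj₁ d
      from (inj₂ d) with ∨-split {a == u ∧ E g v b} d
      ... | inj₁ f = let x , y = ∧-split {a == u} f in inj₂ (inj₁ (==-sound a u x , y))
      ... | inj₂ f = let x , y = ∧-split {b == u} f in inj₂ (inj₂ (==-sound b u x , y))

    E′-keep : ∀ {a b} → a ≢ v → b ≢ v → E g a b ≡ true → E′ a b ≡ true
    E′-keep a≢v b≢v e rewrite ≢⇒==false a≢v | ≢⇒==false b≢v | ≢⇒==false (apart g e) | e = refl

    E′-new : ∀ {b} → b ≢ u → E g v b ≡ true → E′ u b ≡ true
    E′-new {b} b≢u e rewrite ≢⇒==false u≢v | ≢⇒==false (λ d → apart g e (sym d)) | ≢⇒==false (λ d → b≢u (sym d)) | ==-refl u | e with E g u b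
    ... | true  = refl
    ... | false = refl

    -- `v` is isolated in the contracted graph, whereas every labelled vertex has an edge because
    -- `K₆⁻` has no isolated vertex. So `v` is unlabelled there and may join the bag of `u`.
    contract-minor : K₆⁻-Minor contract-edge → K₆⁻-Minor g
    contract-minor (β , M) = put v (β u) β , transfer (flip g) (λ z → z) lab inner cover outer M
      where
      β′ = put v (β u) β
      v-lab : β′ v ≡ β u
      v-lab = put-same v (β u) β
      has-edge : ∀ {a i} → β a ≡ just i → ∃ λ z → E′ a z ≡ true
      has-edge {i = i} ai with degree≥3 k₆⁻ i i i
      ... | _ , _ , _ , ij with joined M ij
      ...   | a₀ , b , a₀i , _ , e with connected M ai a₀i
      ...     | stop _ = b , e
      ...     | move _ d _ = _ , d
      labelled≢v : ∀ {a i} → β a ≡ just i → a ≢ v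
      labelled≢v ai refl = let z , e = has-edge ai in proj₁ (E′-elim {v} {z} e) refl
      lab : ∀ {a i} → β a ≡ just i → β′ a ≡ just i
      lab ai = trans (put-other v (β u) β (labelled≢v ai)) ai
      inner : ∀ {a b i} → β a ≡ just i → β b ≡ just i → E′ a b ≡ true → Path (Edges g) (Bag β′ i) a b
      inner {a} {b} ai bi e with proj₂ (proj₂ (E′-elim {a} {b} e))
      ... | inj₁ d = edge-path (lab ai) (lab bi) d
      ... | inj₂ (inj₁ (refl , d)) = move (lab ai) uv (edge-path (trans v-lab ai) (lab bi) d)
      ... | inj₂ (inj₂ (refl , d)) = move (lab ai) (flip g d) (edge-path (trans v-lab bi) (lab bi) (flip g uv))
      cover : ∀ {w i} → β′ w ≡ just i → ∃ λ a → β a ≡ just i × Path (Edges g) (Bag β′ i) w a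
      cover {w} {i} wi = go (w ≟ v)
        where
        go : Dec (w ≡ v) → ∃ λ a → β a ≡ just i × Path (Edges g) (Bag β′ i) w a
        go (yes refl) = u , trans (sym v-lab) wi , edge-path wi (lab (trans (sym v-lab) wi)) (flip g uv)
        go (no w≢v) = w , trans (sym (put-other v (β u) β w≢v)) wi , stop wi
      outer : ∀ {a b i j} → K₆⁻ i j ≡ true → β a ≡ just i → β b ≡ just j → E′ a b ≡ true → Joined (Edges g) β′ i j
      outer {a} {b} _ ai bj e with proj₂ (proj₂ (E′-elim {a} {b} e))
      ... | inj₁ d = a , b , lab ai , lab bj , d
      ... | inj₂ (inj₁ (refl , d)) = v , b , trans v-lab ai , lab bj , d
      ... | inj₂ (inj₂ (refl , d)) = a , v , lab ai , trans v-lab bj , flip g d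

    -- The contraction loses the edge `uv` itself and, for each common neighbour, one of two edges
    -- that become parallel; every lost edge counts twice.
    contract-degrees : degree-sum g ≤ degree-sum contract-edge + 2 * (1 + common g u v)
    contract-degrees = begin
      degree-sum g                                              ≤⟨ total-except-two {f = deg g} {λ a → deg contract-edge a + c a} u≢v row corner ⟩
      total (λ a → deg contract-edge a + c a) + (2 + common g u v) ≡⟨ cong (_+ (2 + common g u v)) (total-+ (deg contract-edge) c) ⟩
      degree-sum contract-edge + total c + (2 + common g u v)   ≡⟨ cong (λ x → degree-sum contract-edge + x + (2 + common g u v)) (total-cong λ a → cong b2n (cong₂ _∧_ (E-sym g a u) (E-sym g a v))) ⟩
      degree-sum contract-edge + k + (2 + k)                    ≡⟨ +-assoc (degree-sum contract-edge) k (2 + k) ⟩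
      degree-sum contract-edge + (k + (2 + k))                  ≡⟨ cong (degree-sum contract-edge +_) (arith k) ⟩
      degree-sum contract-edge + 2 * (1 + k)                    ∎
      where
      open ≤-Reasoning
      k = common g u v
      c : Fin N → ℕ
      c a = b2n (E g a u ∧ E g a v)
      arith : ∀ k → k + (2 + k) ≡ 2 * (1 + k)
      arith k = trans (+-suc k (suc k)) (cong suc (cong (k +_) (cong suc (sym (+-identityʳ k)))))
      row : ∀ a → a ≢ u → a ≢ v → deg g a ≤ deg contract-edge a + c a
      row a a≢u a≢v = total-except-two {f = b2n ∘ E g a} {b2n ∘ E′ a} {u} {v} u≢v
        (λ b _ b≢v → b2n-mono (E′-keep a≢v b≢v)) ends
        where
        ends : b2n (E g a u) + b2n (E g a v) ≤ b2n (E′ a u) + b2n (E′ a v) + c a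
        ends = ≤-trans (b2n-union (E g a u) (E g a v) (E′ a u) (E′-keep a≢v u≢v)
                         (λ q → trans (E-sym contract-edge a u) (E′-new a≢u (flip g q))))
                       (+-monoˡ-≤ (c a) (m≤m+n (b2n (E′ a u)) (b2n (E′ a v))))
      corner : deg g u + deg g v ≤ (deg contract-edge u + c u) + (deg contract-edge v + c v) + (2 + common g u v)
      corner = begin
        deg g u + deg g v                                           ≡⟨ sym (total-+ (b2n ∘ E g u) (b2n ∘ E g v)) ⟩
        total (λ b → b2n (E g u b) + b2n (E g v b))                 ≤⟨ total-mono entry ⟩
        total (λ b → b2n (E′ u b) + (b2n (b == u) + b2n (b == v) + b2n (E g u b ∧ E g v b)))
          ≡⟨ total-+ (b2n ∘ E′ u) _ ⟩
        deg contract-edge u + total (λ b → b2n (b == u) + b2n (b == v) + b2n (E g u b ∧ E g v b))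
          ≡⟨ cong (deg contract-edge u +_) (trans (total-+ (λ b → b2n (b == u) + b2n (b == v)) _)
               (cong (_+ k) (trans (total-+ (λ b → b2n (b == u)) _) (cong₂ _+_ (card-single u) (card-single v))))) ⟩
        deg contract-edge u + (2 + k)
          ≤⟨ +-monoˡ-≤ (2 + k) (≤-trans (m≤m+n _ (c u)) (m≤m+n _ (deg contract-edge v + c v))) ⟩
        (deg contract-edge u + c u) + (deg contract-edge v + c v) + (2 + k) ∎
        where
        entry : ∀ b → b2n (E g u b) + b2n (E g v b) ≤ b2n (E′ u b) + (b2n (b == u) + b2n (b == v) + b2n (E g u b ∧ E g v b))
        entry b with b ≟ u | b ≟ v
        ... | yes refl | _ = ≤-trans (+-mono-≤ (≤-reflexive (cong b2n (E-irr g b))) (b2n≤1 (E g v b)))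
                (≤-trans (≤-reflexive (cong b2n (sym (==-refl b)))) (≤-trans (m≤m+n (b2n (b == b)) (b2n (b == v)))
                (≤-trans (m≤m+n _ (b2n (E g b b ∧ E g v b))) (m≤n+m _ (b2n (E′ b b))))))
        ... | no b≢u | yes refl = ≤-trans (+-mono-≤ (b2n≤1 (E g u b)) (≤-reflexive (cong b2n (E-irr g b))))
                (≤-trans (≤-reflexive (cong b2n (sym (==-refl b)))) (≤-trans (m≤n+m (b2n (b == b)) (b2n (b == u)))
                (≤-trans (m≤m+n _ (b2n (E g u b ∧ E g b b))) (m≤n+m _ (b2n (E′ u b))))))
        ... | no b≢u | no b≢v = ≤-trans (b2n-union (E g u b) (E g v b) (E′ u b) (E′-keep u≢v b≢v) (E′-new b≢u))
                (+-monoʳ-≤ (b2n (E′ u b)) (m≤n+m _ (b2n (b == u) + b2n (b == v))))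

-- Dense graphs have a K₆⁻ minor

lookup-injective : ∀ {A : Set} {xs : List A} → AllPairs _≢_ xs → ∀ {i j} → List.lookup xs i ≡ List.lookup xs j → i ≡ j
lookup-injective (d ∷ ds) {zero}  {zero}  e = refl
lookup-injective (d ∷ ds) {zero}  {suc j} e = ⊥-elim (All.lookup d (∈-lookup j) e)
lookup-injective (d ∷ ds) {suc i} {zero}  e = ⊥-elim (All.lookup d (∈-lookup i) (sym e))
lookup-injective (d ∷ ds) {suc i} {suc j} e = cong suc (lookup-injective ds e)

lookup-all : ∀ {A : Set} {P : A → Set} {xs} → All P xs → ∀ i → P (List.lookup xs i)
lookup-all (p ∷ ps) zero    = p
lookup-all (p ∷ ps) (suc i) = lookup-all ps i

module _ {N} (g : LiveGraph N) where

  record Component (R : Fin N → Bool) (r : Fin N) : Set where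
    field
      C      : Fin N → Bool
      root   : C r ≡ true
      within : ∀ {a} → C a ≡ true → R a ≡ true
      closed : ∀ {a b} → C a ≡ true → E g a b ≡ true → R b ≡ true → C b ≡ true
      reach  : ∀ {a} → C a ≡ true → Path (Edges g) (λ z → C z ≡ true) a r

  component : ∀ R {r} → R r ≡ true → Component R r
  component R {r} Rr = grow (card R) (_== r) (==-refl r)
    (λ {a} e → trans (cong R (==-sound a r e)) Rr)
    (λ {a} e → subst (λ z → Path (Edges g) (λ z → z == r ≡ true) z r) (sym (==-sound a r e)) (stop (==-refl r)))
    (card-mono λ a e → proj₁ (∧-split {R a} e))
    where
    -- `n` bounds the number of vertices of `R` outside `C`, which drops with each vertex added.
    grow : ∀ n (C : Fin N → Bool) → C r ≡ true → (∀ {a} → C a ≡ true → R a ≡ true) →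
           (∀ {a} → C a ≡ true → Path (Edges g) (λ z → C z ≡ true) a r) →
           card (λ a → R a ∧ not (C a)) ≤ n → Component R r
    grow n C root within reach bound
      with any? (λ a → any? (λ b → ((C a Bool.≟ true) ×-dec (E g a b Bool.≟ true)) ×-dec ((R b Bool.≟ true) ×-dec ¬? (C b Bool.≟ true))))
    ... | no absent = record
      { C = C ; root = root ; within = within ; reach = reach
      ; closed = λ {a} {b} Ca e Rb → [ (λ t → t) , (λ f → ⊥-elim (absent (a , b , (Ca , e) , Rb , false≢true f))) ]′ (true-or-false (C b)) }
    ... | yes (a , b , (Ca , e) , Rb , b∉C) = extend n bound
      where
      C′ : Fin N → Bool
      C′ z = C z ∨ z == b
      old : ∀ {z} → C z ≡ true → C′ z ≡ true
      old h = ∨-introˡ h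
      new : C′ b ≡ true
      new = ∨-introʳ {C b} (==-refl b)
      widen : ∀ {z w} → Path (Edges g) (λ z → C z ≡ true) z w → Path (Edges g) (λ z → C′ z ≡ true) z w
      widen = path-bind (λ z → z) old (λ p q d → edge-path (old p) (old q) d)
      fewer : card (λ z → R z ∧ not (C′ z)) < card (λ z → R z ∧ not (C z))
      fewer = card-strict {f = λ z → R z ∧ not (C′ z)} {λ z → R z ∧ not (C z)} {b}
        (λ z h → let p , q = ∧-split {R z} h in cong₂ _∧_ p (not-true⁻¹ λ t → not-true q (old t)))
        (trans (cong (λ x → R b ∧ not x) new) (∧-zeroʳ (R b)))
        (cong₂ _∧_ Rb (not-true⁻¹ b∉C))
      within′ : ∀ {z} → C′ z ≡ true → R z ≡ true
      within′ {z} h with ∨-split {C z} h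
      ... | inj₁ p = within p
      ... | inj₂ p = trans (cong R (==-sound z b p)) Rb
      reach′ : ∀ {z} → C′ z ≡ true → Path (Edges g) (λ z → C′ z ≡ true) z r
      reach′ {z} h with ∨-split {C z} h
      ... | inj₁ p = widen (reach p)
      ... | inj₂ p with refl ← ==-sound z b p = move new (flip g e) (widen (reach Ca))
      extend : ∀ n → card (λ z → R z ∧ not (C z)) ≤ n → Component R r
      extend zero    bound = ⊥-elim (n≮0 (≤-trans fewer bound))
      extend (suc n) bound = grow n C′ (old root) within′ reach′ (≤-pred (≤-trans fewer bound))

  module Around (v : Fin N) (triangles : ∀ {a b} → E g a b ≡ true → 3 ≤ common g a b) where

    matrix : (xs : List (Fin N)) → Pattern (length xs)
    matrix xs i j = E g (List.lookup xs i) (List.lookup xs j)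

    matrix-sym : ∀ xs → Symmetric (matrix xs)
    matrix-sym xs i j = E-sym g _ _

    matrix-irr : ∀ xs → Irreflexive (matrix xs)
    matrix-irr xs i = E-irr g _

    Near : List (Fin N) → Set
    Near = All (λ z → E g v z ≡ true)

    apart-from-v : ∀ {xs} → Near xs → All (v ≢_) xs
    apart-from-v = All.map (apart g)

    cone : ∀ {xs} → Near xs → AllPairs _≢_ xs → HasMinor ⟦ apex (matrix xs) ⟧ → K₆⁻-Minor g
    cone {xs} near ds (φ , M) = _ , model-compose (packed (apex (matrix xs)) link) M
      where
      open Pack {E = Edges g} (flip g) (_== v) v (==-refl v)
        (λ {b} e → subst (λ z → Path (Edges g) (λ z → z == v ≡ true) z v) (sym (==-sound b v e)) (stop (==-refl v)))
        (List.lookup (v ∷ xs)) (lookup-injective (apart-from-v near ∷ ds)) (λ {i} e → ==-sound _ v e)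
      link : ∀ i j → apex (matrix xs) i j ≡ true → Link (List.lookup (v ∷ xs) i) (List.lookup (v ∷ xs) j)
      link zero    (suc j) _ = inj₁ (lookup-all near j)
      link (suc i) zero    _ = inj₁ (flip g (lookup-all near i))
      link (suc i) (suc j) e = inj₁ e

    -- The hypothesis `spread` says that `xs` lists the neighbourhood of `v`. The common neighbours
    -- of `v` and a neighbour `z` are the neighbours of `z` within this list, so three triangles on
    -- each edge become minimum degree three.
    matrix-degrees : ∀ {xs} → Near xs → (∀ f → card (λ z → f z ∧ E g v z) ≡ total (λ j → b2n (f (List.lookup xs j)))) →
                     ∀ i → 3 ≤ degree (matrix xs) i
    matrix-degrees {xs} near spread i = subst (3 ≤_) (spread (E g (List.lookup xs i))) (triangles (flip g (lookup-all near i)))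

    module Dominating (all-near : ∀ z → live g z ≡ true → z ≡ v ⊎ E g v z ≡ true) where

      neighbours = elements (E g v)

      spread : ∀ f → card (λ z → f z ∧ E g v z) ≡ sum (map (b2n ∘ f) (list neighbours))
      spread f = trans (total-cong pointwise) (weigh neighbours (b2n ∘ f))
        where
        pointwise : ∀ z → b2n (f z ∧ E g v z) ≡ (if E g v z then b2n (f z) else 0)
        pointwise z with E g v z
        ... | true  = cong b2n (∧-identityʳ (f z))
        ... | false = cong b2n (∧-zeroʳ (f z))

      degree-bound : degree-sum g ≤ deg g v + sum (map (λ a → suc (common g a v)) (list neighbours))
      degree-bound = ≤-trans (≤-reflexive (total-pick v (deg g))) (+-monoʳ-≤ (deg g v)
        (≤-trans (total-mono row) (≤-reflexive (weigh neighbours (λ a → suc (common g a v))))))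
        where
        row : ∀ a → without v (deg g) a ≤ (if E g v a then suc (common g a v) else 0)
        row a with a ≟ v
        ... | yes refl = ≤-trans (≤-reflexive (without-same v (deg g))) z≤n
        ... | no a≢v = ≤-trans (≤-reflexive (without-other (deg g) a≢v)) (go (true-or-false (E g v a)))
          where
          go : E g v a ≡ true ⊎ E g v a ≡ false → deg g a ≤ (if E g v a then suc (common g a v) else 0)
          go (inj₁ e) rewrite e = subst (_≤ suc (common g a v)) (sym (card-remove (E g a) (flip g e)))
            (s≤s (card-mono {f = E g a ∖ v} {λ z → E g a z ∧ E g v z} λ z h →
              let p , z≢v = ∖-elim (E g a) v z h in cong₂ _∧_ p
                ([ (λ q → ⊥-elim (z≢v q)) , (λ q → q) ]′ (all-near z (E-live g (flip g p))))))
          go (inj₂ e) = ≤-trans (≤-reflexive (trans (total-cong isolated) (total-0 {N}))) z≤n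
            where
            isolated : ∀ z → b2n (E g a z) ≡ 0
            isolated z with E g a z in h
            ... | false = refl
            ... | true  = ⊥-elim ([ a≢v , (λ q → false≢true e q) ]′ (all-near a (E-live g h)))

      total-lookup : ∀ (w : Fin N → ℕ) xs → total (λ i → w (List.lookup xs i)) ≡ sum (map w xs)
      total-lookup w []       = refl
      total-lookup w (x ∷ xs) = cong (w x +_) (total-lookup w xs)

      dominated : (xs : List (Fin N)) → list neighbours ≡ xs →
                  (∀ f → card (λ z → f z ∧ E g v z) ≡ total (λ j → b2n (f (List.lookup xs j)))) ×
                  degree-sum g ≤ deg g v + (length xs + total (degree (matrix xs))) × Near xs × AllPairs _≢_ xs
      dominated xs refl = spread′ ,
        ≤-trans degree-bound (+-monoʳ-≤ (deg g v) (≤-reflexive sums)) ,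
        All.tabulate (sound neighbours) , distinct neighbours
        where
        spread′ : ∀ f → card (λ z → f z ∧ E g v z) ≡ total (λ j → b2n (f (List.lookup xs j)))
        spread′ f = trans (spread f) (sym (total-lookup (b2n ∘ f) xs))
        ones : ∀ (w : Fin N → ℕ) xs → sum (map (suc ∘ w) xs) ≡ length xs + sum (map w xs)
        ones w []       = refl
        ones w (x ∷ xs) = cong suc (trans (cong (w x +_) (ones w xs)) (trans (sym (+-assoc (w x) (length xs) _))
                            (trans (cong (_+ sum (map w xs)) (+-comm (w x) (length xs))) (+-assoc (length xs) (w x) _))))
        sums : sum (map (λ a → suc (common g a v)) xs) ≡ length xs + total (degree (matrix xs))
        sums = trans (ones (λ a → common g a v) xs) (cong (length xs +_) (trans (sym (total-lookup (λ a → common g a v) xs))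
                 (total-cong λ i → spread′ (E g (List.lookup xs i)))))

      -- The graph is the cone with apex `v` over a neighbourhood of five or six vertices. Each edge
      -- at `v` counts once for `v` and once for the neighbour, so twice the degree of `v` is taken
      -- off before the finite checks apply.
      small : 6 ≤ order g → deg g v ≤ 6 → 7 * order g ≤ degree-sum g + 14 → order g ≡ suc (deg g v) → K₆⁻-Minor g
      small six≤ ≤six dense size = go (list neighbours) refl
        where
        go : (xs : List (Fin N)) → list neighbours ≡ xs → K₆⁻-Minor g
        go xs e with dominated xs e | trans (sym (cong length e)) (number neighbours)
        ... | spread , bound , near , ds | len = by-length xs spread near ds
          (subst (λ o → 7 * o ≤ degree-sum g + 14) (trans size (cong suc (sym len))) dense)
          (subst (λ x → degree-sum g ≤ x + (length xs + total (degree (matrix xs)))) (sym len) bound)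
          (subst (6 ≤_) (trans size (cong suc (sym len))) six≤) (subst (_≤ 6) (sym len) ≤six)
          where
          by-length : ∀ xs → (∀ f → card (λ z → f z ∧ E g v z) ≡ total (λ j → b2n (f (List.lookup xs j)))) →
                      Near xs → AllPairs _≢_ xs → 7 * suc (length xs) ≤ degree-sum g + 14 →
                      degree-sum g ≤ length xs + (length xs + total (degree (matrix xs))) →
                      6 ≤ suc (length xs) → length xs ≤ 6 → K₆⁻-Minor g
          by-length xs@(_ ∷ _ ∷ _ ∷ _ ∷ _ ∷ []) spread near ds many bound _ _ =
            cone near ds (five-full (matrix xs) (matrix-sym xs) (matrix-irr xs) (matrix-degrees near spread)
              (+-cancelˡ-≤ 10 18 _ (≤-trans (+-cancelʳ-≤ 14 28 _ many) bound)))
          by-length xs@(_ ∷ _ ∷ _ ∷ _ ∷ _ ∷ _ ∷ []) spread near ds many bound _ _ =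
            cone near ds (six-full (matrix xs) (matrix-sym xs) (matrix-irr xs) (matrix-degrees near spread)
              (+-cancelˡ-≤ 12 23 _ (≤-trans (+-cancelʳ-≤ 14 35 _ many) bound)))
          by-length []                  _ _ _ _ _ l _ = ⊥-elim (from-no (6 ≤? 1) l)
          by-length (_ ∷ [])            _ _ _ _ _ l _ = ⊥-elim (from-no (6 ≤? 2) l)
          by-length (_ ∷ _ ∷ [])        _ _ _ _ _ l _ = ⊥-elim (from-no (6 ≤? 3) l)
          by-length (_ ∷ _ ∷ _ ∷ [])    _ _ _ _ _ l _ = ⊥-elim (from-no (6 ≤? 4) l)
          by-length (_ ∷ _ ∷ _ ∷ _ ∷ []) _ _ _ _ _ l _ = ⊥-elim (from-no (6 ≤? 5) l)
          by-length (_ ∷ _ ∷ _ ∷ _ ∷ _ ∷ _ ∷ _ ∷ _) _ _ _ _ _ _ u = ⊥-elim (m+1+n≰m 6 u)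

    module Attached {R : Fin N → Bool} {r : Fin N} (comp : Component R r)
                    (far : ∀ {z} → R z ≡ true → z ≢ v × E g v z ≢ true) where
      open Component comp

      Touch : Fin N → Fin N → Bool
      Touch z c = C c ∧ E g z c

      S : Fin N → Bool
      S z = E g v z ∧ some N (Touch z)

      S-near : ∀ {z} → S z ≡ true → E g v z ≡ true
      S-near {z} h = proj₁ (∧-split {E g v z} h)

      S-touch : ∀ {z} → S z ≡ true → ∃ λ c → C c ≡ true × E g z c ≡ true
      S-touch {z} h = let c , e = some-elim (Touch z) (proj₂ (∧-split {E g v z} h)) in c , ∧-split {C c} e

      S-intro : ∀ {z c} → E g v z ≡ true → C c ≡ true → E g z c ≡ true → S z ≡ true
      S-intro {z} {c} e Cc d = cong₂ _∧_ e (some-intro (Touch z) c (cong₂ _∧_ Cc d))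

      near∉C : ∀ {z} → E g v z ≡ true → C z ≢ true
      near∉C e Cz = proj₂ (far (within Cz)) e

      v∉C : C v ≢ true
      v∉C Cv = proj₁ (far (within Cv)) refl

      -- Contracting C into s makes s and t adjacent.
      cone-plus : ∀ {s t ys} → S s ≡ true → S t ≡ true → Near (s ∷ t ∷ ys) → AllPairs _≢_ (s ∷ t ∷ ys) →
                  HasMinor ⟦ apex (plus (matrix (s ∷ t ∷ ys))) ⟧ → K₆⁻-Minor g
      cone-plus {s} {t} {ys} Ss St near ds (φ , M) = _ , model-compose (packed κ link) M
        where
        xs = s ∷ t ∷ ys
        κ = apex (plus (matrix xs))
        B : Fin N → Bool
        B z = C z ∨ z == s
        s∈B : B s ≡ true
        s∈B = ∨-introʳ {C s} (==-refl s)
        c = proj₁ (S-touch Ss)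
        Cc = proj₁ (proj₂ (S-touch Ss))
        sc = proj₂ (proj₂ (S-touch Ss))
        in-B : ∀ {z w} → Path (Edges g) (λ z → C z ≡ true) z w → Path (Edges g) (λ z → B z ≡ true) z w
        in-B = path-bind (λ z → z) ∨-introˡ (λ p q d → edge-path (∨-introˡ p) (∨-introˡ q) d)
        to-s : ∀ {z} → B z ≡ true → Path (Edges g) (λ z → B z ≡ true) z s
        to-s {z} h with ∨-split {C z} h
        ... | inj₁ p = in-B (reach p) ◅◅ path-reverse (flip g) (move s∈B sc (in-B (reach Cc)))
        ... | inj₂ p with refl ← ==-sound z s p = stop s∈B
        inside : ∀ {i} → B (List.lookup (v ∷ xs) i) ≡ true → List.lookup (v ∷ xs) i ≡ s
        inside {i} h with ∨-split {C (List.lookup (v ∷ xs) i)} h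
        inside {zero}  h | inj₁ p = ⊥-elim (v∉C p)
        inside {suc i} h | inj₁ p = ⊥-elim (near∉C (lookup-all near i) p)
        ... | inj₂ p = ==-sound _ s p
        open Pack {E = Edges g} (flip g) B s s∈B to-s (List.lookup (v ∷ xs)) (lookup-injective (apart-from-v near ∷ ds)) (λ {i} → inside {i})
        touch-t : ∃ λ c → B c ≡ true × E g c t ≡ true
        touch-t = let c , Cc , e = S-touch St in c , ∨-introˡ Cc , flip g e
        link : ∀ i j → κ i j ≡ true → Link (List.lookup (v ∷ xs) i) (List.lookup (v ∷ xs) j)
        link zero    (suc j) _ = inj₁ (lookup-all near j)
        link (suc i) zero    _ = inj₁ (flip g (lookup-all near i))
        link (suc i) (suc j) e with plus-elim (matrix xs) i j e
        ... | inj₁ d = inj₁ d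
        ... | inj₂ (inj₁ (refl , refl)) = inj₂ (inj₁ (refl , touch-t))
        ... | inj₂ (inj₂ (refl , refl)) = let c , b , e = touch-t in inj₂ (inj₂ (refl , c , b , flip g e))

      -- The exceptional neighbourhood. The fields `rich` and `full` make its pair unique: `s` has
      -- four neighbours inside the neighbourhood, every vertex besides `s` and `t` at most three.
      record Special (s t : Fin N) : Set where
        field
          degree-six : deg g v ≡ 6
          full       : ∀ {z} → E g v z ≡ true → z ≢ s → z ≢ t → E g s z ≡ true × E g t z ≡ true × common g z v ≤ 3
          rich       : 4 ≤ common g s v

      module _ (low : 4 ≤ deg g v) (high : deg g v ≤ 6) where

        module NonAdjacent {s t} (Ss : S s ≡ true) (St : S t ≡ true) (s≢t : s ≢ t) (st : E g s t ≡ false) where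

          others = elements ((E g v ∖ s) ∖ t)

          other-elim : ∀ {z} → z ∈ list others → E g v z ≡ true × z ≢ s × z ≢ t
          other-elim {z} i = let p , z≢t = ∖-elim (E g v ∖ s) t z (sound others i) ; q , z≢s = ∖-elim (E g v) s z p in q , z≢s , z≢t

          deg-v : deg g v ≡ 2 + length (list others)
          deg-v = trans (card-remove (E g v) (S-near Ss)) (cong suc (trans
            (card-remove (E g v ∖ s) (∖-intro (E g v) (S-near St) (λ e → s≢t (sym e)))) (cong suc (sym (number others)))))

          spread : ∀ f → card (λ z → f z ∧ E g v z) ≡ b2n (f s) + (b2n (f t) + sum (map (b2n ∘ f) (list others)))
          spread f = trans (card-∖ h s) (cong₂ _+_ (cong b2n (at (S-near Ss)))
            (trans (card-∖ (h ∖ s) t) (cong₂ _+_ (cong b2n (trans (trans (cong (h t ∧_) (≢⇒not== (λ e → s≢t (sym e)))) (∧-identityʳ (h t))) (at (S-near St))))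
              (trans (total-cong pointwise) (weigh others (b2n ∘ f))))))
            where
            h : Fin N → Bool
            h z = f z ∧ E g v z
            at : ∀ {z} → E g v z ≡ true → h z ≡ f z
            at {z} e = trans (cong (f z ∧_) e) (∧-identityʳ (f z))
            pointwise : ∀ z → b2n (((h ∖ s) ∖ t) z) ≡ (if ((E g v ∖ s) ∖ t) z then b2n (f z) else 0)
            pointwise z with f z | E g v z | not (z == s) | not (z == t)
            ... | true  | true  | true  | true  = refl
            ... | true  | true  | true  | false = refl
            ... | true  | true  | false | _     = refl
            ... | true  | false | _     | _     = refl
            ... | false | true  | true  | true  = refl
            ... | false | true  | true  | false = refl
            ... | false | true  | false | _     = refl
            ... | false | false | _     | _     = refl

          near : Near (s ∷ t ∷ list others)
          near = S-near Ss ∷ S-near St ∷ All.tabulate (λ i → proj₁ (other-elim i))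

          ds : AllPairs _≢_ (s ∷ t ∷ list others)
          ds = (s≢t ∷ All.tabulate (λ i e → proj₁ (proj₂ (other-elim i)) (sym e))) ∷
               All.tabulate (λ i e → proj₂ (proj₂ (other-elim i)) (sym e)) ∷ distinct others

          non-adjacent : K₆⁻-Minor g ⊎ Special s t
          non-adjacent = go (list others) spread near ds (λ e a b → complete others (∖-intro (E g v ∖ s) (∖-intro (E g v) e a) b)) deg-v
            where
            go : ∀ ys → (∀ f → card (λ z → f z ∧ E g v z) ≡ b2n (f s) + (b2n (f t) + sum (map (b2n ∘ f) ys))) →
                 Near (s ∷ t ∷ ys) → AllPairs _≢_ (s ∷ t ∷ ys) →
                 (∀ {z} → E g v z ≡ true → z ≢ s → z ≢ t → z ∈ ys) → deg g v ≡ 2 + length ys → K₆⁻-Minor g ⊎ Special s t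
            go [] _ _ _ _ d = ⊥-elim (from-no (4 ≤? 2) (subst (4 ≤_) d low))
            go (_ ∷ []) _ _ _ _ d = ⊥-elim (from-no (4 ≤? 3) (subst (4 ≤_) d low))
            -- If `v` had degree four, `s` would have at most two neighbours around `v`, as `t` is
            -- not one of them; but the edge between `s` and `v` lies in three triangles.
            go (a ∷ b ∷ []) spr nr _ _ _ = ⊥-elim (from-no (3 ≤? 2) (≤-trans (triangles (flip g (S-near Ss)))
              (≤-trans (≤-reflexive (spr (E g s))) (+-mono-≤ (≤-reflexive (cong b2n (E-irr g s)))
                (+-mono-≤ (≤-reflexive (cong b2n st)) (+-mono-≤ (b2n≤1 (E g s a)) (+-mono-≤ (b2n≤1 (E g s b)) z≤n)))))))
            go ys@(_ ∷ _ ∷ _ ∷ []) spr nr dd _ _ = inj₁ (cone-plus Ss St nr dd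
              (five-pair (matrix (s ∷ t ∷ ys)) (matrix-sym (s ∷ t ∷ ys)) (matrix-irr (s ∷ t ∷ ys)) (matrix-degrees nr spr) st))
            go ys@(a ∷ b ∷ c ∷ d ∷ []) spr nr dd compl six =
              Sum.map (cone-plus Ss St nr dd) special
                (six-pair (matrix (s ∷ t ∷ ys)) (matrix-sym (s ∷ t ∷ ys)) (matrix-irr (s ∷ t ∷ ys)) (matrix-degrees nr spr) st)
              where
              special : SpecialPair (matrix (s ∷ t ∷ ys)) → Special s t
              special h = record
                { degree-six = six
                ; full = λ {z} e z≢s z≢t → row (compl e z≢s z≢t)
                ; rich = subst (4 ≤_) (sym (spr (E g s))) (≤-trans (≤-reflexive (sym (four)))
                    (≤-trans (m≤n+m _ (b2n (E g s t))) (m≤n+m _ (b2n (E g s s)))))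
                }
                where
                row : ∀ {z} → z ∈ ys → E g s z ≡ true × E g t z ≡ true × common g z v ≤ 3
                row (here refl) = let p , q , l = h (# 2) (λ ()) (λ ()) in p , q , subst (_≤ 3) (sym (spr (E g a))) l
                row (there (here refl)) = let p , q , l = h (# 3) (λ ()) (λ ()) in p , q , subst (_≤ 3) (sym (spr (E g b))) l
                row (there (there (here refl))) = let p , q , l = h (# 4) (λ ()) (λ ()) in p , q , subst (_≤ 3) (sym (spr (E g c))) l
                row (there (there (there (here refl)))) = let p , q , l = h (# 5) (λ ()) (λ ()) in p , q , subst (_≤ 3) (sym (spr (E g d))) l
                four : sum (map (b2n ∘ E g s) ys) ≡ 4
                four rewrite proj₁ (row (here refl)) | proj₁ (row (there (here refl)))
                           | proj₁ (row (there (there (here refl)))) | proj₁ (row (there (there (there (here refl))))) = refl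
            go (_ ∷ _ ∷ _ ∷ _ ∷ _ ∷ _) _ _ _ _ d = ⊥-elim (m+1+n≰m 6 (subst (_≤ 6) d high))

        -- Vertex 0 stands for v and vertex 1 for the component C.
        double-apex : ∀ {n} → (Fin n → Bool) → Pattern n → Pattern (suc (suc n))
        double-apex σ μ zero          (suc (suc j)) = true
        double-apex σ μ (suc (suc i)) zero          = true
        double-apex σ μ (suc zero)    (suc (suc j)) = σ j
        double-apex σ μ (suc (suc i)) (suc zero)    = σ i
        double-apex σ μ (suc (suc i)) (suc (suc j)) = μ i j
        double-apex σ μ _             _             = false

        double-cone : ∀ {xs} → Near xs → AllPairs _≢_ xs → ∀ σ μ →
                      (∀ i → σ i ≡ true → S (List.lookup xs i) ≡ true) → (∀ i j → μ i j ≡ true → matrix xs i j ≡ true) →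
                      HasMinor ⟦ double-apex σ μ ⟧ → K₆⁻-Minor g
        double-cone {xs} near ds σ μ touching adjacent (φ , M) = _ , model-compose (packed (double-apex σ μ) link) M
          where
          w = v ∷ r ∷ xs
          v≢r : v ≢ r
          v≢r e = proj₁ (far (within root)) (sym e)
          r∉xs : All (r ≢_) xs
          r∉xs = All.map (λ { e refl → near∉C e root }) near
          inside : ∀ {i} → C (List.lookup w i) ≡ true → List.lookup w i ≡ r
          inside {zero}        h = ⊥-elim (v∉C h)
          inside {suc zero}    h = refl
          inside {suc (suc i)} h = ⊥-elim (near∉C (lookup-all near i) h)
          open Pack {E = Edges g} (flip g) C r root reach (List.lookup w)
            (lookup-injective ((v≢r ∷ apart-from-v near) ∷ r∉xs ∷ ds)) (λ {i} → inside {i})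
          link : ∀ i j → double-apex σ μ i j ≡ true → Link (List.lookup w i) (List.lookup w j)
          link zero          (suc (suc j)) _ = inj₁ (lookup-all near j)
          link (suc (suc i)) zero          _ = inj₁ (flip g (lookup-all near i))
          link (suc zero)    (suc (suc j)) e = let c , Cc , d = S-touch (touching j e) in inj₂ (inj₁ (refl , c , Cc , flip g d))
          link (suc (suc i)) (suc zero)    e = let c , Cc , d = S-touch (touching i e) in inj₂ (inj₂ (refl , c , Cc , d))
          link (suc (suc i)) (suc (suc j)) e = inj₁ (adjacent i j e)
          link zero          zero          ()
          link zero          (suc zero)    ()
          link (suc zero)    zero          ()
          link (suc zero)    (suc zero)    ()

        -- `v` and the contracted component are both adjacent to the whole clique; they are the ends
        -- of the missing edge of `K₆⁻`.
        four-clique : ∀ {a b c d} → AllPairs _≢_ (a ∷ b ∷ c ∷ d ∷ []) → All (λ z → S z ≡ true) (a ∷ b ∷ c ∷ d ∷ []) →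
                      (∀ {x y} → S x ≡ true → S y ≡ true → x ≢ y → E g x y ≡ true) → K₆⁻-Minor g
        four-clique ds in-S clique = double-cone (All.map S-near in-S) ds (λ _ → true) (λ i j → not (i == j))
          (λ i _ → lookup-all in-S i)
          (λ i j e → clique (lookup-all in-S i) (lookup-all in-S j) (λ d → ≠-sound i j e (lookup-injective ds d)))
          (near-test-sound (double-apex (λ _ → true) (λ i j → not (i == j))) refl)

        -- Contracting `b` into `p` supplies an edge between `p` and `q`. Then `p`, `q`, `x`, `y`
        -- are a clique that both `v` and the component see completely.
        five-special : ∀ {p q x y b} → AllPairs _≢_ (p ∷ q ∷ x ∷ y ∷ b ∷ []) → Near (p ∷ q ∷ x ∷ y ∷ b ∷ []) →
                       All (λ z → S z ≡ true) (p ∷ q ∷ x ∷ y ∷ []) →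
                       E g p x ≡ true → E g p y ≡ true → E g q x ≡ true → E g q y ≡ true →
                       E g x y ≡ true → E g p b ≡ true → E g q b ≡ true → K₆⁻-Minor g
        five-special {p} {q} {x} {y} {b} ds near in-S px py qx qy xy pb qb = double-cone near ds σ μ touching links
          (contract-test-sound (double-apex σ μ)
            (λ {i} {j} → ⇒ᵇ-elim (every-elim (λ j → double-apex σ μ i j ⇒ᵇ double-apex σ μ j i)
              (every-elim (λ i → every 7 λ j → double-apex σ μ i j ⇒ᵇ double-apex σ μ j i) refl i) j)) refl)
          where
          σ : Fin 5 → Bool
          σ i = not (i == # 4)
          μ : Pattern 5
          μ = fromNeighbours ((2 ∷ 3 ∷ 4 ∷ []) ∷ (2 ∷ 3 ∷ 4 ∷ []) ∷ (0 ∷ 1 ∷ 3 ∷ []) ∷ (0 ∷ 1 ∷ 2 ∷ []) ∷ (0 ∷ 1 ∷ []) ∷ [])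
          touching : ∀ i → σ i ≡ true → S (List.lookup (p ∷ q ∷ x ∷ y ∷ b ∷ []) i) ≡ true
          touching zero                   _ = lookup-all in-S (# 0)
          touching (suc zero)             _ = lookup-all in-S (# 1)
          touching (suc (suc zero))       _ = lookup-all in-S (# 2)
          touching (suc (suc (suc zero))) _ = lookup-all in-S (# 3)
          touching (suc (suc (suc (suc zero)))) ()
          links : ∀ i j → μ i j ≡ true → matrix (p ∷ q ∷ x ∷ y ∷ b ∷ []) i j ≡ true
          links zero (suc (suc zero)) _ = px
          links zero (suc (suc (suc zero))) _ = py
          links zero (suc (suc (suc (suc zero)))) _ = pb
          links (suc zero) (suc (suc zero)) _ = qx
          links (suc zero) (suc (suc (suc zero))) _ = qy
          links (suc zero) (suc (suc (suc (suc zero)))) _ = qb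
          links (suc (suc zero)) zero _ = flip g px
          links (suc (suc zero)) (suc zero) _ = flip g qx
          links (suc (suc zero)) (suc (suc (suc zero))) _ = xy
          links (suc (suc (suc zero))) zero _ = flip g py
          links (suc (suc (suc zero))) (suc zero) _ = flip g qy
          links (suc (suc (suc zero))) (suc (suc zero)) _ = flip g xy
          links (suc (suc (suc (suc zero)))) zero _ = flip g pb
          links (suc (suc (suc (suc zero)))) (suc zero) _ = flip g qb

        module Separate (cover : ∀ {z} → live g z ≡ true → z ≢ v → E g v z ≢ true → R z ≡ true)
                        (R-live : ∀ {z} → R z ≡ true → live g z ≡ true) (v-live : live g v ≡ true)
                        (min-degree : 4 ≤ deg g r) (dense : 7 * order g ≤ degree-sum g + 14)
                        (smaller : ∀ (h : LiveGraph N) → order h < order g → 3 ≤ order h →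
                                   7 * order h ≤ degree-sum h + 14 → K₆⁻-Minor h) where

          Q : Fin N → Bool
          Q z = C z ∨ S z

          Pairs : Fin N → Fin N → Bool
          Pairs a b = (S a ∧ S b) ∧ not (a == b)

          S∉C : ∀ {z} → S z ≡ true → C z ≢ true
          S∉C h = near∉C (S-near h)

          S-live : ∀ {z} → S z ≡ true → live g z ≡ true
          S-live h = E-live g (flip g (S-near h))

          C-live : ∀ {z} → C z ≡ true → live g z ≡ true
          C-live h = R-live (within h)

          Q-live : ∀ {z} → Q z ≡ true → live g z ≡ true
          Q-live {z} h = [ C-live , S-live ]′ (∨-split {C z} h)

          -- There is no third possibility: `cover` puts every live vertex that is neither `v` nor a
          -- neighbour of `v` into `R`, and `C` is closed within `R`.
          C-neighbour : ∀ {a b} → C a ≡ true → E g a b ≡ true → Q b ≡ true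
          C-neighbour {a} {b} Ca e with true-or-false (E g v b)
          ... | inj₁ d = ∨-introʳ {C b} (S-intro d Ca (flip g e))
          ... | inj₂ d = ∨-introˡ (closed Ca e (cover (E-live g (flip g e)) (λ { refl → near∉C (flip g e) Ca }) (false≢true d)))

          -- The side of C, with S completed to a clique.
          sideA : LiveGraph N
          sideA = record
            { E = λ a b → (Q a ∧ Q b) ∧ (E g a b ∨ Pairs a b)
            ; live = Q
            ; E-sym = λ a b → cong₂ _∧_ (∧-comm (Q a) (Q b)) (cong₂ _∨_ (E-sym g a b)
                (cong₂ _∧_ (∧-comm (S a) (S b)) (cong not (==-comm a b))))
            ; E-irr = λ a → trans (cong ((Q a ∧ Q a) ∧_) (cong₂ _∨_ (E-irr g a)
                (trans (cong (λ x → (S a ∧ S a) ∧ not x) (==-refl a)) (∧-zeroʳ (S a ∧ S a))))) (∧-zeroʳ (Q a ∧ Q a))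
            ; E-live = λ {a} {b} e → proj₁ (∧-split {Q a} (proj₁ (∧-split {Q a ∧ Q b} e)))
            }

          sideB : LiveGraph N
          sideB = restrict g (not ∘ C)

          in-B : ∀ {z} → live g z ≡ true → C z ≢ true → live sideB z ≡ true
          in-B l c = cong₂ _∧_ l (not-true⁻¹ c)

          order-A : order sideA < order g
          order-A = card-strict {f = Q} {live g} {v} (λ _ → Q-live) v∉Q v-live
            where
            v∉Q : Q v ≡ false
            v∉Q with true-or-false (Q v)
            ... | inj₂ f = f
            ... | inj₁ t = ⊥-elim ([ v∉C , (λ h → false≢true (E-irr g v) (S-near h)) ]′ (∨-split {C v} t))

          order-B : order sideB < order g
          order-B = card-strict {f = live sideB} {live g} {r} (λ z h → proj₁ (∧-split {live g z} h))
            (trans (cong (λ x → live g r ∧ not x) root) (∧-zeroʳ (live g r))) (C-live root)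

          size-A : 3 ≤ order sideA
          size-A = ≤-trans (≤-trans (s≤s (s≤s (s≤s z≤n))) min-degree) (<⇒≤ (card-strict {f = E g r} {Q} {r}
            (λ _ → C-neighbour root) (E-irr g r) (∨-introˡ root)))

          size-B : 3 ≤ order sideB
          size-B = ≤-trans (≤-trans (s≤s (s≤s (s≤s z≤n))) low) (<⇒≤ (card-strict {f = E g v} {live sideB} {v}
            (λ z e → in-B (E-live g (flip g e)) (near∉C e)) (E-irr g v) (in-B v-live v∉C)))

          orders : order sideA + order sideB ≤ order g + card S
          orders = ≤-trans (≤-reflexive (sym (total-+ (b2n ∘ Q) (b2n ∘ live sideB))))
            (≤-trans (total-mono entry) (≤-reflexive (total-+ (b2n ∘ live g) (b2n ∘ S))))
            where
            entry : ∀ z → b2n (Q z) + b2n (live sideB z) ≤ b2n (live g z) + b2n (S z)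
            entry z with C z in c | S z in s | live g z in l
            ... | true  | true  | _     = ⊥-elim (S∉C s c)
            ... | true  | false | true  = ≤-refl
            ... | true  | false | false = ⊥-elim (false≢true l (C-live c))
            ... | false | true  | true  = ≤-refl
            ... | false | true  | false = ⊥-elim (false≢true l (S-live s))
            ... | false | false | true  = ≤-refl
            ... | false | false | false = z≤n

          -- An edge that meets `C` survives in `sideA`, any other in `sideB`. The pairs of `S` in
          -- `sideA` come on top, including those that are edges of `g`, because such edges are
          -- counted in `sideB` as well.
          degrees : degree-sum g + total (λ a → card (Pairs a)) ≤ degree-sum sideA + degree-sum sideB
          degrees = ≤-trans (≤-reflexive (sym (total-+ (deg g) _))) (≤-trans (total-mono row) (≤-reflexive (total-+ (deg sideA) (deg sideB))))
            where
            entry : ∀ a b → b2n (E g a b) + b2n (Pairs a b) ≤ b2n (E sideA a b) + b2n (E sideB a b)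
            entry a b = go (true-or-false (C a)) (true-or-false (C b))
              where
              no-pair : C a ≡ true ⊎ C b ≡ true → Pairs a b ≡ false
              no-pair h with true-or-false (Pairs a b)
              ... | inj₂ f = f
              ... | inj₁ t = let p , q = ∧-split {S a} (proj₁ (∧-split {S a ∧ S b} t)) in ⊥-elim ([ S∉C p , S∉C q ]′ h)
              touching : C a ≡ true ⊎ C b ≡ true → E g a b ≡ true → Q a ∧ Q b ≡ true
              touching (inj₁ c) e = cong₂ _∧_ (∨-introˡ c) (C-neighbour c e)
              touching (inj₂ c) e = cong₂ _∧_ (C-neighbour c (flip g e)) (∨-introˡ c)
              left : C a ≡ true ⊎ C b ≡ true → b2n (E g a b) + b2n (Pairs a b) ≤ b2n (E sideA a b) + b2n (E sideB a b)
              left h = ≤-trans (+-mono-≤ (b2n-mono {E g a b} {E sideA a b} λ e → cong₂ _∧_ (touching h e) (∨-introˡ e))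
                                         (≤-trans (≤-reflexive (cong b2n (no-pair h))) z≤n)) (+-monoʳ-≤ (b2n (E sideA a b)) (z≤n {b2n (E sideB a b)}))
              go : C a ≡ true ⊎ C a ≡ false → C b ≡ true ⊎ C b ≡ false → _
              go (inj₁ c) _ = left (inj₁ c)
              go _ (inj₁ c) = left (inj₂ c)
              go (inj₂ c) (inj₂ d) = ≤-trans (≤-reflexive (+-comm (b2n (E g a b)) _)) (+-mono-≤
                (b2n-mono {Pairs a b} {E sideA a b} λ e → let p , q = ∧-split {S a} (proj₁ (∧-split {S a ∧ S b} e)) in
                  cong₂ _∧_ (cong₂ _∧_ (∨-introʳ {C a} p) (∨-introʳ {C b} q)) (∨-introʳ {E g a b} e))
                (b2n-mono {E g a b} {E sideB a b} λ e → cong₂ _∧_ (cong₂ _∧_ (cong not c) (cong not d)) e))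
            row : ∀ a → deg g a + card (Pairs a) ≤ deg sideA a + deg sideB a
            row a = ≤-trans (≤-reflexive (sym (total-+ (b2n ∘ E g a) (b2n ∘ Pairs a))))
              (≤-trans (total-mono (entry a)) (≤-reflexive (total-+ (b2n ∘ E sideA a) (b2n ∘ E sideB a))))

          pair-count : total (λ a → card (Pairs a)) + card S ≡ card S * card S
          pair-count = trans (sym (total-+ (λ a → card (Pairs a)) (b2n ∘ S))) (trans (total-cong row) (total-* (card S) (b2n ∘ S)))
            where
            row : ∀ a → card (Pairs a) + b2n (S a) ≡ card S * b2n (S a)
            row a with S a in e
            ... | false = trans (+-identityʳ _) (trans (total-0 {N}) (sym (*-zeroʳ (card S))))
            ... | true  = trans (+-comm (card (λ b → S b ∧ not (a == b))) 1) (trans (cong suc (total-cong λ b → cong (λ x → b2n (S b ∧ not x)) (==-comm a b)))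
                            (trans (sym (card-remove S e)) (sym (*-identityʳ (card S)))))

          -- Density of `g` passes to at least one side, both sides are smaller, and a minor of
          -- `sideB` is one of `g`. Only the edges added in `sideA` have to be realised, which is
          -- left to `lift`.
          separate : card S ≤ 3 → (K₆⁻-Minor sideA → K₆⁻-Minor g) → K₆⁻-Minor g
          separate few lift with 7 * order sideA ≤? degree-sum sideA + 14 | 7 * order sideB ≤? degree-sum sideB + 14
          ... | yes p | _     = lift (smaller sideA order-A size-A p)
          ... | no _  | yes p = restrict-minor g (not ∘ C) (smaller sideB order-B size-B p)
          ... | no p  | no q  = ⊥-elim (numbers (card S) {oA = order sideA} {order sideB} {order g} few pair-count (≰⇒> p) (≰⇒> q) degrees orders dense)
            where
            open ≤-Reasoning
            -- The inequality denied here amounts to (σ - 4)² ≤ 0.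
            squares : ∀ σ → σ ≤ 3 → ¬ σ * σ + 16 ≤ σ * 8
            squares 0 _ = from-no (16 ≤? 0)
            squares 1 _ = from-no (17 ≤? 8)
            squares 2 _ = from-no (20 ≤? 16)
            squares 3 _ = from-no (25 ≤? 24)
            squares (suc (suc (suc (suc _)))) (s≤s (s≤s (s≤s ())))
            numbers : ∀ σ {π dA dB oA oB o d} → σ ≤ 3 → π + σ ≡ σ * σ → dA + 14 < 7 * oA → dB + 14 < 7 * oB →
                      d + π ≤ dA + dB → oA + oB ≤ o + σ → 7 * o ≤ d + 14 → ⊥
            numbers σ {π} {dA} {dB} {oA} {oB} {o} {d} few pc hA hB hd ho hn = squares σ few (+-cancelˡ-≤ (d + 14) _ _ (begin
              d + 14 + (σ * σ + 16)              ≡⟨ cong (λ x → d + 14 + (x + 16)) (sym pc) ⟩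
              d + 14 + (π + σ + 16)              ≡⟨ solve 3 (λ d π σ → d :+ con 14 :+ (π :+ σ :+ con 16) := d :+ π :+ con 30 :+ σ) refl d π σ ⟩
              d + π + 30 + σ                     ≤⟨ +-monoˡ-≤ σ (+-monoˡ-≤ 30 hd) ⟩
              dA + dB + 30 + σ                   ≡⟨ solve 3 (λ a b σ → a :+ b :+ con 30 :+ σ := (con 1 :+ (a :+ con 14)) :+ (con 1 :+ (b :+ con 14)) :+ σ) refl dA dB σ ⟩
              suc (dA + 14) + suc (dB + 14) + σ  ≤⟨ +-monoˡ-≤ σ (+-mono-≤ hA hB) ⟩
              7 * oA + 7 * oB + σ                ≡⟨ cong (_+ σ) (sym (*-distribˡ-+ 7 oA oB)) ⟩
              7 * (oA + oB) + σ                  ≤⟨ +-monoˡ-≤ σ (*-monoʳ-≤ 7 ho) ⟩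
              7 * (o + σ) + σ                    ≡⟨ solve 2 (λ o σ → con 7 :* (o :+ σ) :+ σ := con 7 :* o :+ σ :* con 8) refl o σ ⟩
              7 * o + σ * 8                      ≤⟨ +-monoˡ-≤ (σ * 8) hn ⟩
              d + 14 + σ * 8                     ∎))

          separate-clique : card S ≤ 3 → (∀ {x y} → S x ≡ true → S y ≡ true → x ≢ y → E g x y ≡ true) → K₆⁻-Minor g
          separate-clique few clique = separate few λ { (β , M) → β , model-mono old M }
            where
            old : ∀ {a b} → E sideA a b ≡ true → E g a b ≡ true
            old {a} {b} e with ∨-split {E g a b} (proj₂ (∧-split {Q a ∧ Q b} e))
            ... | inj₁ d = d
            ... | inj₂ d = let p , q = ∧-split {S a ∧ S b} d ; x , y = ∧-split {S a} p in clique x y (≠-sound a b q)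

          -- The missing edge pq is recovered by contracting a further neighbour b of v into p.
          separate-special : ∀ {p q} → S p ≡ true → S q ≡ true → p ≢ q → Special p q → card S ≤ 3 →
                             card ((S ∖ p) ∖ q) ≤ 1 → K₆⁻-Minor g
          separate-special {p} {q} Sp Sq p≢q special few one = separate few lift
            where
            open Special special
            spare : ∃ λ b → E g v b ≡ true × S b ≢ true
            spare with any? (λ b → (E g v b Bool.≟ true) ×-dec ¬? (S b Bool.≟ true))
            ... | yes h = h
            ... | no h = ⊥-elim (from-no (6 ≤? 3) (≤-trans (≤-reflexive (sym degree-six)) (≤-trans
                    (card-mono {f = E g v} {S} λ b e → [ (λ t → t) , (λ f → ⊥-elim (h (b , e , false≢true f))) ]′ (true-or-false (S b))) few)))
            b = proj₁ spare
            vb = proj₁ (proj₂ spare)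
            b∉S = proj₂ (proj₂ spare)
            b≢p : b ≢ p
            b≢p e = b∉S (trans (cong S e) Sp)
            b≢q : b ≢ q
            b≢q e = b∉S (trans (cong S e) Sq)
            pb = proj₁ (full vb b≢p b≢q)
            qb = proj₁ (proj₂ (full vb b≢p b≢q))
            module D = EdgeContraction g {p} {b} pb
            b∉Q : Q b ≢ true
            b∉Q h = [ near∉C vb , b∉S ]′ (∨-split {C b} h)
            in-S : ∀ {x y} → S x ≡ true → S y ≡ true → x ≢ y → E g x y ≡ true ⊎ (x ≡ p × y ≡ q) ⊎ (x ≡ q × y ≡ p)
            in-S {x} {y} Sx Sy x≢y with x ≟ p | x ≟ q | y ≟ p | y ≟ q
            ... | yes refl | _ | yes refl | _ = ⊥-elim (x≢y refl)
            ... | yes refl | _ | _ | yes refl = inj₂ (inj₁ (refl , refl))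
            ... | _ | yes refl | yes refl | _ = inj₂ (inj₂ (refl , refl))
            ... | _ | yes refl | _ | yes refl = ⊥-elim (x≢y refl)
            ... | yes refl | _ | no y≢p | no y≢q = inj₁ (proj₁ (full (S-near Sy) y≢p y≢q))
            ... | _ | yes refl | no y≢p | no y≢q = inj₁ (proj₁ (proj₂ (full (S-near Sy) y≢p y≢q)))
            ... | no x≢p | no x≢q | yes refl | _ = inj₁ (flip g (proj₁ (full (S-near Sx) x≢p x≢q)))
            ... | no x≢p | no x≢q | _ | yes refl = inj₁ (flip g (proj₁ (proj₂ (full (S-near Sx) x≢p x≢q))))
            ... | no x≢p | no x≢q | no y≢p | no y≢q = ⊥-elim (from-no (2 ≤? 1) (≤-trans two one))
              where
              two : 2 ≤ card ((S ∖ p) ∖ q)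
              two = subst (2 ≤_) (sym (card-remove ((S ∖ p) ∖ q) (∖-intro (S ∖ p) (∖-intro S Sx x≢p) x≢q)))
                (s≤s (subst (1 ≤_) (sym (card-remove (((S ∖ p) ∖ q) ∖ x) (∖-intro ((S ∖ p) ∖ q) (∖-intro (S ∖ p) (∖-intro S Sy y≢p) y≢q) (λ e → x≢y (sym e))))) (s≤s z≤n)))
            lift : K₆⁻-Minor sideA → K₆⁻-Minor g
            lift (β , M) = D.contract-minor (β , model-mono convert M)
              where
              convert : ∀ {x y} → E sideA x y ≡ true → D.E′ x y ≡ true
              convert {x} {y} e =
                let inQ , d = ∧-split {Q x ∧ Q y} e
                    Qx , Qy = ∧-split {Q x} inQ
                in by (λ { refl → b∉Q Qx }) (λ { refl → b∉Q Qy }) (∨-split {E g x y} d)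
                where
                by : x ≢ b → y ≢ b → E g x y ≡ true ⊎ Pairs x y ≡ true → D.E′ x y ≡ true
                by x≢b y≢b (inj₁ h) = D.E′-keep x≢b y≢b h
                by x≢b y≢b (inj₂ h) with ∧-split {S x ∧ S y} h
                ... | s , ne with ∧-split {S x} s
                ...   | Sx , Sy with in-S Sx Sy (≠-sound x y ne)
                ...     | inj₁ k = D.E′-keep x≢b y≢b k
                ...     | inj₂ (inj₁ (refl , refl)) = D.E′-new (λ k → p≢q (sym k)) (flip g qb)
                ...     | inj₂ (inj₂ (refl , refl)) = trans (E-sym D.contract-edge q p) (D.E′-new (λ k → p≢q (sym k)) (flip g qb))

          -- If `S` is a clique, it either has four vertices or is a small separator. If not, a
          -- non-adjacent pair gives the minor unless it is special. For a special pair `p`, `q` the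
          -- set `S` is again a small separator, or it contains two more vertices `x`, `y`, and then
          -- a fifth neighbour of `v` helps out.
          attached : K₆⁻-Minor g
          attached with any? (λ s → any? (λ t → ((S s Bool.≟ true) ×-dec (S t Bool.≟ true)) ×-dec (¬? (s ≟ t) ×-dec (E g s t Bool.≟ false))))
          ... | no absent = by-size (list (elements S)) refl
            where
            clique : ∀ {x y} → S x ≡ true → S y ≡ true → x ≢ y → E g x y ≡ true
            clique {x} {y} Sx Sy x≢y = [ (λ t → t) , (λ f → ⊥-elim (absent (x , y , (Sx , Sy) , x≢y , f))) ]′ (true-or-false (E g x y))
            few : ∀ {xs} → list (elements S) ≡ xs → length xs ≤ 3 → card S ≤ 3
            few e l = subst (_≤ 3) (trans (sym (cong length e)) (number (elements S))) l
            by-size : ∀ xs → list (elements S) ≡ xs → K₆⁻-Minor g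
            by-size [] e = separate-clique (few e z≤n) clique
            by-size (_ ∷ []) e = separate-clique (few e (s≤s z≤n)) clique
            by-size (_ ∷ _ ∷ []) e = separate-clique (few e (s≤s (s≤s z≤n))) clique
            by-size (_ ∷ _ ∷ _ ∷ []) e = separate-clique (few e (s≤s (s≤s (s≤s z≤n)))) clique
            by-size (a ∷ b ∷ c ∷ d ∷ _) e
              with subst (AllPairs _≢_) e (distinct (elements S)) | subst (All (λ z → S z ≡ true)) e (All.tabulate (sound (elements S)))
            ... | (ab ∷ ac ∷ ad ∷ _) ∷ (bc ∷ bd ∷ _) ∷ (cd ∷ _) ∷ _ | Sa ∷ Sb ∷ Sc ∷ Sd ∷ _ =
              four-clique ((ab ∷ ac ∷ ad ∷ []) ∷ (bc ∷ bd ∷ []) ∷ (cd ∷ []) ∷ [] ∷ []) (Sa ∷ Sb ∷ Sc ∷ Sd ∷ []) clique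
          ... | yes (p , q , (Sp , Sq) , p≢q , pq) with NonAdjacent.non-adjacent Sp Sq p≢q pq
          ...   | inj₁ m = m
          ...   | inj₂ special = by-size (list rest) refl
            where
            open Special special
            rest = elements ((S ∖ p) ∖ q)
            card-S : card S ≡ 2 + length (list rest)
            card-S = trans (card-remove S Sp) (cong suc (trans (card-remove (S ∖ p) (∖-intro S Sq (λ e → p≢q (sym e)))) (cong suc (sym (number rest)))))
            rest-elim : ∀ {z} → z ∈ list rest → S z ≡ true × z ≢ p × z ≢ q
            rest-elim {z} i = let h , z≢q = ∖-elim (S ∖ p) q z (sound rest i) ; Sz , z≢p = ∖-elim S p z h in Sz , z≢p , z≢q
            few : ∀ {xs} → list rest ≡ xs → length xs ≤ 1 → K₆⁻-Minor g
            few e l = separate-special Sp Sq p≢q special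
              (≤-trans (≤-reflexive card-S) (s≤s (s≤s (subst (_≤ 1) (sym (cong length e)) l))))
              (subst (_≤ 1) (trans (sym (cong length e)) (number rest)) l)
            by-size : ∀ xs → list rest ≡ xs → K₆⁻-Minor g
            by-size [] e = few e z≤n
            by-size (_ ∷ []) e = few e (s≤s z≤n)
            by-size (x ∷ y ∷ _) e
              with rest-elim (subst (x ∈_) (sym e) (here refl)) | rest-elim (subst (y ∈_) (sym e) (there (here refl)))
                 | subst (AllPairs _≢_) e (distinct rest)
            ... | Sx , x≢p , x≢q | Sy , y≢p , y≢q | (x≢y ∷ _) ∷ _ = adjacent-or-not (true-or-false (E g x y))
              where
              -- `v` has six neighbours, and `p`, `q`, `x`, `y` are only four of them.
              spare : ∃ λ b → (E g v b ≡ true × b ≢ p × b ≢ q) × b ≢ x × b ≢ y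
              spare with elements ((((E g v ∖ p) ∖ q) ∖ x) ∖ y)
              ... | el with list el in eq
              ...   | b ∷ _ =
                let h₁ , b≢y = ∖-elim (((E g v ∖ p) ∖ q) ∖ x) y b (sound el (subst (b ∈_) (sym eq) (here refl)))
                    h₂ , b≢x = ∖-elim ((E g v ∖ p) ∖ q) x b h₁
                    h₃ , b≢q = ∖-elim (E g v ∖ p) q b h₂
                    h₄ , b≢p = ∖-elim (E g v) p b h₃
                in b , (h₄ , b≢p , b≢q) , b≢x , b≢y
              ...   | [] = ⊥-elim (from-no (6 ≤? 4) (≤-reflexive (trans (sym degree-six) (trans
                (card-remove (E g v) (S-near Sp)) (cong suc (trans
                (card-remove (E g v ∖ p) (∖-intro (E g v) (S-near Sq) (λ k → p≢q (sym k)))) (cong suc (trans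
                (card-remove ((E g v ∖ p) ∖ q) (∖-intro (E g v ∖ p) (∖-intro (E g v) (S-near Sx) x≢p) x≢q)) (cong suc (trans
                (card-remove (((E g v ∖ p) ∖ q) ∖ x) (∖-intro ((E g v ∖ p) ∖ q) (∖-intro (E g v ∖ p) (∖-intro (E g v) (S-near Sy) y≢p) y≢q) (λ k → x≢y (sym k))))
                (cong suc (trans (sym (number el)) (cong length eq)))))))))))))
              adjacent-or-not : E g x y ≡ true ⊎ E g x y ≡ false → K₆⁻-Minor g
              -- Were `x` and `y` a special pair too, `rich` would give `x` four neighbours around
              -- `v`, while `full` for the pair `p`, `q` allows three.
              adjacent-or-not (inj₂ xy) with NonAdjacent.non-adjacent Sx Sy x≢y xy
              ... | inj₁ m = m
              ... | inj₂ s = ⊥-elim (from-no (4 ≤? 3) (≤-trans (Special.rich s) (proj₂ (proj₂ (full (S-near Sx) x≢p x≢q)))))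
              adjacent-or-not (inj₁ xy) =
                let b , (vb , b≢p , b≢q) , b≢x , b≢y = spare
                    px , qx , _ = full (S-near Sx) x≢p x≢q
                    py , qy , _ = full (S-near Sy) y≢p y≢q
                    pb , qb , _ = full vb b≢p b≢q
                    ≢sym : ∀ {a b : Fin N} → a ≢ b → b ≢ a
                    ≢sym h k = h (sym k)
                in five-special
                  ((p≢q ∷ ≢sym x≢p ∷ ≢sym y≢p ∷ ≢sym b≢p ∷ []) ∷ (≢sym x≢q ∷ ≢sym y≢q ∷ ≢sym b≢q ∷ []) ∷
                   (x≢y ∷ ≢sym b≢x ∷ []) ∷ (≢sym b≢y ∷ []) ∷ [] ∷ [])
                  (S-near Sp ∷ S-near Sq ∷ S-near Sx ∷ S-near Sy ∷ vb ∷ []) (Sp ∷ Sq ∷ Sx ∷ Sy ∷ [])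
                  px py qx qy xy pb qb

-- Induction over dense graphs

module _ {N : ℕ} where

  -- With `degree-sum` equal to 2e this is 2e > 7n - 15, the condition of the theorem without floor
  -- and subtraction.
  Dense : LiveGraph N → Set
  Dense g = 7 * order g ≤ degree-sum g + 14

  degree-sum-bound : ∀ (g : LiveGraph N) {m} → order g ≡ suc m → degree-sum g ≤ m * suc m
  degree-sum-bound g {m} size = ≤-trans (total-mono row) (≤-reflexive (trans (total-* m (b2n ∘ live g)) (cong (m *_) size)))
    where
    row : ∀ a → deg g a ≤ m * b2n (live g a)
    row a with live g a in l
    ... | true = ≤-trans (≤-pred (≤-trans (card-strict {f = E g a} {live g} {a} (λ z e → E-live g (flip g e)) (E-irr g a) l)
                   (≤-reflexive size))) (≤-reflexive (sym (*-identityʳ m)))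
    ... | false = ≤-trans (≤-reflexive (trans (total-cong isolated) (total-0 {N}))) z≤n
      where
      isolated : ∀ z → b2n (E g a z) ≡ 0
      isolated z with E g a z in e
      ... | false = refl
      ... | true  = ⊥-elim (false≢true l (E-live g e))

  -- A complete graph on at most five vertices is not dense.
  dense-order : ∀ (g : LiveGraph N) → 3 ≤ order g → Dense g → 6 ≤ order g
  dense-order g three dense = go (order g) refl three
    where
    absurd : ∀ m → order g ≡ suc m → ¬ 7 * suc m ≤ m * suc m + 14 → ∀ {A : Set} → A
    absurd m e h = ⊥-elim (h (≤-trans (subst (λ o → 7 * o ≤ degree-sum g + 14) e dense) (+-monoˡ-≤ 14 (degree-sum-bound g e))))
    go : ∀ o → order g ≡ o → 3 ≤ o → 6 ≤ o
    go 3 e _ = absurd 2 e (from-no (21 ≤? 20))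
    go 4 e _ = absurd 3 e (from-no (28 ≤? 26))
    go 5 e _ = absurd 4 e (from-no (35 ≤? 34))
    go (suc (suc (suc (suc (suc (suc o)))))) e _ = s≤s (s≤s (s≤s (s≤s (s≤s (s≤s z≤n)))))
    go 0 e ()
    go 1 e (s≤s ())
    go 2 e (s≤s (s≤s ()))

  -- A vertex weighs seven in the density condition, so a loss of one vertex and three edges is
  -- affordable. This covers both the deletion of a vertex of degree at most three and the
  -- contraction of an edge in at most two triangles.
  one-less : ∀ {g h : LiveGraph N} → order g ≡ suc (order h) → degree-sum g ≤ degree-sum h + 6 → Dense g → Dense h
  one-less {g} {h} size loss dense = +-cancelʳ-≤ 7 _ _ (begin
    7 * order h + 7           ≡⟨ solve 1 (λ o → con 7 :* o :+ con 7 := con 7 :* (con 1 :+ o)) refl (order h) ⟩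
    7 * suc (order h)         ≡⟨ cong (7 *_) (sym size) ⟩
    7 * order g               ≤⟨ dense ⟩
    degree-sum g + 14         ≤⟨ +-monoˡ-≤ 14 loss ⟩
    degree-sum h + 6 + 14     ≡⟨ solve 1 (λ d → d :+ con 6 :+ con 14 := d :+ con 14 :+ con 6) refl (degree-sum h) ⟩
    degree-sum h + 14 + 6     ≤⟨ +-monoʳ-≤ (degree-sum h + 14) (n≤1+n 6) ⟩
    degree-sum h + 14 + 7     ∎)
    where open ≤-Reasoning

  reduce : (g : LiveGraph N) →
           (∀ h → order h < order g → 3 ≤ order h → Dense h → K₆⁻-Minor h) →
           (∀ h → order h ≡ order g → degree-sum h < degree-sum g → Dense h → K₆⁻-Minor h) →
           3 ≤ order g → Dense g → K₆⁻-Minor g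
  -- The 2 is the cost of deleting one edge. If no edge can be spared, `degree-sum g` is below 7n -
  -- 12, which is incompatible with minimum degree seven and so yields the vertex of degree at most
  -- six.
  reduce g smaller sparser three dense with 7 * order g + 2 ≤? degree-sum g + 14
  ... | yes extra = drop-edge (any? (λ a → any? (λ b → E g a b Bool.≟ true)))
    where
    drop-edge : Dec (∃ λ a → ∃ λ b → E g a b ≡ true) → K₆⁻-Minor g
    drop-edge (yes (a , b , e)) = delete-edge-minor (sparser delete-edge refl delete-edge-fewer
      (+-cancelʳ-≤ 2 _ _ (≤-trans extra (≤-trans (+-monoˡ-≤ 14 delete-edge-degrees)
        (≤-reflexive (solve 1 (λ d → d :+ con 2 :+ con 14 := d :+ con 14 :+ con 2) refl (degree-sum delete-edge)))))))
      where open EdgeDeletion g e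
    drop-edge (no absent) = ⊥-elim (from-no (23 ≤? 14) (≤-trans (+-monoˡ-≤ 2 (*-monoʳ-≤ 7 three)) (≤-trans extra (≤-reflexive (cong (_+ 14) no-degrees)))))
      where
      no-degrees : degree-sum g ≡ 0
      no-degrees = trans (total-cong λ a → trans (total-cong λ b → isolated a b) (total-0 {N})) (total-0 {N})
        where
        isolated : ∀ a b → b2n (E g a b) ≡ 0
        isolated a b with E g a b in e
        ... | false = refl
        ... | true  = ⊥-elim (absent (a , b , e))
  ... | no sparse with any? (λ a → (live g a Bool.≟ true) ×-dec (deg g a ≤? 3))
  ...   | yes (a , l , d) = restrict-minor g (λ z → not (z == a)) (smaller (delete g a)
            (≤-reflexive (sym (delete-order g l)))
            (≤-trans (s≤s (s≤s (s≤s z≤n))) (≤-pred (subst (6 ≤_) (delete-order g l) (dense-order g three dense))))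
            (one-less {g} {delete g a} (delete-order g l) (≤-trans (delete-degrees g a) (+-monoʳ-≤ _ (*-monoʳ-≤ 2 d))) dense))
  ...   | no min with any? (λ a → any? (λ b → (E g a b Bool.≟ true) ×-dec (common g a b ≤? 2)))
  ...     | yes (a , b , e , c) = contract-minor (smaller contract-edge (≤-reflexive (sym contract-order))
              (≤-trans (s≤s (s≤s (s≤s z≤n))) (≤-pred (subst (6 ≤_) contract-order (dense-order g three dense))))
              (one-less {g} {contract-edge} contract-order (≤-trans contract-degrees (+-monoʳ-≤ _ (*-monoʳ-≤ 2 (s≤s c)))) dense))
    where open EdgeContraction g e
  ...     | no tri with any? (λ a → (live g a Bool.≟ true) ×-dec (deg g a ≤? 6))
  ...       | no high = ⊥-elim (sparse (≤-trans (+-monoˡ-≤ 2 many) (+-monoʳ-≤ (degree-sum g) (s≤s (s≤s z≤n)))))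
    where
    many : 7 * order g ≤ degree-sum g
    many = ≤-trans (≤-reflexive (sym (total-* 7 (b2n ∘ live g)))) (total-mono row)
      where
      row : ∀ a → 7 * b2n (live g a) ≤ deg g a
      row a with live g a in l
      ... | false = z≤n
      ... | true  = ≰⇒> (λ d → high (a , l , d))
  ...       | yes (v , v-live , six) with any? (λ z → ((live g z Bool.≟ true) ×-dec ¬? (z ≟ v)) ×-dec ¬? (E g v z Bool.≟ true))
  ...         | no absent = Around.Dominating.small g v triangles all-near (dense-order g three dense) six dense
                  (trans (card-remove (live g) v-live) (cong suc (total-cong λ z → cong b2n (same z))))
    where
    triangles : ∀ {a b} → E g a b ≡ true → 3 ≤ common g a b
    triangles e = ≰⇒> (λ c → tri (_ , _ , e , c))
    all-near : ∀ z → live g z ≡ true → z ≡ v ⊎ E g v z ≡ true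
    all-near z l with z ≟ v | true-or-false (E g v z)
    ... | yes p | _      = inj₁ p
    ... | no _  | inj₁ e = inj₂ e
    ... | no p  | inj₂ e = ⊥-elim (absent (z , (l , p) , false≢true e))
    same : ∀ z → (live g ∖ v) z ≡ E g v z
    same z with true-or-false (E g v z)
    ... | inj₁ e = trans (∖-intro (live g) (E-live g (flip g e)) (λ { refl → apart g e refl })) (sym e)
    ... | inj₂ e with true-or-false ((live g ∖ v) z)
    ...   | inj₂ f = trans f (sym e)
    ...   | inj₁ t = let l , p = ∖-elim (live g) v z t in ⊥-elim (absent (z , (l , p) , false≢true e))
  ...         | yes (r , (r-live , r≢v) , vr) =
                  Around.Attached.Separate.attached g v triangles (component g R r∈R) far
                    (≰⇒> (λ d → min (v , v-live , d))) six cover (λ {z} h → proj₁ (∖-elim (live g) v z (proj₁ (∧-split {(live g ∖ v) z} h)))) v-live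
                    (≰⇒> (λ d → min (r , r-live , d))) dense smaller
    where
    triangles : ∀ {a b} → E g a b ≡ true → 3 ≤ common g a b
    triangles e = ≰⇒> (λ c → tri (_ , _ , e , c))
    R : Fin N → Bool
    R z = (live g ∖ v) z ∧ not (E g v z)
    r∈R : R r ≡ true
    r∈R = cong₂ _∧_ (∖-intro (live g) r-live r≢v) (not-true⁻¹ vr)
    far : ∀ {z} → R z ≡ true → z ≢ v × E g v z ≢ true
    far {z} h = let p , q = ∧-split {(live g ∖ v) z} h in proj₂ (∖-elim (live g) v z p) , not-true q
    cover : ∀ {z} → live g z ≡ true → z ≢ v → E g v z ≢ true → R z ≡ true
    cover l p q = cong₂ _∧_ (∖-intro (live g) l p) (not-true⁻¹ q)

  -- Lexicographic induction on order and degree sum: deleting an edge keeps the order, while every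
  -- other reduction decreases it and may lead to any degree sum, as completing a separator adds
  -- edges.
  dense-minor : (g : LiveGraph N) → 3 ≤ order g → Dense g → K₆⁻-Minor g
  dense-minor g = <-rec Holds by-order (order g) g refl
    where
    Holds : ℕ → Set
    Holds o = ∀ (g : LiveGraph N) → order g ≡ o → 3 ≤ order g → Dense g → K₆⁻-Minor g
    by-order : ∀ o → (∀ {o′} → o′ < o → Holds o′) → Holds o
    by-order o IH g refl = <-rec Sparse by-degrees (degree-sum g) g refl refl
      where
      Sparse : ℕ → Set
      Sparse d = ∀ (h : LiveGraph N) → degree-sum h ≡ d → order h ≡ o → 3 ≤ order h → Dense h → K₆⁻-Minor h
      by-degrees : ∀ d → (∀ {d′} → d′ < d → Sparse d′) → Sparse d
      by-degrees d IH′ h refl size three = reduce h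
        (λ h′ lt → IH (subst (order h′ <_) size lt) h′ refl)
        (λ h′ same lt → IH′ lt h′ refl (trans same size) (subst (3 ≤_) (sym same) three)) three

-- The lower bound

full-graph : ∀ {n} → Graph n → LiveGraph n
full-graph G = record
  { E = adj G ; live = λ _ → true ; E-sym = Graph.sym G ; E-irr = Graph.irrefl G ; E-live = λ _ → refl }

full-order : ∀ {n} (G : Graph n) → order (full-graph G) ≡ n
full-order {zero}  G = refl
full-order {suc n} G = cong suc (ones n)
  where
  ones : ∀ n → total {n} (λ _ → 1) ≡ n
  ones zero    = refl
  ones (suc n) = cong suc (ones n)

forward : ∀ {n} → Graph n → Fin n → Fin n → Bool
forward G i j = (toℕ i <ᵇ toℕ j) ∧ adj G i j

edgeCount-total : ∀ {n} (G : Graph n) → edgeCount G ≡ total (λ i → card (forward G i))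
edgeCount-total {n} G = trans (sum-allFin (λ i → sum (map (b2n ∘ forward G i) (allFin n)))) (total-cong λ i → sum-allFin (b2n ∘ forward G i))

handshake : ∀ {n} (G : Graph n) → edgeCount G + edgeCount G ≤ degree-sum (full-graph G)
handshake G = begin
  edgeCount G + edgeCount G
    ≡⟨ cong₂ _+_ (edgeCount-total G) (trans (edgeCount-total G) (total-swap (λ i j → b2n (forward G i j)))) ⟩
  total (λ i → card (forward G i)) + total (λ i → card (λ j → forward G j i))
    ≡⟨ sym (total-+ (λ i → card (forward G i)) _) ⟩
  total (λ i → card (forward G i) + card (λ j → forward G j i))
    ≤⟨ total-mono (λ i → ≤-trans (≤-reflexive (sym (total-+ (b2n ∘ forward G i) _))) (total-mono (entry i))) ⟩
  degree-sum (full-graph G) ∎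
  where
  open ≤-Reasoning
  one-way : ∀ m n a → b2n ((m <ᵇ n) ∧ a) + b2n ((n <ᵇ m) ∧ a) ≤ b2n a
  one-way zero    zero    a = z≤n
  one-way zero    (suc n) a = ≤-reflexive (+-identityʳ (b2n a))
  one-way (suc m) zero    a = ≤-refl
  one-way (suc m) (suc n) a = one-way m n a
  entry : ∀ i j → b2n (forward G i j) + b2n (forward G j i) ≤ b2n (adj G i j)
  entry i j = subst (λ a → b2n (forward G i j) + b2n ((toℕ j <ᵇ toℕ i) ∧ a) ≤ b2n (adj G i j)) (Graph.sym G i j)
                (one-way (toℕ i) (toℕ j) (adj G i j))

-- The remainder modulo 2 is at most 1, so `suc m` is at most twice `suc (m / 2)`.
half-bound : ∀ {m e} → m / 2 < e → suc m ≤ e + e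
half-bound {m} {e} h = begin
  suc m                         ≡⟨ cong suc (m≡m%n+[m/n]*n m 2) ⟩
  suc (m % 2) + (m / 2) * 2     ≤⟨ +-monoˡ-≤ ((m / 2) * 2) (m%n<n m 2) ⟩
  suc (m / 2) * 2               ≤⟨ *-monoˡ-≤ 2 h ⟩
  e * 2                         ≡⟨ *-comm e 2 ⟩
  e + (e + 0)                   ≡⟨ cong (e +_) (+-identityʳ e) ⟩
  e + e                         ∎
  where open ≤-Reasoning

lower-bound : (n : ℕ) → 3 ≤ n → (G : Graph n) → (7 * n ∸ 15) / 2 < edgeCount G →
              (m : ℕ) (H : Graph m) → IsSubdivision G H → ¬ TwwAtMost 3 H
lower-bound n three G many m H S = subdivision-bound S (proj₂ minor)
  where
  open ≤-Reasoning
  dense : 7 * n ≤ degree-sum (full-graph G) + 14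
  dense = begin
    7 * n                                  ≤⟨ m≤n+m∸n (7 * n) 15 ⟩
    15 + (7 * n ∸ 15)                      ≡⟨ +-comm 15 _ ⟩
    7 * n ∸ 15 + 15                        ≡⟨ +-suc (7 * n ∸ 15) 14 ⟩
    suc (7 * n ∸ 15) + 14                  ≤⟨ +-monoˡ-≤ 14 (≤-trans (half-bound many) (handshake G)) ⟩
    degree-sum (full-graph G) + 14         ∎
  minor : K₆⁻-Minor (full-graph G)
  minor = dense-minor (full-graph G) (subst (3 ≤_) (sym (full-order G)) three)
    (subst (λ o → 7 * o ≤ degree-sum (full-graph G) + 14) (sym (full-order G)) dense)

-- Contraction sequences from labellings

remove : ∀ {A : Set} {x : A} (ys : List A) → x ∈ ys → List A
remove (y ∷ ys) (here _)  = ys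
remove (y ∷ ys) (there i) = y ∷ remove ys i

length-remove : ∀ {A : Set} {x : A} {ys} (i : x ∈ ys) → length ys ≡ suc (length (remove ys i))
length-remove (here _)  = refl
length-remove (there i) = cong suc (length-remove i)

∈-remove : ∀ {A : Set} {x y : A} {ys} (i : x ∈ ys) → y ∈ ys → y ≢ x → y ∈ remove ys i
∈-remove (here refl) (here refl) y≢x = ⊥-elim (y≢x refl)
∈-remove (here _)    (there j)   y≢x = j
∈-remove (there i)   (here e)    y≢x = here e
∈-remove (there i)   (there j)   y≢x = there (∈-remove i j y≢x)

injection-length : ∀ {A B : Set} (f : A → B) (xs : List A) (ys : List B) → AllPairs _≢_ xs →
                   (∀ {x x′} → x ∈ xs → x′ ∈ xs → f x ≡ f x′ → x ≡ x′) → (∀ {x} → x ∈ xs → f x ∈ ys) → length xs ≤ length ys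
injection-length f []       ys _        _   _ = z≤n
injection-length f (x ∷ xs) ys (d ∷ ds) inj h = ≤-trans
  (s≤s (injection-length f xs (remove ys (h (here refl))) ds (λ i j → inj (there i) (there j))
    (λ i → ∈-remove (h (here refl)) (h (there i)) (λ e → All.lookup d i (sym (inj (there i) (here refl) e))))))
  (≤-reflexive (sym (length-remove (h (here refl)))))

module Labelled {m : ℕ} (H : Graph m) {Λ : Set} (eq : Λ → Λ → Bool)
                (eq-sound : ∀ {x y} → eq x y ≡ true → x ≡ y) (eq-refl : ∀ x → eq x x ≡ true)
                (Merged : Λ → Set) where

  _≟ˡ_ : (x y : Λ) → Dec (x ≡ y)
  x ≟ˡ y with eq x y in e
  ... | true  = yes (eq-sound e)
  ... | false = no λ { refl → false≢true e (eq-refl x) }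

  rename : Λ → Λ → Λ → Λ
  rename l₁ l₂ l = if eq l l₁ then l₂ else l

  rename-hit : ∀ l₁ l₂ → rename l₁ l₂ l₁ ≡ l₂
  rename-hit l₁ l₂ rewrite eq-refl l₁ = refl

  rename-miss : ∀ {l₁ l₂ l} → l ≢ l₁ → rename l₁ l₂ l ≡ l
  rename-miss {l₁} {l₂} {l} ne with eq l l₁ in e
  ... | true  = ⊥-elim (ne (eq-sound e))
  ... | false = refl

  -- The vertices of `T` are the nonempty fibres of `ρ`. Colours are bounded from above only: an
  -- edge of `T` comes from an edge of `H`, and a red edge has an end whose part contains two
  -- vertices. This passes to contractions and is enough to bound red degrees.
  record Realizes {k} (T : Trigraph k) (ρ : Fin m → Λ) : Set where
    field
      σ        : Fin m → Fin k
      onto     : ∀ x → ∃ λ a → σ a ≡ x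
      σ⇒ρ      : ∀ {a b} → σ a ≡ σ b → ρ a ≡ ρ b
      ρ⇒σ      : ∀ {a b} → ρ a ≡ ρ b → σ a ≡ σ b
      diagonal : ∀ x → T x x ≡ none
      symm     : ∀ x y → T x y ≡ T y x
      edge     : ∀ {x y} → T x y ≢ none → ∃₂ λ a b → σ a ≡ x × σ b ≡ y × Edge H a b
      red-part : ∀ {x y} → T x y ≡ red → ∃₂ λ a b → a ≢ b × σ a ≡ σ b × (σ a ≡ x ⊎ σ a ≡ y)

  record Good (ρ : Fin m → Λ) : Set where
    field
      nb       : Λ → List Λ
      nb≤3     : ∀ l → length (nb l) ≤ 3
      unmerged : ∀ {a b} → ρ a ≡ ρ b → ¬ Merged (ρ a) → a ≡ b
      merged?  : ∀ l → Dec (Merged l)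
      covered  : ∀ {a b} → Edge H a b →
                 ρ a ≡ ρ b ⊎ (¬ Merged (ρ a) × ¬ Merged (ρ b)) ⊎ ρ b ∈ nb (ρ a)

  good-ext : ∀ {ρ ρ′} → (∀ a → ρ′ a ≡ ρ a) → Good ρ → Good ρ′
  good-ext {ρ} {ρ′} h G = record
    { nb = nb ; nb≤3 = nb≤3 ; merged? = merged?
    ; unmerged = λ {a} {b} e nm → unmerged (trans (sym (h a)) (trans e (h b))) (subst (λ l → ¬ Merged l) (h a) nm)
    ; covered = λ {a} {b} e → cov a b (covered e) }
    where
    open Good G
    cov : ∀ a b → ρ a ≡ ρ b ⊎ (¬ Merged (ρ a) × ¬ Merged (ρ b)) ⊎ ρ b ∈ nb (ρ a) →
          ρ′ a ≡ ρ′ b ⊎ (¬ Merged (ρ′ a) × ¬ Merged (ρ′ b)) ⊎ ρ′ b ∈ nb (ρ′ a)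
    cov a b rewrite h a | h b = λ x → x

  -- Distinct vertices of `T` have distinct labels, so the red neighbours of `x` inject into a list
  -- of length at most three.
  low-degree : ∀ {k} {T : Trigraph k} {ρ} → Realizes T ρ → Good ρ → MaxRedDeg≤ 3 T
  low-degree {k} {T} {ρ} R G x = ≤-trans (≤-reflexive (trans (sum-allFin (b2n ∘ P)) (sym (number el)))) (≤-trans
    (injection-length name (list el) (nb (name x)) (distinct el)
      (λ {y} {z} _ _ e → trans (sym (proj₂ (onto y))) (trans (ρ⇒σ e) (proj₂ (onto z)))) near) (nb≤3 (name x)))
    where
    open Realizes R
    open Good G
    name : Fin k → Λ
    name y = ρ (proj₁ (onto y))
    name-σ : ∀ {a y} → σ a ≡ y → ρ a ≡ name y
    name-σ {a} {y} e = σ⇒ρ (trans e (sym (proj₂ (onto y))))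
    P : Fin k → Bool
    P y = isRed (T x y)
    el = elements P
    is-red : ∀ {c} → isRed c ≡ true → c ≡ red
    is-red {red} _ = refl
    red≢none : ∀ {c} → c ≡ red → c ≢ none
    red≢none refl ()
    near : ∀ {y} → y ∈ list el → name y ∈ nb (name x)
    near {y} i with is-red (sound el i)
    ... | r with edge (red≢none r)
    ...   | a , b , ax , by , e with covered e
    ...     | inj₁ same = ⊥-elim (red≢none r (trans (cong (T x) (trans (sym by) (trans (sym (ρ⇒σ same)) ax))) (diagonal x)))
    ...     | inj₂ (inj₂ h) = subst (λ l → l ∈ nb (name x)) (name-σ by) (subst (λ l → ρ b ∈ nb l) (name-σ ax) h)
    ...     | inj₂ (inj₁ (na , nb′)) with red-part r
    ...       | c , d , c≢d , same , inj₁ cx = ⊥-elim (c≢d (unmerged (σ⇒ρ same)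
                  (subst (λ l → ¬ Merged l) (trans (name-σ ax) (sym (name-σ cx))) na)))
    ...       | c , d , c≢d , same , inj₂ cy = ⊥-elim (c≢d (unmerged (σ⇒ρ same)
                  (subst (λ l → ¬ Merged l) (trans (name-σ by) (sym (name-σ cy))) nb′)))

  -- A labelling determines the parts but not their numbering, nor all colours; hence the
  -- quantification over all trigraphs that realise it.
  Reducible : (Fin m → Λ) → Set
  Reducible ρ = ∀ {k} {T : Trigraph k} → Realizes T ρ → ContractionSeq 3 T

  same-kernel : ∀ {ρ ρ′} → (∀ {a b} → ρ a ≡ ρ b → ρ′ a ≡ ρ′ b) → (∀ {a b} → ρ′ a ≡ ρ′ b → ρ a ≡ ρ b) → Reducible ρ′ → Reducible ρ
  same-kernel to from next-seq R = next-seq record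
    { σ = σ ; onto = onto ; σ⇒ρ = to ∘ σ⇒ρ ; ρ⇒σ = ρ⇒σ ∘ from ; diagonal = diagonal ; symm = symm ; edge = edge ; red-part = red-part }
    where open Realizes R

  reducible-ext : ∀ {ρ ρ′} → (∀ a → ρ a ≡ ρ′ a) → Reducible ρ′ → Reducible ρ
  reducible-ext h = same-kernel (λ {a} {b} e → trans (sym (h a)) (trans e (h b))) (λ {a} {b} e → trans (h a) (trans e (sym (h b))))

  constant : ∀ {ρ} → (∀ a b → ρ a ≡ ρ b) → Reducible ρ
  constant h {zero}        R = done z≤n
  constant h {suc zero}    R = done (s≤s z≤n)
  constant h {suc (suc k)} R with onto zero | onto (suc zero)
    where open Realizes R
  ... | a , p | b , q with trans (sym p) (trans (Realizes.ρ⇒σ R (h a b)) q)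
  ...   | ()

  module Merge {k} {T : Trigraph (suc k)} {ρ} (R : Realizes T ρ) {l₁ l₂ : Λ} (l₁≢l₂ : l₁ ≢ l₂)
               {p q : Fin m} (p-l₂ : ρ p ≡ l₂) (q-l₁ : ρ q ≡ l₁) where
    open Realizes R
    u = σ p
    v = σ q

    u≢v : u ≢ v
    u≢v e = l₁≢l₂ (trans (sym q-l₁) (trans (sym (σ⇒ρ e)) p-l₂))

    module C = Contraction T symm u v u≢v
    open C using (T′; x; in₋; out; in-out; in-x; in≢v; both-other; left-new; right-new; both-new; T′-sym)

    σ′ : Fin m → Fin k
    σ′ a with σ a ≟ v
    ... | yes _ = x
    ... | no d  = out d

    σ′-v : ∀ {a} → σ a ≡ v → σ′ a ≡ x
    σ′-v {a} e with σ a ≟ v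
    ... | yes _ = refl
    ... | no d  = ⊥-elim (d e)

    σ′-in : ∀ {a} → σ a ≢ v → in₋ (σ′ a) ≡ σ a
    σ′-in {a} d with σ a ≟ v
    ... | yes e = ⊥-elim (d e)
    ... | no d′ = in-out d′

    ρ′ : Fin m → Λ
    ρ′ a = rename l₁ l₂ (ρ a)

    on-v : ∀ {a} → σ a ≡ v → ρ′ a ≡ l₂
    on-v e = trans (cong (rename l₁ l₂) (trans (σ⇒ρ e) q-l₁)) (rename-hit l₁ l₂)

    off-v : ∀ {a} → σ a ≢ v → ρ′ a ≡ ρ a
    off-v d = rename-miss (λ e → d (ρ⇒σ (trans e (sym q-l₁))))

    l₂-on-u : ∀ {a} → ρ a ≡ l₂ → σ a ≡ u
    l₂-on-u e = ρ⇒σ (trans e (sym p-l₂))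

    x-of-u : ∀ {a} → σ a ≡ u → σ′ a ≡ x
    x-of-u e = punchIn-injective v _ _ (trans (σ′-in (λ d → u≢v (trans (sym e) d))) (trans e (sym in-x)))

    from-in : ∀ {a y} → σ a ≡ in₋ y → σ′ a ≡ y
    from-in {a} {y} e = punchIn-injective v _ _ (trans (σ′-in (λ d → in≢v y (trans (sym e) d))) e)

    lift-edge : ∀ {y z} → T′ y z ≢ none → ∃₂ λ a b → σ′ a ≡ y × σ′ b ≡ z × Edge H a b
    lift-edge {y} {z} e = go (in₋ y ≟ u) (in₋ z ≟ u)
      where
      some-new : ∀ {c d} → merge c d ≢ none → c ≢ none ⊎ d ≢ none
      some-new {c} {d} h with c ≟ᶜ none | d ≟ᶜ none
      ... | no p  | _     = inj₁ p
      ... | yes _ | no q  = inj₂ q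
      ... | yes refl | yes refl = ⊥-elim (h refl)
      to-y : ∀ {w} → in₋ w ≡ u → ∀ {a} → σ a ≡ u ⊎ σ a ≡ v → σ′ a ≡ w
      to-y {w} p (inj₁ q) = trans (x-of-u q) (punchIn-injective v _ _ (trans in-x (sym p)))
      to-y {w} p (inj₂ q) = trans (σ′-v q) (punchIn-injective v _ _ (trans in-x (sym p)))
      go : Dec (in₋ y ≡ u) → Dec (in₋ z ≡ u) → ∃₂ λ a b → σ′ a ≡ y × σ′ b ≡ z × Edge H a b
      go (yes p) (yes q) = ⊥-elim (e (both-new p q))
      go (no p) (no q) = let a , b , ay , bz , h = edge (λ d → e (trans (both-other p q) d)) in a , b , from-in ay , from-in bz , h
      go (yes p) (no q) with some-new (λ d → e (trans (left-new p q) d))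
      ... | inj₁ t = let a , b , ay , bz , h = edge t in a , b , to-y p (inj₁ ay) , from-in bz , h
      ... | inj₂ t = let a , b , ay , bz , h = edge t in a , b , to-y p (inj₂ ay) , from-in bz , h
      go (no p) (yes q) with some-new (λ d → e (trans (right-new p q) d))
      ... | inj₁ t = let a , b , ay , bz , h = edge t in a , b , from-in ay , to-y q (inj₁ bz) , h
      ... | inj₂ t = let a , b , ay , bz , h = edge t in a , b , from-in ay , to-y q (inj₂ bz) , h

    merged-realizes : Realizes T′ ρ′
    merged-realizes = record
      { σ = σ′
      ; onto = λ y → let a , e = onto (in₋ y) in a , from-in e
      ; σ⇒ρ = λ {a} {b} e → forth a b e (σ a ≟ v) (σ b ≟ v)
      ; ρ⇒σ = λ {a} {b} e → back a b e (σ a ≟ v) (σ b ≟ v)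
      ; diagonal = diag
      ; symm = T′-sym
      ; edge = lift-edge
      ; red-part = red-lift
      }
      where
      at-x : ∀ {a} → σ′ a ≡ x → σ a ≢ v → ρ a ≡ l₂
      at-x {a} e d = trans (σ⇒ρ (trans (sym (σ′-in d)) (trans (cong in₋ e) in-x))) p-l₂
      forth : ∀ a b → σ′ a ≡ σ′ b → Dec (σ a ≡ v) → Dec (σ b ≡ v) → ρ′ a ≡ ρ′ b
      forth a b e (yes i) (yes j) = trans (on-v i) (sym (on-v j))
      forth a b e (no i) (no j) = trans (off-v i) (trans (σ⇒ρ (trans (sym (σ′-in i)) (trans (cong in₋ e) (σ′-in j)))) (sym (off-v j)))
      forth a b e (yes i) (no j) = trans (on-v i) (sym (trans (off-v j) (at-x (trans (sym e) (σ′-v i)) j)))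
      forth a b e (no i) (yes j) = trans (trans (off-v i) (at-x (trans e (σ′-v j)) i)) (sym (on-v j))
      back : ∀ a b → ρ′ a ≡ ρ′ b → Dec (σ a ≡ v) → Dec (σ b ≡ v) → σ′ a ≡ σ′ b
      back a b e (yes i) (yes j) = trans (σ′-v i) (sym (σ′-v j))
      back a b e (no i) (no j) = punchIn-injective v _ _ (trans (σ′-in i) (trans (ρ⇒σ (trans (sym (off-v i)) (trans e (off-v j)))) (sym (σ′-in j))))
      back a b e (yes i) (no j) = trans (σ′-v i) (sym (x-of-u (l₂-on-u (trans (sym (off-v j)) (trans (sym e) (on-v i))))))
      back a b e (no i) (yes j) = trans (x-of-u (l₂-on-u (trans (sym (off-v i)) (trans e (on-v j))))) (sym (σ′-v j))
      diag : ∀ y → T′ y y ≡ none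
      diag y = go (in₋ y ≟ u)
        where
        go : Dec (in₋ y ≡ u) → T′ y y ≡ none
        go (yes e) = both-new e e
        go (no d) = trans (both-other d d) (diagonal (in₋ y))
      new-part : ∀ {w} → in₋ w ≡ u → ∃₂ λ a b → a ≢ b × σ′ a ≡ σ′ b × σ′ a ≡ w
      new-part e = p , q , (λ { refl → u≢v refl }) , trans (x-of-u refl) (sym (σ′-v refl)) ,
                   trans (x-of-u refl) (punchIn-injective v _ _ (trans in-x (sym e)))
      red-lift : ∀ {y z} → T′ y z ≡ red → ∃₂ λ a b → a ≢ b × σ′ a ≡ σ′ b × (σ′ a ≡ y ⊎ σ′ a ≡ z)
      red-lift {y} {z} r = go (in₋ y ≟ u) (in₋ z ≟ u)
        where
        go : Dec (in₋ y ≡ u) → Dec (in₋ z ≡ u) → ∃₂ λ a b → a ≢ b × σ′ a ≡ σ′ b × (σ′ a ≡ y ⊎ σ′ a ≡ z)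
        go (yes i) _ = let a , b , d , s , w = new-part i in a , b , d , s , inj₁ w
        go _ (yes j) = let a , b , d , s , w = new-part j in a , b , d , s , inj₂ w
        go (no i) (no j) with red-part (trans (sym (both-other i j)) r)
        ... | a , b , d , s , inj₁ w = a , b , d , trans (from-in w) (sym (from-in (trans (sym s) w))) , inj₁ (from-in w)
        ... | a , b , d , s , inj₂ w = a , b , d , trans (from-in w) (sym (from-in (trans (sym s) w))) , inj₂ (from-in w)

  -- A contraction takes place only if both labels are carried by some vertex. Otherwise the
  -- partition is unchanged and no step is made, so that one schedule also serves graphs in which
  -- some vertices or parts are absent.
  rename-step : ∀ {ρ ρ′} l₁ l₂ → l₁ ≢ l₂ → (∀ a → ρ′ a ≡ rename l₁ l₂ (ρ a)) → Good ρ′ → Reducible ρ′ → Reducible ρ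
  rename-step {ρ} {ρ′} l₁ l₂ l₁≢l₂ h good next-seq {k} {T} R with any? (λ a → ρ a ≟ˡ l₂) | any? (λ a → ρ a ≟ˡ l₁)
  ... | _ | no none₁ = reducible-ext (λ a → sym (trans (h a) (rename-miss (λ e → none₁ (a , e))))) next-seq R
  ... | no none₂ | yes _ = same-kernel (λ {a} {b} e → trans (h a) (trans (cong (rename l₁ l₂) e) (sym (h b))))
          (λ {a} {b} e → injective a b (trans (sym (h a)) (trans e (h b)))) next-seq R
    where
    injective : ∀ a b → rename l₁ l₂ (ρ a) ≡ rename l₁ l₂ (ρ b) → ρ a ≡ ρ b
    injective a b e with ρ a ≟ˡ l₁ | ρ b ≟ˡ l₁
    ... | yes i | yes j = trans i (sym j)
    ... | no i  | no j  = trans (sym (rename-miss i)) (trans e (rename-miss j))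
    ... | yes i | no j  = ⊥-elim (none₂ (b , trans (sym (rename-miss j)) (trans (sym e) (trans (cong (rename l₁ l₂) i) (rename-hit l₁ l₂)))))
    ... | no i  | yes j = ⊥-elim (none₂ (a , trans (sym (rename-miss i)) (trans e (trans (cong (rename l₁ l₂) j) (rename-hit l₁ l₂)))))
  rename-step {ρ} {ρ′} l₁ l₂ l₁≢l₂ h good next-seq {k} {T} R | yes (p , p-l₂) | yes (q , q-l₁) = merge-two k T R
    where
    merge-two : ∀ k (T : Trigraph k) → Realizes T ρ → ContractionSeq 3 T
    merge-two zero T R = done z≤n
    merge-two (suc zero) T R = done (s≤s z≤n)
    merge-two (suc (suc k)) T R = step (M.u) (M.v) M.u≢v (low-degree real good) (next-seq real)
      where
      module M = Merge R l₁≢l₂ {p} {q} p-l₂ q-l₁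
      real : Realizes (contract T M.u M.v M.u≢v) ρ′
      real = record
        { σ = σ ; onto = onto
        ; σ⇒ρ = λ {a} {b} e → trans (h a) (trans (σ⇒ρ e) (sym (h b)))
        ; ρ⇒σ = λ {a} {b} e → ρ⇒σ (trans (sym (h a)) (trans e (h b)))
        ; diagonal = diagonal ; symm = symm ; edge = edge ; red-part = red-part }
        where open Realizes M.merged-realizes

-- The extremal graphs and the schedule of their contractions

double : ℕ → ℕ
double zero    = 0
double (suc j) = suc (suc (double j))

paired : ℕ → ℕ → Bool
paired zero          (suc zero)    = true
paired (suc (suc a)) (suc (suc b)) = paired a b
paired _             _             = false

paired-elim : ∀ a b → paired a b ≡ true → ∃ λ i → a ≡ double i × b ≡ suc (double i)
paired-elim zero          (suc zero)    _ = 0 , refl , refl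
paired-elim (suc (suc a)) (suc (suc b)) h =
  let i , p , q = paired-elim a b h in suc i , cong (2 +_) p , cong (2 +_) q

-- Three hubs 0, 1, 2, joined to each other and to all other vertices, which are paired up.
forwardᵇ : ℕ → ℕ → Bool
forwardᵇ (suc (suc (suc u))) (suc (suc (suc v))) = paired u v
forwardᵇ (suc (suc (suc u))) _                   = false
forwardᵇ _                   _                   = true

cockadeᵇ : ℕ → ℕ → Bool
cockadeᵇ u v = (u <ᵇ v) ∧ forwardᵇ u v ∨ (v <ᵇ u) ∧ forwardᵇ v u

<ᵇ-irrefl : ∀ u → (u <ᵇ u) ≡ false
<ᵇ-irrefl zero    = refl
<ᵇ-irrefl (suc u) = <ᵇ-irrefl u

cockade : ∀ n → Graph n
cockade n = record
  { adj    = λ i j → cockadeᵇ (toℕ i) (toℕ j)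
  ; sym    = λ i j → ∨-comm ((toℕ i <ᵇ toℕ j) ∧ forwardᵇ (toℕ i) (toℕ j)) _
  ; irrefl = λ i → cong (λ b → b ∧ forwardᵇ (toℕ i) (toℕ i) ∨ b ∧ forwardᵇ (toℕ i) (toℕ i)) (<ᵇ-irrefl (toℕ i))
  }

-- `B w` is a branch vertex and `R u v i` the inner vertex number `i` of the path from `u` to `v`,
-- both still single. `P h` is the part between hub `h` and the current pair, `F` a temporary part,
-- and `X` the part that finally contains everything.
data Label : Set where
  B : ℕ → Label
  R : ℕ → ℕ → ℕ → Label
  P : ℕ → Label
  F X : Label

eqᴸ : Label → Label → Bool
eqᴸ (B a)     (B b)        = a ≡ᵇ b
eqᴸ (R a b c) (R a′ b′ c′) = (a ≡ᵇ a′) ∧ (b ≡ᵇ b′) ∧ (c ≡ᵇ c′)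
eqᴸ (P a)     (P b)        = a ≡ᵇ b
eqᴸ F         F            = true
eqᴸ X         X            = true
eqᴸ _         _            = false

≡ᵇ-sound : ∀ {a b} → (a ≡ᵇ b) ≡ true → a ≡ b
≡ᵇ-sound {a} {b} h = ≡ᵇ⇒≡ a b (Equivalence.from T-≡ h)

≡ᵇ-refl : ∀ a → (a ≡ᵇ a) ≡ true
≡ᵇ-refl a = Equivalence.to T-≡ (≡⇒≡ᵇ a a refl)

eqᴸ-sound : ∀ {x y} → eqᴸ x y ≡ true → x ≡ y
eqᴸ-sound {B a} {B b} h = cong B (≡ᵇ-sound h)
eqᴸ-sound {R a b c} {R a′ b′ c′} h with ∧-split {a ≡ᵇ a′} h
... | p , h with ∧-split {b ≡ᵇ b′} h
...   | q , r rewrite ≡ᵇ-sound {a} p | ≡ᵇ-sound {b} q | ≡ᵇ-sound {c} r = refl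
eqᴸ-sound {P a} {P b} h = cong P (≡ᵇ-sound h)
eqᴸ-sound {F} {F} h = refl
eqᴸ-sound {X} {X} h = refl

eqᴸ-refl : ∀ x → eqᴸ x x ≡ true
eqᴸ-refl (B a) = ≡ᵇ-refl a
eqᴸ-refl (R a b c) rewrite ≡ᵇ-refl a | ≡ᵇ-refl b | ≡ᵇ-refl c = refl
eqᴸ-refl (P a) = ≡ᵇ-refl a
eqᴸ-refl F = refl
eqᴸ-refl X = refl

Merged : Label → Set
Merged (B _)     = ⊥
Merged (R _ _ _) = ⊥
Merged _         = ⊤

merged? : ∀ l → Dec (Merged l)
merged? (B _)     = no λ ()
merged? (R _ _ _) = no λ ()
merged? (P _)     = yes tt
merged? F         = yes tt
merged? X         = yes tt

-- Symbolic labels: the hubs, the current pair dd, ee, and the merged parts.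
data Sym : Set where
  hub PP      : Fin 3 → Sym
  dd ee FF XX : Sym

_≡³_ : Fin 3 → Fin 3 → Bool
a ≡³ b = toℕ a ≡ᵇ toℕ b

eqˢ : Sym → Sym → Bool
eqˢ (hub a) (hub b) = a ≡³ b
eqˢ (PP a)  (PP b)  = a ≡³ b
eqˢ dd dd = true
eqˢ ee ee = true
eqˢ FF FF = true
eqˢ XX XX = true
eqˢ _  _  = false

eqˢ-sound : ∀ {x y} → eqˢ x y ≡ true → x ≡ y
eqˢ-sound {hub a} {hub b} h = cong hub (toℕ-injective (≡ᵇ-sound h))
eqˢ-sound {PP a}  {PP b}  h = cong PP (toℕ-injective (≡ᵇ-sound h))
eqˢ-sound {dd} {dd} h = refl
eqˢ-sound {ee} {ee} h = refl
eqˢ-sound {FF} {FF} h = refl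
eqˢ-sound {XX} {XX} h = refl

eqˢ-refl : ∀ x → eqˢ x x ≡ true
eqˢ-refl (hub h) = ≡ᵇ-refl (toℕ h)
eqˢ-refl (PP h)  = ≡ᵇ-refl (toℕ h)
eqˢ-refl dd = refl
eqˢ-refl ee = refl
eqˢ-refl FF = refl
eqˢ-refl XX = refl

mergedˢ : Sym → Bool
mergedˢ (hub _) = false
mergedˢ dd      = false
mergedˢ ee      = false
mergedˢ _       = true

-- The ten edges of the K₅ on the three hubs and the current pair: those between hubs, those from a
-- hub to the first or the second vertex of the pair, and the one inside the pair.
data Slot : Set where
  hh leg₁ leg₂ : Fin 3 → Slot
  mate         : Slot

eqᵗ : Slot → Slot → Bool
eqᵗ (hh a)   (hh b)   = a ≡³ b
eqᵗ (leg₁ a) (leg₁ b) = a ≡³ b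
eqᵗ (leg₂ a) (leg₂ b) = a ≡³ b
eqᵗ mate     mate     = true
eqᵗ _        _        = false

eqᵗ-sound : ∀ {x y} → eqᵗ x y ≡ true → x ≡ y
eqᵗ-sound {hh a}   {hh b}   h = cong hh (toℕ-injective (≡ᵇ-sound h))
eqᵗ-sound {leg₁ a} {leg₁ b} h = cong leg₁ (toℕ-injective (≡ᵇ-sound h))
eqᵗ-sound {leg₂ a} {leg₂ b} h = cong leg₂ (toℕ-injective (≡ᵇ-sound h))
eqᵗ-sound {mate} {mate} h = refl

eqᵗ-refl : ∀ s → eqᵗ s s ≡ true
eqᵗ-refl (hh a)   = ≡ᵇ-refl (toℕ a)
eqᵗ-refl (leg₁ a) = ≡ᵇ-refl (toℕ a)
eqᵗ-refl (leg₂ a) = ≡ᵇ-refl (toℕ a)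
eqᵗ-refl mate     = refl

-- The state of one subdivided edge: all inner vertices still single, an initial segment absorbed by
-- a part, or the whole path absorbed. The length of the segment is kept outside the symbolic
-- description.
data Mode : Set where
  raw       : Mode
  grow full : Sym → Mode

record Stage : Set where
  constructor stage
  field
    bd be : Sym
    mode  : Slot → Mode
open Stage

update : Slot → Mode → Stage → Stage
update s μ σ = stage (bd σ) (be σ) (λ s′ → if eqᵗ s′ s then μ else mode σ s′)

renameˢ : Sym → Sym → Sym → Sym
renameˢ x y z = if eqˢ z x then y else z

rename-mode : Sym → Sym → Mode → Mode
rename-mode x y raw      = raw
rename-mode x y (grow l) = grow (renameˢ x y l)
rename-mode x y (full l) = full (renameˢ x y l)

rename-stage : Sym → Sym → Stage → Stage
rename-stage x y σ = stage (renameˢ x y (bd σ)) (renameˢ x y (be σ)) (λ s → rename-mode x y (mode σ s))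

-- In a neighbour table, nothing stands for the next vertex of the path that is being absorbed.
Table : Set
Table = Maybe Sym → List (Maybe Sym)

source target : Stage → Slot → Sym
source σ (hh (suc (suc zero))) = hub (suc zero)
source σ (hh _)                = hub zero
source σ (leg₁ h)              = hub h
source σ (leg₂ h)              = hub h
source σ mate                  = bd σ
target σ (hh zero)             = hub (suc zero)
target σ (hh (suc _))          = hub (suc (suc zero))
target σ (leg₁ h)              = bd σ
target σ (leg₂ h)              = be σ
target σ mate                  = be σ

eqᵐ : Maybe Sym → Maybe Sym → Bool
eqᵐ nothing  nothing  = true
eqᵐ (just x) (just y) = eqˢ x y
eqᵐ _        _        = false

eqᵐ-sound : ∀ {x y} → eqᵐ x y ≡ true → x ≡ y
eqᵐ-sound {nothing} {nothing} h = refl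
eqᵐ-sound {just x}  {just y}  h = cong just (eqˢ-sound h)

member : Maybe Sym → List (Maybe Sym) → Bool
member x []       = false
member x (y ∷ ys) = eqᵐ x y ∨ member x ys

member-sound : ∀ x ys → member x ys ≡ true → x ∈ ys
member-sound x (y ∷ ys) h with ∨-split {eqᵐ x y} h
... | inj₁ e = here (eqᵐ-sound e)
... | inj₂ e = there (member-sound x ys e)

mergedᵐ : Maybe Sym → Bool
mergedᵐ nothing  = false
mergedᵐ (just x) = mergedˢ x

-- Both memberships are required because an edge contributes to the red degrees of both of its ends.
link : Table → Maybe Sym → Maybe Sym → Bool
link t x y = eqᵐ x y ∨ not (mergedᵐ x) ∧ not (mergedᵐ y) ∨ member y (t x) ∧ member x (t y)

-- During growth the part `l` is left by two edges of the path, one to `x` and one to the next inner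
-- vertex. What follows is still single, so `y` must be unmerged; `x` must be so too, as the
-- absorbed segment may be empty.
mode-test : Table → Sym → Mode → Sym → Bool
mode-test t x raw      y = not (mergedˢ x) ∧ not (mergedˢ y)
mode-test t x (grow l) y = mergedˢ l ∧ not (mergedˢ x) ∧ not (mergedˢ y) ∧ link t (just x) (just l) ∧ link t (just l) nothing
mode-test t x (full l) y = mergedˢ l ∧ link t (just x) (just l) ∧ link t (just l) (just y)

every-slot : (Slot → Bool) → Bool
every-slot f = every 3 (f ∘ hh) ∧ every 3 (f ∘ leg₁) ∧ every 3 (f ∘ leg₂) ∧ f mate

every-slot-elim : ∀ f → every-slot f ≡ true → ∀ s → f s ≡ true
every-slot-elim f h (hh i)   = every-elim (f ∘ hh) (proj₁ (∧-split {every 3 (f ∘ hh)} h)) i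
every-slot-elim f h (leg₁ i) = every-elim (f ∘ leg₁) (proj₁ (∧-split {every 3 (f ∘ leg₁)} (proj₂ (∧-split {every 3 (f ∘ hh)} h)))) i
every-slot-elim f h (leg₂ i) = every-elim (f ∘ leg₂) (proj₁ (∧-split {every 3 (f ∘ leg₂)}
  (proj₂ (∧-split {every 3 (f ∘ leg₁)} (proj₂ (∧-split {every 3 (f ∘ hh)} h)))))) i
every-slot-elim f h mate = proj₂ (∧-split {every 3 (f ∘ leg₂)}
  (proj₂ (∧-split {every 3 (f ∘ leg₁)} (proj₂ (∧-split {every 3 (f ∘ hh)} h)))))

every-symbol : (Maybe Sym → Bool) → Bool
every-symbol f = every 3 (f ∘ just ∘ hub) ∧ every 3 (f ∘ just ∘ PP) ∧ f (just dd) ∧ f (just ee) ∧ f (just FF) ∧ f (just XX) ∧ f nothing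

every-symbol-elim : ∀ f → every-symbol f ≡ true → ∀ x → f x ≡ true
every-symbol-elim f h = go
  where
  a = ∧-split {every 3 (f ∘ just ∘ hub)} h
  b = ∧-split {every 3 (f ∘ just ∘ PP)} (proj₂ a)
  c = ∧-split {f (just dd)} (proj₂ b)
  d = ∧-split {f (just ee)} (proj₂ c)
  e = ∧-split {f (just FF)} (proj₂ d)
  g = ∧-split {f (just XX)} (proj₂ e)
  go : ∀ x → f x ≡ true
  go (just (hub i)) = every-elim (f ∘ just ∘ hub) (proj₁ a) i
  go (just (PP i))  = every-elim (f ∘ just ∘ PP) (proj₁ b) i
  go (just dd)      = proj₁ c
  go (just ee)      = proj₁ d
  go (just FF)      = proj₁ e
  go (just XX)      = proj₁ g
  go nothing        = proj₂ g

-- The clause on hubs accounts for everything finished earlier: older pairs and their paths carry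
-- `XX` and have edges only to hubs or within `XX`. The first two clauses make an unmerged label
-- determine its vertex.
stage-test : Table → Stage → Bool
stage-test t σ = (eqˢ (bd σ) dd ∨ mergedˢ (bd σ)) ∧ (eqˢ (be σ) ee ∨ mergedˢ (be σ)) ∧
  every-symbol (λ x → length (t x) ≤ᵇ 3) ∧ every 3 (λ h → link t (just (hub h)) (just XX)) ∧
  every-slot (λ s → mode-test t (source σ s) (mode σ s) (target σ s))

data Op : Set where
  absorb : Slot → Sym → Table → Table → Op
  relabel : Sym → Sym → Table → Op

-- Hubs and `XX` also label vertices outside the ten slots, which `rename-stage` does not reach.
renamable : Sym → Bool
renamable (hub _) = false
renamable XX      = false
renamable _       = true

is-raw : Mode → Bool
is-raw raw = true
is-raw _   = false

settled : Mode → Bool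
settled (grow _) = false
settled _        = true

no-grow : Stage → Bool
no-grow σ = every-slot (λ s → settled (mode σ s))

apply : Op → Stage → Stage
apply (absorb s l _ _) σ = update s (full l) σ
apply (relabel x y _)  σ = rename-stage x y σ

-- A single check of the growing stage covers all intermediate positions on the absorbed path, which
-- is why finitely many tables suffice for paths of arbitrary length.
op-test : Op → Stage → Bool
op-test (absorb s l t t′) σ = no-grow σ ∧ is-raw (mode σ s) ∧ stage-test t (update s (grow l) σ) ∧ stage-test t′ (update s (full l) σ)
op-test (relabel x y t)   σ = no-grow σ ∧ renamable x ∧ not (eqˢ x y) ∧ stage-test t (rename-stage x y σ)

run : List Op → Stage → Stage
run []         σ = σ
run (op ∷ ops) σ = run ops (apply op σ)

run-test : List Op → Stage → Bool
run-test []         σ = true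
run-test (op ∷ ops) σ = op-test op σ ∧ run-test ops (apply op σ)

table : (f p₀ p₁ p₂ pair next : List (Maybe Sym)) → Table
table f p₀ p₁ p₂ pr nx (just (hub h)) = just XX ∷ just (PP h) ∷ just FF ∷ []
table f p₀ p₁ p₂ pr nx (just (PP zero)) = p₀
table f p₀ p₁ p₂ pr nx (just (PP (suc zero))) = p₁
table f p₀ p₁ p₂ pr nx (just (PP (suc (suc zero)))) = p₂
table f p₀ p₁ p₂ pr nx (just dd) = pr
table f p₀ p₁ p₂ pr nx (just ee) = pr
table f p₀ p₁ p₂ pr nx (just FF) = f
table f p₀ p₁ p₂ pr nx (just XX) = just (hub zero) ∷ just (hub (suc zero)) ∷ just (hub (suc (suc zero))) ∷ []
table f p₀ p₁ p₂ pr nx nothing = nx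

module Schedule where
  h₀ h₁ h₂ P₀ P₁ P₂ d e f : Maybe Sym
  h₀ = just (hub zero)
  h₁ = just (hub (suc zero))
  h₂ = just (hub (suc (suc zero)))
  P₀ = just (PP zero)
  P₁ = just (PP (suc zero))
  P₂ = just (PP (suc (suc zero)))
  d  = just dd
  e  = just ee
  f  = just FF
  ⋯ : Maybe Sym
  ⋯ = nothing

  hub-ops : List Op
  hub-ops =
    absorb (hh zero) FF (table (h₀ ∷ ⋯ ∷ []) [] [] [] [] (f ∷ [])) (table (h₀ ∷ h₁ ∷ []) [] [] [] [] []) ∷
    relabel FF XX (table [] [] [] [] [] []) ∷
    absorb (hh (suc zero)) FF (table (h₀ ∷ ⋯ ∷ []) [] [] [] [] (f ∷ [])) (table (h₀ ∷ h₂ ∷ []) [] [] [] [] []) ∷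
    relabel FF XX (table [] [] [] [] [] []) ∷
    absorb (hh (suc (suc zero))) FF (table (h₁ ∷ ⋯ ∷ []) [] [] [] [] (f ∷ [])) (table (h₁ ∷ h₂ ∷ []) [] [] [] [] []) ∷
    relabel FF XX (table [] [] [] [] [] []) ∷ []

  -- The order keeps every row within three entries. The path inside the pair is collapsed and put
  -- into `PP zero`, whose neighbours already include `dd` and `ee`; otherwise the pair would see it
  -- besides the three parts `PP h`. At the end each `PP h` has only the hub `h` and `FF` as
  -- neighbours, so moving it into `FF` replaces one neighbour of `FF` by another.
  pair-ops : List Op
  pair-ops =
    absorb mate FF (table (d ∷ ⋯ ∷ []) [] [] [] (f ∷ []) (f ∷ [])) (table (d ∷ e ∷ []) [] [] [] (f ∷ []) []) ∷
    absorb (leg₁ zero) (PP zero) (table (d ∷ e ∷ []) (h₀ ∷ ⋯ ∷ []) [] [] (f ∷ P₀ ∷ []) (P₀ ∷ []))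
                                 (table (d ∷ e ∷ []) (h₀ ∷ d ∷ []) [] [] (f ∷ P₀ ∷ []) []) ∷
    absorb (leg₂ zero) (PP zero) (table (d ∷ e ∷ []) (h₀ ∷ d ∷ ⋯ ∷ []) [] [] (f ∷ P₀ ∷ []) (P₀ ∷ []))
                                 (table (d ∷ e ∷ []) (h₀ ∷ d ∷ e ∷ []) [] [] (f ∷ P₀ ∷ []) []) ∷
    relabel FF (PP zero) (table [] (h₀ ∷ d ∷ e ∷ []) [] [] (P₀ ∷ []) []) ∷
    absorb (leg₁ (suc zero)) (PP (suc zero)) (table [] (h₀ ∷ d ∷ e ∷ []) (h₁ ∷ ⋯ ∷ []) [] (P₀ ∷ P₁ ∷ []) (P₁ ∷ []))
                                             (table [] (h₀ ∷ d ∷ e ∷ []) (h₁ ∷ d ∷ []) [] (P₀ ∷ P₁ ∷ []) []) ∷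
    absorb (leg₂ (suc zero)) (PP (suc zero)) (table [] (h₀ ∷ d ∷ e ∷ []) (h₁ ∷ d ∷ ⋯ ∷ []) [] (P₀ ∷ P₁ ∷ []) (P₁ ∷ []))
                                             (table [] (h₀ ∷ d ∷ e ∷ []) (h₁ ∷ d ∷ e ∷ []) [] (P₀ ∷ P₁ ∷ []) []) ∷
    absorb (leg₁ (suc (suc zero))) (PP (suc (suc zero)))
      (table [] (h₀ ∷ d ∷ e ∷ []) (h₁ ∷ d ∷ e ∷ []) (h₂ ∷ ⋯ ∷ []) (P₀ ∷ P₁ ∷ P₂ ∷ []) (P₂ ∷ []))
      (table [] (h₀ ∷ d ∷ e ∷ []) (h₁ ∷ d ∷ e ∷ []) (h₂ ∷ d ∷ []) (P₀ ∷ P₁ ∷ P₂ ∷ []) []) ∷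
    absorb (leg₂ (suc (suc zero))) (PP (suc (suc zero)))
      (table [] (h₀ ∷ d ∷ e ∷ []) (h₁ ∷ d ∷ e ∷ []) (h₂ ∷ d ∷ ⋯ ∷ []) (P₀ ∷ P₁ ∷ P₂ ∷ []) (P₂ ∷ []))
      (table [] (h₀ ∷ d ∷ e ∷ []) (h₁ ∷ d ∷ e ∷ []) (h₂ ∷ d ∷ e ∷ []) (P₀ ∷ P₁ ∷ P₂ ∷ []) []) ∷
    -- No vertex carries `FF` at this point, so this only declares `dd` merged; the contraction
    -- happens when `ee` follows.
    relabel dd FF (table (P₀ ∷ P₁ ∷ P₂ ∷ []) (h₀ ∷ f ∷ e ∷ []) (h₁ ∷ f ∷ e ∷ []) (h₂ ∷ f ∷ e ∷ []) (P₀ ∷ P₁ ∷ P₂ ∷ []) []) ∷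
    relabel ee FF (table (P₀ ∷ P₁ ∷ P₂ ∷ []) (h₀ ∷ f ∷ []) (h₁ ∷ f ∷ []) (h₂ ∷ f ∷ []) [] []) ∷
    relabel (PP zero) FF (table (h₀ ∷ P₁ ∷ P₂ ∷ []) [] (h₁ ∷ f ∷ []) (h₂ ∷ f ∷ []) [] []) ∷
    relabel (PP (suc zero)) FF (table (h₀ ∷ h₁ ∷ P₂ ∷ []) [] [] (h₂ ∷ f ∷ []) [] []) ∷
    relabel (PP (suc (suc zero))) FF (table (h₀ ∷ h₁ ∷ h₂ ∷ []) [] [] [] [] []) ∷
    relabel FF XX (table [] [] [] [] [] []) ∷ []

open Schedule using (hub-ops; pair-ops)

start-stage : Stage
start-stage = stage dd ee (λ _ → raw)

between : Stage
between = stage dd ee mode₀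
  where
  mode₀ : Slot → Mode
  mode₀ (hh _) = full XX
  mode₀ _      = raw

hub-ops-test : run-test hub-ops start-stage ≡ true
hub-ops-test = refl

pair-ops-test : run-test pair-ops between ≡ true
pair-ops-test = refl

<ᵇ-yes : ∀ {m n} → m < n → (m <ᵇ n) ≡ true
<ᵇ-yes h = Equivalence.to T-≡ (<⇒<ᵇ h)

<ᵇ-no : ∀ {m n} → n ≤ m → (m <ᵇ n) ≡ false
<ᵇ-no {m} {n} h with m <ᵇ n in e
... | false = refl
... | true  = ⊥-elim (<⇒≱ (<ᵇ⇒< m n (Equivalence.from T-≡ e)) h)

≤ᵇ-no : ∀ {m n} → n < m → (m ≤ᵇ n) ≡ false
≤ᵇ-no {m} {n} h with m ≤ᵇ n in e
... | false = refl
... | true  = ⊥-elim (<⇒≱ h (≤ᵇ⇒≤ m n (Equivalence.from T-≡ e)))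

≡ᵇ-no : ∀ {m n} → m ≢ n → (m ≡ᵇ n) ≡ false
≡ᵇ-no {m} {n} h with m ≡ᵇ n in e
... | false = refl
... | true  = ⊥-elim (h (≡ᵇ-sound e))

double-mono : ∀ {i j} → i < j → suc (suc (double i)) ≤ double j
double-mono {zero}  {suc j} h       = s≤s (s≤s z≤n)
double-mono {suc i} {suc j} (s≤s h) = s≤s (s≤s (double-mono h))


not-elim : ∀ {b} → not b ≡ true → b ≡ false
not-elim {false} _ = refl

-- From symbolic stages to labellings of a subdivision

hub-number : ℕ → Fin 3
hub-number 0 = zero
hub-number 1 = suc zero
hub-number _ = suc (suc zero)

hub-number-toℕ : ∀ h → hub-number (toℕ h) ≡ h
hub-number-toℕ zero             = refl
hub-number-toℕ (suc zero)       = refl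
hub-number-toℕ (suc (suc zero)) = refl

hub-pair : ℕ → ℕ → Fin 3
hub-pair 0 1 = zero
hub-pair 0 _ = suc zero
hub-pair _ _ = suc (suc zero)

data Where : Set where
  old new : Where
  at      : Slot → Where

module At (j : ℕ) where

  d e : ℕ
  d = 3 + double j
  e = suc d

  name : Sym → Label
  name (hub h) = B (toℕ h)
  name (PP h)  = P (toℕ h)
  name dd      = B d
  name ee      = B e
  name FF      = F
  name XX      = X

  ends : Slot → ℕ × ℕ
  ends (hh zero)             = 0 , 1
  ends (hh (suc zero))       = 0 , 2
  ends (hh (suc (suc zero))) = 1 , 2
  ends (leg₁ h)              = toℕ h , d
  ends (leg₂ h)              = toℕ h , e
  ends mate                  = d , e

  slotOf : ℕ → ℕ → Where
  slotOf u v =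
    if v <ᵇ 3 then at (hh (hub-pair u v)) else
    if v <ᵇ d then old else
    if v ≡ᵇ d then at (leg₁ (hub-number u)) else
    if v ≡ᵇ e then (if u ≡ᵇ d then at mate else at (leg₂ (hub-number u))) else new

  slotOf-d : ∀ u → slotOf u d ≡ at (leg₁ (hub-number u))
  slotOf-d u rewrite <ᵇ-no {d} {d} ≤-refl | ≡ᵇ-refl d = refl

  slotOf-e : ∀ u → slotOf u e ≡ (if u ≡ᵇ d then at mate else at (leg₂ (hub-number u)))
  slotOf-e u rewrite <ᵇ-no {e} {d} (n≤1+n d) | ≡ᵇ-no {e} {d} 1+n≢n | ≡ᵇ-refl e = refl

  hub≢d : ∀ h → toℕ {3} h ≢ d
  hub≢d h eq = <⇒≱ (toℕ<n h) (subst (3 ≤_) (sym eq) (m≤m+n 3 (double j)))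

  slotOf-ends : ∀ s → slotOf (proj₁ (ends s)) (proj₂ (ends s)) ≡ at s
  slotOf-ends (hh zero)             = refl
  slotOf-ends (hh (suc zero))       = refl
  slotOf-ends (hh (suc (suc zero))) = refl
  slotOf-ends (leg₁ h) = trans (slotOf-d (toℕ h)) (cong (at ∘ leg₁) (hub-number-toℕ h))
  slotOf-ends (leg₂ h) = trans (slotOf-e (toℕ h))
    (trans (cong (if_then at mate else at (leg₂ (hub-number (toℕ h)))) (≡ᵇ-no (hub≢d h))) (cong (at ∘ leg₂) (hub-number-toℕ h)))
  slotOf-ends mate = trans (slotOf-e d) (cong (if_then at mate else at (leg₂ (hub-number d))) (≡ᵇ-refl d))

  slotOf-old : ∀ u {v} → 3 ≤ v → v < d → slotOf u v ≡ old
  slotOf-old u 3≤v v<d rewrite <ᵇ-no 3≤v | <ᵇ-yes v<d = refl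

  slotOf-new : ∀ u {v} → e < v → slotOf u v ≡ new
  slotOf-new u {v} e<v rewrite <ᵇ-no {v} {3} (≤-trans (m≤m+n 3 (double j)) (≤-trans (n≤1+n d) (<⇒≤ e<v)))
    | <ᵇ-no {v} {d} (≤-trans (n≤1+n d) (<⇒≤ e<v)) | ≡ᵇ-no {v} {d} (λ { refl → <-asym e<v (n<1+n d) })
    | ≡ᵇ-no {v} {e} (λ { refl → <-irrefl refl e<v }) = refl

  at-injective : ∀ {s s′} → at s ≡ at s′ → s ≡ s′
  at-injective refl = refl

  ends-injective : ∀ {s s′} → ends s ≡ ends s′ → s ≡ s′
  ends-injective {s} {s′} h = at-injective (trans (sym (slotOf-ends s))
    (trans (cong (λ p → slotOf (proj₁ p) (proj₂ p)) h) (slotOf-ends s′)))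

  data Place : ℕ → ℕ → Set where
    on    : ∀ s → Place (proj₁ (ends s)) (proj₂ (ends s))
    older : ∀ {u v} → u < v → 3 ≤ v → v < d → Place u v
    newer : ∀ {u v} → e < v → u < 3 ⊎ e < u → Place u v

  far-from-hub : ∀ (h : Fin 3) {v} → 3 ≤ v → Place (toℕ h) v
  far-from-hub h {v} 3≤v with <-cmp v d
  ... | tri< v<d _ _ = older (≤-trans (toℕ<n h) 3≤v) 3≤v v<d
  ... | tri≈ _ refl _ = on (leg₁ h)
  ... | tri> _ _ d<v with <-cmp v e
  ...   | tri< v<e _ _ = ⊥-elim (<⇒≱ v<e d<v)
  ...   | tri≈ _ refl _ = on (leg₂ h)
  ...   | tri> _ _ e<v = newer e<v (inj₁ (toℕ<n h))

  classify : ∀ u v → u < v → forwardᵇ u v ≡ true → Place u v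
  classify 0 1 _ _ = on (hh zero)
  classify 0 2 _ _ = on (hh (suc zero))
  classify 0 (suc (suc (suc v))) _ _ = far-from-hub zero (s≤s (s≤s (s≤s z≤n)))
  classify 1 1 (s≤s ()) _
  classify 1 2 _ _ = on (hh (suc (suc zero)))
  classify 1 (suc (suc (suc v))) _ _ = far-from-hub (suc zero) (s≤s (s≤s (s≤s z≤n)))
  classify 2 1 (s≤s ()) _
  classify 2 2 (s≤s (s≤s ())) _
  classify 2 (suc (suc (suc v))) _ _ = far-from-hub (suc (suc zero)) (s≤s (s≤s (s≤s z≤n)))
  classify (suc (suc (suc u))) (suc (suc (suc v))) u<v h with paired-elim u v h
  ... | i , refl , refl with <-cmp i j
  ...   | tri< i<j _ _ = older u<v (s≤s (s≤s (s≤s z≤n))) (s≤s (s≤s (s≤s (double-mono i<j))))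
  ...   | tri≈ _ refl _ = on mate
  ...   | tri> _ _ j<i = newer (s≤s (s≤s (s≤s (s≤s (<⇒≤ (double-mono j<i)))))) (inj₂ (s≤s (s≤s (s≤s (double-mono j<i)))))

  mode-label : Mode → ℕ → ℕ → ℕ → ℕ → Label
  mode-label raw      c u v i = R u v i
  mode-label (grow l) c u v i = if i <ᵇ c then name l else R u v i
  mode-label (full l) c u v i = name l

  place-label : Stage → Where → ℕ → ℕ → ℕ → ℕ → Label
  place-label σ old    c u v i = X
  place-label σ new    c u v i = R u v i
  place-label σ (at s) c u v i = mode-label (mode σ s) c u v i

  mid-label : Stage → ℕ → ℕ → ℕ → ℕ → Label
  mid-label σ c u v i = place-label σ (slotOf u v) c u v i

  br-label : Stage → ℕ → Label
  br-label σ w =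
    if w <ᵇ 3 then B w else
    if w <ᵇ d then X else
    if w ≡ᵇ d then name (bd σ) else
    if w ≡ᵇ e then name (be σ) else B w

  module _ (σ : Stage) where

    br-hub : ∀ {w} → w < 3 → br-label σ w ≡ B w
    br-hub h rewrite <ᵇ-yes h = refl

    br-old : ∀ {w} → 3 ≤ w → w < d → br-label σ w ≡ X
    br-old p q rewrite <ᵇ-no p | <ᵇ-yes q = refl

    br-d : br-label σ d ≡ name (bd σ)
    br-d rewrite <ᵇ-no {d} {d} ≤-refl | ≡ᵇ-refl d = refl

    br-e : br-label σ e ≡ name (be σ)
    br-e rewrite <ᵇ-no {e} {d} (n≤1+n d) | ≡ᵇ-no {e} {d} 1+n≢n | ≡ᵇ-refl e = refl

    br-new : ∀ {w} → e < w → br-label σ w ≡ B w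
    br-new {w} e<w rewrite <ᵇ-no {w} {3} (≤-trans (m≤m+n 3 (double j)) (≤-trans (n≤1+n d) (<⇒≤ e<w)))
      | <ᵇ-no {w} {d} (≤-trans (n≤1+n d) (<⇒≤ e<w)) | ≡ᵇ-no {w} {d} (λ { refl → <-asym e<w (n<1+n d) })
      | ≡ᵇ-no {w} {e} (λ { refl → <-irrefl refl e<w }) = refl

    br-source : ∀ s → br-label σ (proj₁ (ends s)) ≡ name (source σ s)
    br-source (hh zero)             = refl
    br-source (hh (suc zero))       = refl
    br-source (hh (suc (suc zero))) = refl
    br-source (leg₁ h)              = br-hub (toℕ<n h)
    br-source (leg₂ h)              = br-hub (toℕ<n h)
    br-source mate                  = br-d

    br-target : ∀ s → br-label σ (proj₂ (ends s)) ≡ name (target σ s)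
    br-target (hh zero)             = refl
    br-target (hh (suc zero))       = refl
    br-target (hh (suc (suc zero))) = refl
    br-target (leg₁ h)              = br-d
    br-target (leg₂ h)              = br-e
    br-target mate                  = br-e

    data BrCase (w : ℕ) : Set where
      is-hub : w < 3 → BrCase w
      is-old : 3 ≤ w → w < d → BrCase w
      is-d   : w ≡ d → BrCase w
      is-e   : w ≡ e → BrCase w
      is-new : e < w → BrCase w

    br-case : ∀ w → BrCase w
    br-case w with w <? 3 | <-cmp w d
    ... | yes p | _ = is-hub p
    ... | no p | tri< q _ _ = is-old (≮⇒≥ p) q
    ... | no p | tri≈ _ q _ = is-d q
    ... | no p | tri> _ _ q with <-cmp w e
    ...   | tri< r _ _ = ⊥-elim (<⇒≱ r q)
    ...   | tri≈ _ r _ = is-e r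
    ...   | tri> _ _ r = is-new r

    mid-on : ∀ s c i → mid-label σ c (proj₁ (ends s)) (proj₂ (ends s)) i ≡ mode-label (mode σ s) c (proj₁ (ends s)) (proj₂ (ends s)) i
    mid-on s c i = cong (λ w → place-label σ w c (proj₁ (ends s)) (proj₂ (ends s)) i) (slotOf-ends s)

    mid-old : ∀ {u v} c i → 3 ≤ v → v < d → mid-label σ c u v i ≡ X
    mid-old {u} {v} c i p q = cong (λ w → place-label σ w c u v i) (slotOf-old u p q)

    mid-new : ∀ {u v} c i → e < v → mid-label σ c u v i ≡ R u v i
    mid-new {u} {v} c i p = cong (λ w → place-label σ w c u v i) (slotOf-new u p)

  merged-name : ∀ l → mergedˢ l ≡ true → Merged (name l)
  merged-name (PP h) _ = tt
  merged-name FF     _ = tt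
  merged-name XX     _ = tt

  unmerged-name : ∀ l → mergedˢ l ≡ false → ¬ Merged (name l)
  unmerged-name (hub h) _ ()
  unmerged-name dd      _ ()
  unmerged-name ee      _ ()

  module Neighbours (t : Table) (short : ∀ x → length (t x) ≤ 3) (u₀ v₀ c : ℕ) where

    tname : Maybe Sym → Label
    tname nothing  = R u₀ v₀ c
    tname (just x) = name x

    -- Reads a label back as a symbol, so that `nb` can consult the table. Among the inner vertices
    -- only `R u₀ v₀ c`, the next one to be absorbed, has a row; the others have no merged
    -- neighbour.
    back : Label → Maybe (Maybe Sym)
    back (B w) = if w <ᵇ 3 then just (just (hub (hub-number w))) else
                 if w ≡ᵇ d then just (just dd) else
                 if w ≡ᵇ e then just (just ee) else nothing
    back (R u v i) = if (u ≡ᵇ u₀) ∧ (v ≡ᵇ v₀) ∧ (i ≡ᵇ c) then just nothing else nothing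
    back (P h) = just (just (PP (hub-number h)))
    back F = just (just FF)
    back X = just (just XX)

    back-tname : ∀ x → back (tname x) ≡ just x
    back-tname nothing rewrite ≡ᵇ-refl u₀ | ≡ᵇ-refl v₀ | ≡ᵇ-refl c = refl
    back-tname (just (hub h)) rewrite <ᵇ-yes (toℕ<n h) = cong (just ∘ just ∘ hub) (hub-number-toℕ h)
    back-tname (just (PP h)) = cong (just ∘ just ∘ PP) (hub-number-toℕ h)
    back-tname (just dd) rewrite ≡ᵇ-refl d = refl
    back-tname (just ee) rewrite ≡ᵇ-no {e} {d} 1+n≢n | ≡ᵇ-refl e = refl
    back-tname (just FF) = refl
    back-tname (just XX) = refl

    nb : Label → List Label
    nb l with back l
    ... | just x  = map tname (t x)
    ... | nothing = []

    nb≤3 : ∀ l → length (nb l) ≤ 3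
    nb≤3 l with back l
    ... | just x  = ≤-trans (≤-reflexive (length-map tname (t x))) (short x)
    ... | nothing = z≤n

    nb-tname : ∀ x → nb (tname x) ≡ map tname (t x)
    nb-tname x with back (tname x) | back-tname x
    ... | .(just x) | refl = refl

    Linked : Label → Label → Set
    Linked x y = x ≡ y ⊎ (¬ Merged x × ¬ Merged y) ⊎ (y ∈ nb x × x ∈ nb y)

    Linked-sym : ∀ {x y} → Linked x y → Linked y x
    Linked-sym (inj₁ h)              = inj₁ (sym h)
    Linked-sym (inj₂ (inj₁ (p , q))) = inj₂ (inj₁ (q , p))
    Linked-sym (inj₂ (inj₂ (p , q))) = inj₂ (inj₂ (q , p))

    Linked-≡ : ∀ {x x′ y y′} → x ≡ x′ → y ≡ y′ → Linked x′ y′ → Linked x y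
    Linked-≡ refl refl h = h

    unmergedᵐ : ∀ x → mergedᵐ x ≡ false → ¬ Merged (tname x)
    unmergedᵐ nothing  _ ()
    unmergedᵐ (just x) h = unmerged-name x h

    link-sound : ∀ x y → link t x y ≡ true → Linked (tname x) (tname y)
    link-sound x y h with ∨-split {eqᵐ x y} h
    ... | inj₁ p = inj₁ (cong tname (eqᵐ-sound {x} {y} p))
    ... | inj₂ h with ∨-split {not (mergedᵐ x) ∧ not (mergedᵐ y)} h
    ...   | inj₁ p = let a , b = ∧-split {not (mergedᵐ x)} p in
                     inj₂ (inj₁ (unmergedᵐ x (not-elim a) , unmergedᵐ y (not-elim b)))
    ...   | inj₂ p = let a , b = ∧-split {member y (t x)} p in
                     inj₂ (inj₂ (member-in y x a , member-in x y b))
      where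
      member-in : ∀ y x → member y (t x) ≡ true → tname y ∈ nb (tname x)
      member-in y x m = subst (tname y ∈_) (sym (nb-tname x)) (∈-map⁺ tname (member-sound y (t x) m))

module Reduction {n m} {H : Graph m} (S : IsSubdivision (cockade n) H) where
  open IsSubdivision S
  open Subdivided S using (Vertex; Adj; pos; pos-injective; edge-adj; T₀; T₀-sym; endpoints-ordered)
  open Labelled H eqᴸ eqᴸ-sound eqᴸ-refl Merged

  -- Numbers outside the graph get length 0, so a slot whose ends do not exist is an empty path and
  -- is absorbed without any contraction.
  length-at : ℕ → ℕ → ℕ
  length-at u v with u <? n | v <? n
  ... | yes p | yes q = len (fromℕ< p) (fromℕ< q)
  ... | _     | _     = 0

  length-at-≡ : ∀ u v → length-at (toℕ u) (toℕ v) ≡ len u v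
  length-at-≡ u v with toℕ u <? n | toℕ v <? n
  ... | yes p | yes q = cong₂ len (fromℕ<-toℕ u p) (fromℕ<-toℕ v q)
  ... | no p  | _     = ⊥-elim (p (toℕ<n u))
  ... | yes _ | no q  = ⊥-elim (q (toℕ<n v))

  forward-edge : ∀ {u v} → Fin (len u v) → toℕ u < toℕ v × forwardᵇ (toℕ u) (toℕ v) ≡ true
  forward-edge {u} {v} i = u<v , go (∨-split {(toℕ u <ᵇ toℕ v) ∧ forwardᵇ (toℕ u) (toℕ v)} edge)
    where
    u<v = endpoints-ordered i
    edge = proj₂ (len-zero u v (≤-trans (s≤s z≤n) (toℕ<n i)))
    go : _ ⊎ ((toℕ v <ᵇ toℕ u) ∧ forwardᵇ (toℕ v) (toℕ u)) ≡ true → forwardᵇ (toℕ u) (toℕ v) ≡ true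
    go (inj₁ h) = proj₂ (∧-split {toℕ u <ᵇ toℕ v} h)
    go (inj₂ h) = ⊥-elim (false≢true (<ᵇ-no (<⇒≤ u<v)) (proj₁ (∧-split {toℕ v <ᵇ toℕ u} h)))

  relabelled : (ℕ → Label) → (ℕ → ℕ → ℕ → Label) → Fin m → Label
  relabelled β μ a = lab (pos a)
    where
    lab : Vertex → Label
    lab (br u)      = β (toℕ u)
    lab (mid u v i) = μ (toℕ u) (toℕ v) (toℕ i)

  pointwise : ∀ {β β′ μ μ′} (f : Label → Label) → (∀ w → w < n → β′ w ≡ f (β w)) →
              (∀ u v i → v < n → u < v → forwardᵇ u v ≡ true → i < length-at u v → μ′ u v i ≡ f (μ u v i)) →
              ∀ a → relabelled β′ μ′ a ≡ f (relabelled β μ a)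
  pointwise f hβ hμ a with pos a
  ... | br u      = hβ (toℕ u) (toℕ<n u)
  ... | mid u v i = hμ _ _ _ (toℕ<n v) (proj₁ (forward-edge i)) (proj₂ (forward-edge i)) (subst (toℕ i <_) (sym (length-at-≡ u v)) (toℕ<n i))

  module Staged (j : ℕ) where
    open At j

    ρ : Stage → ℕ → Fin m → Label
    ρ σ c = relabelled (br-label σ) (mid-label σ c)

    Growing : Stage → ℕ → ℕ → ℕ → Set
    Growing σ u₀ v₀ c = ∀ s l → mode σ s ≡ grow l → ends s ≡ (u₀ , v₀) × c < length-at u₀ v₀

    module StageGood (t : Table) (σ : Stage) (ok : stage-test t σ ≡ true) {u₀ v₀ c} (growing : Growing σ u₀ v₀ c) where

      private
        s₁ = ∧-split {eqˢ (bd σ) dd ∨ mergedˢ (bd σ)} ok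
        s₂ = ∧-split {eqˢ (be σ) ee ∨ mergedˢ (be σ)} (proj₂ s₁)
        s₃ = ∧-split {every-symbol (λ x → length (t x) ≤ᵇ 3)} (proj₂ s₂)
        s₄ = ∧-split {every 3 (λ h → link t (just (hub h)) (just XX))} (proj₂ s₃)

      open Neighbours t (λ x → ≤ᵇ-elim (every-symbol-elim (λ x → length (t x) ≤ᵇ 3) (proj₁ s₃) x)) u₀ v₀ c

      slot-ok : ∀ s → mode-test t (source σ s) (mode σ s) (target σ s) ≡ true
      slot-ok = every-slot-elim (λ s → mode-test t (source σ s) (mode σ s) (target σ s)) (proj₂ s₄)

      hub-X : ∀ {w} → w < 3 → Linked (B w) X
      hub-X {w} h = subst (λ x → Linked (B x) X) (toℕ-fromℕ< h) (link-sound (just (hub (fromℕ< h))) (just XX)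
        (every-elim (λ h → link t (just (hub h)) (just XX)) (proj₁ s₄) (fromℕ< h)))

      raw-linked : ∀ {x y} → ¬ Merged x → ¬ Merged y → Linked x y
      raw-linked p q = inj₂ (inj₁ (p , q))

      module _ (s : Slot) where
        private
          u = proj₁ (ends s)
          v = proj₂ (ends s)

        FirstOK LastOK : Mode → Set
        FirstOK μ = Linked (name (source σ s)) (mode-label μ c u v 0)
        LastOK μ  = ∀ i → suc i ≡ length-at u v → Linked (mode-label μ c u v i) (name (target σ s))

        slot-links : ∀ μ → mode σ s ≡ μ → mode-test t (source σ s) μ (target σ s) ≡ true →
                     FirstOK μ × (∀ i → Linked (mode-label μ c u v i) (mode-label μ c u v (suc i))) × LastOK μ
        slot-links raw eq h =
          let p , q = ∧-split {not (mergedˢ (source σ s))} h in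
          raw-linked (unmerged-name _ (not-elim p)) (λ ()) , (λ i → raw-linked (λ ()) (λ ())) ,
          (λ i _ → raw-linked (λ ()) (unmerged-name _ (not-elim q)))
        slot-links (full l) eq h =
          let _ , h = ∧-split {mergedˢ l} h
              p , q = ∧-split {link t (just (source σ s)) (just l)} h
          in link-sound (just (source σ s)) (just l) p , (λ i → inj₁ refl) ,
             (λ i _ → link-sound (just l) (just (target σ s)) q)
        slot-links (grow l) eq h with growing s l eq
        ... | refl , c<len =
          let _ , h = ∧-split {mergedˢ l} h
              a , h = ∧-split {not (mergedˢ (source σ s))} h
              b , h = ∧-split {not (mergedˢ (target σ s))} h
              p , q = ∧-split {link t (just (source σ s)) (just l)} h
          in first-ok a p , next-ok q , last-ok b
          where
          first-ok : not (mergedˢ (source σ s)) ≡ true → link t (just (source σ s)) (just l) ≡ true → FirstOK (grow l)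
          first-ok a p with 0 <ᵇ c
          ... | true  = link-sound (just (source σ s)) (just l) p
          ... | false = raw-linked (unmerged-name _ (not-elim a)) (λ ())
          next-ok : link t (just l) nothing ≡ true → ∀ i → Linked (mode-label (grow l) c u v i) (mode-label (grow l) c u v (suc i))
          next-ok q i with <-cmp (suc i) c
          ... | tri< lt _ _ rewrite <ᵇ-yes (<-trans (n<1+n i) lt) | <ᵇ-yes lt = inj₁ refl
          -- The border between the absorbed segment and the rest of the path: the edge that uses
          -- the table row of `nothing`.
          ... | tri≈ _ refl _ rewrite <ᵇ-yes (n<1+n i) | <ᵇ-no {suc i} {suc i} ≤-refl = link-sound (just l) nothing q
          ... | tri> _ _ gt rewrite <ᵇ-no {i} {c} (≤-pred gt) | <ᵇ-no {suc i} {c} (<⇒≤ gt) = raw-linked (λ ()) (λ ())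
          last-ok : not (mergedˢ (target σ s)) ≡ true → LastOK (grow l)
          -- As `c` is below the length, the last inner vertex is still single.
          last-ok b i eq′ rewrite <ᵇ-no {i} {c} (≤-pred (subst (suc c ≤_) (sym eq′) c<len)) = raw-linked (λ ()) (unmerged-name _ (not-elim b))

        links = slot-links (mode σ s) refl (slot-ok s)

      first-link : ∀ {u v} → Place u v → Linked (br-label σ u) (mid-label σ c u v 0)
      first-link (on s) = Linked-≡ (br-source σ s) (mid-on σ s c 0) (proj₁ (links s))
      first-link (older {u} {v} u<v 3≤v v<d) with u <? 3
      ... | yes u<3 = Linked-≡ (br-hub σ u<3) (mid-old σ c 0 3≤v v<d) (hub-X u<3)
      ... | no u≮3  = Linked-≡ (br-old σ (≮⇒≥ u≮3) (<-trans u<v v<d)) (mid-old σ c 0 3≤v v<d) (inj₁ refl)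
      first-link (newer e<v (inj₁ u<3)) = Linked-≡ (br-hub σ u<3) (mid-new σ c 0 e<v) (raw-linked (λ ()) (λ ()))
      first-link (newer e<v (inj₂ e<u)) = Linked-≡ (br-new σ e<u) (mid-new σ c 0 e<v) (raw-linked (λ ()) (λ ()))

      next-link : ∀ {u v} i → Place u v → Linked (mid-label σ c u v i) (mid-label σ c u v (suc i))
      next-link i (on s) = Linked-≡ (mid-on σ s c i) (mid-on σ s c (suc i)) (proj₁ (proj₂ (links s)) i)
      next-link i (older _ 3≤v v<d) = Linked-≡ (mid-old σ c i 3≤v v<d) (mid-old σ c (suc i) 3≤v v<d) (inj₁ refl)
      next-link i (newer e<v _) = Linked-≡ (mid-new σ c i e<v) (mid-new σ c (suc i) e<v) (raw-linked (λ ()) (λ ()))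

      last-link : ∀ {u v} i → Place u v → suc i ≡ length-at u v → Linked (mid-label σ c u v i) (br-label σ v)
      last-link i (on s) eq = Linked-≡ (mid-on σ s c i) (br-target σ s) (proj₂ (proj₂ (links s)) i eq)
      last-link i (older _ 3≤v v<d) eq = Linked-≡ (mid-old σ c i 3≤v v<d) (br-old σ 3≤v v<d) (inj₁ refl)
      last-link i (newer e<v _) eq = Linked-≡ (mid-new σ c i e<v) (br-new σ e<v) (raw-linked (λ ()) (λ ()))

      lab : Vertex → Label
      lab (br u)      = br-label σ (toℕ u)
      lab (mid u v i) = mid-label σ c (toℕ u) (toℕ v) (toℕ i)

      ρ-lab : ∀ a → ρ σ c a ≡ lab (pos a)
      ρ-lab a with pos a
      ... | br _      = refl
      ... | mid _ _ _ = refl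

      place : ∀ {u v} → Fin (len u v) → Place (toℕ u) (toℕ v)
      place i = let lt , f = forward-edge i in classify _ _ lt f

      step-linked : ∀ {p q} → Step p q → Linked (lab p) (lab q)
      step-linked (first u v i eq) rewrite eq = first-link (place i)
      step-linked (next u v i i′ eq) rewrite eq = next-link (toℕ i) (place i)
      step-linked (last u v i eq) = last-link (toℕ i) (place i) (trans eq (sym (length-at-≡ u v)))

      -- An unmerged label names its own vertex; with `own-mid` this makes all unmerged parts
      -- singletons, as `Good` demands.
      own-br : ∀ w → ¬ Merged (br-label σ w) → br-label σ w ≡ B w
      own-br w nm with br-case σ w
      ... | is-hub p = br-hub σ p
      ... | is-old p q = ⊥-elim (nm (subst Merged (sym (br-old σ p q)) tt))
      ... | is-d refl = [ (λ h → trans (br-d σ) (cong name (eqˢ-sound h))) ,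
                          (λ h → ⊥-elim (nm (subst Merged (sym (br-d σ)) (merged-name _ h)))) ]′ (∨-split {eqˢ (bd σ) dd} (proj₁ s₁))
      ... | is-e refl = [ (λ h → trans (br-e σ) (cong name (eqˢ-sound h))) ,
                          (λ h → ⊥-elim (nm (subst Merged (sym (br-e σ)) (merged-name _ h)))) ]′ (∨-split {eqˢ (be σ) ee} (proj₁ s₂))
      ... | is-new p = br-new σ p

      own-mode : ∀ s μ → mode-test t (source σ s) μ (target σ s) ≡ true → ∀ u v i → ¬ Merged (mode-label μ c u v i) → mode-label μ c u v i ≡ R u v i
      own-mode s raw h u v i nm = refl
      own-mode s (full l) h u v i nm = ⊥-elim (nm (merged-name l (proj₁ (∧-split {mergedˢ l} h))))
      own-mode s (grow l) h u v i nm with i <ᵇ c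
      ... | true  = ⊥-elim (nm (merged-name l (proj₁ (∧-split {mergedˢ l} h))))
      ... | false = refl

      own-mid : ∀ {u v} i → Place u v → ¬ Merged (mid-label σ c u v i) → mid-label σ c u v i ≡ R u v i
      own-mid i (on s) nm = trans (mid-on σ s c i) (own-mode s (mode σ s) (slot-ok s) _ _ i (subst (λ l → ¬ Merged l) (mid-on σ s c i) nm))
      own-mid i (older _ p q) nm = ⊥-elim (nm (subst Merged (sym (mid-old σ c i p q)) tt))
      own-mid i (newer p _) nm = mid-new σ c i p

      lab-injective : ∀ p q → lab p ≡ lab q → ¬ Merged (lab p) → p ≡ q
      lab-injective (br u) (br v) h nm =
        cong br (toℕ-injective (B-inj (trans (sym (own-br (toℕ u) nm)) (trans h (own-br (toℕ v) (subst (λ l → ¬ Merged l) h nm))))))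
        where
        B-inj : ∀ {a b} → B a ≡ B b → a ≡ b
        B-inj refl = refl
      lab-injective (br u) (mid a b i) h nm
        with trans (sym (own-br (toℕ u) nm)) (trans h (own-mid (toℕ i) (place i) (subst (λ l → ¬ Merged l) h nm)))
      ... | ()
      lab-injective (mid a b i) (br u) h nm
        with trans (sym (own-mid (toℕ i) (place i) nm)) (trans h (own-br (toℕ u) (subst (λ l → ¬ Merged l) h nm)))
      ... | ()
      lab-injective (mid a b i) (mid a′ b′ i′) h nm = same (trans (sym (own-mid _ (place i) nm)) (trans h (own-mid _ (place i′) (subst (λ l → ¬ Merged l) h nm))))
        where
        R-inj : ∀ {a b c a′ b′ c′} → R a b c ≡ R a′ b′ c′ → a ≡ a′ × b ≡ b′ × c ≡ c′
        R-inj refl = refl , refl , refl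
        same : ∀ {a b a′ b′} {i : Fin (len a b)} {i′ : Fin (len a′ b′)} →
               R (toℕ a) (toℕ b) (toℕ i) ≡ R (toℕ a′) (toℕ b′) (toℕ i′) → _≡_ {A = Vertex} (mid a b i) (mid a′ b′ i′)
        same eq with R-inj eq
        ... | p , q , r with toℕ-injective p | toℕ-injective q
        ...   | refl | refl with toℕ-injective r
        ...     | refl = refl

      good : Good (ρ σ c)
      good = good-ext ρ-lab record
        { nb = nb ; nb≤3 = nb≤3 ; merged? = merged?
        ; unmerged = λ {a} {b} h nm → pos-injective (lab-injective (pos a) (pos b) h nm)
        ; covered = λ {a} {b} h → cover (edge-adj h) }
        where
        weaken : ∀ {x y} → Linked x y → x ≡ y ⊎ (¬ Merged x × ¬ Merged y) ⊎ y ∈ nb x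
        weaken (inj₁ h)              = inj₁ h
        weaken (inj₂ (inj₁ h))       = inj₂ (inj₁ h)
        weaken (inj₂ (inj₂ (h , _))) = inj₂ (inj₂ h)
        cover : ∀ {p q} → Adj p q → lab p ≡ lab q ⊎ (¬ Merged (lab p) × ¬ Merged (lab q)) ⊎ lab q ∈ nb (lab p)
        cover (inj₁ h) = weaken (step-linked h)
        cover (inj₂ h) = weaken (Linked-sym (step-linked h))

    name-injective : ∀ {x y} → name x ≡ name y → x ≡ y
    name-injective {x} {y} h = both (trans (sym (back-tname (just x))) (trans (cong back h) (back-tname (just y))))
      where
      open Neighbours (λ _ → []) (λ _ → z≤n) 0 0 0
      both : ∀ {x y : Sym} → just (just x) ≡ just (just y) → x ≡ y
      both refl = refl

    rename-name : ∀ x y z → name (renameˢ x y z) ≡ rename (name x) (name y) (name z)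
    rename-name x y z with eqˢ z x in h
    ... | true  = sym (trans (cong (rename (name x) (name y)) (cong name (eqˢ-sound {z} {x} h))) (rename-hit (name x) (name y)))
    ... | false = sym (rename-miss λ k → false≢true h (trans (cong (λ w → eqˢ w x) (name-injective k)) (eqˢ-refl x)))

    R≢name : ∀ {u v i} x → R u v i ≢ name x
    R≢name (hub _) ()
    R≢name (PP _)  ()
    R≢name dd      ()
    R≢name ee      ()
    R≢name FF      ()
    R≢name XX      ()

    module Relabelling (x y : Sym) (ok : renamable x ≡ true) (σ : Stage) where
      private
        f = rename (name x) (name y)
        σ′ = rename-stage x y σ

      X-fixed : f X ≡ X
      X-fixed = rename-miss (go x ok)
        where
        go : ∀ x → renamable x ≡ true → X ≢ name x
        go (PP _) _ ()
        go dd     _ ()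
        go ee     _ ()
        go FF     _ ()

      B-fixed : ∀ {w} → w < 3 ⊎ e < w → f (B w) ≡ B w
      B-fixed {w} h = rename-miss (go x ok h)
        where
        B-inj : ∀ {a b} → B a ≡ B b → a ≡ b
        B-inj refl = refl
        go : ∀ x → renamable x ≡ true → w < 3 ⊎ e < w → B w ≢ name x
        go (PP _) _ _ ()
        go FF     _ _ ()
        go dd _ (inj₁ h) k = <⇒≱ h (subst (3 ≤_) (sym (B-inj k)) (m≤m+n 3 (double j)))
        go dd _ (inj₂ h) k = <-asym h (subst (_< e) (sym (B-inj k)) (n<1+n d))
        go ee _ (inj₁ h) k = <⇒≱ h (subst (3 ≤_) (sym (B-inj k)) (≤-trans (m≤m+n 3 (double j)) (n≤1+n d)))
        go ee _ (inj₂ h) k = <-irrefl (sym (B-inj k)) h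

      br-renamed : ∀ w → br-label σ′ w ≡ f (br-label σ w)
      br-renamed w with br-case σ w
      ... | is-hub p = trans (br-hub σ′ p) (sym (trans (cong f (br-hub σ p)) (B-fixed (inj₁ p))))
      ... | is-old p q = trans (br-old σ′ p q) (sym (trans (cong f (br-old σ p q)) X-fixed))
      ... | is-d refl = trans (br-d σ′) (trans (rename-name x y (bd σ)) (cong f (sym (br-d σ))))
      ... | is-e refl = trans (br-e σ′) (trans (rename-name x y (be σ)) (cong f (sym (br-e σ))))
      ... | is-new p = trans (br-new σ′ p) (sym (trans (cong f (br-new σ p)) (B-fixed (inj₂ p))))

      mode-renamed : ∀ μ u v i → mode-label (rename-mode x y μ) 0 u v i ≡ f (mode-label μ 0 u v i)
      mode-renamed raw      u v i = sym (rename-miss (R≢name x))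
      mode-renamed (grow l) u v i = sym (rename-miss (R≢name x))
      mode-renamed (full l) u v i = rename-name x y l

      mid-renamed : ∀ {u v} i → Place u v → mid-label σ′ 0 u v i ≡ f (mid-label σ 0 u v i)
      mid-renamed i (on s) = trans (mid-on σ′ s 0 i) (trans (mode-renamed (mode σ s) _ _ i) (cong f (sym (mid-on σ s 0 i))))
      mid-renamed i (older _ p q) = trans (mid-old σ′ 0 i p q) (sym (trans (cong f (mid-old σ 0 i p q)) X-fixed))
      mid-renamed i (newer p _) = trans (mid-new σ′ 0 i p) (sym (trans (cong f (mid-new σ 0 i p)) (rename-miss (R≢name x))))

      renamed : ∀ a → ρ σ′ 0 a ≡ f (ρ σ 0 a)
      renamed = pointwise f (λ w _ → br-renamed w) (λ u v i _ u<v h _ → mid-renamed i (classify u v u<v h))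

    not-growing : ∀ σ → no-grow σ ≡ true → ∀ s l → mode σ s ≢ grow l
    not-growing σ h s l eq = false≢true refl (trans (cong settled (sym eq)) (every-slot-elim (λ s → settled (mode σ s)) h s))

    update-same : ∀ s μ σ → mode (update s μ σ) s ≡ μ
    update-same s μ σ rewrite eqᵗ-refl s = refl

    update-other : ∀ {s s′} μ σ → s′ ≢ s → mode (update s μ σ) s′ ≡ mode σ s′
    update-other {s} {s′} μ σ ne with eqᵗ s′ s in h
    ... | true  = ⊥-elim (ne (eqᵗ-sound h))
    ... | false = refl

    same-or-other : ∀ s′ s → s′ ≡ s ⊎ s′ ≢ s
    same-or-other s′ s with eqᵗ s′ s in h
    ... | true  = inj₁ (eqᵗ-sound h)
    ... | false = inj₂ λ { refl → false≢true h (eqᵗ-refl s) }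

    module Absorption (s : Slot) (l : Sym) (σ : Stage) where
      u₀ = proj₁ (ends s)
      v₀ = proj₂ (ends s)
      growing = update s (grow l) σ

      compare : ∀ μ c μ′ c′ (f : Label → Label) → no-grow σ ≡ true →
                (∀ w → f (br-label σ w) ≡ br-label σ w) → f X ≡ X →
                (∀ {u v i} → (u , v) ≢ (u₀ , v₀) → f (R u v i) ≡ R u v i) →
                (∀ x → f (name x) ≡ name x) →
                (∀ i → i < length-at u₀ v₀ → mode-label μ′ c′ u₀ v₀ i ≡ f (mode-label μ c u₀ v₀ i)) →
                ∀ a → ρ (update s μ′ σ) c′ a ≡ f (ρ (update s μ σ) c a)
      compare μ c μ′ c′ f settled-σ f-br f-X f-R f-name f-slot = pointwise f (λ w _ → sym (f-br w))
        (λ u v i _ u<v h i<len → by-place u v i (classify u v u<v h) i<len)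
        where
        σ₁ = update s μ σ
        σ₂ = update s μ′ σ
        unaffected : ∀ s′ → s′ ≢ s → ∀ m → mode σ s′ ≡ m → ∀ i →
                     mode-label m c′ (proj₁ (ends s′)) (proj₂ (ends s′)) i ≡ f (mode-label m c (proj₁ (ends s′)) (proj₂ (ends s′)) i)
        unaffected s′ ne raw      eq i = sym (f-R (λ h → ne (ends-injective h)))
        unaffected s′ ne (full x) eq i = sym (f-name x)
        unaffected s′ ne (grow x) eq i = ⊥-elim (not-growing σ settled-σ s′ x eq)
        by-place : ∀ u v i → Place u v → i < length-at u v → mid-label σ₂ c′ u v i ≡ f (mid-label σ₁ c u v i)
        by-place u v i (older _ p q) _ = trans (mid-old σ₂ c′ i p q) (sym (trans (cong f (mid-old σ₁ c i p q)) f-X))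
        by-place u v i (newer p _) _ = trans (mid-new σ₂ c′ i p) (sym (trans (cong f (mid-new σ₁ c i p)) (f-R elsewhere)))
          where
          elsewhere : (u , v) ≢ (u₀ , v₀)
          elsewhere refl with trans (sym (slotOf-new u₀ p)) (slotOf-ends s)
          ... | ()
        by-place .(proj₁ (ends s′)) .(proj₂ (ends s′)) i (on s′) i<len with same-or-other s′ s
        ... | inj₁ refl = trans (mid-on σ₂ s c′ i) (trans (cong (λ m → mode-label m c′ u₀ v₀ i) (update-same s μ′ σ))
                (trans (f-slot i i<len) (cong f (sym (trans (mid-on σ₁ s c i) (cong (λ m → mode-label m c u₀ v₀ i) (update-same s μ σ)))))))
        ... | inj₂ ne = trans (mid-on σ₂ s′ c′ i) (trans (cong (λ m → mode-label m c′ _ _ i) (update-other μ′ σ ne))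
                (trans (unaffected s′ ne (mode σ s′) refl i)
                  (cong f (sym (trans (mid-on σ₁ s′ c i) (cong (λ m → mode-label m c _ _ i) (update-other μ σ ne)))))))

      module _ (settled-σ : no-grow σ ≡ true) (raw-s : mode σ s ≡ raw) where

        before : ∀ a → ρ σ 0 a ≡ ρ growing 0 a
        before = pointwise (λ z → z) (λ _ _ → refl) (λ u v i _ u<v h _ → by-place u v i (classify u v u<v h))
          where
          by-place : ∀ u v i → Place u v → mid-label σ 0 u v i ≡ mid-label growing 0 u v i
          by-place u v i (older _ p q) = trans (mid-old σ 0 i p q) (sym (mid-old growing 0 i p q))
          by-place u v i (newer p _) = trans (mid-new σ 0 i p) (sym (mid-new growing 0 i p))
          by-place .(proj₁ (ends s′)) .(proj₂ (ends s′)) i (on s′) with same-or-other s′ s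
          ... | inj₁ refl = trans (mid-on σ s 0 i) (trans (cong (λ m → mode-label m 0 u₀ v₀ i) raw-s)
                  (sym (trans (mid-on growing s 0 i) (cong (λ m → mode-label m 0 u₀ v₀ i) (update-same s (grow l) σ)))))
          ... | inj₂ ne = trans (mid-on σ s′ 0 i) (sym (trans (mid-on growing s′ 0 i) (cong (λ m → mode-label m 0 _ _ i) (update-other (grow l) σ ne))))

        after : ∀ a → ρ (update s (full l) σ) 0 a ≡ ρ growing (length-at u₀ v₀) a
        after = compare (grow l) (length-at u₀ v₀) (full l) 0 (λ z → z) settled-σ (λ _ → refl) refl (λ _ → refl) (λ _ → refl)
          λ i i<len → sym (cong (if_then name l else R u₀ v₀ i) (<ᵇ-yes i<len))

        one-more : ∀ c a → ρ growing (suc c) a ≡ rename (R u₀ v₀ c) (name l) (ρ growing c a)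
        one-more c = compare (grow l) c (grow l) (suc c) f settled-σ (λ w → rename-miss (br≢R w)) (rename-miss {R u₀ v₀ c} {name l} λ ())
          (λ ne → rename-miss {R u₀ v₀ c} {name l} λ { refl → ne refl }) (λ x → rename-miss λ h → R≢name x (sym h)) slot-step
          where
          f = rename (R u₀ v₀ c) (name l)
          br≢R : ∀ w → br-label σ w ≢ R u₀ v₀ c
          br≢R w h with br-case σ w
          ... | is-hub p with trans (sym (br-hub σ p)) h
          ...   | ()
          br≢R w h | is-old p q with trans (sym (br-old σ p q)) h
          ...   | ()
          br≢R w h | is-d refl = R≢name (bd σ) (trans (sym h) (br-d σ))
          br≢R w h | is-e refl = R≢name (be σ) (trans (sym h) (br-e σ))
          br≢R w h | is-new p with trans (sym (br-new σ p)) h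
          ...   | ()
          slot-step : ∀ i → i < length-at u₀ v₀ → mode-label (grow l) (suc c) u₀ v₀ i ≡ f (mode-label (grow l) c u₀ v₀ i)
          slot-step i _ with <-cmp i c
          ... | tri< lt _ _ rewrite <ᵇ-yes lt | <ᵇ-yes (<-trans lt (n<1+n c)) = sym (rename-miss λ h → R≢name l (sym h))
          ... | tri≈ _ refl _ rewrite <ᵇ-no {i} {i} ≤-refl | <ᵇ-yes (n<1+n i) = sym (rename-hit (R u₀ v₀ i) (name l))
          ... | tri> _ ne gt rewrite <ᵇ-no {i} {c} (<⇒≤ gt) | <ᵇ-no {i} {suc c} gt = sym (rename-miss {R u₀ v₀ c} {name l} λ { refl → ne refl })

        module _ (t t′ : Table) (ok : stage-test t growing ≡ true) (ok′ : stage-test t′ (update s (full l) σ) ≡ true) where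

          good-full : Good (ρ (update s (full l) σ) 0)
          good-full = StageGood.good t′ (update s (full l) σ) ok′ {0} {0} {0} λ s′ x eq → ⊥-elim (go s′ x eq)
            where
            go : ∀ s′ x → mode (update s (full l) σ) s′ ≢ grow x
            go s′ x eq with same-or-other s′ s
            ... | inj₁ refl with trans (sym (update-same s (full l) σ)) eq
            ...   | ()
            go s′ x eq | inj₂ ne = not-growing σ settled-σ s′ x (trans (sym (update-other (full l) σ ne)) eq)

          good-growing : ∀ {c} → c < length-at u₀ v₀ → Good (ρ growing c)
          good-growing {c} c<len = StageGood.good t growing ok {u₀} {v₀} {c} go
            where
            go : Growing growing u₀ v₀ c
            go s′ x eq with same-or-other s′ s
            ... | inj₁ refl = refl , c<len
            ... | inj₂ ne = ⊥-elim (not-growing σ settled-σ s′ x (trans (sym (update-other (grow l) σ ne)) eq))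

          -- The inner vertices join `l` one at a time from the source on. Position 0 of the growing
          -- stage is the old labelling, and the position equal to the length is the new one.
          absorbed : Reducible (ρ (update s (full l) σ) 0) → Reducible (ρ σ 0)
          absorbed next-seq = reducible-ext before (from (length-at u₀ v₀) 0 refl)
            where
            from : ∀ k c → c + k ≡ length-at u₀ v₀ → Reducible (ρ growing c)
            from zero c eq = reducible-ext (λ a → trans (cong (λ x → ρ growing x a) (trans (sym (+-identityʳ c)) eq)) (sym (after a))) next-seq
            from (suc k) c eq = rename-step (R u₀ v₀ c) (name l) (R≢name l) (one-more c) (good-next k eq) (from k (suc c) (trans (sym (+-suc c k)) eq))
              where
              -- The certificate of the growing stage needs a remaining inner vertex; after the last
              -- one has been absorbed, that of the full stage takes over.
              good-next : ∀ k → c + suc k ≡ length-at u₀ v₀ → Good (ρ growing (suc c))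
              good-next zero    eq = good-ext (λ a → trans (cong (λ x → ρ growing x a) (trans (+-comm 1 c) eq)) (sym (after a))) good-full
              good-next (suc k) eq = good-growing (≤-trans (s≤s (s≤s (m≤m+n c k))) (≤-reflexive (trans (sym (trans (+-suc c (suc k)) (cong suc (+-suc c k)))) eq)))

    op-sound : ∀ op σ → op-test op σ ≡ true → Reducible (ρ (apply op σ) 0) → Reducible (ρ σ 0)
    op-sound (absorb s l t t′) σ h =
      let a , h = ∧-split {no-grow σ} h
          b , h = ∧-split {is-raw (mode σ s)} h
          p , q = ∧-split {stage-test t (update s (grow l) σ)} h
      in Absorption.absorbed s l σ a (raw-mode b) t t′ p q
      where
      raw-mode : ∀ {μ} → is-raw μ ≡ true → μ ≡ raw
      raw-mode {raw} _ = refl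
    op-sound (relabel x y t) σ h =
      let a , h = ∧-split {no-grow σ} h
          b , h = ∧-split {renamable x} h
          c , p = ∧-split {not (eqˢ x y)} h
      in rename-step (name x) (name y) (unequal c) (Relabelling.renamed x y b σ)
           (StageGood.good t (rename-stage x y σ) p {0} {0} {0} λ s l eq → ⊥-elim (settled-after a s l (mode σ s) refl eq))
      where
      unequal : not (eqˢ x y) ≡ true → name x ≢ name y
      unequal c eq with name-injective eq
      ... | refl = not-true c (eqˢ-refl x)
      settled-after : no-grow σ ≡ true → ∀ s l μ → mode σ s ≡ μ → rename-mode x y μ ≢ grow l
      settled-after a s l (grow z) eq _ = not-growing σ a s z eq
      settled-after a s l raw      eq ()
      settled-after a s l (full z) eq ()

    run-sound : ∀ ops σ → run-test ops σ ≡ true → Reducible (ρ (run ops σ) 0) → Reducible (ρ σ 0)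
    run-sound []         σ h next-seq = next-seq
    run-sound (op ∷ ops) σ h next-seq =
      let p , q = ∧-split {op-test op σ} h in op-sound op σ p (run-sound ops (apply op σ) q next-seq)

hub-result : ∀ s → mode (run hub-ops start-stage) s ≡ mode between s
hub-result (hh zero)               = refl
hub-result (hh (suc zero))         = refl
hub-result (hh (suc (suc zero)))   = refl
hub-result (leg₁ zero)             = refl
hub-result (leg₁ (suc zero))       = refl
hub-result (leg₁ (suc (suc zero))) = refl
hub-result (leg₂ zero)             = refl
hub-result (leg₂ (suc zero))       = refl
hub-result (leg₂ (suc (suc zero))) = refl
hub-result mate                    = refl

pair-result : ∀ s → mode (run pair-ops between) s ≡ full XX
pair-result (hh zero)               = refl
pair-result (hh (suc zero))         = refl
pair-result (hh (suc (suc zero)))   = refl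
pair-result (leg₁ zero)             = refl
pair-result (leg₁ (suc zero))       = refl
pair-result (leg₁ (suc (suc zero))) = refl
pair-result (leg₂ zero)             = refl
pair-result (leg₂ (suc zero))       = refl
pair-result (leg₂ (suc (suc zero))) = refl
pair-result mate                    = refl

module _ (j : ℕ) where
  open At j

  hub≤d : 3 ≤ d
  hub≤d = m≤m+n 3 (double j)

  between-br : ∀ {w} → d ≤ w → br-label between w ≡ B w
  between-br {w} d≤w with br-case between w
  ... | is-hub p   = br-hub between p
  ... | is-old _ q = ⊥-elim (<⇒≱ q d≤w)
  ... | is-d refl  = br-d between
  ... | is-e refl  = br-e between
  ... | is-new p   = br-new between p

  between-mid : ∀ u {v} i → d ≤ v → mid-label between 0 u v i ≡ R u v i
  between-mid u {v} i d≤v rewrite <ᵇ-no {v} {3} (≤-trans hub≤d d≤v) | <ᵇ-no d≤v with v ≡ᵇ d | v ≡ᵇ e | u ≡ᵇ d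
  ... | true  | _     | _     = refl
  ... | false | true  | true  = refl
  ... | false | true  | false = refl
  ... | false | false | _     = refl

  between-old : ∀ {u v} i → u < v → v < d → forwardᵇ u v ≡ true → mid-label between 0 u v i ≡ X
  between-old {u} {v} i u<v v<d h with classify u v u<v h
  ... | older _ p q = mid-old between 0 i p q
  ... | newer p _   = ⊥-elim (<-asym v<d (<-trans (n<1+n d) p))
  ... | on (hh zero)             = refl
  ... | on (hh (suc zero))       = refl
  ... | on (hh (suc (suc zero))) = refl
  ... | on (leg₁ _) = ⊥-elim (<-irrefl refl v<d)
  ... | on (leg₂ _) = ⊥-elim (<-asym v<d (n<1+n d))
  ... | on mate     = ⊥-elim (<-asym v<d (n<1+n d))

module _ {n m} {H : Graph m} (S : IsSubdivision (cockade n) H) where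
  open Reduction S
  open IsSubdivision S
  open Subdivided S using (Vertex; Adj; pos; pos-injective; edge-adj; T₀; T₀-sym; endpoints-ordered)
  open Labelled H eqᴸ eqᴸ-sound eqᴸ-refl Merged

  hubs-absorbed : Reducible (Staged.ρ 0 between 0) → Reducible (Staged.ρ 0 start-stage 0)
  hubs-absorbed next-seq = run-sound hub-ops start-stage hub-ops-test (reducible-ext
    (pointwise (λ z → z) (λ _ _ → refl) (λ u v i _ u<v h _ → same i (classify u v u<v h))) next-seq)
    where
    open Staged 0
    open At 0
    σ = run hub-ops start-stage
    same : ∀ {u v} i → Place u v → mid-label σ 0 u v i ≡ mid-label between 0 u v i
    same i (on s) = trans (mid-on σ s 0 i) (trans (cong (λ μ → mode-label μ 0 (proj₁ (ends s)) (proj₂ (ends s)) i) (hub-result s)) (sym (mid-on between s 0 i)))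
    same i (older _ p q) = trans (mid-old σ 0 i p q) (sym (mid-old between 0 i p q))
    same i (newer p _) = trans (mid-new σ 0 i p) (sym (mid-new between 0 i p))

  -- Once the pair and its paths carry `X`, they are indistinguishable from older pairs, so the
  -- outcome is the stage `between` as seen from the next pair.
  pair-absorbed : ∀ j → Reducible (Staged.ρ (suc j) between 0) → Reducible (Staged.ρ j between 0)
  pair-absorbed j next-seq = run-sound pair-ops between pair-ops-test (reducible-ext
    (pointwise (λ z → z) (λ w _ → on-br w) (λ u v i _ u<v h _ → on-mid i u<v h (classify u v u<v h))) next-seq)
    where
    open Staged j
    open At j
    module J′ = At (suc j)
    σ = run pair-ops between
    on-br : ∀ w → br-label σ w ≡ J′.br-label between w
    on-br w with br-case σ w
    ... | is-hub p   = trans (br-hub σ p) (sym (J′.br-hub between p))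
    ... | is-old p q = trans (br-old σ p q) (sym (J′.br-old between p (<-trans q (<-trans (n<1+n d) (n<1+n e)))))
    ... | is-d refl  = trans (br-d σ) (sym (J′.br-old between (hub≤d j) (<-trans (n<1+n d) (n<1+n e))))
    ... | is-e refl  = trans (br-e σ) (sym (J′.br-old between (≤-trans (hub≤d j) (n≤1+n d)) (n<1+n e)))
    ... | is-new p   = trans (br-new σ p) (sym (between-br (suc j) p))
    on-mid : ∀ {u v} i → u < v → forwardᵇ u v ≡ true → Place u v → mid-label σ 0 u v i ≡ J′.mid-label between 0 u v i
    on-mid i u<v h (older _ p q) = trans (mid-old σ 0 i p q) (sym (between-old (suc j) i u<v (<-trans q (<-trans (n<1+n d) (n<1+n e))) h))
    on-mid i u<v h (newer {u} p _) = trans (mid-new σ 0 i p) (sym (between-mid (suc j) u i p))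
    on-mid i u<v h (on s) = trans (mid-on σ s 0 i) (trans (cong (λ μ → mode-label μ 0 (proj₁ (ends s)) (proj₂ (ends s)) i) (pair-result s)) (sym (between-old (suc j) i u<v (below s) h)))
      where
      below : ∀ s → proj₂ (ends s) < J′.d
      below (hh zero)             = ≤-trans (s≤s (s≤s z≤n)) (hub≤d (suc j))
      below (hh (suc zero))       = hub≤d (suc j)
      below (hh (suc (suc zero))) = hub≤d (suc j)
      below (leg₁ _)              = <-trans (n<1+n d) (n<1+n e)
      below (leg₂ _)              = n<1+n e
      below mate                  = n<1+n e

  -- The hubs from k on are still separate; everything else has been merged.
  last-br : ℕ → ℕ → Label
  last-br k w = if (w <ᵇ 3) ∧ (k ≤ᵇ w) then B w else X

  last-labels : ℕ → Fin m → Label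
  last-labels k = relabelled (last-br k) (λ _ _ _ → X)

  last-good : ∀ k → Good (last-labels k)
  last-good k = good-ext lab-≡ record
    { nb = nb ; nb≤3 = nb≤3 ; merged? = merged?
    ; unmerged = λ {a} {b} h nm → pos-injective (lab-injective (pos a) (pos b) h nm)
    ; covered = λ h → cover (edge-adj h) }
    where
    lab : Vertex → Label
    lab (br u)      = last-br k (toℕ u)
    lab (mid _ _ _) = X
    lab-≡ : ∀ a → last-labels k a ≡ lab (pos a)
    lab-≡ a with pos a
    ... | br _      = refl
    ... | mid _ _ _ = refl
    nb : Label → List Label
    nb (B _) = X ∷ []
    nb X     = B 0 ∷ B 1 ∷ B 2 ∷ []
    nb _     = []
    nb≤3 : ∀ l → length (nb l) ≤ 3
    nb≤3 (B _)     = s≤s z≤n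
    nb≤3 X         = ≤-refl
    nb≤3 (R _ _ _) = z≤n
    nb≤3 (P _)     = z≤n
    nb≤3 F         = z≤n
    own : ∀ w → last-br k w ≡ X ⊎ last-br k w ≡ B w × w < 3
    own w with w <? 3
    ... | no p = inj₁ (cong (λ b → if b ∧ (k ≤ᵇ w) then B w else X) (<ᵇ-no (≮⇒≥ p)))
    ... | yes p with k ≤ᵇ w
    ...   | true  rewrite <ᵇ-yes p = inj₂ (refl , p)
    ...   | false rewrite <ᵇ-yes p = inj₁ refl
    B-inj : ∀ {a b} → B a ≡ B b → a ≡ b
    B-inj refl = refl
    own-B : ∀ w → ¬ Merged (last-br k w) → last-br k w ≡ B w
    own-B w nm = [ (λ h → ⊥-elim (nm (subst Merged (sym h) tt))) , proj₁ ]′ (own w)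
    lab-injective : ∀ p q → lab p ≡ lab q → ¬ Merged (lab p) → p ≡ q
    lab-injective (br u) (br v) h nm =
      cong br (toℕ-injective (B-inj (trans (sym (own-B (toℕ u) nm)) (trans h (own-B (toℕ v) (subst (λ l → ¬ Merged l) h nm))))))
    lab-injective (br u) (mid _ _ _) h nm = ⊥-elim (nm (subst Merged (sym h) tt))
    lab-injective (mid _ _ _) q h nm = ⊥-elim (nm tt)
    hub-X : ∀ w → last-br k w ≡ X ⊎ X ∈ nb (last-br k w) × last-br k w ∈ nb X
    hub-X w with own w
    ... | inj₁ h = inj₁ h
    ... | inj₂ (h , p) = inj₂ (subst (λ l → X ∈ nb l) (sym h) (here refl) , subst (_∈ nb X) (sym h) (listed w p))
      where
      listed : ∀ w → w < 3 → B w ∈ nb X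
      listed 0 _ = here refl
      listed 1 _ = there (here refl)
      listed 2 _ = there (there (here refl))
      listed (suc (suc (suc _))) (s≤s (s≤s (s≤s ())))
    cover : ∀ {p q} → Adj p q → lab p ≡ lab q ⊎ (¬ Merged (lab p) × ¬ Merged (lab q)) ⊎ lab q ∈ nb (lab p)
    cover (inj₁ (first u _ _ _)) = [ inj₁ , (λ h → inj₂ (inj₂ (proj₁ h))) ]′ (hub-X (toℕ u))
    cover (inj₁ (next _ _ _ _ _)) = inj₁ refl
    cover (inj₁ (last _ v _ _)) = [ (λ h → inj₁ (sym h)) , (λ h → inj₂ (inj₂ (proj₂ h))) ]′ (hub-X (toℕ v))
    cover (inj₂ (first u _ _ _)) = [ (λ h → inj₁ (sym h)) , (λ h → inj₂ (inj₂ (proj₂ h))) ]′ (hub-X (toℕ u))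
    cover (inj₂ (next _ _ _ _ _)) = inj₁ refl
    cover (inj₂ (last _ v _ _)) = [ inj₁ , (λ h → inj₂ (inj₂ (proj₁ h))) ]′ (hub-X (toℕ v))

  hub-merged : ∀ k → k < 3 → Reducible (last-labels (suc k)) → Reducible (last-labels k)
  hub-merged k k<3 = rename-step (B k) X (λ ())
    (pointwise (rename (B k) X) (λ w _ → on-br w) (λ _ _ _ _ _ _ _ → refl)) (last-good (suc k))
    where
    on-br : ∀ w → last-br (suc k) w ≡ rename (B k) X (last-br k w)
    on-br w with <-cmp w k
    ... | tri< lt _ _ rewrite ≤ᵇ-no lt | ≤ᵇ-no (<-trans lt (n<1+n k)) with w <ᵇ 3
    ...   | true  = refl
    ...   | false = refl
    on-br w | tri≈ _ refl _ rewrite <ᵇ-yes k<3 | ≤ᵇ-no (n<1+n w) | ≤ᵇ-true (≤-refl {w}) | ≡ᵇ-refl w = refl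
    on-br w | tri> _ ne gt rewrite ≤ᵇ-true gt | ≤ᵇ-true (<⇒≤ gt) with w <ᵇ 3
    ...   | true  = sym (cong (if_then X else B w) (≡ᵇ-no ne))
    ...   | false = refl

  all-absorbed : Reducible (Staged.ρ n between 0)
  all-absorbed = reducible-ext (pointwise (λ z → z) on-br on-mid)
    (hub-merged 0 (s≤s z≤n) (hub-merged 1 (s≤s (s≤s z≤n)) (hub-merged 2 (s≤s (s≤s (s≤s z≤n))) (constant (λ a b → trans (all-X a) (sym (all-X b)))))))
    where
    open At n
    n<d : n < d
    n<d = s≤s (≤-trans (double-≥ n) (m≤n+m (double n) 2))
      where
      double-≥ : ∀ n → n ≤ double n
      double-≥ zero    = z≤n
      double-≥ (suc n) = s≤s (≤-trans (double-≥ n) (n≤1+n _))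
    on-br : ∀ w → w < n → br-label between w ≡ last-br 0 w
    on-br w w<n with w <? 3
    ... | yes p = trans (br-hub between p) (sym (cong (λ b → if b ∧ true then B w else X) (<ᵇ-yes p)))
    ... | no p  = trans (br-old between (≮⇒≥ p) (<-trans w<n n<d)) (sym (cong (λ b → if b ∧ true then B w else X) (<ᵇ-no (≮⇒≥ p))))
    on-mid : ∀ u v i → v < n → u < v → forwardᵇ u v ≡ true → i < length-at u v → mid-label between 0 u v i ≡ X
    on-mid u v i v<n u<v h _ = between-old n i u<v (<-trans v<n n<d) h
    all-X : ∀ a → last-labels 3 a ≡ X
    all-X a with pos a
    ... | mid _ _ _ = refl
    ... | br w with toℕ w
    ...   | 0 = refl
    ...   | 1 = refl
    ...   | 2 = refl
    ...   | suc (suc (suc _)) = refl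

  -- There are `n` rounds, more than there are pairs. Rounds beyond the graph, and the half of a
  -- round that belongs to a vertex without mate, meet only labels that no vertex carries.
  between-reducible : ∀ k j → j + k ≡ n → Reducible (Staged.ρ j between 0)
  between-reducible zero    j eq = subst (λ i → Reducible (Staged.ρ i between 0)) (trans (sym eq) (+-identityʳ j)) all-absorbed
  between-reducible (suc k) j eq = pair-absorbed j (between-reducible k (suc j) (trans (sym (+-suc j k)) eq))

  start-good : Good (Staged.ρ 0 start-stage 0)
  start-good = StageGood.good (table [] [] [] [] [] []) start-stage refl {0} {0} {0} λ _ _ ()
    where open Staged 0

  start-unmerged : ∀ a → ¬ Merged (Staged.ρ 0 start-stage 0 a)
  start-unmerged a with pos a
  ... | br u = br-unmerged (toℕ u)
    where
    open At 0
    br-unmerged : ∀ w → ¬ Merged (br-label start-stage w)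
    br-unmerged w with br-case start-stage w
    ... | is-hub p   = subst (λ l → ¬ Merged l) (sym (br-hub start-stage p)) (λ ())
    ... | is-old p q = ⊥-elim (<⇒≱ q p)
    ... | is-d refl  = λ ()
    ... | is-e refl  = λ ()
    ... | is-new p   = subst (λ l → ¬ Merged l) (sym (br-new start-stage p)) (λ ())
  ... | mid u v i = mid-unmerged (toℕ i) (classify _ _ (proj₁ (forward-edge i)) (proj₂ (forward-edge i)))
    where
    open At 0
    mid-unmerged : ∀ {u v} i → Place u v → ¬ Merged (mid-label start-stage 0 u v i)
    mid-unmerged i (on s)        = subst (λ l → ¬ Merged l) (sym (mid-on start-stage s 0 i)) (λ ())
    mid-unmerged i (older _ p q) = ⊥-elim (<⇒≱ q p)
    mid-unmerged i (newer p _)   = subst (λ l → ¬ Merged l) (sym (mid-new start-stage 0 i p)) (λ ())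

  start-realizes : Realizes T₀ (Staged.ρ 0 start-stage 0)
  start-realizes = record
    { σ = λ a → a ; onto = λ a → a , refl ; σ⇒ρ = cong (Staged.ρ 0 start-stage 0)
    ; ρ⇒σ = λ {a} h → Good.unmerged start-good h (start-unmerged a)
    ; diagonal = λ a → cong (if_then black else none) (Graph.irrefl H a)
    ; symm = T₀-sym
    ; edge = λ {a} {b} h → a , b , refl , refl , is-edge (adj H a b) h
    ; red-part = λ {a} {b} h → ⊥-elim (not-red (adj H a b) h) }
    where
    is-edge : ∀ c → (if c then black else none) ≢ none → c ≡ true
    is-edge true  _ = refl
    is-edge false h = ⊥-elim (h refl)
    not-red : ∀ c → (if c then black else none) ≢ red
    not-red true  ()
    not-red false ()

  cockade-bound : TwwAtMost 3 H
  cockade-bound = low-degree start-realizes start-good , hubs-absorbed (between-reducible n 0 refl) start-realizes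

-- The number of edges of the extremal graphs

weight : ℕ → ℕ → ℕ
weight u v = b2n ((u <ᵇ v) ∧ cockadeᵇ u v)

total-last : ∀ n (f : ℕ → ℕ) → total {suc n} (f ∘ toℕ) ≡ total {n} (f ∘ toℕ) + f n
total-last zero    f = +-identityʳ (f 0)
total-last (suc n) f = trans (cong (f 0 +_) (total-last n (f ∘ suc))) (sym (+-assoc (f 0) _ (f (suc n))))

edges : ℕ → ℕ
edges n = total {n} (λ i → total {n} (λ j → weight (toℕ i) (toℕ j)))

column : ℕ → ℕ
column n = total {n} (λ i → weight (toℕ i) n)

edges-suc : ∀ n → edges (suc n) ≡ edges n + column n
edges-suc n = begin
  edges (suc n)
    ≡⟨ total-last n (λ u → total {suc n} (λ j → weight u (toℕ j))) ⟩
  total {n} (λ i → total {suc n} (λ j → weight (toℕ i) (toℕ j))) + total {suc n} (λ j → weight n (toℕ j))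
    ≡⟨ cong₂ _+_ (total-cong {n} λ i → total-last n (weight (toℕ i))) (trans (total-cong {suc n} no-weight) (total-0 {suc n})) ⟩
  total {n} (λ i → total {n} (λ j → weight (toℕ i) (toℕ j)) + weight (toℕ i) n) + 0
    ≡⟨ +-identityʳ _ ⟩
  total {n} (λ i → total {n} (λ j → weight (toℕ i) (toℕ j)) + weight (toℕ i) n)
    ≡⟨ total-+ {n} (λ i → total {n} (λ j → weight (toℕ i) (toℕ j))) (λ i → weight (toℕ i) n) ⟩
  edges n + column n ∎
  where
  open ≡-Reasoning
  no-weight : ∀ (j : Fin (suc n)) → weight n (toℕ j) ≡ 0
  no-weight j = cong (λ b → b2n (b ∧ cockadeᵇ n (toℕ j))) (<ᵇ-no (≤-pred (toℕ<n j)))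

-- Equal to 1 for odd `m` and to 0 for even `m`, since only the second vertex of a pair finds its
-- mate among its predecessors.
mates : ℕ → ℕ
mates m = total {m} (λ i → b2n (paired (toℕ i) m))

mates-suc-suc : ∀ m → mates (suc (suc m)) ≡ mates m
mates-suc-suc zero    = refl
mates-suc-suc (suc m) = refl

two-mates : ∀ m → mates m + mates (suc m) ≡ 1
two-mates zero          = refl
two-mates (suc zero)    = refl
two-mates (suc (suc m)) = trans (cong₂ _+_ (mates-suc-suc m) (mates-suc-suc (suc m))) (two-mates m)

column-hubs : ∀ m → column (3 + m) ≡ 3 + mates m
column-hubs m = cong (3 +_) (total-cong λ i → cong b2n (entry (toℕ i) (toℕ<n i)))
  where
  entry : ∀ u → u < m → (u <ᵇ m) ∧ cockadeᵇ (3 + u) (3 + m) ≡ paired u m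
  entry u u<m rewrite <ᵇ-yes u<m | <ᵇ-no (<⇒≤ u<m) with paired u m
  ... | true  = refl
  ... | false = refl

-- Two consecutive vertices bring three edges to the hubs each, and exactly one of them completes a
-- pair.
edges-step : ∀ m → edges (5 + m) ≡ edges (3 + m) + 7
edges-step m = begin
  edges (5 + m)                                              ≡⟨ edges-suc (4 + m) ⟩
  edges (4 + m) + column (4 + m)                             ≡⟨ cong₂ _+_ (edges-suc (3 + m)) (column-hubs (suc m)) ⟩
  edges (3 + m) + column (3 + m) + (3 + mates (suc m))       ≡⟨ cong (λ c → edges (3 + m) + c + (3 + mates (suc m))) (column-hubs m) ⟩
  edges (3 + m) + (3 + mates m) + (3 + mates (suc m))        ≡⟨ +-assoc (edges (3 + m)) _ _ ⟩
  edges (3 + m) + ((3 + mates m) + (3 + mates (suc m)))      ≡⟨ cong (edges (3 + m) +_) (interchange 3 (mates m) 3 (mates (suc m))) ⟩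
  edges (3 + m) + (6 + (mates m + mates (suc m)))            ≡⟨ cong (λ c → edges (3 + m) + (6 + c)) (two-mates m) ⟩
  edges (3 + m) + 7                                          ∎
  where open ≡-Reasoning

-- The right-hand side is the number of the theorem at `n = 3 + m`. Induction in steps of two adds
-- 14 to the numerator, which the floor respects.
edges-formula : ∀ m → edges (3 + m) ≡ (6 + 7 * m) / 2
edges-formula zero          = refl
edges-formula (suc zero)    = refl
edges-formula (suc (suc m)) = begin
  edges (5 + m)                  ≡⟨ edges-step m ⟩
  edges (3 + m) + 7              ≡⟨ cong (_+ 7) (edges-formula m) ⟩
  (6 + 7 * m) / 2 + 14 / 2       ≡⟨ sym (+-distrib-/-∣ʳ (6 + 7 * m) {14} {2} (divides 7 refl)) ⟩
  (6 + 7 * m + 14) / 2           ≡⟨ cong (_/ 2) (trans (+-assoc 6 (7 * m) 14) (cong (6 +_) (sym (trans (cong (7 *_) (+-comm 2 m)) (*-distribˡ-+ 7 m 2))))) ⟩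
  (6 + 7 * (2 + m)) / 2          ∎
  where open ≡-Reasoning

cockade-edges : ∀ n → 3 ≤ n → edgeCount (cockade n) ≡ (7 * n ∸ 15) / 2
cockade-edges (suc (suc (suc m))) _ = trans (edgeCount-total (cockade (3 + m)))
  (trans (edges-formula m) (cong (λ x → (x ∸ 15) / 2) (sym (*-distribˡ-+ 7 3 m))))
cockade-edges (suc zero) (s≤s ())
cockade-edges (suc (suc zero)) (s≤s (s≤s ()))

upper-bound : (n : ℕ) → 3 ≤ n → Σ (Graph n) (λ G → (edgeCount G ≡ (7 * n ∸ 15) / 2) ×
              ((m : ℕ) (H : Graph m) → IsSubdivision G H → TwwAtMost 3 H))
upper-bound n three = cockade n , cockade-edges n three , λ m H S → cockade-bound S

theorem1p5 : ((n : ℕ) → 3 ≤ n → (G : Graph n) → (7 * n ∸ 15) / 2 < edgeCount G →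
    (m : ℕ) (H : Graph m) → IsSubdivision G H → ¬ TwwAtMost 3 H)
    ×
    ((n : ℕ) → 3 ≤ n → Σ (Graph n) (λ G → (edgeCount G ≡ (7 * n ∸ 15) / 2) ×
    ((m : ℕ) (H : Graph m) → IsSubdivision G H → TwwAtMost 3 H)))
theorem1p5 = lower-bound , upper-bound
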